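{- Let $m\ge 2$ and let $k$ be a positive integer with $(k-10)(m-1)\ge 42$. Then $$\lambda_1(T_2(c_2=k-2))>\lambda_1(T_3(c_2=k-3))>\lambda_1(T_3(c_2=k-4,c_3=1))>\lambda_1(T_4(c_3=k-4))>\lambda_1(T_4(c_2=k-4))>\lambda_1(T_3(c_2=k-5,c_3=2))>\lambda_1(T_4(c_2=1,c_3=k-5)),$$ and these are the hypertrees with the first seven largest spectral radii among all $m$-uniform hypertrees with $k$ edges; that is, every $m$-uniform hypertree with $k$ edges not isomorphic to one of these seven has spectral radius strictly smaller than $\lambda_1(T_4(c_2=1,c_3=k-5))$.
   Context: A hypergraph has a finite vertex set and an edge set of non-empty subsets of the vertex set; it is $m$-uniform if all edges have cardinality $m$, and linear if two distinct edges share at most one vertex. The adjacency matrix of a linear $m$-uniform hypergraph $\mathcal{H}$ has $(i,j)$ entry $\frac{1}{m-1}$ if $i\ne j$ lie in a common edge, and $0$ otherwise; $\lambda_1(\mathcal{H})$ denotes its spectral radius. The degree of a vertex is the number of edges containing it; a vertex is pendant if its degree is one and non-pendant if its degree is larger. A loose path of length $d$, $P_L(d)=v_1e_1v_2e_2\dots v_de_dv_{d+1}$, is the $m$-uniform hypergraph with edges $e_1,\dots,e_d$ such that $e_{i-1}\cap e_i=\{v_i\}$ for $2\le i\le d$ (the $v_i$ distinct), non-consecutive edges are disjoint, and $v_1\in e_1$, $v_{d+1}\in e_d$ are pendant. A loose cycle of length $l\ge3$, $v_1e_1v_2e_2\dots v_le_lv_1$, is the $m$-uniform hypergraph with edges $e_1,\dots,e_l$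 in which cyclically consecutive edges meet exactly in $v_i$ ($e_{i-1}\cap e_i=\{v_i\}$, indices mod $l$, the $v_i$ distinct) and non-consecutive edges are disjoint. A hypertree is a connected linear hypergraph containing no loose cycle in which every edge contains at most two non-pendant vertices. Attaching a pendant edge at a vertex $v$ means adding a new edge consisting of $v$ and $m-1$ new vertices. $T_d(c_2,\dots,c_d)$ is the hypertree obtained from $P_L(d)=v_1e_1v_2\dots v_de_dv_{d+1}$ by attaching $c_i$ pendant edges at $v_i$ for $i=2,\dots,d$; when only some of the $c_i$ are listed, the others are $0$. -}

module Defs where

open import Data.Fin.Base as Fin using (Fin; zero; suc; toℕ; fromℕ<; inject₁; _↑ʳ_)
open import Data.Fin.Permutation using (Permutation; _⟨$⟩ˡ_)
import Data.Fin.Properties as Fin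
open import Data.Fin.Subset
  using (Subset; _∈_; _∩_; ∣_∣; ⁅_⁆; ⊤; ⊥; Nonempty; Empty)
open import Data.Fin.Subset.Properties using (_∈?_; x∈⁅x⁆)
open import Data.Integer.Base using (+_)
open import Data.List.Base as List using (List; []; _∷_; length; filter)
open import Data.List.Membership.Propositional using () renaming (_∈_ to _∈ˡ_)
open import Data.List.Relation.Unary.All as All using (All; []; _∷_)
import Data.List.Relation.Unary.All.Properties as All
open import Data.List.Relation.Unary.Any using (any?)
open import Data.List.Relation.Unary.Unique.Propositional using (Unique; []; _∷_)
import Data.List.Relation.Unary.Unique.Propositional.Properties as Unique
open import Data.Nat.Base as ℕ using (ℕ; zero; suc; _∸_; NonTrivial; nonTrivial⇒n>1)
open import Data.Nat.DivMod using (_mod_)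
import Data.Nat.Properties as ℕ
open import Data.Product.Base using (Σ; ∃; _×_; _,_; proj₁)
open import Data.Rational.Base as ℚ using (ℚ; 0ℚ; 1ℚ; ½)
import Data.Rational.Properties as ℚ
open import Data.Rational.Solver using (module +-*-Solver)
open import Data.Vec.Base as Vec using (Vec; []; _∷_; tabulate; lookup; _++_)
import Data.Vec.Functional as Vector
import Data.Vec.Properties as Vec
open import Function.Base using (_∘_)
open import Function.Bundles using (_⇔_)
open import Function.Definitions using (Injective)
open import Relation.Binary.Construct.Closure.ReflexiveTransitive using (Star)
open import Relation.Binary.PropositionalEquality
  using (_≡_; _≢_; refl; sym; trans; cong; cong₂; subst)
open import Relation.Nullary using (¬_; yes; no; does)
open import Relation.Nullary.Decidable using (_×-dec_; ¬?; dec-true)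
open import Relation.Unary using (Pred; Decidable)

------------------------------------------------------------------------
-- Real numbers as Cauchy sequences of rationals

IsCauchy : (ℕ → ℚ) → Set
IsCauchy s = ∀ {ε} → 0ℚ ℚ.< ε →
  ∃ λ N → ∀ {i j} → N ℕ.≤ i → N ℕ.≤ j → ℚ.∣ s i ℚ.- s j ∣ ℚ.< ε

record ℝ : Set where
  constructor mkℝ
  field
    seq    : ℕ → ℚ
    cauchy : IsCauchy seq

open ℝ public

infix  4 _≈ℝ_ _<ℝ_ _≤ℝ_ _>ℝ_
infixl 6 _+ℝ_ _-ℝ_
infixl 7 _*ℝ_
infix  8 -ℝ_

_≈ℝ_ : ℝ → ℝ → Set
x ≈ℝ y = ∀ {ε} → 0ℚ ℚ.< ε →
  ∃ λ N → ∀ {i} → N ℕ.≤ i → ℚ.∣ seq x i ℚ.- seq y i ∣ ℚ.< ε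

_<ℝ_ : ℝ → ℝ → Set
x <ℝ y = ∃ λ ε → 0ℚ ℚ.< ε ×
  (∃ λ N → ∀ {i} → N ℕ.≤ i → seq x i ℚ.+ ε ℚ.≤ seq y i)

_>ℝ_ : ℝ → ℝ → Set
x >ℝ y = y <ℝ x

_≤ℝ_ : ℝ → ℝ → Set
x ≤ℝ y = ¬ (y <ℝ x)

private
  half-pos : ∀ {ε} → 0ℚ ℚ.< ε → 0ℚ ℚ.< ½ ℚ.* ε
  half-pos 0<ε = ℚ.*-monoʳ-<-pos ½ 0<ε

  half+half : ∀ ε → ½ ℚ.* ε ℚ.+ ½ ℚ.* ε ≡ ε
  half+half ε = trans (sym (ℚ.*-distribʳ-+ ε ½ ½)) (ℚ.*-identityˡ ε)

  left : ∀ M N {i} → M ℕ.⊔ N ℕ.≤ i → M ℕ.≤ i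
  left M N = ℕ.≤-trans (ℕ.m≤m⊔n M N)

  right : ∀ M N {i} → M ℕ.⊔ N ℕ.≤ i → N ℕ.≤ i
  right M N = ℕ.≤-trans (ℕ.m≤n⊔m M N)

  ∣p∣≤∣p-q∣+∣q∣ : ∀ p q → ℚ.∣ p ∣ ℚ.≤ ℚ.∣ p ℚ.- q ∣ ℚ.+ ℚ.∣ q ∣
  ∣p∣≤∣p-q∣+∣q∣ p q = subst (λ r → ℚ.∣ r ∣ ℚ.≤ ℚ.∣ p ℚ.- q ∣ ℚ.+ ℚ.∣ q ∣)
    (trans (ℚ.+-assoc p (ℚ.- q) q)
      (trans (cong (p ℚ.+_) (ℚ.+-inverseˡ q)) (ℚ.+-identityʳ p)))
    (ℚ.∣p+q∣≤∣p∣+∣q∣ (p ℚ.- q) q)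

  +-increment : ∀ a b c d →
    ℚ.∣ (a ℚ.+ b) ℚ.- (c ℚ.+ d) ∣ ℚ.≤ ℚ.∣ a ℚ.- c ∣ ℚ.+ ℚ.∣ b ℚ.- d ∣
  +-increment a b c d = subst
    (λ r → ℚ.∣ r ∣ ℚ.≤ ℚ.∣ a ℚ.- c ∣ ℚ.+ ℚ.∣ b ℚ.- d ∣)
    (solve 4 (λ a b c d → (a :- c) :+ (b :- d) := (a :+ b) :- (c :+ d)) refl a b c d)
    (ℚ.∣p+q∣≤∣p∣+∣q∣ (a ℚ.- c) (b ℚ.- d))
    where open +-*-Solver

  *-increment : ∀ a b c d →
    ℚ.∣ a ℚ.* b ℚ.- c ℚ.* d ∣ ℚ.≤ ℚ.∣ a ∣ ℚ.* ℚ.∣ b ℚ.- d ∣ ℚ.+ ℚ.∣ d ∣ ℚ.* ℚ.∣ a ℚ.- c ∣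
  *-increment a b c d = begin
    ℚ.∣ a ℚ.* b ℚ.- c ℚ.* d ∣
      ≡⟨ cong ℚ.∣_∣ (solve 4 (λ a b c d →
           a :* b :- c :* d := a :* (b :- d) :+ d :* (a :- c)) refl a b c d) ⟩
    ℚ.∣ a ℚ.* (b ℚ.- d) ℚ.+ d ℚ.* (a ℚ.- c) ∣
      ≤⟨ ℚ.∣p+q∣≤∣p∣+∣q∣ (a ℚ.* (b ℚ.- d)) (d ℚ.* (a ℚ.- c)) ⟩
    ℚ.∣ a ℚ.* (b ℚ.- d) ∣ ℚ.+ ℚ.∣ d ℚ.* (a ℚ.- c) ∣
      ≡⟨ cong₂ ℚ._+_ (ℚ.∣p*q∣≡∣p∣*∣q∣ a (b ℚ.- d)) (ℚ.∣p*q∣≡∣p∣*∣q∣ d (a ℚ.- c)) ⟩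
    ℚ.∣ a ∣ ℚ.* ℚ.∣ b ℚ.- d ∣ ℚ.+ ℚ.∣ d ∣ ℚ.* ℚ.∣ a ℚ.- c ∣ ∎
    where
    open ℚ.≤-Reasoning
    open +-*-Solver

  bounded : ∀ {s} → IsCauchy s →
    ∃ λ B → 0ℚ ℚ.< B × (∃ λ N → ∀ {i} → N ℕ.≤ i → ℚ.∣ s i ∣ ℚ.≤ B)
  bounded {s} c =
    let N , close = c {1ℚ} (ℚ.positive⁻¹ 1ℚ) in
      1ℚ ℚ.+ ℚ.∣ s N ∣
    , ℚ.+-mono-<-≤ (ℚ.positive⁻¹ 1ℚ) (ℚ.0≤∣p∣ (s N))
    , N , λ {i} N≤i → ℚ.≤-trans (∣p∣≤∣p-q∣+∣q∣ (s i) (s N))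
        (ℚ.+-monoˡ-≤ ℚ.∣ s N ∣ (ℚ.<⇒≤ (close N≤i ℕ.≤-refl)))

  -- multiplication by a bounded factor can be made as small as desired
  scale : ∀ C → 0ℚ ℚ.< C → ∀ {ε} → 0ℚ ℚ.< ε → ∃ λ δ → 0ℚ ℚ.< δ ×
    (∀ a d → ℚ.∣ a ∣ ℚ.≤ C → ℚ.∣ d ∣ ℚ.< δ → ℚ.∣ a ∣ ℚ.* ℚ.∣ d ∣ ℚ.< ε)
  scale C 0<C {ε} 0<ε = C⁻¹ ℚ.* ε , 0<δ , λ a d a≤C d<δ → begin-strict
      ℚ.∣ a ∣ ℚ.* ℚ.∣ d ∣    ≤⟨ ℚ.*-monoʳ-≤-nonNeg ℚ.∣ d ∣ {{ℚ.∣-∣-nonNeg d}} a≤C ⟩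
      C ℚ.* ℚ.∣ d ∣          <⟨ ℚ.*-monoʳ-<-pos C d<δ ⟩
      C ℚ.* (C⁻¹ ℚ.* ε)      ≡⟨ sym (ℚ.*-assoc C C⁻¹ ε) ⟩
      (C ℚ.* C⁻¹) ℚ.* ε      ≡⟨ cong (ℚ._* ε) (ℚ.*-inverseʳ C) ⟩
      1ℚ ℚ.* ε               ≡⟨ ℚ.*-identityˡ ε ⟩
      ε                      ∎
    where
    open ℚ.≤-Reasoning
    instance
      C-pos : ℚ.Positive C
      C-pos = ℚ.positive 0<C
      C-nonZero : ℚ.NonZero C
      C-nonZero = ℚ.pos⇒nonZero C
    C⁻¹ : ℚ
    C⁻¹ = ℚ.1/ C
    0<δ : 0ℚ ℚ.< C⁻¹ ℚ.* ε
    0<δ = subst (ℚ._< C⁻¹ ℚ.* ε) (ℚ.*-zeroʳ C⁻¹)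
            (ℚ.*-monoʳ-<-pos C⁻¹ {{ℚ.1/pos⇒pos C}} 0<ε)

abstract
  +-cauchy : ∀ s t → IsCauchy s → IsCauchy t → IsCauchy (λ i → s i ℚ.+ t i)
  +-cauchy s t cs ct {ε} 0<ε =
    let M , s-close = cs (half-pos 0<ε)
        N , t-close = ct (half-pos 0<ε)
    in M ℕ.⊔ N , λ {i} {j} ≤i ≤j →
      ℚ.≤-<-trans (+-increment (s i) (t i) (s j) (t j))
        (subst (ℚ.∣ s i ℚ.- s j ∣ ℚ.+ ℚ.∣ t i ℚ.- t j ∣ ℚ.<_) (half+half ε)
          (ℚ.+-mono-< (s-close (left M N ≤i) (left M N ≤j))
                      (t-close (right M N ≤i) (right M N ≤j))))

  -‿cauchy : ∀ s → IsCauchy s → IsCauchy (λ i → ℚ.- s i)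
  -‿cauchy s cs {ε} 0<ε =
    let N , close = cs 0<ε in N , λ {i} {j} ≤i ≤j →
      subst (ℚ._< ε)
        (trans (sym (ℚ.∣-p∣≡∣p∣ (s i ℚ.- s j)))
               (cong ℚ.∣_∣ (ℚ.neg-distrib-+ (s i) (ℚ.- s j))))
        (close ≤i ≤j)

  *-cauchy : ∀ s t → IsCauchy s → IsCauchy t → IsCauchy (λ i → s i ℚ.* t i)
  *-cauchy s t cs ct {ε} 0<ε =
    let A , 0<A , K , s-bound = bounded cs
        B , 0<B , L , t-bound = bounded ct
        δ₁ , 0<δ₁ , small₁ = scale A 0<A (half-pos 0<ε)
        δ₂ , 0<δ₂ , small₂ = scale B 0<B (half-pos 0<ε)
        M , t-close = ct 0<δ₁
        N , s-close = cs 0<δ₂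
    in (K ℕ.⊔ L) ℕ.⊔ (M ℕ.⊔ N) , λ {i} {j} ≤i ≤j →
      ℚ.≤-<-trans (*-increment (s i) (t i) (s j) (t j))
        (subst (ℚ.∣ s i ∣ ℚ.* ℚ.∣ t i ℚ.- t j ∣ ℚ.+ ℚ.∣ t j ∣ ℚ.* ℚ.∣ s i ℚ.- s j ∣ ℚ.<_)
          (half+half ε)
          (ℚ.+-mono-<
            (small₁ (s i) (t i ℚ.- t j)
              (s-bound (left K L (left (K ℕ.⊔ L) (M ℕ.⊔ N) ≤i)))
              (t-close (left M N (right (K ℕ.⊔ L) (M ℕ.⊔ N) ≤i))
                       (left M N (right (K ℕ.⊔ L) (M ℕ.⊔ N) ≤j))))
            (small₂ (t j) (s i ℚ.- s j)
              (t-bound (right K L (left (K ℕ.⊔ L) (M ℕ.⊔ N) ≤j)))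
              (s-close (right M N (right (K ℕ.⊔ L) (M ℕ.⊔ N) ≤i))
                       (right M N (right (K ℕ.⊔ L) (M ℕ.⊔ N) ≤j))))))

fromℚ : ℚ → ℝ
fromℚ q = mkℝ (λ _ → q) λ {ε} 0<ε →
  0 , λ _ _ → subst (λ r → ℚ.∣ r ∣ ℚ.< ε) (sym (ℚ.+-inverseʳ q)) 0<ε

0ℝ : ℝ
0ℝ = fromℚ 0ℚ

_+ℝ_ : ℝ → ℝ → ℝ
x +ℝ y = mkℝ (λ i → seq x i ℚ.+ seq y i) (+-cauchy (seq x) (seq y) (cauchy x) (cauchy y))

-ℝ_ : ℝ → ℝ
-ℝ x = mkℝ (λ i → ℚ.- seq x i) (-‿cauchy (seq x) (cauchy x))

_-ℝ_ : ℝ → ℝ → ℝ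
x -ℝ y = x +ℝ (-ℝ y)

_*ℝ_ : ℝ → ℝ → ℝ
x *ℝ y = mkℝ (λ i → seq x i ℚ.* seq y i) (*-cauchy (seq x) (seq y) (cauchy x) (cauchy y))

------------------------------------------------------------------------
-- Complex numbers

infix  4 _≈ℂ_
infixl 6 _+ℂ_
infixl 7 _*ℂ_

record ℂ : Set where
  constructor _+i_
  field
    re : ℝ
    im : ℝ

open ℂ public

_≈ℂ_ : ℂ → ℂ → Set
z ≈ℂ w = re z ≈ℝ re w × im z ≈ℝ im w

fromℝ : ℝ → ℂ
fromℝ x = x +i 0ℝ

_+ℂ_ : ℂ → ℂ → ℂ
z +ℂ w = (re z +ℝ re w) +i (im z +ℝ im w)

_*ℂ_ : ℂ → ℂ → ℂ
z *ℂ w = (re z *ℝ re w -ℝ im z *ℝ im w) +i (re z *ℝ im w +ℝ im z *ℝ re w)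

∣_∣² : ℂ → ℝ
∣ z ∣² = re z *ℝ re z +ℝ im z *ℝ im z

sumℂ : ∀ {n} → (Fin n → ℂ) → ℂ
sumℂ = Vector.foldr _+ℂ_ (fromℝ 0ℝ)

------------------------------------------------------------------------
-- Spectral radius

Matrix : ℕ → Set
Matrix n = Fin n → Fin n → ℝ

IsEigenvalue : ∀ {n} → Matrix n → ℂ → Set
IsEigenvalue {n} A z = Σ (Fin n → ℂ) λ x →
  (∃ λ i → 0ℝ <ℝ ∣ x i ∣²) ×
  (∀ i → sumℂ (λ j → fromℝ (A i j) *ℂ x j) ≈ℂ z *ℂ x i)

-- The largest modulus of a complex eigenvalue.  Moduli are compared through
-- their squares, which is legitimate since ρ ≥ 0.
record IsSpectralRadius {n} (A : Matrix n) (ρ : ℝ) : Set where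
  field
    nonNegative : 0ℝ ≤ℝ ρ
    attained    : ∃ λ z → IsEigenvalue A z × ∣ z ∣² ≈ℝ ρ *ℝ ρ
    dominates   : ∀ z → IsEigenvalue A z → ∣ z ∣² ≤ℝ ρ *ℝ ρ

------------------------------------------------------------------------
-- Hypergraphs

comprehension : ∀ {n p} {P : Pred (Fin n) p} → Decidable P → Subset n
comprehension P? = tabulate (does ∘ P?)

record Hypergraph : Set where
  field
    order    : ℕ
    edges    : List (Subset order)
    unique   : Unique edges
    nonempty : All Nonempty edges

  Vertex : Set
  Vertex = Fin order

  size : ℕ
  size = length edges

open Hypergraph public

module _ (H : Hypergraph) where

  Uniform : ℕ → Set
  Uniform m = All (λ e → ∣ e ∣ ≡ m) (edges H)

  Linear : Set
  Linear = ∀ {e f} → e ∈ˡ edges H → f ∈ˡ edges H → e ≢ f → ∣ e ∩ f ∣ ℕ.≤ 1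

  degree : Vertex H → ℕ
  degree v = length (filter (v ∈?_) (edges H))

  nonPendant : Subset (order H)
  nonPendant = comprehension (λ v → 1 ℕ.<? degree v)

  Adjacent : Vertex H → Vertex H → Set
  Adjacent u v = u ≢ v × (∃ λ e → e ∈ˡ edges H × u ∈ e × v ∈ e)

  Connected : Set
  Connected = ∀ u v → Star Adjacent u v

-- i ↦ i + 1 modulo n
next : ∀ {n} → Fin n → Fin n
next {suc n} i = suc (toℕ i) mod suc n

record LooseCycle (H : Hypergraph) : Set where
  field
    len         : ℕ
    len≥3       : 3 ℕ.≤ len
    vertex      : Fin len → Vertex H
    edge        : Fin len → Subset (order H)
    edge∈       : ∀ i → edge i ∈ˡ edges H
    injective   : Injective _≡_ _≡_ vertex
    consecutive : ∀ i → edge i ∩ edge (next i) ≡ ⁅ vertex (next i) ⁆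
    disjoint    : ∀ i j → i ≢ j → j ≢ next i → i ≢ next j → Empty (edge i ∩ edge j)

record IsHypertree (H : Hypergraph) : Set where
  field
    connected       : Connected H
    linear          : Linear H
    acyclic         : ¬ LooseCycle H
    nonPendant≤2    : ∀ {e} → e ∈ˡ edges H → ∣ e ∩ nonPendant H ∣ ℕ.≤ 2

record IsUniformHypertree (m k : ℕ) (H : Hypergraph) : Set where
  field
    uniform   : Uniform H m
    hypertree : IsHypertree H
    size≡     : size H ≡ k

image : ∀ {m n} → Permutation m n → Subset m → Subset n
image π e = tabulate (λ j → lookup e (π ⟨$⟩ˡ j))

infix 4 _≅_

_≅_ : Hypergraph → Hypergraph → Set
G ≅ H = Σ (Permutation (order G) (order H)) λ π →
  ∀ e → (e ∈ˡ edges G) ⇔ (image π e ∈ˡ edges H)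

-- 1/n, and 0 for n = 0
reciprocal : ℕ → ℚ
reciprocal zero    = 0ℚ
reciprocal (suc n) = + 1 ℚ./ suc n

adjacency : ℕ → (H : Hypergraph) → Matrix (order H)
adjacency m H i j
  with ¬? (i Fin.≟ j) ×-dec any? (λ e → (i ∈? e) ×-dec (j ∈? e)) (edges H)
... | yes _ = fromℚ (reciprocal (m ∸ 1))
... | no  _ = 0ℝ

------------------------------------------------------------------------
-- The hypertrees T_d(c₂,…,c_d)

private
  ∈-comprehension⁺ : ∀ {n p} {P : Pred (Fin n) p} (P? : Decidable P) {i} →
                     P i → i ∈ comprehension P?
  ∈-comprehension⁺ P? {i} Pi = Vec.lookup⇒[]= i (comprehension P?)
    (trans (Vec.lookup∘tabulate (does ∘ P?) i) (dec-true (P? i) Pi))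

  ∈-comprehension⁻ : ∀ {n p} {P : Pred (Fin n) p} (P? : Decidable P) {i} →
                     i ∈ comprehension P? → P i
  ∈-comprehension⁻ P? {i} i∈ with P? i
    | trans (sym (Vec.lookup∘tabulate (does ∘ P?) i)) (Vec.[]=⇒lookup i∈)
  ... | yes Pi | _ = Pi

  ∈-++⁺ : ∀ {m n} (p : Subset m) {q : Subset n} {i} → i ∈ q → (m ↑ʳ i) ∈ (p ++ q)
  ∈-++⁺ []      i∈q = i∈q
  ∈-++⁺ (_ ∷ p) i∈q = Vec.there (∈-++⁺ p i∈q)

  ⊤≢⊥ : ∀ {n} → 0 ℕ.< n → ⊤ {n} ≢ ⊥ {n}
  ⊤≢⊥ {suc n} _ ()

module _ (m : ℕ) .{{_ : NonTrivial m}} where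

  private
    0<m∸1 : 0 ℕ.< m ∸ 1
    0<m∸1 = ℕ.m<n⇒0<n∸m (nonTrivial⇒n>1 m)

    instance
      m∸1-nonZero : ℕ.NonZero (m ∸ 1)
      m∸1-nonZero = ℕ.>-nonZero 0<m∸1

  -- The loose path on the vertices 0, …, d(m-1), with v_{i+1} = i(m-1) and
  -- e_{i+1} = {i(m-1), …, (i+1)(m-1)}.

  pathVertex : ∀ d → Fin (suc d) → Fin (suc (d ℕ.* (m ∸ 1)))
  pathVertex d i = fromℕ< (ℕ.s≤s (ℕ.*-monoˡ-≤ (m ∸ 1) (ℕ.≤-pred (Fin.toℕ<n i))))

  private
    InSegment : ∀ d → Fin d → Pred (Fin (suc (d ℕ.* (m ∸ 1)))) _
    InSegment d i v = toℕ i ℕ.* (m ∸ 1) ℕ.≤ toℕ v × toℕ v ℕ.≤ suc (toℕ i) ℕ.* (m ∸ 1)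

    inSegment? : ∀ d i → Decidable (InSegment d i)
    inSegment? d i v =
      (toℕ i ℕ.* (m ∸ 1) ℕ.≤? toℕ v) ×-dec (toℕ v ℕ.≤? suc (toℕ i) ℕ.* (m ∸ 1))

  pathEdge : ∀ d → Fin d → Subset (suc (d ℕ.* (m ∸ 1)))
  pathEdge d i = comprehension (inSegment? d i)

  private
    toℕ-pathVertex : ∀ d (i : Fin d) → toℕ (pathVertex d (inject₁ i)) ≡ toℕ i ℕ.* (m ∸ 1)
    toℕ-pathVertex d i =
      trans (Fin.toℕ-fromℕ< _) (cong (ℕ._* (m ∸ 1)) (Fin.toℕ-inject₁ i))

    start∈ : ∀ d i → pathVertex d (inject₁ i) ∈ pathEdge d i
    start∈ d i = ∈-comprehension⁺ (inSegment? d i)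
      ( ℕ.≤-reflexive (sym (toℕ-pathVertex d i))
      , ℕ.≤-trans (ℕ.≤-reflexive (toℕ-pathVertex d i)) (ℕ.m≤n+m _ (m ∸ 1)))

    -- the first vertex of a segment determines the segment
    start-≤ : ∀ d i j → pathEdge d i ≡ pathEdge d j → toℕ j ℕ.≤ toℕ i
    start-≤ d i j eq = ℕ.*-cancelʳ-≤ (toℕ j) (toℕ i) (m ∸ 1)
      (subst (toℕ j ℕ.* (m ∸ 1) ℕ.≤_) (toℕ-pathVertex d i)
        (proj₁ (∈-comprehension⁻ (inSegment? d j)
          (subst (pathVertex d (inject₁ i) ∈_) eq (start∈ d i)))))

    pathEdge-injective : ∀ d {i j} → pathEdge d i ≡ pathEdge d j → i ≡ j
    pathEdge-injective d {i} {j} eq =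
      Fin.toℕ-injective (ℕ.≤-antisym (start-≤ d j i (sym eq)) (start-≤ d i j eq))

  loosePath : ℕ → Hypergraph
  loosePath d = record
    { order    = suc (d ℕ.* (m ∸ 1))
    ; edges    = List.tabulate (pathEdge d)
    ; unique   = Unique.tabulate⁺ (pathEdge-injective d)
    ; nonempty = All.tabulate⁺ (λ i → _ , start∈ d i)
    }

  -- The m-1 new vertices come first: an old vertex v becomes (m ∸ 1) ↑ʳ v.
  attach : (H : Hypergraph) → Vertex H → Hypergraph
  attach H v = record
    { order    = (m ∸ 1) ℕ.+ order H
    ; edges    = (⊤ ++ ⁅ v ⁆) ∷ List.map (⊥ ++_) (edges H)
    ; unique   = All.map⁺ (All.universal
                   (λ e eq → ⊤≢⊥ 0<m∸1 (Vec.++-injectiveˡ (⊤ {m ∸ 1}) ⊥ eq)) (edges H))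
               ∷ Unique.map⁺ (Vec.++-injectiveʳ (⊥ {m ∸ 1}) ⊥) (unique H)
    ; nonempty = (_ , ∈-++⁺ (⊤ {m ∸ 1}) (x∈⁅x⁆ v))
               ∷ All.map⁺ (All.map (λ (_ , i∈e) → _ , ∈-++⁺ (⊥ {m ∸ 1}) i∈e) (nonempty H))
    }

  attachAll : ∀ {c} (H : Hypergraph) → Vec (Vertex H) c → Hypergraph
  attachAll H []       = H
  attachAll H (v ∷ vs) = attachAll (attach H v) (Vec.map ((m ∸ 1) ↑ʳ_) vs)

  -- T d (c₂ ∷ … ∷ c_d ∷ []): the entry with index i (from 0) counts the
  -- pendant edges at v_{i+2}.
  T : ∀ d → Vec ℕ (ℕ.pred d) → Hypergraph
  T d c = attachAll (loosePath d) (Vec.fromList (List.concat (Vec.toList pendants)))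
    where
    inner : ∀ d → Fin (ℕ.pred d) → Fin (suc d)
    inner (suc d) i = suc (inject₁ i)

    pendants : Vec (List (Vertex (loosePath d))) (ℕ.pred d)
    pendants = tabulate (λ i → List.replicate (lookup c i) (pathVertex d (inner d i)))

{-# OPTIONS --safe #-}
module Submission where

-- Put (m - 1) λ = ν + (m - 2).  Below a root, the eigenvalue equations of a hypertree are
-- solved from the pendant edges upwards: an edge above a part of cost C adds κ + 1/(ν - C)
-- to the cost of its upper vertex, where κ = (m - 2)/(ν + m - 1).  The positive vector so
-- obtained satisfies all equations but the one at the root, where Φ(ν) = ν + κ - cost is
-- left over.  Hence Φ(ν) ≥ 0 bounds the spectral radius from above, and a zero of Φ, found
-- by bisection, is an eigenvalue.  Two hypertrees are compared by their costs at a rational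
-- ν just below the zero of Φ for the larger one.
--
-- The hypothesis makes ν ≥ 7 in all comparisons, and then an edge at the root with j edges
-- below it costs little more than one pendant edge, and much less than j + 1 of them.
-- Rooted at a centroid, a hypertree has at most k/2 edges below each edge at the root; if
-- four or more edges avoid the root, the saving already exceeds that of the seventh
-- hypertree.  Otherwise it is one of the seven, or its branches are of one of five kinds,
-- each compared with the seventh directly.
--
-- A hypertree is presented as a rooted tree by adding edges one at a time: by acyclicity
-- and linearity a new edge meets the part already built in a single non-pendant vertex.

open import Data.Empty using (⊥-elim)
open import Data.Fin.Base as Fin using (Fin; zero; suc; toℕ; fromℕ<; _↑ˡ_; _↑ʳ_)
open import Data.Fin.Permutation as Perm using (Permutation; permutation; _⟨$⟩ˡ_; _⟨$⟩ʳ_)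
import Data.Fin.Properties as Fin
open import Data.Fin.Subset using (Subset; _∈_; _∉_; _∩_; ∣_∣; ⁅_⁆; ⊤; ⊥)
import Data.Fin.Subset.Properties as Subset
open import Data.Integer.Base as ℤ using (ℤ)
import Data.Integer.Properties as ℤ
import Data.Integer.Tactic.RingSolver as IntSolver
open import Data.List.Base as List using (List; []; _∷_; _++_; length; filter; map; replicate)
open import Data.List.Membership.Propositional using (find; lose) renaming (_∈_ to _∈ˡ_; _∉_ to _∉ˡ_)
import Data.List.Membership.Propositional.Properties as Membership
open import Data.List.Membership.Propositional.Properties.WithK using (unique∧set⇒bag)
import Data.List.Properties as List
open import Data.List.Relation.Binary.Permutation.Propositional as ↭ using (_↭_; ↭-sym; ↭-trans; ↭-refl)
import Data.List.Relation.Binary.Permutation.Propositional.Properties as ↭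
open import Data.List.Relation.Unary.All as All using (All; []; _∷_)
import Data.List.Relation.Unary.All.Properties as All
open import Data.List.Relation.Unary.AllPairs as AllPairs using ([]; _∷_)
open import Data.List.Relation.Unary.Any as Any using (Any; here; there)
import Data.List.Relation.Unary.Any.Properties as Any
open import Data.List.Relation.Unary.Unique.Propositional using (Unique)
import Data.List.Relation.Unary.Unique.Propositional.Properties as Unique
open import Data.Nat.Base as ℕ using (ℕ; zero; suc; z≤n; s≤s; _∸_; NonTrivial)
import Data.Nat.DivMod as ℕ
import Data.Nat.Induction as ℕ
import Data.Nat.Properties as ℕ
import Data.Nat.Tactic.RingSolver as NatSolver
open import Data.Product.Base using (Σ; ∃; ∃₂; _×_; _,_; proj₁; proj₂)
open import Data.Rational.Base as ℚ using (ℚ; 0ℚ; 1ℚ; ½)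
import Data.Rational.Properties as ℚ
import Data.Rational.Unnormalised.Base as ℚᵘ
import Data.Rational.Unnormalised.Properties as ℚᵘ
open import Data.Sum.Base using (_⊎_; inj₁; inj₂; [_,_]′)
open import Data.Unit.Base using (tt) renaming (⊤ to Unit)
open import Data.Vec.Base as Vec using (Vec; []; _∷_)
import Data.Vec.Properties as Vec
open import Function.Base using (_∘_; id; _$_; case_of_)
open import Function.Bundles using (_⇔_; mk⇔; module Equivalence)
open import Function.Definitions using (Injective)
open import Induction.WellFounded using (Acc; acc)
open import Relation.Binary.Construct.Closure.ReflexiveTransitive as Star using (Star; _◅_; _◅◅_)
open import Relation.Binary.Definitions using (tri<; tri≈; tri>)
open import Relation.Binary.PropositionalEquality
open import Relation.Nullary using (¬_; Dec; yes; no; does; contradiction)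
open import Relation.Nullary.Decidable using (_×-dec_; ¬?; dec-true; dec⇒maybe)
open import Relation.Unary using (Pred; Decidable)
open import Tactic.RingSolver using (solve-∀)
open import Tactic.RingSolver.Core.AlmostCommutativeRing using (AlmostCommutativeRing; fromCommutativeRing)

open import Data.Bool.Base using (Bool; true; false)
import Data.Bool.Properties as Bool
import Data.List.Relation.Binary.BagAndSetEquality as BagSet
open import Defs

-- Write α = κ + 1/ν for the cost of a pendant edge. The vector is positive if every part below an
-- edge costs less than ν, and a margin of 1 is kept. This is what the centroid is for: just below
-- the zero of Φ for the seventh hypertree, kα ≤ ν + κ + 3α ≤ ν + 5, so a part with at most k/2
-- edges costs at most (ν + 5)/2, which is at most ν - 1 when ν ≥ 7. The number four arises
-- likewise: an edge off the root saves at least 3α/4 against a pendant edge at the root, so four of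
-- them save 3α, and the seventh hypertree saves less than that.
--
-- A strict inequality of Cauchy reals asks for a rational gap, and the zeros of Φ need not be
-- rational. So vectors are kept as functions of a rational ν, and successive costs differ by a
-- margin uniform over the bisection interval; the eigenvector itself appears along a Cauchy
-- sequence of such ν. The upper bound covers complex eigenvalues because a positive y with Ay ≤ λy
-- bounds the norm of the symmetric non-negative A by λ.

-- Ordered-field arithmetic of the rationals.

module Rational where

  open import Data.Rational.Base using (_+_; _-_; _*_; -_; _≤_; _<_) public

  ring : AlmostCommutativeRing _ _
  ring = fromCommutativeRing ℚ.+-*-commutativeRing λ q → dec⇒maybe (0ℚ ℚ.≟ q)

  0<1 : 0ℚ < 1ℚ
  0<1 = ℚ.positive⁻¹ 1ℚ

  <-by : ∀ {p q d} → 0ℚ < d → p + d ≡ q → p < q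
  <-by {p} {q} {d} 0<d refl = subst (_< p + d) (ℚ.+-identityʳ p) (ℚ.+-monoʳ-< p 0<d)

  ≤-by : ∀ {p q d} → 0ℚ ≤ d → p + d ≡ q → p ≤ q
  ≤-by {p} {q} {d} 0≤d refl = subst (_≤ p + d) (ℚ.+-identityʳ p) (ℚ.+-monoʳ-≤ p 0≤d)

  <⇒0< : ∀ {p q} → p < q → 0ℚ < q - p
  <⇒0< {p} {q} p<q = subst (_< q - p) (ℚ.+-inverseʳ p) (ℚ.+-monoˡ-< (- p) p<q)

  ≤⇒0≤ : ∀ {p q} → p ≤ q → 0ℚ ≤ q - p
  ≤⇒0≤ {p} {q} p≤q = subst (_≤ q - p) (ℚ.+-inverseʳ p) (ℚ.+-monoˡ-≤ (- p) p≤q)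

  *-pos : ∀ {p q} → 0ℚ < p → 0ℚ < q → 0ℚ < p * q
  *-pos {p} {q} 0<p 0<q =
    subst (_< p * q) (ℚ.*-zeroʳ p) (ℚ.*-monoʳ-<-pos p {{ℚ.positive 0<p}} 0<q)

  *-nonNeg : ∀ {p q} → 0ℚ ≤ p → 0ℚ ≤ q → 0ℚ ≤ p * q
  *-nonNeg {p} {q} 0≤p 0≤q =
    subst (_≤ p * q) (ℚ.*-zeroʳ p) (ℚ.*-monoˡ-≤-nonNeg p {{ℚ.nonNegative 0≤p}} 0≤q)

  +-pos : ∀ {p q} → 0ℚ < p → 0ℚ < q → 0ℚ < p + q
  +-pos = ℚ.+-mono-<

  +-nonNeg : ∀ {p q} → 0ℚ ≤ p → 0ℚ ≤ q → 0ℚ ≤ p + q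
  +-nonNeg = ℚ.+-mono-≤

  *-mono : ∀ {p q r s} → 0ℚ ≤ p → 0ℚ ≤ r → p ≤ q → r ≤ s → p * r ≤ q * s
  *-mono {p} {q} {r} {s} 0≤p 0≤r p≤q r≤s = ℚ.≤-trans
    (ℚ.*-monoʳ-≤-nonNeg r {{ℚ.nonNegative 0≤r}} p≤q)
    (ℚ.*-monoˡ-≤-nonNeg q {{ℚ.nonNegative (ℚ.≤-trans 0≤p p≤q)}} r≤s)

  *-monoˡ : ∀ {r p q} → 0ℚ ≤ r → p ≤ q → r * p ≤ r * q
  *-monoˡ {r} 0≤r = ℚ.*-monoˡ-≤-nonNeg r {{ℚ.nonNegative 0≤r}}

  *-monoʳ : ∀ {r p q} → 0ℚ ≤ r → p ≤ q → p * r ≤ q * r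
  *-monoʳ {r} 0≤r = ℚ.*-monoʳ-≤-nonNeg r {{ℚ.nonNegative 0≤r}}

  *-cancelˡ-< : ∀ {r p q} → 0ℚ ≤ r → r * p < r * q → p < q
  *-cancelˡ-< {r} 0≤r = ℚ.*-cancelˡ-<-nonNeg r {{ℚ.nonNegative 0≤r}}

  *-cancelˡ-≤ : ∀ {r p q} → 0ℚ < r → r * p ≤ r * q → p ≤ q
  *-cancelˡ-≤ {r} 0<r = ℚ.*-cancelˡ-≤-pos r {{ℚ.positive 0<r}}

  square-nonNeg : ∀ p → 0ℚ ≤ p * p
  square-nonNeg p with ℚ.≤-total 0ℚ p
  ... | inj₁ 0≤p = *-nonNeg 0≤p 0≤p
  ... | inj₂ p≤0 = subst (0ℚ ≤_) (square-neg p) (*-nonNeg (neg p≤0) (neg p≤0))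
    where
    square-neg : ∀ p → (- p) * (- p) ≡ p * p
    square-neg = solve-∀ ring
    neg : p ≤ 0ℚ → 0ℚ ≤ - p
    neg p≤0 = ℚ.neg-antimono-≤ p≤0

  ≤-∣-∣ : ∀ p → p ≤ ℚ.∣ p ∣
  ≤-∣-∣ p with ℚ.≤-total 0ℚ p
  ... | inj₁ 0≤p = ℚ.≤-reflexive (sym (ℚ.0≤p⇒∣p∣≡p 0≤p))
  ... | inj₂ p≤0 = ℚ.≤-trans p≤0 (ℚ.0≤∣p∣ p)

  ∣-∣-< : ∀ {p e} → p < e → - p < e → ℚ.∣ p ∣ < e
  ∣-∣-< {p} p<e -p<e with ℚ.∣p∣≡p∨∣p∣≡-p p
  ... | inj₁ eq = subst (_< _) (sym eq) p<e
  ... | inj₂ eq = subst (_< _) (sym eq) -p<e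

  ∣-∣-swap : ∀ p q → ℚ.∣ p - q ∣ ≡ ℚ.∣ q - p ∣
  ∣-∣-swap p q = trans (sym (ℚ.∣-p∣≡∣p∣ (p - q))) (cong ℚ.∣_∣ (swap p q))
    where
    swap : ∀ p q → - (p - q) ≡ q - p
    swap = solve-∀ ring

  close-upper : ∀ {p q e} → ℚ.∣ p - q ∣ < e → p < q + e
  close-upper {p} {q} {e} h = subst₂ _<_ (cancel p q) (ℚ.+-comm e q)
    (ℚ.+-monoˡ-< q (ℚ.≤-<-trans (≤-∣-∣ (p - q)) h))
    where
    cancel : ∀ p q → p - q + q ≡ p
    cancel = solve-∀ ring

  close-lower : ∀ {p q e} → ℚ.∣ p - q ∣ < e → q < p + e
  close-lower {p} {q} h = close-upper (subst (_< _) (∣-∣-swap p q) h)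

  abstract
    -- the reciprocal, with junk value 0 at 0
    inv : ℚ → ℚ
    inv q with q ℚ.≟ 0ℚ
    ... | yes _ = 0ℚ
    ... | no q≢0 = ℚ.1/_ q {{ℚ.≢-nonZero q≢0}}

    inv-inverse : ∀ {q} → 0ℚ < q → q * inv q ≡ 1ℚ
    inv-inverse {q} 0<q with q ℚ.≟ 0ℚ
    ... | yes q≡0 = contradiction (sym q≡0) (ℚ.<⇒≢ 0<q)
    ... | no q≢0 = ℚ.*-inverseʳ q {{ℚ.≢-nonZero q≢0}}

  inv-pos : ∀ {q} → 0ℚ < q → 0ℚ < inv q
  inv-pos {q} 0<q = *-cancelˡ-< (ℚ.<⇒≤ 0<q)
    (subst₂ _<_ (sym (ℚ.*-zeroʳ q)) (sym (inv-inverse 0<q)) 0<1)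

  -- both sides of p⁻¹ ≤ q⁻¹ are multiplied by p q
  inv-antimono : ∀ {p q} → 0ℚ < p → p ≤ q → inv q ≤ inv p
  inv-antimono {p} {q} 0<p p≤q = subst₂ _≤_ left right
    (*-monoʳ (ℚ.<⇒≤ (*-pos (inv-pos 0<p) (inv-pos 0<q))) p≤q)
    where
    0<q : 0ℚ < q
    0<q = ℚ.<-≤-trans 0<p p≤q
    left : p * (inv p * inv q) ≡ inv q
    left = trans (sym (ℚ.*-assoc p (inv p) (inv q)))
             (trans (cong (_* inv q) (inv-inverse 0<p)) (ℚ.*-identityˡ (inv q)))
    rearrange : ∀ q i j → q * (i * j) ≡ q * j * i
    rearrange = solve-∀ ring
    right : q * (inv p * inv q) ≡ inv p
    right = trans (rearrange q (inv p) (inv q))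
             (trans (cong (_* inv p) (inv-inverse 0<q)) (ℚ.*-identityˡ (inv p)))

  -- Unary, so that `fromNat (suc n)` unfolds to `1ℚ + fromNat n`; identities about numerals can
  -- then be proved with one of them replaced by a variable.
  fromNat : ℕ → ℚ
  fromNat zero    = 0ℚ
  fromNat (suc n) = 1ℚ + fromNat n

  fromNat-nonNeg : ∀ n → 0ℚ ≤ fromNat n
  fromNat-nonNeg zero    = ℚ.≤-refl
  fromNat-nonNeg (suc n) = +-nonNeg (ℚ.<⇒≤ 0<1) (fromNat-nonNeg n)

  fromNat-pos : ∀ n → 0ℚ < fromNat (suc n)
  fromNat-pos n = ℚ.+-mono-<-≤ 0<1 (fromNat-nonNeg n)

  fromNat-+ : ∀ m n → fromNat (m ℕ.+ n) ≡ fromNat m + fromNat n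
  fromNat-+ zero    n = sym (ℚ.+-identityˡ (fromNat n))
  fromNat-+ (suc m) n = trans (cong (1ℚ +_) (fromNat-+ m n)) (sym (ℚ.+-assoc 1ℚ (fromNat m) (fromNat n)))

  fromNat-* : ∀ m n → fromNat (m ℕ.* n) ≡ fromNat m * fromNat n
  fromNat-* zero    n = sym (ℚ.*-zeroˡ (fromNat n))
  fromNat-* (suc m) n = begin
    fromNat (n ℕ.+ m ℕ.* n)               ≡⟨ fromNat-+ n (m ℕ.* n) ⟩
    fromNat n + fromNat (m ℕ.* n)         ≡⟨ cong (λ r → fromNat n + r) (fromNat-* m n) ⟩
    fromNat n + fromNat m * fromNat n     ≡⟨ rearrange (fromNat m) (fromNat n) ⟩
    (1ℚ + fromNat m) * fromNat n          ∎
    where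
    open ≡-Reasoning
    rearrange : ∀ p q → q + p * q ≡ (1ℚ + p) * q
    rearrange = solve-∀ ring

  fromNat-mono : ∀ {m n} → m ℕ.≤ n → fromNat m ≤ fromNat n
  fromNat-mono {n = n} z≤n = fromNat-nonNeg n
  fromNat-mono (s≤s m≤n)   = ℚ.+-monoʳ-≤ 1ℚ (fromNat-mono m≤n)

  two three four seven : ℚ
  two   = fromNat 2
  three = fromNat 3
  four  = fromNat 4
  seven = fromNat 7

  0<four : 0ℚ < four
  0<four = fromNat-pos 3

open Rational using (ring; seven)


-- Duplicate-free lists.

module Lists where

  private variable
    A B : Set

  ∈-tail : ∀ {x y : A} {xs} → x ∈ˡ y ∷ xs → x ≢ y → x ∈ˡ xs
  ∈-tail (here x≡y)   x≢y = contradiction x≡y x≢y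
  ∈-tail (there x∈xs) _   = x∈xs

  unique⇒∉ : ∀ {x : A} {xs} → Unique (x ∷ xs) → x ∉ˡ xs
  unique⇒∉ (x≢ ∷ _) x∈xs = All.lookup x≢ x∈xs refl

  ∉⇒unique : ∀ {x : A} {xs} → x ∉ˡ xs → Unique xs → Unique (x ∷ xs)
  ∉⇒unique x∉xs u = All.tabulate (λ { y∈xs refl → x∉xs y∈xs }) ∷ u

  unique-++⁻ : ∀ (xs : List A) {ys} → Unique (xs ++ ys) →
    Unique xs × Unique ys × (∀ {v} → v ∈ˡ xs → v ∉ˡ ys)
  unique-++⁻ []       u        = [] , u , λ ()
  unique-++⁻ (x ∷ xs) (x≢ ∷ u) =
    let uxs , uys , disj = unique-++⁻ xs u in
      All.++⁻ˡ xs x≢ ∷ uxs , uys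
    , λ { (here refl) v∈ys → All.lookup (All.++⁻ʳ xs x≢) v∈ys refl
        ; (there v∈xs) v∈ys → disj v∈xs v∈ys }

  unique-++⁺ : ∀ {xs ys : List A} → Unique xs → Unique ys →
    (∀ {v} → v ∈ˡ xs → v ∉ˡ ys) → Unique (xs ++ ys)
  unique-++⁺ uxs uys disj = Unique.++⁺ uxs uys (λ (v∈xs , v∈ys) → disj v∈xs v∈ys)

  unique-resp-↭ : ∀ {xs ys : List A} → xs ↭ ys → Unique xs → Unique ys
  unique-resp-↭ ↭.refl u = u
  unique-resp-↭ (↭.prep x p) (x≢ ∷ u) = ↭.All-resp-↭ p x≢ ∷ unique-resp-↭ p u
  unique-resp-↭ (↭.swap x y p) ((x≢y ∷ x≢) ∷ y≢ ∷ u) =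
    (≢-sym x≢y ∷ ↭.All-resp-↭ p y≢) ∷ ↭.All-resp-↭ p x≢ ∷ unique-resp-↭ p u
  unique-resp-↭ (↭.trans p q) u = unique-resp-↭ q (unique-resp-↭ p u)

  unique-↭ : ∀ {xs ys : List A} → Unique xs → Unique ys →
    (∀ {v} → v ∈ˡ xs → v ∈ˡ ys) → (∀ {v} → v ∈ˡ ys → v ∈ˡ xs) → xs ↭ ys
  unique-↭ uxs uys to from =
    BagSet.∼bag⇒↭ (unique∧set⇒bag uxs uys (mk⇔ to from))

  length≤1 : ∀ {xs : List A} → Unique xs →
    (∀ {x y} → x ∈ˡ xs → y ∈ˡ xs → x ≡ y) → length xs ℕ.≤ 1
  length≤1 {xs = []}        _ _ = z≤n
  length≤1 {xs = _ ∷ []}    _ _ = s≤s z≤n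
  length≤1 {xs = _ ∷ _ ∷ _} u h =
    contradiction (subst (_∈ˡ _) (h (there (here refl)) (here refl)) (here refl)) (unique⇒∉ u)

  length≤1⁻ : ∀ {xs : List A} {x y} → length xs ℕ.≤ 1 → x ∈ˡ xs → y ∈ˡ xs → x ≡ y
  length≤1⁻ {xs = _ ∷ []} _ (here refl) (here refl) = refl
  length≤1⁻ {xs = _ ∷ _ ∷ _} (s≤s ())

  length≤2 : ∀ {xs : List A} {u w} → Unique xs → (∀ {x} → x ∈ˡ xs → x ≡ u ⊎ x ≡ w) →
    length xs ℕ.≤ 2
  length≤2 {xs = []} _ _ = z≤n
  length≤2 {xs = _ ∷ []} _ _ = s≤s z≤n
  length≤2 {xs = _ ∷ _ ∷ []} _ _ = s≤s (s≤s z≤n)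
  length≤2 {xs = _ ∷ _ ∷ _ ∷ _} ((x≢y ∷ x≢z ∷ _) ∷ (y≢z ∷ _) ∷ _) h
    with h (here refl) | h (there (here refl)) | h (there (there (here refl)))
  ... | inj₁ refl | inj₁ refl | _         = contradiction refl x≢y
  ... | inj₁ refl | inj₂ refl | inj₁ refl = contradiction refl x≢z
  ... | inj₁ refl | inj₂ refl | inj₂ refl = contradiction refl y≢z
  ... | inj₂ refl | inj₂ refl | _         = contradiction refl x≢y
  ... | inj₂ refl | inj₁ refl | inj₂ refl = contradiction refl x≢z
  ... | inj₂ refl | inj₁ refl | inj₁ refl = contradiction refl y≢z

  length≤2⁻ : ∀ {xs : List A} {x y z} → length xs ℕ.≤ 2 → x ∈ˡ xs → y ∈ˡ xs → z ∈ˡ xs →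
    x ≢ y → x ≢ z → y ≡ z
  length≤2⁻ {xs = _ ∷ []} _ (here refl) (here refl) _ x≢y _ = contradiction refl x≢y
  length≤2⁻ {xs = _ ∷ _ ∷ []} _ (here refl) (here refl) _ x≢y _ = contradiction refl x≢y
  length≤2⁻ {xs = _ ∷ _ ∷ []} _ (here refl) (there (here refl)) (here refl) _ x≢z = contradiction refl x≢z
  length≤2⁻ {xs = _ ∷ _ ∷ []} _ (here refl) (there (here refl)) (there (here refl)) _ _ = refl
  length≤2⁻ {xs = _ ∷ _ ∷ []} _ (there (here refl)) (here refl) (here refl) _ _ = refl
  length≤2⁻ {xs = _ ∷ _ ∷ []} _ (there (here refl)) (here refl) (there (here refl)) _ x≢z = contradiction refl x≢z
  length≤2⁻ {xs = _ ∷ _ ∷ []} _ (there (here refl)) (there (here refl)) _ x≢y _ = contradiction refl x≢y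
  length≤2⁻ {xs = _ ∷ _ ∷ _ ∷ _} (s≤s (s≤s ()))

  1<length : ∀ {xs : List A} {x y} → x ∈ˡ xs → y ∈ˡ xs → x ≢ y → 1 ℕ.< length xs
  1<length {xs = _ ∷ []} (here refl) (here refl) x≢y = contradiction refl x≢y
  1<length {xs = _ ∷ _ ∷ _} _ _ _ = s≤s (s≤s z≤n)

  length-⊆ : ∀ {xs ys : List A} → Unique xs → (∀ {x} → x ∈ˡ xs → x ∈ˡ ys) →
    length xs ℕ.≤ length ys
  length-⊆ {xs = []} _ _ = z≤n
  length-⊆ {xs = x ∷ xs} (x≢ ∷ u) sub with Membership.∈-∃++ (sub (here refl))
  ... | ys , zs , refl = subst (suc (length xs) ℕ.≤_)
    (sym (trans (List.length-++ ys) (trans (ℕ.+-suc _ _) (cong suc (sym (List.length-++ ys))))))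
    (s≤s (length-⊆ u λ v∈xs → remove (≢-sym (All.lookup x≢ v∈xs)) (sub (there v∈xs))))
    where
    remove : ∀ {v} → v ≢ x → v ∈ˡ ys ++ x ∷ zs → v ∈ˡ ys ++ zs
    remove v≢x v∈ with Membership.∈-++⁻ ys v∈
    ... | inj₁ v∈ys = Membership.∈-++⁺ˡ v∈ys
    ... | inj₂ v∈x∷zs = Membership.∈-++⁺ʳ ys (∈-tail v∈x∷zs v≢x)

  ++-injective : ∀ (xs {xs′ ys ys′} : List A) → length xs ≡ length xs′ →
    xs ++ ys ≡ xs′ ++ ys′ → xs ≡ xs′ × ys ≡ ys′
  ++-injective []       {[]}      _  eq = refl , eq
  ++-injective (x ∷ xs) {y ∷ xs′} le eq =
    let x≡y , eq′ = List.∷-injective eq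
        p , q     = ++-injective xs (ℕ.suc-injective le) eq′
    in cong₂ _∷_ x≡y p , q

open Lists

-- Finite subsets and their enumerations.

module Subsets where


  infix 4 _∈ˡ?_

  _∈ˡ?_ : ∀ {n} (x : Fin n) xs → Dec (x ∈ˡ xs)
  x ∈ˡ? xs = Any.any? (x Fin.≟_) xs

  ∈-comprehension⁺ : ∀ {n p} {P : Pred (Fin n) p} (P? : Decidable P) {i} →
    P i → i ∈ comprehension P?
  ∈-comprehension⁺ P? {i} Pi = Vec.lookup⇒[]= i (comprehension P?)
    (trans (Vec.lookup∘tabulate (does ∘ P?) i) (dec-true (P? i) Pi))

  ∈-comprehension⁻ : ∀ {n p} {P : Pred (Fin n) p} (P? : Decidable P) {i} →
    i ∈ comprehension P? → P i
  ∈-comprehension⁻ P? {i} i∈ with P? i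
    | trans (sym (Vec.lookup∘tabulate (does ∘ P?) i)) (Vec.[]=⇒lookup i∈)
  ... | yes Pi | _ = Pi

  abstract
    setOf : ∀ {n} → List (Fin n) → Subset n
    setOf xs = comprehension (_∈ˡ? xs)

    ∈-setOf⁺ : ∀ {n} {xs} {x : Fin n} → x ∈ˡ xs → x ∈ setOf xs
    ∈-setOf⁺ {xs = xs} = ∈-comprehension⁺ (_∈ˡ? xs)

    ∈-setOf⁻ : ∀ {n} {xs} {x : Fin n} → x ∈ setOf xs → x ∈ˡ xs
    ∈-setOf⁻ {xs = xs} = ∈-comprehension⁻ (_∈ˡ? xs)

  elements : ∀ {n} → Subset n → List (Fin n)
  elements p = filter (Subset._∈? p) (List.allFin _)

  ∈-elements⁺ : ∀ {n} {p : Subset n} {x} → x ∈ p → x ∈ˡ elements p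
  ∈-elements⁺ {p = p} {x} = Membership.∈-filter⁺ (Subset._∈? p) (Membership.∈-allFin x)

  ∈-elements⁻ : ∀ {n} {p : Subset n} {x} → x ∈ˡ elements p → x ∈ p
  ∈-elements⁻ {p = p} x∈ = proj₂ (Membership.∈-filter⁻ (Subset._∈? p) {xs = List.allFin _} x∈)

  elements-unique : ∀ {n} (p : Subset n) → Unique (elements p)
  elements-unique p = Unique.filter⁺ (Subset._∈? p) (Unique.allFin⁺ _)

  -- `∣_∣` recurses on the bit vector, and `members` follows that recursion; any other
  -- duplicate-free enumeration is a permutation of it.
  ∣∣≡length : ∀ {n} {p : Subset n} {xs} → Unique xs →
    (∀ {x} → x ∈ˡ xs → x ∈ p) → (∀ {x} → x ∈ p → x ∈ˡ xs) → ∣ p ∣ ≡ length xs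
  ∣∣≡length {p = p} u sound complete = trans (∣∣≡ p)
    (↭.↭-length (unique-↭ (members-unique p) u (complete ∘ ∈-members⁻ p) (∈-members⁺ ∘ sound)))
    where
    members : ∀ {n} → Subset n → List (Fin n)
    members []          = []
    members (true  ∷ p) = zero ∷ map suc (members p)
    members (false ∷ p) = map suc (members p)

    ∣∣≡ : ∀ {n} (p : Subset n) → ∣ p ∣ ≡ length (members p)
    ∣∣≡ []          = refl
    ∣∣≡ (true  ∷ p) = cong suc (trans (∣∣≡ p) (sym (List.length-map suc (members p))))
    ∣∣≡ (false ∷ p) = trans (∣∣≡ p) (sym (List.length-map suc (members p)))

    ∈-members⁺ : ∀ {n} {p : Subset n} {x} → x ∈ p → x ∈ˡ members p
    ∈-members⁺ Vec.here = here refl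
    ∈-members⁺ {p = true  ∷ _} (Vec.there x∈p) = there (Membership.∈-map⁺ suc (∈-members⁺ x∈p))
    ∈-members⁺ {p = false ∷ _} (Vec.there x∈p) = Membership.∈-map⁺ suc (∈-members⁺ x∈p)

    ∈-members⁻ : ∀ {n} (p : Subset n) {x} → x ∈ˡ members p → x ∈ p
    ∈-members⁻ (true  ∷ p) (here refl) = Vec.here
    ∈-members⁻ (true  ∷ p) (there x∈) with Membership.∈-map⁻ suc x∈
    ... | _ , y∈ , refl = Vec.there (∈-members⁻ p y∈)
    ∈-members⁻ (false ∷ p) x∈ with Membership.∈-map⁻ suc x∈
    ... | _ , y∈ , refl = Vec.there (∈-members⁻ p y∈)

    members-unique : ∀ {n} (p : Subset n) → Unique (members p)
    members-unique []          = []
    members-unique (true  ∷ p) = ∉⇒unique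
      (λ 0∈ → case Membership.∈-map⁻ suc 0∈ of λ { (_ , _ , ()) })
      (Unique.map⁺ Fin.suc-injective (members-unique p))
    members-unique (false ∷ p) = Unique.map⁺ Fin.suc-injective (members-unique p)

  ∣∣≡length-elements : ∀ {n} (p : Subset n) → ∣ p ∣ ≡ length (elements p)
  ∣∣≡length-elements p = ∣∣≡length (elements-unique p) ∈-elements⁻ ∈-elements⁺

  ∣∣≤1⁺ : ∀ {n} {p : Subset n} → (∀ {x y} → x ∈ p → y ∈ p → x ≡ y) → ∣ p ∣ ℕ.≤ 1
  ∣∣≤1⁺ {p = p} h = subst (ℕ._≤ 1) (sym (∣∣≡length-elements p))
    (length≤1 (elements-unique p) λ x∈ y∈ → h (∈-elements⁻ x∈) (∈-elements⁻ y∈))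

  ∣∣≤1⁻ : ∀ {n} {p : Subset n} → ∣ p ∣ ℕ.≤ 1 → ∀ {x y} → x ∈ p → y ∈ p → x ≡ y
  ∣∣≤1⁻ {p = p} h x∈ y∈ = length≤1⁻ (subst (ℕ._≤ 1) (∣∣≡length-elements p) h)
    (∈-elements⁺ x∈) (∈-elements⁺ y∈)

  setOf-≡ : ∀ {n} {p : Subset n} {xs} →
    (∀ {x} → x ∈ˡ xs → x ∈ p) → (∀ {x} → x ∈ p → x ∈ˡ xs) → p ≡ setOf xs
  setOf-≡ sound complete = Subset.⊆-antisym (∈-setOf⁺ ∘ complete) (sound ∘ ∈-setOf⁻)

open Subsets


-- Rooted hypertrees as labelled shapes.

module Forests where

  infixr 6 _▷_

  -- The shape of a rooted hypertree.  c ▷ r has a first edge, carrying the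
  -- shape c at its other non-pendant vertex, and the remaining edges r at the root.
  data Shape : Set where
    ε   : Shape
    _▷_ : (children siblings : Shape) → Shape

  ⟪_⟫ : Shape → ℕ
  ⟪ ε ⟫     = 0
  ⟪ c ▷ r ⟫ = suc (⟪ c ⟫ ℕ.+ ⟪ r ⟫)

  -- The edges below a vertex u.  The first edge of branch ps w c r is {u, w} ∪ ps;
  -- c hangs below w, and no edge hangs below the vertices ps.
  data Forest (s : ℕ) (X : Set) : Set where
    ε      : Forest s X
    branch : (ps : Vec X s) (w : X) (c r : Forest s X) → Forest s X

  private variable
    s : ℕ
    X Y Z : Set

  shape : Forest s X → Shape
  shape ε                = ε
  shape (branch ps w c r) = shape c ▷ shape r

  vertices : Forest s X → List X
  vertices ε                = []
  vertices (branch ps w c r) = w ∷ Vec.toList ps ++ (vertices c ++ vertices r)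

  -- Edges come before the edge above them, so that each edge meets all later ones only in its upper
  -- vertex; `edgeLists-ear` rests on this order.
  edgeLists : X → Forest s X → List (List X)
  edgeLists u ε                = []
  edgeLists u (branch ps w c r) = edgeLists w c ++ (u ∷ w ∷ Vec.toList ps) ∷ edgeLists u r

  mapForest : (X → Y) → Forest s X → Forest s Y
  mapForest f ε                = ε
  mapForest f (branch ps w c r) = branch (Vec.map f ps) (f w) (mapForest f c) (mapForest f r)

  length-edgeLists : ∀ (u : X) (F : Forest s X) → length (edgeLists u F) ≡ ⟪ shape F ⟫
  length-edgeLists u ε = refl
  length-edgeLists u (branch ps w c r) = begin
    length (edgeLists w c ++ (u ∷ w ∷ Vec.toList ps) ∷ edgeLists u r)
      ≡⟨ List.length-++ (edgeLists w c) ⟩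
    length (edgeLists w c) ℕ.+ suc (length (edgeLists u r))
      ≡⟨ ℕ.+-suc _ _ ⟩
    suc (length (edgeLists w c) ℕ.+ length (edgeLists u r))
      ≡⟨ cong₂ (λ a b → suc (a ℕ.+ b)) (length-edgeLists w c) (length-edgeLists u r) ⟩
    ⟪ shape c ▷ shape r ⟫ ∎
    where open ≡-Reasoning

  length-toList : ∀ {n} (xs : Vec X n) → length (Vec.toList xs) ≡ n
  length-toList []       = refl
  length-toList (_ ∷ xs) = cong suc (length-toList xs)

  edgeLists-length : ∀ (u : X) (F : Forest s X) {l} → l ∈ˡ edgeLists u F → length l ≡ suc (suc s)
  edgeLists-length u (branch ps w c r) l∈ with Membership.∈-++⁻ (edgeLists w c) l∈
  ... | inj₁ l∈c         = edgeLists-length w c l∈c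
  ... | inj₂ (here refl) = cong (2 ℕ.+_) (length-toList ps)
  ... | inj₂ (there l∈r) = edgeLists-length u r l∈r

  vertices-map : ∀ (f : X → Y) (F : Forest s X) → vertices (mapForest f F) ≡ map f (vertices F)
  vertices-map f ε = refl
  vertices-map f (branch ps w c r) = cong (f w ∷_) (begin
    Vec.toList (Vec.map f ps) ++ (vertices (mapForest f c) ++ vertices (mapForest f r))
      ≡⟨ cong₂ _++_ (Vec.toList-map f ps) (cong₂ _++_ (vertices-map f c) (vertices-map f r)) ⟩
    map f (Vec.toList ps) ++ (map f (vertices c) ++ map f (vertices r))
      ≡⟨ cong (map f (Vec.toList ps) ++_) (List.map-++ f (vertices c) (vertices r)) ⟨
    map f (Vec.toList ps) ++ map f (vertices c ++ vertices r)
      ≡⟨ List.map-++ f (Vec.toList ps) (vertices c ++ vertices r) ⟨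
    map f (Vec.toList ps ++ (vertices c ++ vertices r)) ∎)
    where open ≡-Reasoning

  edgeLists-map : ∀ (f : X → Y) (u : X) (F : Forest s X) →
    edgeLists (f u) (mapForest f F) ≡ map (map f) (edgeLists u F)
  edgeLists-map f u ε = refl
  edgeLists-map f u (branch ps w c r) = trans
    (cong₂ _++_ (edgeLists-map f w c)
      (cong₂ _∷_ (cong (λ qs → f u ∷ f w ∷ qs) (Vec.toList-map f ps)) (edgeLists-map f u r)))
    (sym (List.map-++ (map f) (edgeLists w c) _))

  shape-map : ∀ (f : X → Y) (F : Forest s X) → shape (mapForest f F) ≡ shape F
  shape-map f ε                = refl
  shape-map f (branch ps w c r) = cong₂ _▷_ (shape-map f c) (shape-map f r)

  mapForest-∘ : ∀ (g : Y → Z) (f : X → Y) (F : Forest s X) →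
    mapForest g (mapForest f F) ≡ mapForest (g ∘ f) F
  mapForest-∘ g f ε = refl
  mapForest-∘ g f (branch ps w c r)
    rewrite Vec.map-∘ g f ps | mapForest-∘ g f c | mapForest-∘ g f r = refl

  length-vertices : ∀ (F : Forest s X) (G : Forest s Y) → shape F ≡ shape G →
    length (vertices F) ≡ length (vertices G)
  length-vertices ε ε _ = refl
  length-vertices (branch ps w c r) (branch qs x d t) eq = cong suc (begin
    length (Vec.toList ps ++ (vertices c ++ vertices r))
      ≡⟨ trans (List.length-++ (Vec.toList ps)) (cong (length (Vec.toList ps) ℕ.+_) (List.length-++ (vertices c))) ⟩
    length (Vec.toList ps) ℕ.+ (length (vertices c) ℕ.+ length (vertices r))
      ≡⟨ cong₂ ℕ._+_ (trans (length-toList ps) (sym (length-toList qs)))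
           (cong₂ ℕ._+_ (length-vertices c d (cong left eq)) (length-vertices r t (cong right eq))) ⟩
    length (Vec.toList qs) ℕ.+ (length (vertices d) ℕ.+ length (vertices t))
      ≡⟨ trans (List.length-++ (Vec.toList qs)) (cong (length (Vec.toList qs) ℕ.+_) (List.length-++ (vertices d))) ⟨
    length (Vec.toList qs ++ (vertices d ++ vertices t)) ∎)
    where
    open ≡-Reasoning
    left right : Shape → Shape
    left ε = ε
    left (a ▷ _) = a
    right ε = ε
    right (_ ▷ b) = b

  ▷-injective : ∀ {a b a′ b′} → a ▷ b ≡ a′ ▷ b′ → a ≡ a′ × b ≡ b′
  ▷-injective refl = refl , refl

  toList-injective : ∀ {n} {xs ys : Vec X n} → Vec.toList xs ≡ Vec.toList ys → xs ≡ ys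
  toList-injective {xs = []}    {[]}    _  = refl
  toList-injective {xs = _ ∷ _} {_ ∷ _} eq =
    cong₂ _∷_ (proj₁ (List.∷-injective eq)) (toList-injective (proj₂ (List.∷-injective eq)))

  -- The shape fixes the lengths of the blocks that `vertices` concatenates, so the list can be cut
  -- back into the labels in only one way.
  forest-≡ : ∀ (F G : Forest s X) → shape F ≡ shape G → vertices F ≡ vertices G → F ≡ G
  forest-≡ ε ε _ _ = refl
  forest-≡ (branch ps w c r) (branch qs x d t) sh vs =
    let w≡x , vs₁ = List.∷-injective vs
        shc , shr = ▷-injective sh
        p≡q , vs₂ = ++-injective (Vec.toList ps) {Vec.toList qs}
                      (trans (length-toList ps) (sym (length-toList qs))) vs₁
        vc , vr   = ++-injective (vertices c) {vertices d} (length-vertices c d shc) vs₂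
    in branch-cong (toList-injective p≡q) w≡x (forest-≡ c d shc vc) (forest-≡ r t shr vr)
    where
    branch-cong : ∀ {ps qs : Vec _ _} {w x c d r t} → ps ≡ qs → w ≡ x → c ≡ d → r ≡ t →
      branch ps w c r ≡ branch qs x d t
    branch-cong refl refl refl refl = refl

  module _ {n : ℕ} where

    lookupIn : List (Fin n) → List Y → Y → Fin n → Y
    lookupIn (x ∷ xs) (y ∷ ys) d v with v Fin.≟ x
    ... | yes _ = y
    ... | no  _ = lookupIn xs ys d v
    lookupIn _ _ d _ = d

    map-lookupIn : ∀ {xs} {ys : List Y} {d} → Unique xs → length xs ≡ length ys →
      map (lookupIn xs ys d) xs ≡ ys
    map-lookupIn {xs = []} {[]} _ _ = refl
    map-lookupIn {xs = x ∷ xs} {y ∷ ys} {d} (x≢ ∷ u) eq =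
      cong₂ _∷_ head (trans (rest xs x≢) (map-lookupIn u (ℕ.suc-injective eq)))
      where
      f g : Fin n → _
      f = lookupIn (x ∷ xs) (y ∷ ys) d
      g = lookupIn xs ys d
      head : f x ≡ y
      head with x Fin.≟ x
      ... | yes _  = refl
      ... | no x≢x = contradiction refl x≢x
      skip : ∀ {v} → x ≢ v → f v ≡ g v
      skip {v} x≢v with v Fin.≟ x
      ... | yes v≡x = contradiction (sym v≡x) x≢v
      ... | no _    = refl
      rest : ∀ vs → All (x ≢_) vs → map f vs ≡ map g vs
      rest []       []       = refl
      rest (v ∷ vs) (p ∷ ps) = cong₂ _∷_ (skip p) (rest vs ps)

    -- Distinctness turns matching two vertex lists position by position into a function on
    -- vertices. The target may be any type: with the vertices of another hypergraph this gives
    -- isomorphisms, with functions of ν it gives eigenvectors.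
    relabel : ∀ {u} {F : Forest s (Fin n)} {u′ : Y} {G : Forest s Y} →
      Unique (u ∷ vertices F) → shape F ≡ shape G →
      ∃ λ f → f u ≡ u′ × mapForest f F ≡ G
    relabel {u = u} {F} {u′} {G} uniq sh =
      let eq = map-lookupIn {ys = u′ ∷ vertices G} {d = u′} uniq (cong suc (length-vertices F G sh))
          f  = lookupIn (u ∷ vertices F) (u′ ∷ vertices G) u′
          eu , eF = List.∷-injective eq
      in f , eu , forest-≡ (mapForest f F) G (trans (shape-map f F) sh)
                    (trans (vertices-map f F) eF)

  record Split (u : X) (ps : Vec X s) (w : X) (c r : Forest s X) : Set where
    field
      edge-unique     : Unique (u ∷ w ∷ Vec.toList ps)
      children-unique : Unique (w ∷ vertices c)
      siblings-unique : Unique (u ∷ vertices r)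
      edge∩children   : ∀ {v} → v ∈ˡ u ∷ w ∷ Vec.toList ps → v ∉ˡ vertices c
      edge∩siblings   : ∀ {v} → v ∈ˡ u ∷ w ∷ Vec.toList ps → v ∉ˡ vertices r
      children∩siblings : ∀ {v} → v ∈ˡ vertices c → v ∉ˡ vertices r

  split : ∀ {u : X} (ps : Vec X s) w c r →
    Unique (u ∷ vertices (branch ps w c r)) → Split u ps w c r
  split ps w c r uniq with unique⇒∉ uniq | uniq
  ... | u∉ | _ ∷ uwps@(_ ∷ ups)
    with unique⇒∉ uwps | unique-++⁻ (Vec.toList ps) ups
  ... | w∉ | ups′ , ucr , ps∩
    with unique-++⁻ (vertices c) ucr
  ... | uc , ur , c∩r = record
    { edge-unique = ∉⇒unique
        (λ { (here u≡w) → u∉ (here u≡w) ; (there u∈ps) → u∉ (there (Membership.∈-++⁺ˡ u∈ps)) })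
        (∉⇒unique (λ w∈ps → w∉ (Membership.∈-++⁺ˡ w∈ps)) ups′)
    ; children-unique = ∉⇒unique (λ w∈c → w∉ (inC w∈c)) uc
    ; siblings-unique = ∉⇒unique (λ u∈r → u∉ (there (inR u∈r))) ur
    ; edge∩children = λ { (here refl) v∈c → u∉ (there (inC v∈c))
                        ; (there (here refl)) v∈c → w∉ (inC v∈c)
                        ; (there (there v∈ps)) v∈c → ps∩ v∈ps (Membership.∈-++⁺ˡ v∈c) }
    ; edge∩siblings = λ { (here refl) v∈r → u∉ (there (inR v∈r))
                        ; (there (here refl)) v∈r → w∉ (inR v∈r)
                        ; (there (there v∈ps)) v∈r → ps∩ v∈ps (Membership.∈-++⁺ʳ (vertices c) v∈r) }
    ; children∩siblings = c∩r
    }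
    where
    inC : ∀ {v} → v ∈ˡ vertices c → v ∈ˡ Vec.toList ps ++ (vertices c ++ vertices r)
    inC = Membership.∈-++⁺ʳ (Vec.toList ps) ∘ Membership.∈-++⁺ˡ
    inR : ∀ {v} → v ∈ˡ vertices r → v ∈ˡ Vec.toList ps ++ (vertices c ++ vertices r)
    inR = Membership.∈-++⁺ʳ (Vec.toList ps) ∘ Membership.∈-++⁺ʳ (vertices c)

  ∈-vertices-branch : ∀ {v} {ps : Vec X s} {w} {c r : Forest s X} → v ∈ˡ vertices (branch ps w c r) →
    v ≡ w ⊎ v ∈ˡ Vec.toList ps ⊎ v ∈ˡ vertices c ⊎ v ∈ˡ vertices r
  ∈-vertices-branch (here eq) = inj₁ eq
  ∈-vertices-branch {ps = ps} {c = c} (there v∈) with Membership.∈-++⁻ (Vec.toList ps) v∈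
  ... | inj₁ v∈ps = inj₂ (inj₁ v∈ps)
  ... | inj₂ v∈cr with Membership.∈-++⁻ (vertices c) v∈cr
  ... | inj₁ v∈c = inj₂ (inj₂ (inj₁ v∈c))
  ... | inj₂ v∈r = inj₂ (inj₂ (inj₂ v∈r))

  ∈-edge⇒∈-vertices : ∀ {u : X} {F : Forest s X} {l v} →
    l ∈ˡ edgeLists u F → v ∈ˡ l → v ∈ˡ u ∷ vertices F
  ∈-edge⇒∈-vertices {F = branch ps w c r} l∈ v∈l with Membership.∈-++⁻ (edgeLists w c) l∈
  ... | inj₁ l∈c = case ∈-edge⇒∈-vertices {F = c} l∈c v∈l of λ
    { (here refl) → there (here refl)
    ; (there v∈c) → there (there (Membership.∈-++⁺ʳ (Vec.toList ps) (Membership.∈-++⁺ˡ v∈c))) }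
  ... | inj₂ (here refl) = case v∈l of λ
    { (here refl) → here refl
    ; (there (here refl)) → there (here refl)
    ; (there (there v∈ps)) → there (there (Membership.∈-++⁺ˡ v∈ps)) }
  ... | inj₂ (there l∈r) = case ∈-edge⇒∈-vertices {F = r} l∈r v∈l of λ
    { (here refl) → here refl
    ; (there v∈r) → there (there (Membership.∈-++⁺ʳ (Vec.toList ps) (Membership.∈-++⁺ʳ (vertices c) v∈r))) }

  -- Edges are matched as sets, because the order within an edge list depends on the choice of the
  -- root.
  record Model {s} (H : Hypergraph) (u : Vertex H) (F : Forest s (Vertex H)) : Set where
    field
      distinct : Unique (u ∷ vertices F)
      covers   : ∀ v → v ∈ˡ u ∷ vertices F
      sound    : ∀ {l} → l ∈ˡ edgeLists u F → setOf l ∈ˡ edges H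
      complete : ∀ {e} → e ∈ˡ edges H → ∃ λ l → l ∈ˡ edgeLists u F × e ≡ setOf l

open Forests


-- Ear orderings exclude loose cycles.

module LooseCycles where

  next-suc : ∀ {n} (i : Fin (suc n)) → suc (toℕ i) ℕ.< suc n → toℕ (next i) ≡ suc (toℕ i)
  next-suc i 1+i<n = trans (Fin.toℕ-fromℕ< _) (ℕ.m<n⇒m%n≡m 1+i<n)

  next-last : ∀ {n} (i : Fin (suc n)) → toℕ i ≡ n → toℕ (next i) ≡ 0
  next-last {n} i i≡n = trans (Fin.toℕ-fromℕ< _)
    (trans (cong (λ a → suc a ℕ.% suc n) i≡n) (ℕ.n%n≡0 (suc n)))

  next-case : ∀ {n} (i : Fin (suc n)) →
    (toℕ i ℕ.< n × toℕ (next i) ≡ suc (toℕ i)) ⊎ (toℕ i ≡ n × toℕ (next i) ≡ 0)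
  next-case i with ℕ.m≤n⇒m<n∨m≡n (ℕ.≤-pred (Fin.toℕ<n i))
  ... | inj₁ i<n = inj₁ (i<n , next-suc i (s≤s i<n))
  ... | inj₂ i≡n = inj₂ (i≡n , next-last i i≡n)

  next≢ : ∀ {n} → 1 ℕ.< n → (i : Fin n) → next i ≢ i
  next≢ {suc n} 1<n i eq with next-case i | cong toℕ eq
  ... | inj₁ (_ , eq₁)   | eq₂ = ℕ.1+n≢n (trans (sym eq₁) eq₂)
  ... | inj₂ (i≡n , eq₁) | eq₂ =
    ℕ.<-irrefl (trans (trans (sym eq₁) eq₂) i≡n) (ℕ.≤-pred 1<n)

  previous : ∀ {n} (i : Fin n) → ∃ λ j → next j ≡ i
  previous {suc n} zero = Fin.fromℕ n , Fin.toℕ-injective (next-last _ (Fin.toℕ-fromℕ n))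
  previous {suc n} (suc i) = Fin.inject₁ i , Fin.toℕ-injective
    (trans (next-suc (Fin.inject₁ i) (s≤s (subst (ℕ._< n) (sym (Fin.toℕ-inject₁ i)) (Fin.toℕ<n i))))
           (cong suc (Fin.toℕ-inject₁ i)))

  -- A strict form of the ear orderings (Graham reductions) of acyclic hypergraphs: each edge hangs
  -- on the edges after it by one vertex. Linearity, acyclicity, the number of edges and the rows of
  -- the adjacency matrix are all read off from it.
  data Ear {X : Set} : List (List X) → Set where
    []   : Ear []
    ear : ∀ {l ls} (p : X) → (∀ {f x} → f ∈ˡ ls → x ∈ˡ l → x ∈ˡ f → x ≡ p) →
      Ear ls → Ear (l ∷ ls)

  ear-linear : ∀ {X : Set} {ls : List (List X)} → Ear ls → ∀ {l f} → l ∈ˡ ls → f ∈ˡ ls → l ≢ f →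
    ∀ {x y} → x ∈ˡ l → x ∈ˡ f → y ∈ˡ l → y ∈ˡ f → x ≡ y
  ear-linear (ear p h e) (here refl) (here refl) l≢f = contradiction refl l≢f
  ear-linear (ear p h e) (here refl) (there f∈) _ x∈l x∈f y∈l y∈f =
    trans (h f∈ x∈l x∈f) (sym (h f∈ y∈l y∈f))
  ear-linear (ear p h e) (there l∈) (here refl) _ x∈l x∈f y∈l y∈f =
    trans (h l∈ x∈f x∈l) (sym (h l∈ y∈f y∈l))
  ear-linear (ear p h e) (there l∈) (there f∈) = ear-linear e l∈ f∈

  -- Of the edges of a cycle, the earliest meets its two neighbours in different vertices.
  ear⇒¬cycle : ∀ {H} {ls : List (List (Vertex H))} → Ear ls → (C : LooseCycle H) →
    ¬ (∀ i → ∃ λ l → l ∈ˡ ls × LooseCycle.edge C i ≡ setOf l)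
  ear⇒¬cycle [] C in-ls with ℕ.≤-trans (s≤s z≤n) (LooseCycle.len≥3 C)
  ... | 0<len with in-ls (fromℕ< 0<len)
  ... | _ , () , _
  ear⇒¬cycle {ls = l ∷ ls} (ear p h e) C in-ls
    with Fin.any? (λ i → Vec.≡-dec Bool._≟_ (LooseCycle.edge C i) (setOf l))
  ... | no none = ear⇒¬cycle e C (λ i → tail i (in-ls i))
    where
    tail : ∀ i → (∃ λ f → f ∈ˡ l ∷ ls × LooseCycle.edge C i ≡ setOf f) →
      ∃ λ f → f ∈ˡ ls × LooseCycle.edge C i ≡ setOf f
    tail i (_ , here refl , eq) = contradiction (i , eq) none
    tail i (f , there f∈ , eq)  = f , f∈ , eq
  ... | yes (i , i≡l) with previous i
  ... | j , refl = next≢ 1<len (next j) (injective (trans x≡p (sym y≡p)))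
    where
    open LooseCycle C
    1<len : 1 ℕ.< len
    1<len = ℕ.≤-trans (s≤s (s≤s z≤n)) len≥3
    vertex∈ : ∀ a → vertex (next a) ∈ edge a × vertex (next a) ∈ edge (next a)
    vertex∈ a = Subset.x∈p∩q⁻ (edge a) (edge (next a))
      (subst (vertex (next a) ∈_) (sym (consecutive a)) (Subset.x∈⁅x⁆ _))
    -- Equal neighbours would both contain the vertex shared with the edge after them, while their
    -- intersection holds a single other vertex.
    distinct : ∀ a → edge a ≢ edge (next a)
    distinct a eq = next≢ 1<len (next a) (injective (Subset.x∈⁅y⁆⇒x≡y _
      (subst (vertex (next (next a)) ∈_) (consecutive a)
        (Subset.x∈p∩q⁺ (subst (vertex (next (next a)) ∈_) (sym eq) v∈ , v∈)))))
      where
      v∈ : vertex (next (next a)) ∈ edge (next a)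
      v∈ = proj₁ (vertex∈ (next a))
    meets : ∀ a x → edge a ≢ edge (next j) → x ∈ edge a → x ∈ edge (next j) → x ≡ p
    meets a x a≢ x∈a x∈j with in-ls a
    ... | f , here refl , eq = contradiction (trans eq (sym i≡l)) a≢
    ... | f , there f∈ , eq  =
      h f∈ (∈-setOf⁻ (subst (x ∈_) i≡l x∈j)) (∈-setOf⁻ (subst (x ∈_) eq x∈a))
    x≡p : vertex (next (next j)) ≡ p
    x≡p = meets (next (next j)) _ (≢-sym (distinct (next j)))
      (proj₂ (vertex∈ (next j))) (proj₁ (vertex∈ (next j)))
    y≡p : vertex (next j) ≡ p
    y≡p = meets j _ (distinct j) (proj₁ (vertex∈ j)) (proj₂ (vertex∈ j))

open LooseCycles

-- Every presented hypergraph is a hypertree.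

module ModelsAreHypertrees where

  private variable
    s : ℕ
    X : Set

  -- `ls` collects the edges that stand later in the list. The recursion into `c` adds to it the
  -- edge above `c` and the siblings, which `c` can meet only in `w`.
  edgeLists-ear : ∀ {u : X} {F : Forest s X} {ls} → Unique (u ∷ vertices F) →
    (∀ {f v} → f ∈ˡ ls → v ∈ˡ f → v ∉ˡ vertices F) → Ear ls → Ear (edgeLists u F ++ ls)
  edgeLists-ear {F = ε} _ _ e = e
  edgeLists-ear {u = u} {F = branch ps w c r} {ls} uniq avoid e = subst Ear
    (sym (List.++-assoc (edgeLists w c) _ ls))
    (edgeLists-ear {F = c} children-unique avoid-c (ear u meet
      (edgeLists-ear {F = r} siblings-unique
        (λ f∈ v∈f v∈r → avoid f∈ v∈f (there (Membership.∈-++⁺ʳ (Vec.toList ps) (Membership.∈-++⁺ʳ (vertices c) v∈r))))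
        e)))
    where
    open Split (split ps w c r uniq)
    meet : ∀ {f v} → f ∈ˡ edgeLists u r ++ ls → v ∈ˡ u ∷ w ∷ Vec.toList ps → v ∈ˡ f → v ≡ u
    meet f∈ v∈e v∈f with Membership.∈-++⁻ (edgeLists u r) f∈
    meet f∈ (here refl) v∈f | _ = refl
    meet f∈ (there v∈) v∈f | inj₂ f∈ls = contradiction
      (case v∈ of λ { (here refl) → here refl ; (there v∈ps) → there (Membership.∈-++⁺ˡ v∈ps) })
      (avoid f∈ls v∈f)
    meet f∈ (there v∈) v∈f | inj₁ f∈r with ∈-edge⇒∈-vertices {F = r} f∈r v∈f
    ... | here refl = refl
    ... | there v∈r = contradiction v∈r (edge∩siblings (there v∈))
    avoid-c : ∀ {f v} → f ∈ˡ (u ∷ w ∷ Vec.toList ps) ∷ edgeLists u r ++ ls →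
      v ∈ˡ f → v ∉ˡ vertices c
    avoid-c (here refl) v∈f v∈c = edge∩children v∈f v∈c
    avoid-c (there f∈) v∈f v∈c with Membership.∈-++⁻ (edgeLists u r) f∈
    ... | inj₂ f∈ls = avoid f∈ls v∈f (there (Membership.∈-++⁺ʳ (Vec.toList ps) (Membership.∈-++⁺ˡ v∈c)))
    ... | inj₁ f∈r with ∈-edge⇒∈-vertices {F = r} f∈r v∈f
    ... | here refl = edge∩children (here refl) v∈c
    ... | there v∈r = children∩siblings v∈c v∈r

  edgeLists-unique : ∀ {u : X} {F : Forest s X} → Unique (u ∷ vertices F) →
    ∀ {l} → l ∈ˡ edgeLists u F → Unique l
  edgeLists-unique {F = branch ps w c r} uniq l∈ with Membership.∈-++⁻ (edgeLists w c) l∈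
  ... | inj₁ l∈c         = edgeLists-unique {F = c} (Split.children-unique (split ps w c r uniq)) l∈c
  ... | inj₂ (here refl) = Split.edge-unique (split ps w c r uniq)
  ... | inj₂ (there l∈r) = edgeLists-unique {F = r} (Split.siblings-unique (split ps w c r uniq)) l∈r

  -- Besides its two ends, an edge has only vertices that lie in no other edge. The clause `v ≢ u`
  -- serves the induction: it places `v` strictly below the root of its part, out of reach of every
  -- edge outside the part.
  pendants : ∀ {u : X} {F : Forest s X} → Unique (u ∷ vertices F) →
    ∀ {l} → l ∈ˡ edgeLists u F →
    ∃₂ λ x y → ∀ {v} → v ∈ˡ l → v ≡ x ⊎ v ≡ y ⊎
      (v ≢ u × (∀ {f} → f ∈ˡ edgeLists u F → v ∈ˡ f → f ≡ l))
  pendants {u = u} {F = branch ps w c r} uniq {l} l∈ with Membership.∈-++⁻ (edgeLists w c) l∈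
  ... | inj₂ (here refl) = u , w , λ
    { (here refl) → inj₁ refl
    ; (there (here refl)) → inj₂ (inj₁ refl)
    ; (there (there v∈ps)) → inj₂ (inj₂ (
        (λ { refl → unique⇒∉ edge-unique (there v∈ps) })
      , only v∈ps)) }
    where
    open Split (split ps w c r uniq)
    only : ∀ {v} → v ∈ˡ Vec.toList ps → ∀ {f} → f ∈ˡ edgeLists u (branch ps w c r) → v ∈ˡ f →
      f ≡ u ∷ w ∷ Vec.toList ps
    only v∈ps f∈ v∈f with Membership.∈-++⁻ (edgeLists w c) f∈
    ... | inj₂ (here refl) = refl
    ... | inj₁ f∈c with ∈-edge⇒∈-vertices {F = c} f∈c v∈f
    ...   | here refl = contradiction v∈ps (unique⇒∉ (AllPairs.tail edge-unique))
    ...   | there v∈c = contradiction v∈c (edge∩children (there (there v∈ps)))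
    only v∈ps f∈ v∈f | inj₂ (there f∈r) with ∈-edge⇒∈-vertices {F = r} f∈r v∈f
    ...   | here refl = contradiction (there v∈ps) (unique⇒∉ edge-unique)
    ...   | there v∈r = contradiction v∈r (edge∩siblings (there (there v∈ps)))
  ... | inj₁ l∈c = let x , y , h = pendants {F = c} children-unique l∈c in
      x , y , λ v∈l → case h v∈l of λ
        { (inj₁ eq) → inj₁ eq
        ; (inj₂ (inj₁ eq)) → inj₂ (inj₁ eq)
        ; (inj₂ (inj₂ (v≢w , only))) → inj₂ (inj₂ (extend v∈l v≢w only)) }
    where
    open Split (split ps w c r uniq)
    extend : ∀ {v} → v ∈ˡ l → v ≢ w → (∀ {f} → f ∈ˡ edgeLists w c → v ∈ˡ f → f ≡ l) →
      v ≢ u × (∀ {f} → f ∈ˡ edgeLists u (branch ps w c r) → v ∈ˡ f → f ≡ l)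
    extend {v} v∈l v≢w only = (λ { refl → edge∩children (here refl) v∈c }) , only′
      where
      v∈c : v ∈ˡ vertices c
      v∈c = ∈-tail (∈-edge⇒∈-vertices {F = c} l∈c v∈l) v≢w
      only′ : ∀ {f} → f ∈ˡ edgeLists u (branch ps w c r) → v ∈ˡ f → f ≡ l
      only′ f∈ v∈f with Membership.∈-++⁻ (edgeLists w c) f∈
      ... | inj₁ f∈c         = only f∈c v∈f
      ... | inj₂ (here refl) = contradiction v∈c (edge∩children v∈f)
      ... | inj₂ (there f∈r) with ∈-edge⇒∈-vertices {F = r} f∈r v∈f
      ...   | here refl = contradiction v∈c (edge∩children (here refl))
      ...   | there v∈r = contradiction v∈r (children∩siblings v∈c)
  ... | inj₂ (there l∈r) = let x , y , h = pendants {F = r} siblings-unique l∈r in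
      x , y , λ v∈l → case h v∈l of λ
        { (inj₁ eq) → inj₁ eq
        ; (inj₂ (inj₁ eq)) → inj₂ (inj₁ eq)
        ; (inj₂ (inj₂ (v≢u , only))) → inj₂ (inj₂ (v≢u , λ {f} → extend v∈l v≢u only {f})) }
    where
    open Split (split ps w c r uniq)
    extend : ∀ {v} → v ∈ˡ l → v ≢ u → (∀ {f} → f ∈ˡ edgeLists u r → v ∈ˡ f → f ≡ l) →
      ∀ {f} → f ∈ˡ edgeLists u (branch ps w c r) → v ∈ˡ f → f ≡ l
    extend {v} v∈l v≢u only f∈ v∈f with Membership.∈-++⁻ (edgeLists w c) f∈
    ... | inj₂ (there f∈r) = only f∈r v∈f
    ... | inj₂ (here refl) = contradiction v∈r (edge∩siblings v∈f)
      where
      v∈r : v ∈ˡ vertices r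
      v∈r = ∈-tail (∈-edge⇒∈-vertices {F = r} l∈r v∈l) v≢u
    ... | inj₁ f∈c with ∈-tail (∈-edge⇒∈-vertices {F = r} l∈r v∈l) v≢u
                      | ∈-edge⇒∈-vertices {F = c} f∈c v∈f
    ...   | v∈r | here refl = contradiction v∈r (edge∩siblings (there (here refl)))
    ...   | v∈r | there v∈c = contradiction v∈r (children∩siblings v∈c)

  two-members : ∀ {l : List X} → length l ≡ suc (suc s) → Unique l → ∃₂ λ x y → x ∈ˡ l × y ∈ˡ l × x ≢ y
  two-members {l = x ∷ y ∷ _} _ uniq = x , y , here refl , there (here refl) , λ { refl → unique⇒∉ uniq (here refl) }

  module _ {H : Hypergraph} where

    adjacent-sym : ∀ {x y} → Adjacent H x y → Adjacent H y x
    adjacent-sym (x≢y , e , e∈ , x∈ , y∈) = ≢-sym x≢y , e , e∈ , y∈ , x∈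

    reachable : ∀ {u} {F : Forest s (Vertex H)} → Unique (u ∷ vertices F) →
      (∀ {l} → l ∈ˡ edgeLists u F → setOf l ∈ˡ edges H) →
      ∀ {v} → v ∈ˡ u ∷ vertices F → Star (Adjacent H) u v
    reachable _ _ (here refl) = Star.ε
    reachable {u = u} {branch ps w c r} uniq sound (there v∈)
      with ∈-vertices-branch {ps = ps} {c = c} v∈ | split ps w c r uniq
    ... | v∈′ | sp = cases v∈′
      where
      open Split sp
      adj : ∀ {v} → v ∈ˡ w ∷ Vec.toList ps → Adjacent H u v
      adj v∈ = (λ { refl → unique⇒∉ edge-unique v∈ }) , _
        , sound (Membership.∈-++⁺ʳ (edgeLists w c) (here refl))
        , ∈-setOf⁺ (here refl) , ∈-setOf⁺ (there v∈)
      cases : ∀ {v} → v ≡ w ⊎ v ∈ˡ Vec.toList ps ⊎ v ∈ˡ vertices c ⊎ v ∈ˡ vertices r →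
        Star (Adjacent H) u v
      cases (inj₁ refl) = adj (here refl) ◅ Star.ε
      cases (inj₂ (inj₁ v∈ps)) = adj (there v∈ps) ◅ Star.ε
      cases (inj₂ (inj₂ (inj₁ v∈c))) = adj (here refl) ◅
        reachable {F = c} children-unique (sound ∘ Membership.∈-++⁺ˡ) (there v∈c)
      cases (inj₂ (inj₂ (inj₂ v∈r))) =
        reachable {F = r} siblings-unique (sound ∘ Membership.∈-++⁺ʳ (edgeLists w c) ∘ there) (there v∈r)

    model⇒hypertree : ∀ {u} {F : Forest s (Vertex H)} → Model H u F →
      IsUniformHypertree (suc (suc s)) ⟪ shape F ⟫ H
    model⇒hypertree {s = s} {u} {F} M = record
      { uniform = All.tabulate (λ e∈ → case complete e∈ of λ
          { (l , l∈ , refl) → trans (∣setOf∣ l∈) (edgeLists-length u F l∈) })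
      ; hypertree = record
        { connected = λ x y → Star.reverse adjacent-sym (reach x) ◅◅ reach y
        ; linear = λ {e} {f} e∈ f∈ e≢f → ∣∣≤1⁺ {p = e ∩ f} (λ x∈ y∈ → case complete e∈ , complete f∈ of λ
            { ((l , l∈ , refl) , (k , k∈ , refl)) →
              ear-linear earF l∈ k∈ (λ { refl → e≢f refl })
                (∈-setOf⁻ (proj₁ (Subset.x∈p∩q⁻ (setOf l) (setOf k) x∈)))
                (∈-setOf⁻ (proj₂ (Subset.x∈p∩q⁻ (setOf l) (setOf k) x∈)))
                (∈-setOf⁻ (proj₁ (Subset.x∈p∩q⁻ (setOf l) (setOf k) y∈)))
                (∈-setOf⁻ (proj₂ (Subset.x∈p∩q⁻ (setOf l) (setOf k) y∈))) })
        ; acyclic = λ C → ear⇒¬cycle earF C (λ i → complete (LooseCycle.edge∈ C i))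
        ; nonPendant≤2 = λ {e} e∈ → case complete e∈ of λ
            { (l , l∈ , refl) → subst (ℕ._≤ 2) (sym (∣∣≡length-elements (e ∩ nonPendant H)))
                (length≤2 (elements-unique _) (twoNonPendant l∈ ∘ ∈-elements⁻)) }
        }
      ; size≡ = trans (↭.↭-length (unique-↭ (unique H) (setOf-unique earF (λ l∈ → l∈))
                  (λ e∈ → case complete e∈ of λ { (l , l∈ , refl) → Membership.∈-map⁺ setOf l∈ })
                  (λ e∈ → case Membership.∈-map⁻ setOf e∈ of λ { (l , l∈ , refl) → sound l∈ })))
                (trans (List.length-map setOf (edgeLists u F)) (length-edgeLists u F))
      }
      where
      open Model M
      earF : Ear (edgeLists u F)
      earF = subst Ear (List.++-identityʳ _) (edgeLists-ear {F = F} distinct (λ ()) [])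
      ∣setOf∣ : ∀ {l} → l ∈ˡ edgeLists u F → ∣ setOf l ∣ ≡ length l
      ∣setOf∣ l∈ = ∣∣≡length (edgeLists-unique {F = F} distinct l∈) ∈-setOf⁺ ∈-setOf⁻
      reach : ∀ v → Star (Adjacent H) u v
      reach v = reachable {F = F} distinct sound (covers v)
      twoNonPendant : ∀ {l} (l∈ : l ∈ˡ edgeLists u F) → ∀ {v} → v ∈ setOf l ∩ nonPendant H →
        v ≡ proj₁ (pendants {F = F} distinct l∈) ⊎ v ≡ proj₁ (proj₂ (pendants {F = F} distinct l∈))
      twoNonPendant {l} l∈ {v} v∈ with pendants {F = F} distinct l∈
      ... | x , y , h with Subset.x∈p∩q⁻ (setOf l) (nonPendant H) v∈
      ... | v∈l , v∈N with h (∈-setOf⁻ v∈l)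
      ... | inj₁ eq = inj₁ eq
      ... | inj₂ (inj₁ eq) = inj₂ eq
      ... | inj₂ (inj₂ (_ , only)) = contradiction
        (∈-comprehension⁻ (λ v → 1 ℕ.<? degree H v) v∈N)
        (ℕ.≤⇒≯ (length≤1 (Unique.filter⁺ (v Subset.∈?_) (unique H)) same))
        where
        same : ∀ {e f} → e ∈ˡ filter (v Subset.∈?_) (edges H) → f ∈ˡ filter (v Subset.∈?_) (edges H) → e ≡ f
        same e∈ f∈ with Membership.∈-filter⁻ (v Subset.∈?_) e∈ | Membership.∈-filter⁻ (v Subset.∈?_) f∈
        ... | e∈H , v∈e | f∈H , v∈f with complete e∈H | complete f∈H
        ... | _ , l₁∈ , refl | _ , l₂∈ , refl =
          cong setOf (trans (only l₁∈ (∈-setOf⁻ v∈e)) (sym (only l₂∈ (∈-setOf⁻ v∈f))))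
      -- Two lists with the same set would share both of two distinct members, but an ear shares at
      -- most one vertex with the later lists.
      setOf-unique : ∀ {ls} → Ear ls → (∀ {l} → l ∈ˡ ls → l ∈ˡ edgeLists u F) →
        Unique (map setOf ls)
      setOf-unique [] _ = []
      setOf-unique {l ∷ ls} (ear p h e) sub = ∉⇒unique fresh (setOf-unique e (sub ∘ there))
        where
        fresh : setOf l ∉ˡ map setOf ls
        fresh l∈ with Membership.∈-map⁻ setOf l∈
        ... | f , f∈ , eq = let x , y , x∈ , y∈ , x≢y = two-members (edgeLists-length u F (sub (here refl)))
                                                           (edgeLists-unique {F = F} distinct (sub (here refl)))
          in x≢y (trans (h f∈ x∈ (∈-setOf⁻ (subst (x ∈_) eq (∈-setOf⁺ x∈))))
                   (sym (h f∈ y∈ (∈-setOf⁻ (subst (y ∈_) eq (∈-setOf⁺ y∈))))))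

open ModelsAreHypertrees


-- Equal shapes give isomorphic hypergraphs.

module Isomorphism where

  private variable
    s : ℕ

  ∈-image : ∀ {m n} (π : Permutation m n) {e v} → v ∈ e → π ⟨$⟩ʳ v ∈ image π e
  ∈-image π {e} {v} v∈e = Vec.lookup⇒[]= (π ⟨$⟩ʳ v) (image π e)
    (trans (Vec.lookup∘tabulate _ (π ⟨$⟩ʳ v))
      (trans (cong (Vec.lookup e) (Perm.inverseˡ π)) (Vec.[]=⇒lookup v∈e)))

  ∈-image⁻ : ∀ {m n} (π : Permutation m n) {e v} → v ∈ image π e → π ⟨$⟩ˡ v ∈ e
  ∈-image⁻ π {e} {v} v∈ = Vec.lookup⇒[]= (π ⟨$⟩ˡ v) e
    (trans (sym (Vec.lookup∘tabulate _ v)) (Vec.[]=⇒lookup v∈))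

  image-injective : ∀ {m n} (π : Permutation m n) {e f} → image π e ≡ image π f → e ≡ f
  image-injective π eq = Subset.⊆-antisym (sub eq) (sub (sym eq))
    where
    sub : ∀ {e f} → image π e ≡ image π f → ∀ {v} → v ∈ e → v ∈ f
    sub {f = f} eq {v} v∈e = subst (_∈ f) (Perm.inverseˡ π)
      (∈-image⁻ π (subst (π ⟨$⟩ʳ v ∈_) eq (∈-image π v∈e)))

  image-setOf : ∀ {m n} (π : Permutation m n) xs → image π (setOf xs) ≡ setOf (map (π ⟨$⟩ʳ_) xs)
  image-setOf π xs = setOf-≡
    (λ v∈ → case Membership.∈-map⁻ (π ⟨$⟩ʳ_) v∈ of λ { (_ , x∈ , refl) → ∈-image π (∈-setOf⁺ x∈) })
    (λ v∈ → subst (_∈ˡ map (π ⟨$⟩ʳ_) xs) (Perm.inverseʳ π)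
      (Membership.∈-map⁺ (π ⟨$⟩ʳ_) (∈-setOf⁻ (∈-image⁻ π v∈))))

  map-fixed : ∀ {A : Set} {h : A → A} {xs} → map h xs ≡ xs → ∀ {v} → v ∈ˡ xs → h v ≡ v
  map-fixed eq (here refl) = List.∷-injectiveˡ eq
  map-fixed eq (there v∈)  = map-fixed (List.∷-injectiveʳ eq) v∈

  -- Vertices in equal positions of the common shape correspond. The two relabellings are inverse to
  -- each other because their composites fix the vertex lists entry by entry, and these lists
  -- contain all vertices.
  model-≅ : ∀ {H G u w} {F : Forest s (Vertex H)} {E : Forest s (Vertex G)} →
    Model H u F → Model G w E → shape F ≡ shape E → H ≅ G
  model-≅ {H = H} {G} {u} {w} {F} {E} M N sh
    with relabel {u′ = w} {G = E} (Model.distinct M) sh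
       | relabel {u′ = u} {G = F} (Model.distinct N) (sym sh)
  ... | f , refl , refl | g , gfu , gfF = π , λ e → mk⇔ to from
    where
    gf : ∀ v → g (f v) ≡ v
    gf v = map-fixed
      (cong₂ _∷_ gfu (trans (sym (vertices-map (g ∘ f) F))
        (cong vertices (trans (sym (mapForest-∘ g f F)) gfF))))
      (Model.covers M v)
    fg : ∀ v → f (g v) ≡ v
    fg v with subst (v ∈ˡ_) (cong (f u ∷_) (vertices-map f F)) (Model.covers N v)
    ... | v∈ with Membership.∈-map⁻ f {xs = u ∷ vertices F} v∈
    ... | x , _ , refl = cong f (gf x)
    π : Permutation (order H) (order G)
    π = permutation f g fg gf
    to : ∀ {e} → e ∈ˡ edges H → image π e ∈ˡ edges G
    to e∈ with Model.complete M e∈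
    ... | l , l∈ , refl = subst (_∈ˡ edges G) (sym (image-setOf π l))
      (Model.sound N (subst (map f l ∈ˡ_) (sym (edgeLists-map f u F)) (Membership.∈-map⁺ (map f) l∈)))
    from : ∀ {e} → image π e ∈ˡ edges G → e ∈ˡ edges H
    from {e} e∈ with Model.complete N e∈
    ... | l , l∈ , eq with Membership.∈-map⁻ (map f) (subst (l ∈ˡ_) (edgeLists-map f u F) l∈)
    ... | k , k∈ , refl = subst (_∈ˡ edges H)
      (sym (image-injective π (trans eq (sym (image-setOf π k))))) (Model.sound M k∈)

open Isomorphism

-- Rearranging branches and moving the root.

module Rearrangements where

  private variable
    s : ℕ

  infix 4 _~_ _≈_

  -- rearrangements of the edges below each vertex
  data _~_ : Shape → Shape → Set where
    ~-refl  : ∀ {a} → a ~ a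
    ~-trans : ∀ {a b c} → a ~ b → b ~ c → a ~ c
    ~-swap  : ∀ {a b c} → a ▷ (b ▷ c) ~ b ▷ (a ▷ c)
    ~-cong  : ∀ {a b c d} → a ~ c → b ~ d → a ▷ b ~ c ▷ d

  -- rearrangements and changes of the root
  data _≈_ : Shape → Shape → Set where
    arrange : ∀ {a b} → a ~ b → a ≈ b
    reroot  : ∀ {a b} → a ▷ b ≈ b ▷ a
    ≈-trans : ∀ {a b c} → a ≈ b → b ≈ c → a ≈ c

  record Rearranged {X : Set} (u : X) (F : Forest s X) (t : Shape) : Set where
    field
      forest    : Forest s X
      shape≡    : shape forest ≡ t
      vertices↭ : vertices F ↭ vertices forest
      edges↭    : edgeLists u F ↭ edgeLists u forest

  rearrange : ∀ {X : Set} (u : X) (F : Forest s X) {a t} → a ~ t → shape F ≡ a → Rearranged u F t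
  rearrange u F ~-refl sh = record { forest = F ; shape≡ = sh ; vertices↭ = ↭-refl ; edges↭ = ↭-refl }
  rearrange u F (~-trans p q) sh = record
    { forest = S₂.forest ; shape≡ = S₂.shape≡
    ; vertices↭ = ↭-trans S₁.vertices↭ S₂.vertices↭
    ; edges↭ = ↭-trans S₁.edges↭ S₂.edges↭ }
    where
    module S₁ = Rearranged (rearrange u F p sh)
    module S₂ = Rearranged (rearrange u S₁.forest q S₁.shape≡)
  rearrange u (branch ps w c (branch qs x d r)) ~-swap refl = record
    { forest = branch qs x d (branch ps w c r) ; shape≡ = refl
    ; vertices↭ = blocks (w ∷ Vec.toList ps) (vertices c) (x ∷ Vec.toList qs) (vertices d)
    ; edges↭ = blocks′ (edgeLists w c) (edgeLists x d) }
    where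
    open ↭.PermutationReasoning
    blocks : ∀ {A : Set} (as bs cs ds : List A) {es} →
      as ++ (bs ++ (cs ++ (ds ++ es))) ↭ cs ++ (ds ++ (as ++ (bs ++ es)))
    blocks as bs cs ds {es} = begin
      as ++ (bs ++ (cs ++ (ds ++ es)))    ≡⟨ List.++-assoc as bs _ ⟨
      (as ++ bs) ++ (cs ++ (ds ++ es))    ≡⟨ cong ((as ++ bs) ++_) (List.++-assoc cs ds es) ⟨
      (as ++ bs) ++ ((cs ++ ds) ++ es)    ↭⟨ ↭.shifts (as ++ bs) (cs ++ ds) ⟩
      (cs ++ ds) ++ ((as ++ bs) ++ es)    ≡⟨ List.++-assoc cs ds _ ⟩
      cs ++ (ds ++ ((as ++ bs) ++ es))    ≡⟨ cong (λ l → cs ++ (ds ++ l)) (List.++-assoc as bs es) ⟩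
      cs ++ (ds ++ (as ++ (bs ++ es)))    ∎
    blocks′ : ∀ {A : Set} (as bs : List A) {a b es} →
      as ++ a ∷ (bs ++ b ∷ es) ↭ bs ++ b ∷ (as ++ a ∷ es)
    blocks′ as bs {a} {b} = blocks as (a ∷ []) bs (b ∷ [])
  rearrange u (branch ps w c r) (~-cong p q) refl = record
    { forest = branch ps w S₁.forest S₂.forest
    ; shape≡ = cong₂ _▷_ S₁.shape≡ S₂.shape≡
    ; vertices↭ = ↭.prep w (↭.++⁺ˡ (Vec.toList ps) (↭.++⁺ S₁.vertices↭ S₂.vertices↭))
    ; edges↭ = ↭.++⁺ S₁.edges↭ (↭.prep _ S₂.edges↭) }
    where
    module S₁ = Rearranged (rearrange w c p refl)
    module S₂ = Rearranged (rearrange u r q refl)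

  HasShape : ℕ → Hypergraph → Shape → Set
  HasShape s H t = ∃₂ λ u (F : Forest s (Vertex H)) → Model H u F × shape F ≡ t

  model-↭ : ∀ {H u u′} {F F′ : Forest s (Vertex H)} → Model H u F →
    u ∷ vertices F ↭ u′ ∷ vertices F′ →
    (∀ {l} → l ∈ˡ edgeLists u F → ∃ λ k → k ∈ˡ edgeLists u′ F′ × setOf l ≡ setOf k) →
    (∀ {l} → l ∈ˡ edgeLists u′ F′ → ∃ λ k → k ∈ˡ edgeLists u F × setOf l ≡ setOf k) →
    Model H u′ F′
  model-↭ {H = H} M vs to from = record
    { distinct = unique-resp-↭ vs distinct
    ; covers   = λ v → ↭.∈-resp-↭ vs (covers v)
    ; sound    = λ l∈ → let k , k∈ , eq = from l∈ in subst (_∈ˡ edges H) (sym eq) (sound k∈)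
    ; complete = λ e∈ → let l , l∈ , eq = complete e∈ ; k , k∈ , eq′ = to l∈ in
        k , k∈ , trans eq eq′
    }
    where open Model M

  arrange-model : ∀ {H u} {F : Forest s (Vertex H)} {t} → Model H u F → shape F ~ t →
    ∃ λ F′ → Model H u F′ × shape F′ ≡ t
  arrange-model {u = u} {F} M p = forest , model-↭ M (↭.prep u vertices↭)
      (λ l∈ → _ , ↭.∈-resp-↭ edges↭ l∈ , refl)
      (λ l∈ → _ , ↭.∈-resp-↭ (↭-sym edges↭) l∈ , refl)
    , shape≡
    where open Rearranged (rearrange u F p refl)

  -- Only the edge across which the root moves changes its list, by a transposition of its two ends;
  -- its set stays the same.
  exchange-edges : ∀ {n} u (ps : Vec (Fin n) s) w c r {l} → l ∈ˡ edgeLists u (branch ps w c r) →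
    ∃ λ k → k ∈ˡ edgeLists w (branch ps u r c) × setOf l ≡ setOf k
  exchange-edges u ps w c r l∈ with Membership.∈-++⁻ (edgeLists w c) l∈
  ... | inj₁ l∈c         = _ , Membership.∈-++⁺ʳ (edgeLists u r) (there l∈c) , refl
  ... | inj₂ (there l∈r) = _ , Membership.∈-++⁺ˡ l∈r , refl
  ... | inj₂ (here refl) = w ∷ u ∷ Vec.toList ps
    , Membership.∈-++⁺ʳ (edgeLists u r) (here refl)
    , setOf-≡ (∈-setOf⁺ ∘ transpose) (transpose ∘ ∈-setOf⁻)
    where
    transpose : ∀ {x y v} → v ∈ˡ x ∷ y ∷ Vec.toList ps → v ∈ˡ y ∷ x ∷ Vec.toList ps
    transpose (here eq)         = there (here eq)
    transpose (there (here eq)) = here eq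
    transpose (there (there v∈)) = there (there v∈)

  -- The first edge joins two rooted parts symmetrically, `c` at `w` and `r` at `u`; moving the root
  -- across it merely exchanges their roles.
  reroot-model : ∀ {H u} {ps : Vec (Vertex H) s} {w c r} →
    Model H u (branch ps w c r) → Model H w (branch ps u r c)
  reroot-model {u = u} {ps} {w} {c} {r} M = model-↭ M
    (↭.swap u w (↭.++⁺ˡ (Vec.toList ps) (↭.++-comm (vertices c) (vertices r))))
    (exchange-edges u ps w c r) (exchange-edges w ps u r c)

  hasShape-≈ : ∀ {H a b} → a ≈ b → HasShape s H a → HasShape s H b
  hasShape-≈ (arrange p) (u , F , M , refl) = u , arrange-model M p
  hasShape-≈ reroot (u , branch ps w c r , M , refl) = w , branch ps u r c , reroot-model M , refl
  hasShape-≈ (≈-trans p q) m = hasShape-≈ q (hasShape-≈ p m)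

  hasShape-≅ : ∀ {H G t} → HasShape s H t → HasShape s G t → H ≅ G
  hasShape-≅ (_ , _ , M , sh) (_ , _ , N , sh′) = model-≅ M N (trans sh (sym sh′))

open Rearrangements


-- Shapes after attaching pendant edges.

module Attaching where

  private variable
    s : ℕ

  ∈-toList-tabulate⁺ : ∀ {A : Set} {n} (f : Fin n → A) i → f i ∈ˡ Vec.toList (Vec.tabulate f)
  ∈-toList-tabulate⁺ f zero    = here refl
  ∈-toList-tabulate⁺ f (suc i) = there (∈-toList-tabulate⁺ (f ∘ suc) i)

  ∈-toList-tabulate⁻ : ∀ {A : Set} {n} (f : Fin n → A) {x} →
    x ∈ˡ Vec.toList (Vec.tabulate f) → ∃ λ i → x ≡ f i
  ∈-toList-tabulate⁻ {n = suc _} f (here eq)  = zero , eq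
  ∈-toList-tabulate⁻ {n = suc _} f (there x∈) =
    let i , eq = ∈-toList-tabulate⁻ (f ∘ suc) x∈ in suc i , eq

  unique-toList-tabulate : ∀ {A : Set} {n} (f : Fin n → A) → Injective _≡_ _≡_ f →
    Unique (Vec.toList (Vec.tabulate f))
  unique-toList-tabulate {n = zero}  f inj = []
  unique-toList-tabulate {n = suc n} f inj = ∉⇒unique
    (λ f0∈ → case ∈-toList-tabulate⁻ (f ∘ suc) f0∈ of λ { (i , eq) → case inj eq of λ () })
    (unique-toList-tabulate (f ∘ suc) (Fin.suc-injective ∘ inj))

  module _ {m n : ℕ} (p : Subset m) (q : Subset n) where

    ∈-++ˡ : ∀ {i} → i ∈ p → (i ↑ˡ n) ∈ (p Vec.++ q)
    ∈-++ˡ {i} i∈ = Vec.lookup⇒[]= (i ↑ˡ n) (p Vec.++ q)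
      (trans (Vec.lookup-++ˡ p q i) (Vec.[]=⇒lookup i∈))

    ∈-++ʳ : ∀ {j} → j ∈ q → (m ↑ʳ j) ∈ (p Vec.++ q)
    ∈-++ʳ {j} j∈ = Vec.lookup⇒[]= (m ↑ʳ j) (p Vec.++ q)
      (trans (Vec.lookup-++ʳ p q j) (Vec.[]=⇒lookup j∈))

    ∈-++ˡ⁻ : ∀ {i} → (i ↑ˡ n) ∈ (p Vec.++ q) → i ∈ p
    ∈-++ˡ⁻ {i} i∈ = Vec.lookup⇒[]= i p (trans (sym (Vec.lookup-++ˡ p q i)) (Vec.[]=⇒lookup i∈))

    ∈-++ʳ⁻ : ∀ {j} → (m ↑ʳ j) ∈ (p Vec.++ q) → j ∈ q
    ∈-++ʳ⁻ {j} j∈ = Vec.lookup⇒[]= j q (trans (sym (Vec.lookup-++ʳ p q j)) (Vec.[]=⇒lookup j∈))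

  data Sum (m n : ℕ) : Fin (m ℕ.+ n) → Set where
    left  : ∀ i → Sum m n (i ↑ˡ n)
    right : ∀ j → Sum m n (m ↑ʳ j)

  sum? : ∀ m n v → Sum m n v
  sum? m n v with Fin.splitAt m v | Fin.join-splitAt m n v
  ... | inj₁ i | refl = left i
  ... | inj₂ j | refl = right j

  ↑ˡ≢↑ʳ : ∀ {m n} (i : Fin m) (j : Fin n) → i ↑ˡ n ≢ m ↑ʳ j
  ↑ˡ≢↑ʳ {m} {n} i j eq with trans (sym (Fin.splitAt-↑ˡ m i n)) (trans (cong (Fin.splitAt m) eq) (Fin.splitAt-↑ʳ m n j))
  ... | ()

  -- A branch must name a lower vertex even when nothing hangs below it; of the m - 1 new vertices
  -- the first one is taken.
  attachForest : ∀ {n} → Forest s (Fin n) → Forest s (Fin (suc s ℕ.+ n))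
  attachForest {s} {n} F =
    branch (Vec.tabulate (λ i → suc i ↑ˡ n)) (zero ↑ˡ n) ε (mapForest (suc s ↑ʳ_) F)

  setOf-shift : ∀ {m n} (l : List (Fin n)) → ⊥ {m} Vec.++ setOf l ≡ setOf (map (m ↑ʳ_) l)
  setOf-shift {m} {n} l = setOf-≡
    (λ v∈ → case Membership.∈-map⁻ (m ↑ʳ_) v∈ of λ { (_ , x∈ , refl) → ∈-++ʳ _ _ (∈-setOf⁺ x∈) })
    (λ {v} v∈ → shifted (sum? m n v) v∈)
    where
    shifted : ∀ {v} → Sum m n v → v ∈ (⊥ Vec.++ setOf l) → v ∈ˡ map (m ↑ʳ_) l
    shifted (left i) v∈ = contradiction (∈-++ˡ⁻ ⊥ (setOf l) v∈) Subset.∉⊥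
    shifted (right j) v∈ = Membership.∈-map⁺ (m ↑ʳ_) (∈-setOf⁻ (∈-++ʳ⁻ (⊥ {m}) (setOf l) v∈))

  attach-model : ∀ {H : Hypergraph} {u} {F : Forest s (Vertex H)} → Model H u F →
    Model (attach (suc (suc s)) H u) (suc s ↑ʳ u) (attachForest F)
  attach-model {s} {H} {u} {F} M = record
    { distinct = distinct′
    ; covers   = λ v → covers′ (sum? n N v)
    ; sound    = sound′
    ; complete = complete′
    }
    where
    open Model M
    n N : ℕ
    n = suc s
    N = order H
    ps : List (Fin (n ℕ.+ N))
    ps = Vec.toList (Vec.tabulate (λ i → suc {s} i ↑ˡ N))
    w : Fin (n ℕ.+ N)
    w = zero ↑ˡ N
    old : List (Fin (n ℕ.+ N))
    old = map (n ↑ʳ_) (u ∷ vertices F)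
    new-∈ : ∀ {v} → v ∈ˡ w ∷ ps → ∃ λ i → v ≡ i ↑ˡ N
    new-∈ (here eq) = zero , eq
    new-∈ (there v∈) = let i , eq = ∈-toList-tabulate⁻ (λ i → suc {s} i ↑ˡ N) v∈ in suc i , eq
    ∈-new : ∀ i → (i ↑ˡ N) ∈ˡ w ∷ ps
    ∈-new zero    = here refl
    ∈-new (suc i) = there (∈-toList-tabulate⁺ (λ i → suc {s} i ↑ˡ N) i)
    vertices≡ : vertices (attachForest F) ≡ (w ∷ ps) ++ map (n ↑ʳ_) (vertices F)
    vertices≡ = cong (λ l → (w ∷ ps) ++ l) (vertices-map (n ↑ʳ_) F)
    distinct′ : Unique ((n ↑ʳ u) ∷ vertices (attachForest F))
    distinct′ = subst (λ l → Unique ((n ↑ʳ u) ∷ l)) (sym vertices≡)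
      (unique-resp-↭ (↭.shift (n ↑ʳ u) (w ∷ ps) (map (n ↑ʳ_) (vertices F)))
        (unique-++⁺ (unique-toList-tabulate (_↑ˡ N) (Fin.↑ˡ-injective N _ _))
          (Unique.map⁺ (Fin.↑ʳ-injective n _ _) distinct)
          (λ v∈ v∈old → case new-∈ v∈ , Membership.∈-map⁻ (n ↑ʳ_) v∈old of λ
            { ((i , refl) , (j , _ , eq)) → ↑ˡ≢↑ʳ i j eq })))
    covers′ : ∀ {v} → Sum n N v → v ∈ˡ (n ↑ʳ u) ∷ vertices (attachForest F)
    covers′ {v} sum = subst (λ l → v ∈ˡ (n ↑ʳ u) ∷ l) (sym vertices≡)
      (↭.∈-resp-↭ (↭.shift (n ↑ʳ u) (w ∷ ps) (map (n ↑ʳ_) (vertices F))) (place sum))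
      where
      place : ∀ {v} → Sum n N v → v ∈ˡ (w ∷ ps) ++ old
      place (left i)  = Membership.∈-++⁺ˡ (∈-new i)
      place (right j) = Membership.∈-++⁺ʳ (w ∷ ps) (Membership.∈-map⁺ (n ↑ʳ_) (covers j))
    newEdge : ⊤ {n} Vec.++ ⁅ u ⁆ ≡ setOf ((n ↑ʳ u) ∷ w ∷ ps)
    newEdge = setOf-≡
      (λ { (here refl) → ∈-++ʳ (⊤ {n}) ⁅ u ⁆ (Subset.x∈⁅x⁆ u)
         ; (there v∈) → case new-∈ v∈ of λ { (i , refl) → ∈-++ˡ (⊤ {n}) ⁅ u ⁆ {i} Subset.∈⊤ } })
      (λ {v} v∈ → member (sum? n N v) v∈)
      where
      member : ∀ {v} → Sum n N v → v ∈ (⊤ {n} Vec.++ ⁅ u ⁆) → v ∈ˡ (n ↑ʳ u) ∷ w ∷ ps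
      member (left i) _ = there (∈-new i)
      member (right j) v∈ = here (cong (n ↑ʳ_) (Subset.x∈⁅y⁆⇒x≡y u (∈-++ʳ⁻ (⊤ {n}) ⁅ u ⁆ v∈)))
    sound′ : ∀ {l} → l ∈ˡ edgeLists (n ↑ʳ u) (attachForest F) →
      setOf l ∈ˡ edges (attach (suc (suc s)) H u)
    sound′ (here refl) = here (sym newEdge)
    sound′ (there l∈) with Membership.∈-map⁻ (map (n ↑ʳ_))
                             (subst (_ ∈ˡ_) (edgeLists-map (n ↑ʳ_) u F) l∈)
    ... | l , l∈F , refl = there (subst (_∈ˡ _) (setOf-shift l)
      (Membership.∈-map⁺ (⊥ {n} Vec.++_) (sound l∈F)))
    complete′ : ∀ {e} → e ∈ˡ edges (attach (suc (suc s)) H u) →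
      ∃ λ l → l ∈ˡ edgeLists (n ↑ʳ u) (attachForest F) × e ≡ setOf l
    complete′ (here refl) = _ , here refl , newEdge
    complete′ (there e∈) with Membership.∈-map⁻ (⊥ {n} Vec.++_) e∈
    ... | e , e∈H , refl with complete e∈H
    ... | l , l∈ , refl = map (n ↑ʳ_) l
      , there (subst (map (n ↑ʳ_) l ∈ˡ_) (sym (edgeLists-map (n ↑ʳ_) u F)) (Membership.∈-map⁺ (map (n ↑ʳ_)) l∈))
      , setOf-shift l

  -- An edge with ends `u` and `w`, a part of shape `b` at `u` and one of shape `a` at `w`. In all
  -- seven hypertrees the pendant edges are attached at v₂ and v₃ only, so one link survives the
  -- whole construction.
  Link : ∀ (s : ℕ) (H : Hypergraph) → Vertex H → Vertex H → Shape → Shape → Set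
  Link s H u w a b = Σ (Vec (Vertex H) s) λ ps → ∃₂ λ c r →
    Model H u (branch ps w c r) × shape c ≡ a × shape r ≡ b

  link-sym : ∀ {H u w a b} → Link s H u w a b → Link s H w u b a
  link-sym (ps , c , r , M , eqa , eqb) = ps , r , c , reroot-model M , eqb , eqa

  link-attach : ∀ {H u w a b} → Link s H u w a b →
    Link s (attach (suc (suc s)) H u) (suc s ↑ʳ u) (suc s ↑ʳ w) a (ε ▷ b)
  link-attach {s} (ps , c , r , M , eqa , eqb) = _ , _ , _
    , model-↭ (attach-model M)
        (↭.prep _ (Rearranged.vertices↭ R))
        (λ l∈ → _ , ↭.∈-resp-↭ (Rearranged.edges↭ R) l∈ , refl)
        (λ l∈ → _ , ↭.∈-resp-↭ (↭-sym (Rearranged.edges↭ R)) l∈ , refl)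
    , trans (shape-map (suc s ↑ʳ_) c) eqa
    , cong (ε ▷_) (trans (shape-map (suc s ↑ʳ_) r) eqb)
    where
    -- The new edge arrives as the first branch and is swapped behind the linking edge, which has to
    -- stay first.
    R = rearrange (suc s ↑ʳ _) (attachForest (branch ps _ c r)) ~-swap refl

  leaves : ℕ → Shape → Shape
  leaves zero    t = t
  leaves (suc a) t = ε ▷ leaves a t

  leaves-ε▷ : ∀ a t → leaves a (ε ▷ t) ≡ ε ▷ leaves a t
  leaves-ε▷ zero    t = refl
  leaves-ε▷ (suc a) t = cong (ε ▷_) (leaves-ε▷ a t)

  attachAll-root : ∀ p {c H u w a b} (vs : Vec (Vertex H) c) →
    Vec.toList vs ≡ replicate p u → Link s H u w a b →
    HasShape s (attachAll (suc (suc s)) H vs) (a ▷ leaves p b)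
  attachAll-root zero [] _ (ps , c , r , M , eqa , eqb) = _ , _ , M , cong₂ _▷_ eqa eqb
  attachAll-root {s} (suc p) {u = u} {a = a} {b} (v ∷ vs) eq L with List.∷-injective eq
  ... | refl , eq′ = subst (λ t → HasShape s _ (a ▷ t)) (leaves-ε▷ p b)
    (attachAll-root p (Vec.map (suc s ↑ʳ_) vs)
      (trans (Vec.toList-map (suc s ↑ʳ_) vs)
        (trans (cong (map (suc s ↑ʳ_)) eq′) (List.map-replicate (suc s ↑ʳ_) p u)))
      (link-attach L))

  -- The edges at `u` are attached first; then the link is turned around, and the edges at `w` are
  -- attached with `w` as the root.
  attachAll-link : ∀ p q {c H u w a b} (vs : Vec (Vertex H) c) →
    Vec.toList vs ≡ replicate p u ++ replicate q w → Link s H u w a b →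
    HasShape s (attachAll (suc (suc s)) H vs) (leaves q a ▷ leaves p b)
  attachAll-link zero q vs eq L = hasShape-≈ reroot (attachAll-root q vs eq (link-sym L))
  attachAll-link {s} (suc p) q {u = u} {w} {a} {b} (v ∷ vs) eq L with List.∷-injective eq
  ... | refl , eq′ = subst (λ t → HasShape s _ (leaves q a ▷ t)) (leaves-ε▷ p b)
    (attachAll-link p q (Vec.map (suc s ↑ʳ_) vs)
      (begin
        Vec.toList (Vec.map (suc s ↑ʳ_) vs)             ≡⟨ Vec.toList-map (suc s ↑ʳ_) vs ⟩
        map (suc s ↑ʳ_) (Vec.toList vs)                 ≡⟨ cong (map (suc s ↑ʳ_)) eq′ ⟩
        map (suc s ↑ʳ_) (replicate p u ++ replicate q w) ≡⟨ List.map-++ (suc s ↑ʳ_) (replicate p u) _ ⟩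
        map (suc s ↑ʳ_) (replicate p u) ++ map (suc s ↑ʳ_) (replicate q w)
          ≡⟨ cong₂ _++_ (List.map-replicate (suc s ↑ʳ_) p u) (List.map-replicate (suc s ↑ʳ_) q w) ⟩
        replicate p (suc s ↑ʳ u) ++ replicate q (suc s ↑ʳ w) ∎)
      (link-attach L))
    where open ≡-Reasoning

open Attaching


-- The loose path as a chain.

module LoosePaths where

  private variable
    s : ℕ

  interval : ∀ s → ℕ → Vec ℕ s
  interval zero    a = []
  interval (suc s) a = suc a ∷ interval s (suc a)

  ∈-interval⁻ : ∀ s a {v} → v ∈ˡ Vec.toList (interval s a) → a ℕ.< v × v ℕ.≤ s ℕ.+ a
  ∈-interval⁻ (suc s) a (here refl) = ℕ.≤-refl , s≤s (ℕ.m≤n+m a s)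
  ∈-interval⁻ (suc s) a {v} (there v∈) =
    let a<v , v≤ = ∈-interval⁻ s (suc a) v∈ in
    ℕ.<-trans (ℕ.n<1+n a) a<v , subst (v ℕ.≤_) (ℕ.+-suc s a) v≤

  ∈-interval⁺ : ∀ s a {v} → a ℕ.< v → v ℕ.≤ s ℕ.+ a → v ∈ˡ Vec.toList (interval s a)
  ∈-interval⁺ zero a a<v v≤a = contradiction v≤a (ℕ.<⇒≱ a<v)
  ∈-interval⁺ (suc s) a {v} a<v v≤ with v ℕ.≟ suc a
  ... | yes refl = here refl
  ... | no v≢    = there (∈-interval⁺ s (suc a) (ℕ.≤∧≢⇒< a<v (≢-sym v≢))
                     (subst (v ℕ.≤_) (sym (ℕ.+-suc s a)) v≤))

  interval-unique : ∀ s a → Unique (Vec.toList (interval s a))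
  interval-unique zero    a = []
  interval-unique (suc s) a =
    ∉⇒unique (λ v∈ → ℕ.<-irrefl refl (proj₁ (∈-interval⁻ s (suc a) v∈))) (interval-unique s (suc a))

  -- Labelled by natural numbers, so that edges are intervals governed by plain arithmetic; the
  -- labels become elements of `Fin` only in `pathForest`.
  chain : ∀ s → ℕ → ℕ → Forest s ℕ
  chain s a zero    = ε
  chain s a (suc d) = branch (interval s a) (suc s ℕ.+ a) (chain s (suc s ℕ.+ a) d) ε

  end : ∀ s a d → d ℕ.* suc s ℕ.+ (suc s ℕ.+ a) ≡ suc d ℕ.* suc s ℕ.+ a
  end s a d = begin
    d ℕ.* suc s ℕ.+ (suc s ℕ.+ a)  ≡⟨ ℕ.+-assoc (d ℕ.* suc s) (suc s) a ⟨
    d ℕ.* suc s ℕ.+ suc s ℕ.+ a    ≡⟨ cong (ℕ._+ a) (ℕ.+-comm (d ℕ.* suc s) (suc s)) ⟩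
    suc d ℕ.* suc s ℕ.+ a          ∎
    where open ≡-Reasoning

  ∈-chain⁻ : ∀ s a d {v} → v ∈ˡ vertices (chain s a d) → a ℕ.< v × v ℕ.≤ d ℕ.* suc s ℕ.+ a
  ∈-chain⁻ s a (suc d) {v} v∈
    with ∈-vertices-branch {ps = interval s a} {c = chain s (suc s ℕ.+ a) d} {r = ε} v∈
  ... | inj₁ refl = s≤s (ℕ.m≤n+m a s) , ℕ.+-monoˡ-≤ a (ℕ.m≤m+n (suc s) (d ℕ.* suc s))
  ... | inj₂ (inj₁ v∈ps) = let a<v , v≤ = ∈-interval⁻ s a v∈ps in a<v
    , ℕ.≤-trans v≤ (ℕ.+-monoˡ-≤ a (ℕ.≤-trans (ℕ.n≤1+n s) (ℕ.m≤m+n (suc s) (d ℕ.* suc s))))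
  ... | inj₂ (inj₂ (inj₁ v∈c)) = let b<v , v≤ = ∈-chain⁻ s (suc s ℕ.+ a) d v∈c in
      ℕ.≤-<-trans (ℕ.m≤n+m a (suc s)) b<v , subst (v ℕ.≤_) (end s a d) v≤

  ∈-chain⁺ : ∀ s a d {v} → a ℕ.≤ v → v ℕ.≤ d ℕ.* suc s ℕ.+ a → v ∈ˡ a ∷ vertices (chain s a d)
  ∈-chain⁺ s a zero a≤v v≤a = here (ℕ.≤-antisym v≤a a≤v)
  ∈-chain⁺ s a (suc d) {v} a≤v v≤ with ℕ.m≤n⇒m<n∨m≡n a≤v
  ... | inj₂ refl = here refl
  ... | inj₁ a<v with v ℕ.≤? s ℕ.+ a
  ... | yes v≤s+a = there (there (Membership.∈-++⁺ˡ (∈-interval⁺ s a a<v v≤s+a)))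
  ... | no v≰s+a with ∈-chain⁺ s (suc s ℕ.+ a) d (ℕ.≰⇒> v≰s+a) (subst (v ℕ.≤_) (sym (end s a d)) v≤)
  ... | here refl = there (here refl)
  ... | there v∈c = there (there (Membership.∈-++⁺ʳ (Vec.toList (interval s a)) (Membership.∈-++⁺ˡ v∈c)))

  chain-unique : ∀ s a d → Unique (a ∷ vertices (chain s a d))
  chain-unique s a zero    = [] ∷ []
  chain-unique s a (suc d) = ∉⇒unique
    (λ a∈ → ℕ.<-irrefl refl (proj₁ (∈-chain⁻ s a (suc d) a∈)))
    (subst (λ l → Unique (b ∷ Vec.toList (interval s a) ++ l)) (sym (List.++-identityʳ _))
      (unique-resp-↭ (↭.shift b (Vec.toList (interval s a)) (vertices (chain s b d)))
        (unique-++⁺ (interval-unique s a) (chain-unique s b d) disjoint)))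
    where
    b : ℕ
    b = suc s ℕ.+ a
    disjoint : ∀ {v} → v ∈ˡ Vec.toList (interval s a) → v ∉ˡ b ∷ vertices (chain s b d)
    disjoint v∈ (here refl) = ℕ.<-irrefl refl (proj₂ (∈-interval⁻ s a v∈))
    disjoint v∈ (there v∈c) = ℕ.<-asym (s≤s (proj₂ (∈-interval⁻ s a v∈))) (proj₁ (∈-chain⁻ s b d v∈c))

  Segment : ℕ → ℕ → ℕ → List ℕ → Set
  Segment s a i l = ∀ {v} →
    v ∈ˡ l ⇔ (i ℕ.* suc s ℕ.+ a ℕ.≤ v × v ℕ.≤ suc i ℕ.* suc s ℕ.+ a)

  segment₀ : ∀ s a → Segment s a 0 (a ∷ suc s ℕ.+ a ∷ Vec.toList (interval s a))
  segment₀ s a {v} = mk⇔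
    (λ { (here refl) → ℕ.≤-refl , ℕ.m≤n+m a _
       ; (there (here refl)) → ℕ.m≤n+m a (suc s) , ℕ.≤-reflexive (cong (ℕ._+ a) (sym (ℕ.+-identityʳ (suc s))))
       ; (there (there v∈)) → let a<v , v≤ = ∈-interval⁻ s a v∈ in ℕ.<⇒≤ a<v
           , ℕ.≤-trans v≤ (ℕ.+-monoˡ-≤ a (ℕ.≤-trans (ℕ.n≤1+n s) (ℕ.m≤m+n (suc s) 0))) })
    (λ (a≤v , v≤) → place a≤v (subst (λ k → v ℕ.≤ k ℕ.+ a) (ℕ.+-identityʳ (suc s)) v≤))
    where
    place : a ℕ.≤ v → v ℕ.≤ suc s ℕ.+ a → v ∈ˡ a ∷ suc s ℕ.+ a ∷ Vec.toList (interval s a)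
    place a≤v v≤ with ℕ.m≤n⇒m<n∨m≡n a≤v | ℕ.m≤n⇒m<n∨m≡n v≤
    ... | inj₂ refl | _ = here refl
    ... | inj₁ a<v | inj₂ refl = there (here refl)
    ... | inj₁ a<v | inj₁ v<b = there (there (∈-interval⁺ s a a<v (ℕ.≤-pred v<b)))

  segment-shift : ∀ s a i {l} → Segment s (suc s ℕ.+ a) i l → Segment s a (suc i) l
  segment-shift s a i {l} S {v} =
    subst₂ (λ b c → v ∈ˡ l ⇔ (b ℕ.≤ v × v ℕ.≤ c)) (end s a i) (end s a (suc i)) S

  ∈-edge-chain : ∀ s a d {l} → l ∈ˡ edgeLists a (chain s a d) →
    Σ (Fin d) λ i → Segment s a (toℕ i) l
  ∈-edge-chain s a (suc d) l∈ with Membership.∈-++⁻ (edgeLists (suc s ℕ.+ a) (chain s (suc s ℕ.+ a) d)) l∈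
  ... | inj₂ (here refl) = zero , segment₀ s a
  ... | inj₁ l∈c = let i , S = ∈-edge-chain s (suc s ℕ.+ a) d l∈c in
    suc i , segment-shift s a (toℕ i) S

  edge-chain : ∀ s a {d} (i : Fin d) →
    ∃ λ l → l ∈ˡ edgeLists a (chain s a d) × Segment s a (toℕ i) l
  edge-chain s a {suc d} zero =
    _ , Membership.∈-++⁺ʳ (edgeLists (suc s ℕ.+ a) (chain s (suc s ℕ.+ a) d)) (here refl) , segment₀ s a
  edge-chain s a {suc d} (suc i) =
    let l , l∈ , S = edge-chain s (suc s ℕ.+ a) {d} i in
    l , Membership.∈-++⁺ˡ l∈ , segment-shift s a (toℕ i) S

  mapForest-fixed : ∀ {X : Set} (h : X → X) (F : Forest s X) → All (λ v → h v ≡ v) (vertices F) →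
    mapForest h F ≡ F
  mapForest-fixed h F fixed = forest-≡ (mapForest h F) F (shape-map h F)
    (trans (vertices-map h F) (List.map-id-local fixed))

  module _ (s d : ℕ) where

    private
      m N : ℕ
      m = suc (suc s)
      N = d ℕ.* suc s

    -- Reduction modulo `suc N` only makes the map total; the labels it is applied to are at most
    -- `N`.
    toFin : ℕ → Fin (suc N)
    toFin a = a ℕ.mod suc N

    toℕ-toFin : ∀ {a} → a ℕ.≤ N → toℕ (toFin a) ≡ a
    toℕ-toFin a≤N = trans (Fin.toℕ-fromℕ< _) (ℕ.m≤n⇒m%n≡m a≤N)

    pathForest : Forest s (Fin (suc N))
    pathForest = mapForest toFin (chain s 0 d)

    toℕ-pathForest : mapForest toℕ pathForest ≡ chain s 0 d
    toℕ-pathForest = trans (mapForest-∘ toℕ toFin (chain s 0 d))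
      (mapForest-fixed (toℕ ∘ toFin) (chain s 0 d) (All.tabulate λ {v} v∈ →
        toℕ-toFin (subst (v ℕ.≤_) (ℕ.+-identityʳ N) (proj₂ (∈-chain⁻ s 0 d v∈)))))

    segment⇒edge : ∀ (i : Fin d) {l} → Segment s 0 (toℕ i) (map toℕ l) →
      pathEdge m d i ≡ setOf l
    segment⇒edge i {l} S = setOf-≡
      (λ {v} v∈l → let low , high = Equivalence.to S (Membership.∈-map⁺ toℕ v∈l) in
        ∈-comprehension⁺ in?
          ( subst (ℕ._≤ toℕ v) (ℕ.+-identityʳ _) low , subst (toℕ v ℕ.≤_) (ℕ.+-identityʳ _) high))
      (λ {v} v∈e → let low , high = ∈-comprehension⁻ in? v∈e in
        case Membership.∈-map⁻ toℕ (Equivalence.from S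
          ( subst (ℕ._≤ toℕ v) (sym (ℕ.+-identityʳ _)) low
          , subst (toℕ v ℕ.≤_) (sym (ℕ.+-identityʳ _)) high)) of λ
        { (x , x∈ , eq) → subst (_∈ˡ l) (sym (Fin.toℕ-injective eq)) x∈ })
      where
      in? : ∀ (v : Fin (suc N)) → Dec (toℕ i ℕ.* suc s ℕ.≤ toℕ v × toℕ v ℕ.≤ suc (toℕ i) ℕ.* suc s)
      in? v = (toℕ i ℕ.* suc s ℕ.≤? toℕ v) ×-dec (toℕ v ℕ.≤? suc (toℕ i) ℕ.* suc s)

    path-model : Model (loosePath m d) (toFin 0) pathForest
    path-model = record
      { distinct = Unique.map⁻ {f = toℕ} (subst Unique (sym map-vertices) (chain-unique s 0 d))
      ; covers = λ v → case Membership.∈-map⁻ toℕ (subst (toℕ v ∈ˡ_) (sym map-vertices)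
          (∈-chain⁺ s 0 d z≤n (subst (toℕ v ℕ.≤_) (sym (ℕ.+-identityʳ N)) (ℕ.≤-pred (Fin.toℕ<n v))))) of λ
          { (x , x∈ , eq) → subst (_∈ˡ toFin 0 ∷ vertices pathForest) (sym (Fin.toℕ-injective eq)) x∈ }
      ; sound = λ {l} l∈ →
          let i , S = ∈-edge-chain s 0 d (subst (map toℕ l ∈ˡ_) map-edges (Membership.∈-map⁺ (map toℕ) l∈))
          in subst (_∈ˡ edges (loosePath m d)) (segment⇒edge i S) (Membership.∈-tabulate⁺ i)
      ; complete = λ e∈ → case Membership.∈-tabulate⁻ e∈ of λ
          { (i , refl) → let l , l∈ , S = edge-chain s 0 i in
            case Membership.∈-map⁻ (map toℕ) (subst (l ∈ˡ_) (sym map-edges) l∈) of λ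
            { (k , k∈ , eq) → k , k∈ , segment⇒edge i (λ {v} → subst (λ l → Segment s 0 (toℕ i) l) eq (λ {v} → S {v}) {v}) } }
      }
      where
      map-vertices : map toℕ (toFin 0 ∷ vertices pathForest) ≡ 0 ∷ vertices (chain s 0 d)
      map-vertices = cong₂ _∷_ (toℕ-toFin z≤n)
        (trans (sym (vertices-map toℕ pathForest)) (cong vertices toℕ-pathForest))
      map-edges : map (map toℕ) (edgeLists (toFin 0) pathForest) ≡ edgeLists 0 (chain s 0 d)
      map-edges = trans (sym (edgeLists-map toℕ (toFin 0) pathForest))
        (cong₂ edgeLists (toℕ-toFin z≤n) toℕ-pathForest)

    pathVertex≡ : ∀ i → toFin (toℕ i ℕ.* suc s) ≡ pathVertex m d i
    pathVertex≡ i = Fin.toℕ-injective (trans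
      (toℕ-toFin (ℕ.*-monoˡ-≤ (suc s) (ℕ.≤-pred (Fin.toℕ<n i))))
      (sym (Fin.toℕ-fromℕ< _)))

  tail-shape : ℕ → Shape
  tail-shape zero    = ε
  tail-shape (suc d) = tail-shape d ▷ ε

  shape-chain : ∀ s a d → shape (chain s a d) ≡ tail-shape d
  shape-chain s a zero    = refl
  shape-chain s a (suc d) = cong (_▷ ε) (shape-chain s (suc s ℕ.+ a) d)

  -- The chain is rooted at the end v₁. Moving the root to v₂ turns the first edge into a pendant
  -- branch there, and a swap puts the edge from v₂ to v₃ in front.
  path-link : ∀ s d → Link s (loosePath (suc (suc s)) (suc (suc d)))
    (pathVertex (suc (suc s)) (suc (suc d)) (suc zero))
    (pathVertex (suc (suc s)) (suc (suc d)) (suc (suc zero)))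
    (tail-shape d) (ε ▷ ε)
  path-link s d = subst₂ (λ u w → Link s (loosePath (suc (suc s)) D) u w (tail-shape d) (ε ▷ ε))
    (trans (cong (toFin s D) (trans (ℕ.+-identityʳ (suc s)) (sym (ℕ.+-identityʳ (suc s))))) (pathVertex≡ s D (suc zero)))
    (trans (cong (toFin s D) (cong (suc s ℕ.+_) refl)) (pathVertex≡ s D (suc (suc zero))))
    (_ , _ , _ , model-↭ (reroot-model (path-model s D))
        (↭.prep _ (Rearranged.vertices↭ R))
        (λ l∈ → _ , ↭.∈-resp-↭ (Rearranged.edges↭ R) l∈ , refl)
        (λ l∈ → _ , ↭.∈-resp-↭ (↭-sym (Rearranged.edges↭ R)) l∈ , refl)
      , trans (shape-map (toFin s D) _) (shape-chain s _ d) , refl)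
    where
    D : ℕ
    D = suc (suc d)
    R = rearrange (toFin s D (suc s ℕ.+ 0))
      (branch (Vec.map (toFin s D) (interval s 0)) (toFin s D 0) ε
        (mapForest (toFin s D) (chain s (suc s ℕ.+ 0) (suc d)))) ~-swap refl

open LoosePaths


-- Shapes of the seven hypertrees.

module SevenShapes where

  star₁ star₂ path₂ star₃ : Shape
  star₁ = ε ▷ ε
  star₂ = ε ▷ ε ▷ ε
  path₂ = (ε ▷ ε) ▷ ε
  star₃ = ε ▷ ε ▷ ε ▷ ε

  rooted : List Shape → ℕ → Shape
  rooted bs a = List.foldr _▷_ (leaves a ε) bs

  leaves-~ : ∀ a {b t} → leaves a (b ▷ t) ~ b ▷ leaves a t
  leaves-~ zero    = ~-refl
  leaves-~ (suc a) = ~-trans (~-cong ~-refl (leaves-~ a)) ~-swap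

  ≡⇒≈ : ∀ {a b} → a ≡ b → a ≈ b
  ≡⇒≈ refl = arrange ~-refl

  module _ (s k : ℕ) where

    private
      m : ℕ
      m = suc (suc s)

    hasShape₁ : HasShape s (T m 2 (k ∸ 2 ∷ [])) (rooted [] (2 ℕ.+ (k ∸ 2)))
    hasShape₁ = hasShape-≈ (≡⇒≈ (cong (ε ▷_) (leaves-ε▷ (k ∸ 2) ε)))
      (attachAll-link (k ∸ 2) 0 _ (Vec.toList∘fromList _) (path-link s 0))

    hasShape₂ : HasShape s (T m 3 (k ∸ 3 ∷ 0 ∷ [])) (rooted (star₁ ∷ []) (1 ℕ.+ (k ∸ 3)))
    hasShape₂ = hasShape-≈ (≡⇒≈ (cong (star₁ ▷_) (leaves-ε▷ (k ∸ 3) ε)))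
      (attachAll-link (k ∸ 3) 0 _ (Vec.toList∘fromList _) (path-link s 1))

    hasShape₃ : HasShape s (T m 3 (k ∸ 4 ∷ 1 ∷ [])) (rooted (star₂ ∷ []) (1 ℕ.+ (k ∸ 4)))
    hasShape₃ = hasShape-≈ (≡⇒≈ (cong (star₂ ▷_) (leaves-ε▷ (k ∸ 4) ε)))
      (attachAll-link (k ∸ 4) 1 _ (Vec.toList∘fromList _) (path-link s 1))

    hasShape₄ : HasShape s (T m 4 (0 ∷ k ∸ 4 ∷ 0 ∷ [])) (rooted (star₁ ∷ star₁ ∷ []) (k ∸ 4))
    -- Here v₃ is the vertex of large degree, so the root moves from v₂ to v₃.
    hasShape₄ = hasShape-≈ (≈-trans reroot (arrange (~-cong ~-refl (leaves-~ (k ∸ 4)))))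
      (attachAll-link 0 (k ∸ 4) _ (trans (Vec.toList∘fromList _) (List.++-identityʳ _)) (path-link s 2))

    hasShape₅ : HasShape s (T m 4 (k ∸ 4 ∷ 0 ∷ 0 ∷ [])) (rooted (path₂ ∷ []) (1 ℕ.+ (k ∸ 4)))
    hasShape₅ = hasShape-≈ (≡⇒≈ (cong (path₂ ▷_) (leaves-ε▷ (k ∸ 4) ε)))
      (attachAll-link (k ∸ 4) 0 _ (Vec.toList∘fromList _) (path-link s 2))

    hasShape₆ : HasShape s (T m 3 (k ∸ 5 ∷ 2 ∷ [])) (rooted (star₃ ∷ []) (1 ℕ.+ (k ∸ 5)))
    hasShape₆ = hasShape-≈ (≡⇒≈ (cong (star₃ ▷_) (leaves-ε▷ (k ∸ 5) ε)))
      (attachAll-link (k ∸ 5) 2 _ (Vec.toList∘fromList _) (path-link s 1))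

    hasShape₇ : HasShape s (T m 4 (1 ∷ k ∸ 5 ∷ 0 ∷ [])) (rooted (star₂ ∷ star₁ ∷ []) (k ∸ 5))
    hasShape₇ = hasShape-≈ (≈-trans reroot (arrange (~-cong ~-refl (leaves-~ (k ∸ 5)))))
      (attachAll-link 1 (k ∸ 5) _
        (trans (Vec.toList∘fromList _) (cong (_ ∷_) (List.++-identityʳ _))) (path-link s 2))

open SevenShapes


-- Moving the root to an arbitrary non-pendant vertex.

module Extraction where

  private variable
    s : ℕ

  infixr 5 _⊕_

  _⊕_ : ∀ {X : Set} → Forest s X → Forest s X → Forest s X
  ε                ⊕ F = F
  branch ps w c r ⊕ F = branch ps w c (r ⊕ F)

  AllPads : ∀ {X : Set} → (X → Set) → Forest s X → Set
  AllPads P ε                = Unit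
  AllPads P (branch ps w c r) = All P (Vec.toList ps) × AllPads P c × AllPads P r

  AllPads-⊕ : ∀ {X : Set} {P : X → Set} (F : Forest s X) {G} → AllPads P F → AllPads P G → AllPads P (F ⊕ G)
  AllPads-⊕ ε                _             g = g
  AllPads-⊕ (branch ps w c r) (ap , ac , ar) g = ap , ac , AllPads-⊕ r ar g

  AllPads-⊕⁻ : ∀ {X : Set} {P : X → Set} (F : Forest s X) {G} → AllPads P (F ⊕ G) → AllPads P F × AllPads P G
  AllPads-⊕⁻ ε                g = tt , g
  AllPads-⊕⁻ (branch ps w c r) (ap , ac , arg) =
    let ar , g = AllPads-⊕⁻ r arg in (ap , ac , ar) , g

  -- the non-pendant vertices below the root
  data Node {s : ℕ} {X : Set} (x : X) : Forest s X → Set where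
    top     : ∀ {ps : Vec X s} {c r} → Node x (branch ps x c r)
    child   : ∀ {ps : Vec X s} {w c r} → Node x c → Node x (branch ps w c r)
    sibling : ∀ {ps : Vec X s} {w c r} → Node x r → Node x (branch ps w c r)

  vertex-cases : ∀ {X : Set} {P : X → Set} (F : Forest s X) → AllPads P F →
    ∀ {x} → x ∈ˡ vertices F → Node x F ⊎ P x
  vertex-cases (branch ps w c r) (ap , ac , ar) x∈ with ∈-vertices-branch {ps = ps} {c = c} x∈
  ... | inj₁ refl        = inj₁ top
  ... | inj₂ (inj₁ x∈ps) = inj₂ (All.lookup ap x∈ps)
  ... | inj₂ (inj₂ (inj₁ x∈c)) = [ inj₁ ∘ child , inj₂ ]′ (vertex-cases c ac x∈c)
  ... | inj₂ (inj₂ (inj₂ x∈r)) = [ inj₁ ∘ sibling , inj₂ ]′ (vertex-cases r ar x∈r)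

  infix 4 _≼_

  _≼_ : ∀ {n} → List (List (Fin n)) → List (List (Fin n)) → Set
  ls ≼ ks = ∀ {l} → l ∈ˡ ls → ∃ λ k → k ∈ˡ ks × setOf l ≡ setOf k

  ≼-trans : ∀ {n} {ls ks js : List (List (Fin n))} → ls ≼ ks → ks ≼ js → ls ≼ js
  ≼-trans p q l∈ = let k , k∈ , eq = p l∈ ; j , j∈ , eq′ = q k∈ in j , j∈ , trans eq eq′

  ↭⇒≼ : ∀ {n} {ls ks : List (List (Fin n))} → ls ↭ ks → ls ≼ ks
  ↭⇒≼ p l∈ = _ , ↭.∈-resp-↭ p l∈ , refl

  -- the same rooted hypertree, presented from another root
  record Recast {n} (u : Fin n) (F : Forest s (Fin n)) (x : Fin n) (G : Forest s (Fin n)) : Set₁ where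
    field
      vertices↭ : u ∷ vertices F ↭ x ∷ vertices G
      to        : edgeLists u F ≼ edgeLists x G
      from      : edgeLists x G ≼ edgeLists u F
      pads      : ∀ {P} → AllPads P F → AllPads P G

  recast-trans : ∀ {n} {u v w : Fin n} {F G E : Forest s (Fin n)} →
    Recast u F v G → Recast v G w E → Recast u F w E
  recast-trans p q = record
    { vertices↭ = ↭-trans P.vertices↭ Q.vertices↭
    ; to = ≼-trans P.to Q.to ; from = ≼-trans Q.from P.from ; pads = Q.pads ∘ P.pads }
    where
    module P = Recast p
    module Q = Recast q


  move-vertices : ∀ {X : Set} (ps : Vec X s) w c r a →
    vertices (branch ps w c (r ⊕ a)) ↭ vertices (r ⊕ branch ps w c a)
  move-vertices ps w c ε a = ↭-refl
  move-vertices ps w c (branch qs y d r) a = begin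
    as ++ (vertices c ++ (bs ++ (vertices d ++ vertices (r ⊕ a))))
      ≡⟨ List.++-assoc as (vertices c) _ ⟨
    (as ++ vertices c) ++ (bs ++ (vertices d ++ vertices (r ⊕ a)))
      ≡⟨ cong ((as ++ vertices c) ++_) (List.++-assoc bs (vertices d) _) ⟨
    (as ++ vertices c) ++ ((bs ++ vertices d) ++ vertices (r ⊕ a))
      ↭⟨ ↭.shifts (as ++ vertices c) (bs ++ vertices d) ⟩
    (bs ++ vertices d) ++ ((as ++ vertices c) ++ vertices (r ⊕ a))
      ≡⟨ cong ((bs ++ vertices d) ++_) (List.++-assoc as (vertices c) _) ⟩
    (bs ++ vertices d) ++ vertices (branch ps w c (r ⊕ a))
      ↭⟨ ↭.++⁺ˡ (bs ++ vertices d) (move-vertices ps w c r a) ⟩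
    (bs ++ vertices d) ++ vertices (r ⊕ branch ps w c a)
      ≡⟨ List.++-assoc bs (vertices d) _ ⟩
    bs ++ (vertices d ++ vertices (r ⊕ branch ps w c a)) ∎
    where
    open ↭.PermutationReasoning
    as bs : List _
    as = w ∷ Vec.toList ps
    bs = y ∷ Vec.toList qs

  move-edges : ∀ {X : Set} (u : X) (ps : Vec X s) w c r a →
    edgeLists u (branch ps w c (r ⊕ a)) ↭ edgeLists u (r ⊕ branch ps w c a)
  move-edges u ps w c ε a = ↭-refl
  move-edges u ps w c (branch qs y d r) a = begin
    edgeLists w c ++ e ∷ (edgeLists y d ++ f ∷ rest)
      ≡⟨ List.++-assoc (edgeLists w c) (e ∷ []) _ ⟨
    (edgeLists w c ++ e ∷ []) ++ (edgeLists y d ++ f ∷ rest)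
      ≡⟨ cong ((edgeLists w c ++ e ∷ []) ++_) (List.++-assoc (edgeLists y d) (f ∷ []) rest) ⟨
    (edgeLists w c ++ e ∷ []) ++ ((edgeLists y d ++ f ∷ []) ++ rest)
      ↭⟨ ↭.shifts (edgeLists w c ++ e ∷ []) (edgeLists y d ++ f ∷ []) ⟩
    (edgeLists y d ++ f ∷ []) ++ ((edgeLists w c ++ e ∷ []) ++ rest)
      ≡⟨ cong ((edgeLists y d ++ f ∷ []) ++_) (List.++-assoc (edgeLists w c) (e ∷ []) rest) ⟩
    (edgeLists y d ++ f ∷ []) ++ edgeLists u (branch ps w c (r ⊕ a))
      ↭⟨ ↭.++⁺ˡ (edgeLists y d ++ f ∷ []) (move-edges u ps w c r a) ⟩
    (edgeLists y d ++ f ∷ []) ++ edgeLists u (r ⊕ branch ps w c a)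
      ≡⟨ List.++-assoc (edgeLists y d) (f ∷ []) _ ⟩
    edgeLists y d ++ f ∷ edgeLists u (r ⊕ branch ps w c a) ∎
    where
    open ↭.PermutationReasoning
    e f : List _
    e = u ∷ w ∷ Vec.toList ps
    f = u ∷ y ∷ Vec.toList qs
    rest : List (List _)
    rest = edgeLists u (r ⊕ a)

  module _ {n : ℕ} where

    move : ∀ (u : Fin n) (ps : Vec (Fin n) s) w c r a →
      Recast u (branch ps w c (r ⊕ a)) u (r ⊕ branch ps w c a)
    move u ps w c r a = record
      { vertices↭ = ↭.prep u (move-vertices ps w c r a)
      ; to = ↭⇒≼ (move-edges u ps w c r a)
      ; from = ↭⇒≼ (↭-sym (move-edges u ps w c r a))
      ; pads = λ (ap , ac , ara) → let ar , aa = AllPads-⊕⁻ r ara in AllPads-⊕ r ar (ap , ac , aa) }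

    exchange : ∀ (u : Fin n) (ps : Vec (Fin n) s) w c r → Recast u (branch ps w c r) w (branch ps u r c)
    exchange u ps w c r = record
      { vertices↭ = ↭.swap u w (↭.++⁺ˡ (Vec.toList ps) (↭.++-comm (vertices c) (vertices r)))
      ; to = exchange-edges u ps w c r ; from = exchange-edges w ps u r c
      ; pads = λ (ap , ac , ar) → ap , ar , ac }

    ⊕-ε : ∀ (F : Forest s (Fin n)) → F ⊕ ε ≡ F
    ⊕-ε ε = refl
    ⊕-ε (branch ps w c r) = cong (branch ps w c) (⊕-ε r)

    -- `a` collects the branches already passed. Going down into `c`, everything above `w` becomes
    -- one more branch at `w`, and that branch is the new collection.
    recast-root : ∀ {x : Fin n} u (F a : Forest s (Fin n)) → Node x F → ∃ λ G → Recast u (F ⊕ a) x G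
    recast-root u (branch ps w c r) a top = _ , exchange u ps w c (r ⊕ a)
    recast-root u (branch ps w c r) a (child x∈) =
      let G , R = recast-root w c (branch ps u (r ⊕ a) ε) x∈ in
      G , recast-trans (exchange u ps w c (r ⊕ a)) (recast-trans
        (subst (λ d → Recast w (branch ps u (r ⊕ a) d) w (c ⊕ branch ps u (r ⊕ a) ε)) (⊕-ε c)
          (move w ps u (r ⊕ a) c ε)) R)
    recast-root u (branch ps w c r) a (sibling x∈) =
      let G , R = recast-root u r (branch ps w c a) x∈ in
      G , recast-trans (move u ps w c r a) R

open Extraction


-- Paths that close up to a loose cycle.

module Descents where

  -- A path from the root down to the first vertex in E below it; it has suc k edges.
  data Descent {s : ℕ} {X : Set} (E : X → Set) : X → Forest s X → ℕ → Set where
    stop : ∀ {u} {ps : Vec X s} {w c r} → E w → Descent E u (branch ps w c r) 0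
    down : ∀ {u} {ps : Vec X s} {w c r k} → ¬ E w → Descent E w c k → Descent E u (branch ps w c r) (suc k)
    skip : ∀ {u} {ps : Vec X s} {w c r k} → Descent E u r k → Descent E u (branch ps w c r) k

  module _ {s : ℕ} {X : Set} {E : X → Set} where

    private variable
      k : ℕ
      u : X
      F : Forest s X

    descend : Decidable E → ∀ {u y} {F : Forest s X} → Node y F → E y → ∃ λ k → Descent E u F k
    descend E? top y∈ = 0 , stop y∈
    descend E? {F = branch ps w c r} (child n) y∈ with E? w
    ... | yes w∈ = 0 , stop w∈
    ... | no w∉  = let k , d = descend E? n y∈ in suc k , down w∉ d
    descend E? (sibling n) y∈ = let k , d = descend E? n y∈ in k , skip d

    vertexAt : Descent E u F k → ℕ → X
    vertexAt (stop {u = u} {w = w} _) zero    = u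
    vertexAt (stop {u = u} {w = w} _) (suc _) = w
    vertexAt (down {u = u} _ d) zero    = u
    vertexAt (down {u = u} _ d) (suc i) = vertexAt d i
    vertexAt (skip d) i = vertexAt d i

    edgeAt : Descent E u F k → ℕ → List X
    edgeAt (stop {u = u} {ps} {w} _) _          = u ∷ w ∷ Vec.toList ps
    edgeAt (down {u = u} {ps} {w} _ d) zero    = u ∷ w ∷ Vec.toList ps
    edgeAt (down _ d) (suc i) = edgeAt d i
    edgeAt (skip d) i = edgeAt d i

    vertexAt-0 : (d : Descent E u F k) → vertexAt d 0 ≡ u
    vertexAt-0 (stop _)   = refl
    vertexAt-0 (down _ _) = refl
    vertexAt-0 (skip d)   = vertexAt-0 d

    private
      inChildren : ∀ (ps : Vec X s) {w} c r {v} → v ∈ˡ w ∷ vertices c → v ∈ˡ vertices (branch ps w c r)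
      inChildren ps c r (here eq) = here eq
      inChildren ps c r (there v∈) = there (Membership.∈-++⁺ʳ (Vec.toList ps) (Membership.∈-++⁺ˡ v∈))

      inSiblings : ∀ (ps : Vec X s) {w} c r {v} → v ∈ˡ vertices r → v ∈ˡ vertices (branch ps w c r)
      inSiblings ps c r v∈ =
        there (Membership.∈-++⁺ʳ (Vec.toList ps) (Membership.∈-++⁺ʳ (vertices c) v∈))

    vertexAt-below : (d : Descent E u F k) → ∀ i → vertexAt d (suc i) ∈ˡ vertices F
    vertexAt-below (stop _) i = here refl
    vertexAt-below (down {ps = ps} {c = c} {r} _ d) zero = inChildren ps c r (here (vertexAt-0 d))
    vertexAt-below (down {ps = ps} {c = c} {r} _ d) (suc i) = inChildren ps c r (there (vertexAt-below d i))
    vertexAt-below (skip {ps = ps} {c = c} {r} d) i = inSiblings ps c r (vertexAt-below d i)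

    edgeAt∈ : (d : Descent E u F k) → ∀ i → edgeAt d i ∈ˡ edgeLists u F
    edgeAt∈ (stop {w = w} {c} _) i = Membership.∈-++⁺ʳ (edgeLists w c) (here refl)
    edgeAt∈ (down {w = w} {c} _ d) zero = Membership.∈-++⁺ʳ (edgeLists w c) (here refl)
    edgeAt∈ (down _ d) (suc i) = Membership.∈-++⁺ˡ (edgeAt∈ d i)
    edgeAt∈ (skip {w = w} {c} d) i = Membership.∈-++⁺ʳ (edgeLists w c) (there (edgeAt∈ d i))

    vertexAt∈edgeAt : (d : Descent E u F k) → ∀ {i} → i ℕ.≤ k →
      vertexAt d i ∈ˡ edgeAt d i × vertexAt d (suc i) ∈ˡ edgeAt d i
    vertexAt∈edgeAt (stop _) z≤n = here refl , there (here refl)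
    vertexAt∈edgeAt (down _ d) z≤n = here refl , there (here (vertexAt-0 d))
    vertexAt∈edgeAt (down _ d) (s≤s i≤k) = vertexAt∈edgeAt d i≤k
    vertexAt∈edgeAt (skip d) i≤k = vertexAt∈edgeAt d i≤k

    vertexAt∉ : (d : Descent E u F k) → ∀ {i} → i ℕ.< k → ¬ E (vertexAt d (suc i))
    vertexAt∉ (down w∉ d) {zero} _ w∈ = w∉ (subst E (vertexAt-0 d) w∈)
    vertexAt∉ (down w∉ d) {suc i} (s≤s i<k) = vertexAt∉ d i<k
    vertexAt∉ (skip d) i<k = vertexAt∉ d i<k

    vertexAt-last : (d : Descent E u F k) → E (vertexAt d (suc k))
    vertexAt-last (stop w∈)  = w∈
    vertexAt-last (down _ d) = vertexAt-last d
    vertexAt-last (skip d)   = vertexAt-last d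

    vertexAt-distinct : Unique (u ∷ vertices F) → (d : Descent E u F k) →
      ∀ {i j} → i ℕ.< j → j ℕ.≤ suc k → vertexAt d i ≢ vertexAt d j
    vertexAt-distinct uniq (stop {ps = ps} {w} {c} {r} _) {zero} {suc j} _ _ refl =
      unique⇒∉ uniq (here refl)
    vertexAt-distinct uniq (stop _) {suc i} {suc j} (s≤s i<j) (s≤s z≤n) = contradiction i<j λ ()
    vertexAt-distinct uniq (down {ps = ps} {w} {c} {r} _ d) {zero} {suc j} _ _ eq =
      unique⇒∉ uniq (subst (_∈ˡ vertices (branch ps w c r)) (sym eq) (inBranch j))
      where
      inBranch : ∀ j → vertexAt d j ∈ˡ vertices (branch ps w c r)
      inBranch zero    = inChildren ps c r (here (vertexAt-0 d))
      inBranch (suc j) = inChildren ps c r (there (vertexAt-below d j))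
    vertexAt-distinct uniq (down {ps = ps} {w} {c} {r} _ d) {suc i} {suc j} (s≤s i<j) (s≤s j≤) =
      vertexAt-distinct (Split.children-unique (split ps w c r uniq)) d i<j j≤
    vertexAt-distinct uniq (skip {ps = ps} {w} {c} {r} d) i<j j≤ =
      vertexAt-distinct (Split.siblings-unique (split ps w c r uniq)) d i<j j≤

    edgeAt∩E : (d : Descent E u F k) → AllPads (λ v → ¬ E v) F → ∀ {i} → i ℕ.≤ k →
      ∀ {x} → x ∈ˡ edgeAt d i → E x → x ≡ vertexAt d i ⊎ x ≡ vertexAt d (suc i)
    edgeAt∩E (stop _) _ z≤n (here eq) _ = inj₁ eq
    edgeAt∩E (stop _) _ z≤n (there (here eq)) _ = inj₂ eq
    edgeAt∩E (stop _) (ap , _) z≤n (there (there x∈)) x∈E = contradiction x∈E (All.lookup ap x∈)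
    edgeAt∩E (down _ d) _ z≤n (here eq) _ = inj₁ eq
    edgeAt∩E (down _ d) _ z≤n (there (here eq)) _ = inj₂ (trans eq (sym (vertexAt-0 d)))
    edgeAt∩E (down _ d) (ap , _) z≤n (there (there x∈)) x∈E = contradiction x∈E (All.lookup ap x∈)
    edgeAt∩E (down _ d) (_ , ac , _) (s≤s i≤k) = edgeAt∩E d ac i≤k
    edgeAt∩E (skip d) (_ , _ , ar) i≤k = edgeAt∩E d ar i≤k

    edgeAt-below : Unique (u ∷ vertices F) → (d : Descent E u F k) → ∀ {i} → suc i ℕ.≤ k →
      ∀ {x} → x ∈ˡ edgeAt d (suc i) → x ∈ˡ vertices F
    edgeAt-below uniq (down {ps = ps} {w} {c} {r} _ d) {i} _ x∈ =
      inChildren ps c r (∈-edge⇒∈-vertices {F = c} (edgeAt∈ d i) x∈)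
    edgeAt-below uniq (skip {ps = ps} {w} {c} {r} d) i<k x∈ =
      inSiblings ps c r (edgeAt-below (Split.siblings-unique (split ps w c r uniq)) d i<k x∈)

    edgeAt-consecutive : Unique (u ∷ vertices F) → (d : Descent E u F k) → ∀ {i} → suc i ℕ.≤ k →
      ∀ {x} → x ∈ˡ edgeAt d i → x ∈ˡ edgeAt d (suc i) → x ≡ vertexAt d (suc i)
    edgeAt-consecutive uniq (down {ps = ps} {w} {c} {r} _ d) {zero} _ x∈ x∈′
      with ∈-edge⇒∈-vertices {F = c} (edgeAt∈ d 0) x∈′
    ... | here refl = sym (vertexAt-0 d)
    ... | there x∈c = contradiction x∈c (Split.edge∩children (split ps w c r uniq) x∈)
    edgeAt-consecutive uniq (down {ps = ps} {w} {c} {r} _ d) {suc i} (s≤s i<k) =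
      edgeAt-consecutive (Split.children-unique (split ps w c r uniq)) d i<k
    edgeAt-consecutive uniq (skip {ps = ps} {w} {c} {r} d) =
      edgeAt-consecutive (Split.siblings-unique (split ps w c r uniq)) d

    edgeAt-disjoint : Unique (u ∷ vertices F) → (d : Descent E u F k) →
      ∀ {i j} → suc i ℕ.< j → j ℕ.≤ k → ∀ {x} → x ∈ˡ edgeAt d i → x ∉ˡ edgeAt d j
    edgeAt-disjoint uniq (down {ps = ps} {w} {c} {r} _ d) {zero} {suc (suc j)} _ (s≤s j<k) x∈ x∈′ =
      Split.edge∩children (split ps w c r uniq) x∈
        (edgeAt-below (Split.children-unique (split ps w c r uniq)) d j<k x∈′)
    edgeAt-disjoint uniq (down {ps = ps} {w} {c} {r} _ d) {zero} {suc zero} (s≤s ())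
    edgeAt-disjoint uniq (down {ps = ps} {w} {c} {r} _ d) {suc i} {suc j} (s≤s i<j) (s≤s j≤k) =
      edgeAt-disjoint (Split.children-unique (split ps w c r uniq)) d i<j j≤k
    edgeAt-disjoint uniq (stop _) {j = suc j} _ ()
    edgeAt-disjoint uniq (skip {ps = ps} {w} {c} {r} d) =
      edgeAt-disjoint (Split.siblings-unique (split ps w c r uniq)) d

  module _ {s : ℕ} {H : Hypergraph} (linear : Linear H) {u : Vertex H} {F : Forest s (Vertex H)}
    (uniq : Unique (u ∷ vertices F)) (sound : ∀ {l} → l ∈ˡ edgeLists u F → setOf l ∈ˡ edges H)
    {e : Subset (order H)} (e∈ : e ∈ˡ edges H) (e-new : ∀ {l} → l ∈ˡ edgeLists u F → e ≢ setOf l)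
    (pads∉ : AllPads (_∉ e) F) (u∈e : u ∈ e) where

    -- An edge outside the built part that contains the root and a vertex below it closes the path
    -- between the two into a cycle. The path stops at its first vertex in `e`, which keeps `e`
    -- disjoint from the inner edges. A path of a single edge would share two vertices with `e`,
    -- against linearity.
    descent⇒cycle : ∀ {k} → Descent (_∈ e) u F k → LooseCycle H
    descent⇒cycle {zero} d = ⊥-elim
      (vertexAt-distinct uniq d (s≤s z≤n) (s≤s z≤n)
        (meet₁ z≤n (proj₁ (vertexAt∈edgeAt d z≤n)) (subst (_∈ e) (sym (vertexAt-0 d)) u∈e)
          (proj₂ (vertexAt∈edgeAt d z≤n)) (vertexAt-last d)))
      where
      meet₁ : ∀ {i} → i ℕ.≤ 0 → ∀ {x y} → x ∈ˡ edgeAt d i → x ∈ e → y ∈ˡ edgeAt d i → y ∈ e → x ≡ y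
      meet₁ {i} _ x∈ x∈e y∈ y∈e = ∣∣≤1⁻ (linear (sound (edgeAt∈ d i)) e∈ (≢-sym (e-new (edgeAt∈ d i))))
        (Subset.x∈p∩q⁺ (∈-setOf⁺ x∈ , x∈e)) (Subset.x∈p∩q⁺ (∈-setOf⁺ y∈ , y∈e))
    descent⇒cycle {suc k} d = record
      { len         = suc (suc (suc k))
      ; len≥3       = s≤s (s≤s (s≤s z≤n))
      ; vertex      = vertexAt d ∘ toℕ
      ; edge        = edge ∘ toℕ
      ; edge∈       = edge∈ ∘ toℕ
      ; injective   = injective
      ; consecutive = consecutive
      ; disjoint    = λ i j i≢j j≢i+1 i≢j+1 (x , x∈) →
          let x∈i , x∈j = Subset.x∈p∩q⁻ (edge (toℕ i)) (edge (toℕ j)) x∈ in disjoint i j i≢j j≢i+1 i≢j+1 x∈i x∈j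
      }
      where
      K = suc (suc k)
      edge : ℕ → Subset (order H)
      edge i with i ℕ.≤? suc k
      ... | yes _ = setOf (edgeAt d i)
      ... | no _  = e
      edge-≤ : ∀ {i} → i ℕ.≤ suc k → edge i ≡ setOf (edgeAt d i)
      edge-≤ {i} i≤ with i ℕ.≤? suc k
      ... | yes _ = refl
      ... | no i≰ = contradiction i≤ i≰
      edge-K : edge K ≡ e
      edge-K with K ℕ.≤? suc k
      ... | yes K≤ = contradiction K≤ ℕ.1+n≰n
      ... | no _   = refl
      edge∈ : ∀ i → edge i ∈ˡ edges H
      edge∈ i with i ℕ.≤? suc k
      ... | yes _ = sound (edgeAt∈ d i)
      ... | no _  = e∈
      meet : ∀ i {x y} → x ∈ˡ edgeAt d i → x ∈ e → y ∈ˡ edgeAt d i → y ∈ e → x ≡ y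
      meet i x∈ x∈e y∈ y∈e = ∣∣≤1⁻ (linear (sound (edgeAt∈ d i)) e∈ (≢-sym (e-new (edgeAt∈ d i))))
        (Subset.x∈p∩q⁺ (∈-setOf⁺ x∈ , x∈e)) (Subset.x∈p∩q⁺ (∈-setOf⁺ y∈ , y∈e))
      ≤K : ∀ (i : Fin (suc K)) → toℕ i ℕ.≤ K
      ≤K i = ℕ.≤-pred (Fin.toℕ<n i)
      injective : ∀ {i j : Fin (suc K)} → vertexAt d (toℕ i) ≡ vertexAt d (toℕ j) → i ≡ j
      injective {i} {j} eq with ℕ.<-cmp (toℕ i) (toℕ j)
      ... | tri< i<j _ _ = contradiction eq (vertexAt-distinct uniq d i<j (≤K j))
      ... | tri≈ _ i≡j _ = Fin.toℕ-injective i≡j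
      ... | tri> _ _ j<i = contradiction (sym eq) (vertexAt-distinct uniq d j<i (≤K i))
      singleton : ∀ {p q : Subset (order H)} {v} → v ∈ p → v ∈ q → (∀ {x} → x ∈ p → x ∈ q → x ≡ v) →
        p ∩ q ≡ ⁅ v ⁆
      singleton {p} {q} {v} v∈p v∈q only = Subset.⊆-antisym
        (λ x∈ → let x∈p , x∈q = Subset.x∈p∩q⁻ p q x∈ in subst (_∈ ⁅ v ⁆) (sym (only x∈p x∈q)) (Subset.x∈⁅x⁆ v))
        (λ x∈ → subst (_∈ p ∩ q) (sym (Subset.x∈⁅y⁆⇒x≡y v x∈)) (Subset.x∈p∩q⁺ (v∈p , v∈q)))
      inner : ∀ {i} → suc i ℕ.≤ suc k → edge i ∩ edge (suc i) ≡ ⁅ vertexAt d (suc i) ⁆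
      inner {i} i<k rewrite edge-≤ (ℕ.≤-trans (ℕ.n≤1+n i) i<k) | edge-≤ i<k = singleton
        (∈-setOf⁺ (proj₂ (vertexAt∈edgeAt d (ℕ.≤-trans (ℕ.n≤1+n i) i<k))))
        (∈-setOf⁺ (proj₁ (vertexAt∈edgeAt d i<k)))
        (λ x∈ x∈′ → edgeAt-consecutive uniq d i<k (∈-setOf⁻ x∈) (∈-setOf⁻ x∈′))
      closing : edge (suc k) ∩ edge K ≡ ⁅ vertexAt d K ⁆
      closing rewrite edge-≤ {suc k} ℕ.≤-refl | edge-K = singleton (∈-setOf⁺ v∈) (vertexAt-last d)
        (λ x∈ x∈e → meet (suc k) (∈-setOf⁻ x∈) x∈e v∈ (vertexAt-last d))
        where
        v∈ : vertexAt d K ∈ˡ edgeAt d (suc k)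
        v∈ = proj₂ (vertexAt∈edgeAt d ℕ.≤-refl)
      opening : edge K ∩ edge 0 ≡ ⁅ vertexAt d 0 ⁆
      opening rewrite edge-K | edge-≤ {0} z≤n = singleton u∈e′ (∈-setOf⁺ v∈)
        (λ x∈e x∈ → meet 0 (∈-setOf⁻ x∈) x∈e v∈ u∈e′)
        where
        v∈ : vertexAt d 0 ∈ˡ edgeAt d 0
        v∈ = proj₁ (vertexAt∈edgeAt d z≤n)
        u∈e′ : vertexAt d 0 ∈ e
        u∈e′ = subst (_∈ e) (sym (vertexAt-0 d)) u∈e
      consecutive : ∀ (i : Fin (suc K)) → edge (toℕ i) ∩ edge (toℕ (next i)) ≡ ⁅ vertexAt d (toℕ (next i)) ⁆
      consecutive i with next-case i
      ... | inj₂ (i≡K , eq) rewrite eq | i≡K = opening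
      ... | inj₁ (i<K , eq) rewrite eq with ℕ.m≤n⇒m<n∨m≡n (ℕ.≤-pred i<K)
      ...   | inj₁ i<k  = inner i<k
      ...   | inj₂ i≡k rewrite i≡k = closing
      -- For j = K the second edge is `e`. As pads avoid `e`, a vertex common to `e` and an inner
      -- edge would be an end of that edge, and these ends come before the first path vertex in `e`.
      far : ∀ {i j} → suc i ℕ.< j → j ℕ.≤ K → (j ≡ K → i ≢ 0) → ∀ {x} → x ∈ edge i → x ∉ edge j
      far {i} {j} i<j j≤K wrap {x} x∈i x∈j with ℕ.m≤n⇒m<n∨m≡n j≤K
      ... | inj₁ j<K = edgeAt-disjoint uniq d i<j (ℕ.≤-pred j<K)
        (∈-setOf⁻ (subst (x ∈_) (edge-≤ i≤k) x∈i))
        (∈-setOf⁻ (subst (x ∈_) (edge-≤ (ℕ.≤-pred j<K)) x∈j))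
        where
        i≤k : i ℕ.≤ suc k
        i≤k = ℕ.≤-trans (ℕ.≤-trans (ℕ.n≤1+n i) (ℕ.<⇒≤ i<j)) (ℕ.≤-pred j<K)
      ... | inj₂ refl with i
      ...   | zero   = wrap refl refl
      ...   | suc i′ with edgeAt∩E d pads∉ (ℕ.<⇒≤ (ℕ.≤-pred i<j)) (∈-setOf⁻ (subst (x ∈_) (edge-≤ (ℕ.<⇒≤ (ℕ.≤-pred i<j))) x∈i)) x∈e
        where
        x∈e : x ∈ e
        x∈e = subst (x ∈_) edge-K x∈j
      ...     | inj₁ refl = vertexAt∉ d (ℕ.<-trans (ℕ.n<1+n i′) (ℕ.≤-pred i<j)) (subst (_ ∈_) edge-K x∈j)
      ...     | inj₂ refl = vertexAt∉ d (ℕ.≤-pred i<j) (subst (_ ∈_) edge-K x∈j)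
      gap : ∀ (i j : Fin (suc K)) → toℕ i ℕ.< toℕ j → j ≢ next i → suc (toℕ i) ℕ.< toℕ j
      gap i j i<j j≢ = ℕ.≤∧≢⇒< i<j λ eq → j≢ (Fin.toℕ-injective (trans (sym eq)
        (sym (next-suc i (ℕ.≤-trans (s≤s i<j) (s≤s (≤K j)))))))
      wrap : ∀ (i j : Fin (suc K)) → i ≢ next j → toℕ j ≡ K → toℕ i ≢ 0
      wrap i j i≢ j≡K i≡0 = i≢ (Fin.toℕ-injective (trans i≡0 (sym (next-last j j≡K))))
      disjoint : ∀ (i j : Fin (suc K)) → i ≢ j → j ≢ next i → i ≢ next j →
        ∀ {x} → x ∈ edge (toℕ i) → x ∉ edge (toℕ j)
      disjoint i j i≢j j≢i+1 i≢j+1 x∈i x∈j with ℕ.<-cmp (toℕ i) (toℕ j)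
      ... | tri≈ _ i≡j _ = i≢j (Fin.toℕ-injective i≡j)
      ... | tri< i<j _ _ = far (gap i j i<j j≢i+1) (≤K j) (wrap i j i≢j+1) x∈i x∈j
      ... | tri> _ _ j<i = far (gap j i j<i i≢j+1) (≤K i) (wrap j i j≢i+1) x∈j x∈i

open Descents


-- Presenting a hypertree by adding edges.

module Growth where

  vertex⇒edge : ∀ {s} {X : Set} {u : X} (F : Forest s X) {x} → x ∈ˡ vertices F →
    ∃ λ l → l ∈ˡ edgeLists u F × x ∈ˡ l
  vertex⇒edge {u = u} (branch ps w c r) x∈ with ∈-vertices-branch {ps = ps} {c = c} x∈
  ... | inj₁ refl = _ , Membership.∈-++⁺ʳ (edgeLists w c) (here refl) , there (here refl)
  ... | inj₂ (inj₁ x∈ps) = _ , Membership.∈-++⁺ʳ (edgeLists w c) (here refl) , there (there x∈ps)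
  ... | inj₂ (inj₂ (inj₁ x∈c)) = let l , l∈ , x∈l = vertex⇒edge c x∈c in
    l , Membership.∈-++⁺ˡ l∈ , x∈l
  ... | inj₂ (inj₂ (inj₂ x∈r)) = let l , l∈ , x∈l = vertex⇒edge r x∈r in
    l , Membership.∈-++⁺ʳ (edgeLists w c) (there l∈) , x∈l

  AllPads-map : ∀ {s} {X : Set} {P Q : X → Set} (F : Forest s X) →
    (∀ {x} → x ∈ˡ vertices F → P x → Q x) → AllPads P F → AllPads Q F
  AllPads-map ε _ _ = tt
  AllPads-map (branch ps w c r) f (ap , ac , ar) =
      All.tabulate (λ x∈ → f (there (Membership.∈-++⁺ˡ x∈)) (All.lookup ap x∈))
    , AllPads-map c (f ∘ there ∘ Membership.∈-++⁺ʳ (Vec.toList ps) ∘ Membership.∈-++⁺ˡ) ac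
    , AllPads-map r (f ∘ there ∘ Membership.∈-++⁺ʳ (Vec.toList ps) ∘ Membership.∈-++⁺ʳ (vertices c)) ar

  extract : ∀ {A : Set} {x : A} {xs} → x ∈ˡ xs → ∃ λ ys → xs ↭ x ∷ ys
  extract x∈ with Membership.∈-∃++ x∈
  ... | ys , zs , refl = ys ++ zs , ↭.shift _ ys zs

  toVec : ∀ {A : Set} {s} (xs : List A) → length xs ≡ s → ∃ λ (v : Vec A s) → Vec.toList v ≡ xs
  toVec xs refl = Vec.fromList xs , Vec.toList∘fromList xs

  module _ {s k : ℕ} {H : Hypergraph} (U : IsUniformHypertree (suc (suc s)) k H) where

    open IsUniformHypertree U
    open IsHypertree hypertree

    NonPendant : Vertex H → Set
    NonPendant v = 1 ℕ.< degree H v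

    nonPendant⁺ : ∀ {e f x} → e ∈ˡ edges H → f ∈ˡ edges H → e ≢ f → x ∈ e → x ∈ f → NonPendant x
    nonPendant⁺ {x = x} e∈ f∈ e≢f x∈e x∈f = 1<length
      (Membership.∈-filter⁺ (x Subset.∈?_) e∈ x∈e) (Membership.∈-filter⁺ (x Subset.∈?_) f∈ x∈f) e≢f

    -- The form in which connectedness enters: a walk that leaves a set does so within one edge.
    exit : ∀ {P : Vertex H → Set} → Decidable P → ∀ {a b} → Star (Adjacent H) a b → P a → ¬ P b →
      ∃₂ λ p q → P p × ¬ P q × ∃ λ e → e ∈ˡ edges H × p ∈ e × q ∈ e
    exit P? Star.ε Pa ¬Pa = contradiction Pa ¬Pa
    exit P? (_◅_ {j = c} (_ , e , e∈ , a∈ , c∈) path) Pa ¬Pb with P? c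
    ... | yes Pc = exit P? path Pc ¬Pb
    ... | no ¬Pc = _ , c , Pa , ¬Pc , e , e∈ , a∈ , c∈

    -- Either two edges share a vertex, or a walk from the first to the second leaves the first edge
    -- at a vertex that lies in a further edge.
    some-nonPendant : 2 ℕ.≤ k → ∃ NonPendant
    some-nonPendant 2≤k = pick (edges H) (subst (2 ℕ.≤_) (sym size≡) 2≤k) (unique H) (λ e∈ → e∈)
      where
      pick : ∀ es → 2 ℕ.≤ length es → Unique es → (∀ {e} → e ∈ˡ es → e ∈ˡ edges H) → ∃ NonPendant
      pick (_ ∷ []) (s≤s ()) _ _
      pick (e ∷ f ∷ es) _ ((e≢f ∷ _) ∷ _) sub
        with All.lookup (nonempty H) (sub (here refl)) | All.lookup (nonempty H) (sub (there (here refl)))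
      ... | a , a∈e | b , b∈f with b Subset.∈? e
      ... | yes b∈e = b , nonPendant⁺ (sub (here refl)) (sub (there (here refl))) e≢f b∈e b∈f
      ... | no b∉e with exit (Subset._∈? e) (connected a b) a∈e b∉e
      ... | p , q , p∈e , q∉e , g , g∈ , p∈g , q∈g =
        p , nonPendant⁺ (sub (here refl)) g∈ (λ { refl → q∉e q∈g }) p∈e p∈g

    -- `NonPendant` refers to degrees in the whole of `H`, not in the part built so far; hence no
    -- edge still to come can contain a pad.
    record Partial (u : Vertex H) (F : Forest s (Vertex H)) : Set where
      field
        distinct : Unique (u ∷ vertices F)
        sound    : ∀ {l} → l ∈ˡ edgeLists u F → setOf l ∈ˡ edges H
        root     : NonPendant u
        pads     : AllPads (λ v → ¬ NonPendant v) F

    Covered : Vertex H → Forest s (Vertex H) → Subset (order H) → Set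
    Covered u F e = Any (λ l → e ≡ setOf l) (edgeLists u F)

    covered? : ∀ u F e → Dec (Covered u F e)
    covered? u F e = Any.any? (λ l → Vec.≡-dec Bool._≟_ e (setOf l)) (edgeLists u F)

    ¬covered⇒≢ : ∀ {u F e} → ¬ Covered u F e → ∀ {l} → l ∈ˡ edgeLists u F → e ≢ setOf l
    ¬covered⇒≢ ¬cov l∈ refl = ¬cov (Any.map (λ { refl → refl }) l∈)

    covered-vertex : ∀ {u F e v} → Covered u F e → v ∈ e → v ∈ˡ u ∷ vertices F
    covered-vertex {F = F} cov v∈e with find cov
    ... | l , l∈ , refl = ∈-edge⇒∈-vertices {F = F} l∈ (∈-setOf⁻ v∈e)

    recast-partial : ∀ {u F x G} → Partial u F → Recast u F x G → NonPendant x → Partial x G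
    recast-partial P R np = record
      { distinct = unique-resp-↭ vertices↭ distinct
      ; sound    = λ l∈ → let l , l∈F , eq = from l∈ in subst (_∈ˡ edges H) (sym eq) (sound l∈F)
      ; root     = np
      ; pads     = R.pads (Partial.pads P) }
      where
      open Partial P hiding (pads)
      open module R = Recast R using (vertices↭; from)

    -- The new edge shares only the root with the built part. A further common vertex would be
    -- non-pendant, hence not a pad, and the path down to it would close a loose cycle.
    adjoin : ∀ {u F e} → Partial u F → e ∈ˡ edges H → u ∈ e →
      (∀ {l} → l ∈ˡ edgeLists u F → e ≢ setOf l) →
      ∃ λ F′ → Partial u F′ × length (vertices F) ℕ.< length (vertices F′)
    adjoin {u} {F} {e} P e∈ u∈e new = from-rest (extract (∈-elements⁺ u∈e))
      where
      open Partial P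
      meets : ∀ {v} → v ∈ˡ vertices F → v ∈ e → NonPendant v
      meets v∈ v∈e = let l , l∈ , v∈l = vertex⇒edge F v∈ in
        nonPendant⁺ e∈ (sound l∈) (new l∈) v∈e (∈-setOf⁺ v∈l)
      pads∉ : AllPads (_∉ e) F
      pads∉ = AllPads-map F (λ v∈ ¬np v∈e → ¬np (meets v∈ v∈e)) pads
      disjoint : ∀ {v} → v ∈ e → v ∉ˡ vertices F
      disjoint v∈e v∈ with vertex-cases F pads v∈
      ... | inj₂ ¬np = ¬np (meets v∈ v∈e)
      ... | inj₁ node = acyclic (descent⇒cycle linear distinct sound e∈ new pads∉ u∈e
        (proj₂ (descend (Subset._∈? e) node v∈e)))
      length-elements : length (elements e) ≡ suc (suc s)
      length-elements = trans (sym (∣∣≡length-elements e)) (All.lookup uniform e∈)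

      build : ∀ w zs → elements e ↭ u ∷ w ∷ zs → All (λ v → ¬ NonPendant v) zs →
        ∃ λ F′ → Partial u F′ × length (vertices F) ℕ.< length (vertices F′)
      build w zs p ¬nps with toVec zs (ℕ.suc-injective (ℕ.suc-injective (trans (sym (↭.↭-length p)) length-elements)))
      ... | ps , refl = branch ps w ε F , record
        { distinct = ∉⇒unique
            (λ u∈ → [ unique⇒∉ uniq-e , unique⇒∉ distinct ]′ (Membership.∈-++⁻ (w ∷ Vec.toList ps) u∈))
            (unique-++⁺ (AllPairs.tail uniq-e) (AllPairs.tail distinct)
              (λ v∈ → disjoint (∈-elements⁻ (↭.∈-resp-↭ (↭-sym p) (there v∈)))))
        ; sound = λ { (here refl) → subst (_∈ˡ edges H) (setOf-≡
                        (λ v∈ → ∈-elements⁻ (↭.∈-resp-↭ (↭-sym p) v∈))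
                        (λ v∈ → ↭.∈-resp-↭ p (∈-elements⁺ v∈))) e∈
                    ; (there l∈) → sound l∈ }
        ; root = root
        ; pads = ¬nps , tt , pads }
        , s≤s (subst (length (vertices F) ℕ.≤_) (sym (List.length-++ (Vec.toList ps)))
            (ℕ.m≤n+m _ (length (Vec.toList ps))))
        where
        uniq-e : Unique (u ∷ w ∷ Vec.toList ps)
        uniq-e = unique-resp-↭ p (elements-unique e)

      from-rest : (∃ λ ys → elements e ↭ u ∷ ys) →
        ∃ λ F′ → Partial u F′ × length (vertices F) ℕ.< length (vertices F′)
      -- The lower vertex is the second non-pendant vertex of the edge if there is one, and
      -- arbitrary otherwise. At most two vertices of an edge are non-pendant, so all the others
      -- qualify as pads.
      from-rest (ys , p) with Any.any? (λ v → 1 ℕ.<? degree H v) ys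
      ... | yes any-np with find any-np
      ...   | w , w∈ , np-w with extract w∈
      ...     | zs , q = build w zs (↭-trans p (↭.prep u q)) (All.tabulate λ {z} z∈ np-z →
        unique⇒∉ (AllPairs.tail uniq) (subst (_∈ˡ zs) (sym (length≤2⁻ two≥ (member np-u (here refl))
            (member np-w (there (here refl))) (member np-z (there (there z∈)))
            (λ { refl → unique⇒∉ uniq (here refl) })
            (λ { refl → unique⇒∉ uniq (there z∈) }))) z∈))
        where
        uniq : Unique (u ∷ w ∷ zs)
        uniq = unique-resp-↭ (↭-trans p (↭.prep u q)) (elements-unique e)
        np-u : NonPendant u
        np-u = root
        two≥ : length (elements (e ∩ nonPendant H)) ℕ.≤ 2
        two≥ = subst (ℕ._≤ 2) (∣∣≡length-elements (e ∩ nonPendant H)) (nonPendant≤2 e∈)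
        member : ∀ {v} → NonPendant v → v ∈ˡ u ∷ w ∷ zs → v ∈ˡ elements (e ∩ nonPendant H)
        member np v∈ = ∈-elements⁺ (Subset.x∈p∩q⁺
          ( ∈-elements⁻ (↭.∈-resp-↭ (↭-sym (↭-trans p (↭.prep u q))) v∈)
          , ∈-comprehension⁺ (λ v → 1 ℕ.<? degree H v) np))
      from-rest ([] , p) | no _ with trans (sym length-elements) (↭.↭-length p)
      ... | ()
      from-rest (w ∷ zs , p) | no none = build w zs p
        (All.tabulate λ z∈ np → none (Any.map (λ { refl → np }) (there {x = w} z∈)))

    meeting : ∀ {u F e} → Partial u F → e ∈ˡ edges H → ¬ Covered u F e →
      ∃₂ λ x f → x ∈ˡ u ∷ vertices F × x ∈ f × f ∈ˡ edges H × ¬ Covered u F f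
    meeting {u} {F} {e} P e∈ ¬cov with All.lookup (nonempty H) e∈
    ... | b , b∈e with b ∈ˡ? u ∷ vertices F
    ... | yes b∈ = b , e , b∈ , b∈e , e∈ , ¬cov
    ... | no b∉ with exit (_∈ˡ? u ∷ vertices F) (connected u b) (here refl) b∉
    ... | p , q , p∈ , q∉ , f , f∈ , p∈f , q∈f =
      p , f , p∈ , p∈f , f∈ , λ cov → q∉ (covered-vertex cov q∈f)

    -- The new edge meets the built part in a vertex that now lies in two edges, so it is not a pad.
    -- The root is moved to that vertex, which reduces the case to `adjoin`.
    grow : ∀ {u F e} → Partial u F → e ∈ˡ edges H → ¬ Covered u F e →
      ∃₂ λ u′ F′ → Partial u′ F′ × length (vertices F) ℕ.< length (vertices F′)
    grow {u} {F} P e∈ ¬cov with meeting P e∈ ¬cov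
    ... | x , f , here refl , x∈f , f∈ , ¬cov′ =
      u , adjoin P f∈ x∈f (¬covered⇒≢ {u} {F} ¬cov′)
    ... | x , f , there x∈ , x∈f , f∈ , ¬cov′ with vertex⇒edge {u = u} F x∈
    ... | l , l∈ , x∈l with nonPendant⁺ f∈ (Partial.sound P l∈) (¬covered⇒≢ {u} {F} ¬cov′ l∈) x∈f (∈-setOf⁺ x∈l)
    ... | np-x with vertex-cases F (Partial.pads P) x∈
    ... | inj₂ ¬np = contradiction np-x ¬np
    ... | inj₁ node with recast-root u F ε node
    ... | G , R with adjoin (recast-partial P R′ np-x) f∈ x∈f
      (λ l∈ eq → let l′ , l′∈ , eq′ = Recast.from R′ l∈ in
        ¬covered⇒≢ {u} {F} ¬cov′ l′∈ (trans eq eq′))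
      where
      R′ : Recast u F x G
      R′ = subst (λ E → Recast u E x G) (⊕-ε F) R
    ... | F′ , P′ , lt = x , F′ , P′
      , subst (ℕ._< length (vertices F′)) (sym (ℕ.suc-injective (↭.↭-length (Recast.vertices↭ R′)))) lt
      where
      R′ : Recast u F x G
      R′ = subst (λ E → Recast u E x G) (⊕-ε F) R

    finished : ∀ {u F} → Partial u F → (∀ {e} → e ∈ˡ edges H → Covered u F e) → Model H u F
    finished {u} {F} P cov = record
      { distinct = Partial.distinct P
      ; covers   = covers
      ; sound    = Partial.sound P
      ; complete = λ e∈ → find (cov e∈) }
      where
      covers : ∀ v → v ∈ˡ u ∷ vertices F
      covers v with v ∈ˡ? u ∷ vertices F
      ... | yes v∈ = v∈
      ... | no v∉ with exit (_∈ˡ? u ∷ vertices F) (connected u v) (here refl) v∉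
      ... | p , q , p∈ , q∉ , f , f∈ , p∈f , q∈f = contradiction (covered-vertex (cov f∈) q∈f) q∉

    complete-model : ∀ d {u F} → Partial u F → order H ℕ.≤ length (vertices F) ℕ.+ d →
      ∃₂ λ u′ (F′ : Forest s (Vertex H)) → Model H u′ F′
    -- `vertices F` omits the root, so with `d = 0` the distinct list `u ∷ vertices F` would be
    -- longer than the number of vertices.
    complete-model zero {u} {F} P ≤d = contradiction
      (length-⊆ (Partial.distinct P) (λ {x} _ → Membership.∈-allFin x))
      (ℕ.<⇒≱ (s≤s (subst (length (List.allFin (order H)) ℕ.≤_) (ℕ.+-identityʳ _)
        (subst (ℕ._≤ length (vertices F) ℕ.+ 0) (sym (List.length-tabulate id)) ≤d))))
    complete-model (suc d) {u} {F} P ≤d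
      with Any.any? (λ e → ¬? (covered? u F e)) (edges H)
    ... | yes missing with find missing
    ...   | e , e∈ , ¬cov with grow P e∈ ¬cov
    ...     | u′ , F′ , P′ , lt = complete-model d P′ (ℕ.≤-trans ≤d
                (subst (ℕ._≤ length (vertices F′) ℕ.+ d) (sym (ℕ.+-suc _ d)) (ℕ.+-monoˡ-≤ d lt)))
    complete-model (suc d) {u} {F} P ≤d | no none = u , F , finished P cov
      where
      cov : ∀ {e} → e ∈ˡ edges H → Covered u F e
      cov {e} e∈ with covered? u F e
      ... | yes c = c
      ... | no ¬c = contradiction (lose e∈ ¬c) none

    hypertree⇒shape : 2 ℕ.≤ k → ∃ λ t → HasShape s H t × ⟪ t ⟫ ≡ k
    hypertree⇒shape 2≤k =
      let u , np    = some-nonPendant 2≤k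
          u′ , F , M = complete-model (order H) {u} {ε} (record
            { distinct = [] ∷ [] ; sound = λ () ; root = np ; pads = tt }) ℕ.≤-refl
      in shape F , (u′ , F , M , refl)
         , trans (sym (IsUniformHypertree.size≡ (model⇒hypertree M))) size≡

open Growth using (hypertree⇒shape)


-- The centroid, and the hypertrees with few edges off the root.

module Classification where

  ⟪⟫-~ : ∀ {a b} → a ~ b → ⟪ a ⟫ ≡ ⟪ b ⟫
  ⟪⟫-~ ~-refl = refl
  ⟪⟫-~ (~-trans p q) = trans (⟪⟫-~ p) (⟪⟫-~ q)
  ⟪⟫-~ (~-swap {a} {b} {c}) = cong suc (begin
    ⟪ a ⟫ ℕ.+ suc (⟪ b ⟫ ℕ.+ ⟪ c ⟫)  ≡⟨ ℕ.+-suc ⟪ a ⟫ _ ⟩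
    suc (⟪ a ⟫ ℕ.+ (⟪ b ⟫ ℕ.+ ⟪ c ⟫)) ≡⟨ cong suc (x∙yz≈y∙xz ⟪ a ⟫ ⟪ b ⟫ ⟪ c ⟫) ⟩
    suc (⟪ b ⟫ ℕ.+ (⟪ a ⟫ ℕ.+ ⟪ c ⟫)) ≡⟨ ℕ.+-suc ⟪ b ⟫ _ ⟨
    ⟪ b ⟫ ℕ.+ suc (⟪ a ⟫ ℕ.+ ⟪ c ⟫)  ∎)
    where
    open ≡-Reasoning
    x∙yz≈y∙xz : ∀ x y z → x ℕ.+ (y ℕ.+ z) ≡ y ℕ.+ (x ℕ.+ z)
    x∙yz≈y∙xz x y z = trans (sym (ℕ.+-assoc x y z)) (trans (cong (ℕ._+ z) (ℕ.+-comm x y)) (ℕ.+-assoc y x z))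
  ⟪⟫-~ (~-cong p q) = cong suc (cong₂ ℕ._+_ (⟪⟫-~ p) (⟪⟫-~ q))

  AllBranches : (Shape → Set) → Shape → Set
  AllBranches P ε       = Unit
  AllBranches P (c ▷ r) = P c × AllBranches P r

  -- the number of edges that do not contain the root
  excess : Shape → ℕ
  excess ε       = 0
  excess (c ▷ r) = ⟪ c ⟫ ℕ.+ excess r

  module Centroid (k : ℕ) where

    Light : Shape → Set
    Light c = ⟪ c ⟫ ℕ.+ ⟪ c ⟫ ℕ.≤ k

    heavy? : ∀ c → AllBranches Light c ⊎ (∃₂ λ a b → c ~ a ▷ b × k ℕ.< ⟪ a ⟫ ℕ.+ ⟪ a ⟫)
    heavy? ε = inj₁ tt
    heavy? (c ▷ r) with ⟪ c ⟫ ℕ.+ ⟪ c ⟫ ℕ.≤? k | heavy? r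
    ... | no heavy | _ = inj₂ (c , r , ~-refl , ℕ.≰⇒> heavy)
    ... | yes light | inj₁ rest = inj₁ (light , rest)
    ... | yes _ | inj₂ (a , b , r~ , heavy) =
      inj₂ (a , c ▷ b , ~-trans (~-cong ~-refl r~) ~-swap , heavy)

    -- The two sides of an edge have k - 1 edges together, so they cannot both have more than k/2.
    other-light : ∀ a b → suc (a ℕ.+ b) ≡ k → k ℕ.< b ℕ.+ b → a ℕ.+ a ℕ.≤ k
    other-light a b refl heavy = ℕ.≤-trans (ℕ.+-monoʳ-≤ a (ℕ.<⇒≤ a<b)) (ℕ.n≤1+n (a ℕ.+ b))
      where
      a<b : a ℕ.< b
      a<b = ℕ.+-cancelʳ-< b a b (ℕ.<-trans (ℕ.n<1+n (a ℕ.+ b)) heavy)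

    -- The root moves across an edge into a heavy part. What it leaves behind is then light, and the
    -- part still to be searched has fewer edges.
    search : ∀ a c → Acc ℕ._<_ ⟪ c ⟫ → Light a → suc (⟪ a ⟫ ℕ.+ ⟪ c ⟫) ≡ k →
      ∃ λ t → a ▷ c ≈ t × AllBranches Light t × ⟪ t ⟫ ≡ k
    search a c (acc smaller) light eq with heavy? c
    ... | inj₁ rest = a ▷ c , arrange ~-refl , (light , rest) , eq
    ... | inj₂ (d , b , c~ , heavy) =
      let t , p , balanced , eq′ = search (a ▷ b) d
            (smaller (subst (⟪ d ⟫ ℕ.<_) (sym (⟪⟫-~ c~)) (s≤s (ℕ.m≤m+n ⟪ d ⟫ ⟪ b ⟫))))
            (other-light ⟪ a ▷ b ⟫ ⟪ d ⟫ count heavy) count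
      in t , ≈-trans (arrange (~-trans (~-cong ~-refl c~) ~-swap)) (≈-trans reroot p) , balanced , eq′
      where
      count : suc (⟪ a ▷ b ⟫ ℕ.+ ⟪ d ⟫) ≡ k
      count = trans (trans (cong suc (ℕ.+-comm ⟪ a ▷ b ⟫ ⟪ d ⟫))
        (sym (⟪⟫-~ (~-trans (~-cong (~-refl {a}) c~) ~-swap)))) eq

    centroid : 0 ℕ.< k → ∀ t → ⟪ t ⟫ ≡ k → ∃ λ t′ → t ≈ t′ × AllBranches Light t′ × ⟪ t′ ⟫ ≡ k
    centroid 0<k ε refl = contradiction 0<k λ ()
    centroid 0<k (a ▷ b) eq with ⟪ a ⟫ ℕ.+ ⟪ a ⟫ ℕ.≤? k
    ... | yes light = search a b (ℕ.<-wellFounded _) light eq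
    ... | no heavy =
      let t , p , rest = search b a (ℕ.<-wellFounded _)
            (other-light ⟪ b ⟫ ⟪ a ⟫ count (ℕ.≰⇒> heavy)) count
      in t , ≈-trans reroot p , rest
      where
      count : suc (⟪ b ⟫ ℕ.+ ⟪ a ⟫) ≡ k
      count = trans (cong suc (ℕ.+-comm ⟪ b ⟫ ⟪ a ⟫)) eq

  total : List Shape → ℕ
  total = List.foldr (λ b n → ⟪ b ⟫ ℕ.+ n) 0

  -- Branches with something below them are kept as pairs, so that their being non-empty is visible
  -- to the case distinction in `small-total`.
  fork : Shape × Shape → Shape
  fork (c , r) = c ▷ r

  record Sorted (t : Shape) : Set where
    field
      forks   : List (Shape × Shape)
      pendant : ℕ
      sorted  : t ~ rooted (map fork forks) pendant
      total≡  : total (map fork forks) ≡ excess t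
      count   : length forks ℕ.+ total (map fork forks) ℕ.+ pendant ≡ ⟪ t ⟫

  sort : ∀ t → Sorted t
  sort ε = record { forks = [] ; pendant = 0 ; sorted = ~-refl ; total≡ = refl ; count = refl }
  sort (ε ▷ r) = record
    { forks = forks ; pendant = suc pendant
    ; sorted = ~-trans (~-cong ~-refl sorted) (sink (map fork forks))
    ; total≡ = total≡
    ; count = trans (ℕ.+-suc _ pendant) (cong suc count) }
    where
    open Sorted (sort r)
    sink : ∀ bs {a} → ε ▷ rooted bs a ~ rooted bs (suc a)
    sink []       = ~-refl
    sink (b ∷ bs) = ~-trans ~-swap (~-cong ~-refl (sink bs))
  sort (c@(d ▷ e) ▷ r) = record
    { forks = (d , e) ∷ forks ; pendant = pendant
    ; sorted = ~-cong ~-refl sorted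
    ; total≡ = cong (⟪ c ⟫ ℕ.+_) total≡
    ; count = cong suc (begin
        length forks ℕ.+ (⟪ c ⟫ ℕ.+ rest) ℕ.+ pendant
          ≡⟨ cong (ℕ._+ pendant) (trans (sym (ℕ.+-assoc (length forks) ⟪ c ⟫ rest))
               (trans (cong (ℕ._+ rest) (ℕ.+-comm (length forks) ⟪ c ⟫)) (ℕ.+-assoc ⟪ c ⟫ _ rest))) ⟩
        ⟪ c ⟫ ℕ.+ (length forks ℕ.+ rest) ℕ.+ pendant
          ≡⟨ ℕ.+-assoc ⟪ c ⟫ _ pendant ⟩
        ⟪ c ⟫ ℕ.+ (length forks ℕ.+ rest ℕ.+ pendant)
          ≡⟨ cong (⟪ c ⟫ ℕ.+_) count ⟩
        ⟪ c ⟫ ℕ.+ ⟪ r ⟫ ∎) }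
    where
    open Sorted (sort r)
    open ≡-Reasoning
    rest : ℕ
    rest = total (map fork forks)

  data ListedBranches : List Shape → Set where
    listed₁ : ListedBranches []
    listed₂ : ListedBranches (star₁ ∷ [])
    listed₃ : ListedBranches (star₂ ∷ [])
    listed₄ : ListedBranches (star₁ ∷ star₁ ∷ [])
    listed₅ : ListedBranches (path₂ ∷ [])
    listed₆ : ListedBranches (star₃ ∷ [])
    listed₇ : ListedBranches (star₂ ∷ star₁ ∷ [])

  -- The remaining possibilities with at most three edges off the root; each has exactly three.
  data UnlistedBranches : List Shape → Set where
    three-branches : UnlistedBranches (star₁ ∷ star₁ ∷ star₁ ∷ [])
    path-and-star  : UnlistedBranches (path₂ ∷ star₁ ∷ [])
    leaf-and-star₁ : UnlistedBranches ((ε ▷ star₁ ▷ ε) ∷ [])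
    below-star₂    : UnlistedBranches ((star₂ ▷ ε) ∷ [])
    below-path₂    : UnlistedBranches ((path₂ ▷ ε) ∷ [])

  -- The branches of successive hypertrees in the list; every unlisted one comes after the last.
  data Before : List Shape → List Shape → Set where
    step₁ : Before [] (star₁ ∷ [])
    step₂ : Before (star₁ ∷ []) (star₂ ∷ [])
    step₃ : Before (star₂ ∷ []) (star₁ ∷ star₁ ∷ [])
    step₄ : Before (star₁ ∷ star₁ ∷ []) (path₂ ∷ [])
    step₅ : Before (path₂ ∷ []) (star₃ ∷ [])
    step₆ : Before (star₃ ∷ []) (star₂ ∷ star₁ ∷ [])
    step₇ : ∀ {bs} → UnlistedBranches bs → Before (star₂ ∷ star₁ ∷ []) bs

  record Rooted (Q : List Shape → Set) (k : ℕ) (t : Shape) : Set where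
    constructor mkRooted
    field
      {branches} : List Shape
      pendant    : ℕ
      arranged   : t ~ rooted branches pendant
      kind       : Q branches
      count      : length branches ℕ.+ total branches ℕ.+ pendant ≡ k

  -- the bound on the total size is in computing form, which rules out all larger branches
  small-total : ∀ bs a {k} → (total (map fork bs) ℕ.<ᵇ 4) ≡ true →
    length bs ℕ.+ total (map fork bs) ℕ.+ a ≡ k →
    Rooted ListedBranches k (rooted (map fork bs) a) ⊎ Rooted UnlistedBranches k (rooted (map fork bs) a)
  small-total [] a _ eq = inj₁ (mkRooted a ~-refl listed₁ eq)
  small-total ((ε , ε) ∷ []) a _ eq = inj₁ (mkRooted a ~-refl listed₂ eq)
  small-total ((ε , ε ▷ ε) ∷ []) a _ eq = inj₁ (mkRooted a ~-refl listed₃ eq)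
  small-total ((ε , ε) ∷ (ε , ε) ∷ []) a _ eq = inj₁ (mkRooted a ~-refl listed₄ eq)
  small-total ((ε ▷ ε , ε) ∷ []) a _ eq = inj₁ (mkRooted a ~-refl listed₅ eq)
  small-total ((ε , ε ▷ ε ▷ ε) ∷ []) a _ eq = inj₁ (mkRooted a ~-refl listed₆ eq)
  small-total ((ε , ε ▷ ε) ∷ (ε , ε) ∷ []) a _ eq = inj₁ (mkRooted a ~-refl listed₇ eq)
  small-total ((ε , ε) ∷ (ε , ε ▷ ε) ∷ []) a _ eq = inj₁ (mkRooted a ~-swap listed₇ eq)
  small-total ((ε , ε) ∷ (ε , ε) ∷ (ε , ε) ∷ []) a _ eq = inj₂ (mkRooted a ~-refl three-branches eq)
  small-total ((ε ▷ ε , ε) ∷ (ε , ε) ∷ []) a _ eq = inj₂ (mkRooted a ~-refl path-and-star eq)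
  small-total ((ε , ε) ∷ (ε ▷ ε , ε) ∷ []) a _ eq = inj₂ (mkRooted a ~-swap path-and-star eq)
  small-total ((ε , (ε ▷ ε) ▷ ε) ∷ []) a _ eq = inj₂ (mkRooted a ~-refl leaf-and-star₁ eq)
  small-total ((ε ▷ ε , ε ▷ ε) ∷ []) a _ eq = inj₂ (mkRooted a (~-cong ~-swap ~-refl) leaf-and-star₁ eq)
  small-total ((ε ▷ ε ▷ ε , ε) ∷ []) a _ eq = inj₂ (mkRooted a ~-refl below-star₂ eq)
  small-total (((ε ▷ ε) ▷ ε , ε) ∷ []) a _ eq = inj₂ (mkRooted a ~-refl below-path₂ eq)

  data Verdict (k : ℕ) (t : Shape) : Set where
    listed   : ∀ {t′} → t ≈ t′ → Rooted ListedBranches k t′ → Verdict k t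
    unlisted : ∀ {t′} → t ≈ t′ → Rooted UnlistedBranches k t′ → Verdict k t
    balanced : ∀ {t′} → t ≈ t′ → AllBranches (Centroid.Light k) t′ →
      4 ℕ.≤ excess t′ → ⟪ t′ ⟫ ≡ k → Verdict k t

  classify : ∀ k → 0 ℕ.< k → ∀ t → ⟪ t ⟫ ≡ k → Verdict k t
  classify k 0<k t eq with Centroid.centroid k 0<k t eq
  ... | t′ , p , light , eq′ with 4 ℕ.≤? excess t′
  ... | yes large = balanced p light large eq′
  ... | no  few with sort t′
  ... | record { forks = fs ; pendant = a ; sorted = q ; total≡ = total≡ ; count = count }
    with small-total fs a few′ (trans count eq′)
    where
    few′ : (total (map fork fs) ℕ.<ᵇ 4) ≡ true
    few′ = Equivalence.to Bool.T-≡ (ℕ.<⇒<ᵇ (subst (ℕ._< 4) (sym total≡) (ℕ.≰⇒> few)))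
  ... | inj₁ R = listed (≈-trans p (arrange q)) R
  ... | inj₂ R = unlisted (≈-trans p (arrange q)) R

open Classification


-- Finite sums of rationals.

module Sums where

  open Rational

  abstract

    sum : ∀ {n} → (Fin n → ℚ) → ℚ
    sum {zero}  f = 0ℚ
    sum {suc n} f = f zero + sum (f ∘ suc)

    sum-[] : (f : Fin 0 → ℚ) → sum f ≡ 0ℚ
    sum-[] f = refl

    sum-∷ : ∀ {n} (f : Fin (suc n) → ℚ) → sum f ≡ f zero + sum (f ∘ suc)
    sum-∷ f = refl

    sum-cong-≗ : ∀ {n} {f g : Fin n → ℚ} → (∀ i → f i ≡ g i) → sum f ≡ sum g
    sum-cong-≗ {zero}  _ = refl
    sum-cong-≗ {suc n} h = cong₂ _+_ (h zero) (sum-cong-≗ (h ∘ suc))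

    ∑-distrib-+ : ∀ {n} (f g : Fin n → ℚ) → sum (λ i → f i + g i) ≡ sum f + sum g
    ∑-distrib-+ {zero}  f g = sym (ℚ.+-identityˡ 0ℚ)
    ∑-distrib-+ {suc n} f g = trans (cong (f zero + g zero +_) (∑-distrib-+ (f ∘ suc) (g ∘ suc)))
      (interchange (f zero) (g zero) (sum (f ∘ suc)) (sum (g ∘ suc)))
      where
      interchange : ∀ a b c d → a + b + (c + d) ≡ a + c + (b + d)
      interchange = solve-∀ ring

    sum-zero : ∀ {n} {f : Fin n → ℚ} → (∀ i → f i ≡ 0ℚ) → sum f ≡ 0ℚ
    sum-zero {zero}  _ = refl
    sum-zero {suc n} h = trans (cong₂ _+_ (h zero) (sum-zero (h ∘ suc))) (ℚ.+-identityˡ 0ℚ)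

    ∑-comm : ∀ {m n} (f : Fin m → Fin n → ℚ) →
      sum (λ i → sum (f i)) ≡ sum (λ j → sum (λ i → f i j))
    ∑-comm {zero}  f = sym (sum-zero {f = λ j → sum (λ i → f i j)} λ _ → refl)
    ∑-comm {suc m} f = trans (cong (sum (f zero) +_) (∑-comm (f ∘ suc)))
      (sym (∑-distrib-+ (f zero) (λ j → sum (λ i → f (suc i) j))))

    *-distribˡ-sum : ∀ {n} c (f : Fin n → ℚ) → c * sum f ≡ sum (λ i → c * f i)
    *-distribˡ-sum {zero}  c f = ℚ.*-zeroʳ c
    *-distribˡ-sum {suc n} c f = trans (ℚ.*-distribˡ-+ c (f zero) (sum (f ∘ suc)))
      (cong (c * f zero +_) (*-distribˡ-sum c (f ∘ suc)))

    sum-mono : ∀ {n} {f g : Fin n → ℚ} → (∀ i → f i ≤ g i) → sum f ≤ sum g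
    sum-mono {zero}  _ = ℚ.≤-refl
    sum-mono {suc n} h = ℚ.+-mono-≤ (h zero) (sum-mono (h ∘ suc))

    sum-nonNeg : ∀ {n} {f : Fin n → ℚ} → (∀ i → 0ℚ ≤ f i) → 0ℚ ≤ sum f
    sum-nonNeg {zero}  _ = ℚ.≤-refl
    sum-nonNeg {suc n} h = +-nonNeg (h zero) (sum-nonNeg (h ∘ suc))

  when : ∀ {P : Set} → Dec P → ℚ → ℚ
  when (yes _) q = q
  when (no _)  q = 0ℚ

  when-⇔ : ∀ {P Q : Set} (p : Dec P) (q : Dec Q) → (P → Q) → (Q → P) → ∀ {x} → when p x ≡ when q x
  when-⇔ (yes _) (yes _) _ _ = refl
  when-⇔ (no _)  (no _)  _ _ = refl
  when-⇔ (yes p) (no ¬q) f _ = contradiction (f p) ¬q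
  when-⇔ (no ¬p) (yes q) _ g = contradiction (g q) ¬p

  when-no : ∀ {P : Set} (p : Dec P) → ¬ P → ∀ {x} → when p x ≡ 0ℚ
  when-no (yes p) ¬p = contradiction p ¬p
  when-no (no _)  _  = refl

  sum-single : ∀ {n} (v : Fin n) (y : Fin n → ℚ) → sum (λ j → when (j Fin.≟ v) (y j)) ≡ y v
  sum-single zero y = trans (sum-∷ (λ j → when (j Fin.≟ zero) (y j))) $ trans
    (cong (y zero +_) (sum-zero (λ i → when-no (suc i Fin.≟ zero) (λ ()) {y (suc i)}))) (ℚ.+-identityʳ (y zero))
  sum-single (suc v) y = trans (sum-∷ (λ j → when (j Fin.≟ suc v) (y j))) $ trans
    (cong₂ _+_ (when-no (zero Fin.≟ suc v) (λ ()) {y zero})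
      (trans (sum-cong-≗ (λ i → when-⇔ (suc i Fin.≟ suc v) (i Fin.≟ v) Fin.suc-injective (cong suc) {y (suc i)}))
             (sum-single v (y ∘ suc))))
    (ℚ.+-identityˡ (y (suc v)))

  sumL : List ℚ → ℚ
  sumL = List.foldr _+_ 0ℚ

  sum-members : ∀ {n} {l : List (Fin n)} → Unique l → (y : Fin n → ℚ) →
    sum (λ j → when (j ∈ˡ? l) (y j)) ≡ sumL (map y l)
  sum-members {l = []} _ y = sum-zero {f = λ j → when (j ∈ˡ? []) (y j)} (λ j → refl)
  sum-members {l = x ∷ l} uniq@(_ ∷ u) y = begin
    sum (λ j → when (j ∈ˡ? x ∷ l) (y j))
      ≡⟨ sum-cong-≗ (λ j → step j (j Fin.≟ x) (j ∈ˡ? l) (j ∈ˡ? x ∷ l)) ⟩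
    sum (λ j → when (j Fin.≟ x) (y j) + when (j ∈ˡ? l) (y j))
      ≡⟨ ∑-distrib-+ (λ j → when (j Fin.≟ x) (y j)) (λ j → when (j ∈ˡ? l) (y j)) ⟩
    sum (λ j → when (j Fin.≟ x) (y j)) + sum (λ j → when (j ∈ˡ? l) (y j))
      ≡⟨ cong₂ _+_ (sum-single x y) (sum-members u y) ⟩
    y x + sumL (map y l) ∎
    where
    open ≡-Reasoning
    step : ∀ j (p : Dec (j ≡ x)) (q : Dec (j ∈ˡ l)) (r : Dec (j ∈ˡ x ∷ l)) →
      when r (y j) ≡ when p (y j) + when q (y j)
    step j (yes refl) (yes j∈) _ = contradiction j∈ (unique⇒∉ uniq)
    step j (yes refl) (no _) (yes _) = sym (ℚ.+-identityʳ (y j))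
    step j (yes refl) (no _) (no j∉) = contradiction (here refl) j∉
    step j (no _) (yes _) (yes _) = sym (ℚ.+-identityˡ (y j))
    step j (no _) (yes j∈) (no j∉) = contradiction (there j∈) j∉
    step j (no j≢) (no j∉) (yes j∈) = contradiction (∈-tail j∈ j≢) j∉
    step j (no _) (no _) (no _) = refl

open Sums using (sum; when)

-- Sums over the neighbours of a vertex.

module Neighbours where

  open Rational
  open Sums

  module _ {n : ℕ} (y : Fin n → ℚ) where

    -- A vertex is counted once for every edge it shares with `v`; when edges meet in at most one
    -- vertex, this is the sum over the neighbours.
    neighbourSum : List (List (Fin n)) → Fin n → ℚ
    neighbourSum []       v = 0ℚ
    neighbourSum (l ∷ ls) v = when (v ∈ˡ? l) (sumL (map y l) - y v) + neighbourSum ls v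

    neighbourSum-++ : ∀ ls {ks} v → neighbourSum (ls ++ ks) v ≡ neighbourSum ls v + neighbourSum ks v
    neighbourSum-++ [] v = sym (ℚ.+-identityˡ _)
    neighbourSum-++ (l ∷ ls) {ks} v = trans
      (cong (when (v ∈ˡ? l) (sumL (map y l) - y v) +_) (neighbourSum-++ ls {ks} v))
      (sym (ℚ.+-assoc (when (v ∈ˡ? l) (sumL (map y l) - y v)) (neighbourSum ls v) (neighbourSum ks v)))

    neighbourSum-∉ : ∀ ls {v} → (∀ {l} → l ∈ˡ ls → v ∉ˡ l) → neighbourSum ls v ≡ 0ℚ
    neighbourSum-∉ [] _ = refl
    neighbourSum-∉ (l ∷ ls) {v} h = trans
      (cong₂ _+_ (when-no (v ∈ˡ? l) (h (here refl))) (neighbourSum-∉ ls (h ∘ there))) (ℚ.+-identityˡ 0ℚ)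

    Together : List (List (Fin n)) → Fin n → Fin n → Set
    Together ls v j = v ≢ j × Any (λ l → v ∈ˡ l × j ∈ˡ l) ls

    together? : ∀ ls v j → Dec (Together ls v j)
    together? ls v j = ¬? (v Fin.≟ j) ×-dec Any.any? (λ l → (v ∈ˡ? l) ×-dec (j ∈ˡ? l)) ls

    -- An ear has at most one vertex in common with each later list, so a pair of vertices inside it
    -- lies in none of them, and nothing is counted twice.
    sum-together : ∀ {ls} → Ear ls → (∀ {l} → l ∈ˡ ls → Unique l) → ∀ v →
      sum (λ j → when (together? ls v j) (y j)) ≡ neighbourSum ls v
    sum-together [] _ v = sum-zero (λ j → when-no (together? [] v j) (λ { (_ , ()) }))
    sum-together {l ∷ ls} (ear p h e) u v = begin
      sum (λ j → when (together? (l ∷ ls) v j) (y j))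
        ≡⟨ sum-cong-≗ (λ j → separate j (here? j) (together? ls v j) (together? (l ∷ ls) v j)) ⟩
      sum (λ j → when (here? j) (y j) + when (together? ls v j) (y j))
        ≡⟨ ∑-distrib-+ (λ j → when (here? j) (y j)) (λ j → when (together? ls v j) (y j)) ⟩
      sum (λ j → when (here? j) (y j)) + sum (λ j → when (together? ls v j) (y j))
        ≡⟨ cong₂ _+_ (one-edge (v ∈ˡ? l)) (sum-together e (u ∘ there) v) ⟩
      when (v ∈ˡ? l) (sumL (map y l) - y v) + neighbourSum ls v ∎
      where
      open ≡-Reasoning
      Here : Fin n → Set
      Here j = v ≢ j × v ∈ˡ l × j ∈ˡ l
      here? : ∀ j → Dec (Here j)
      here? j = ¬? (v Fin.≟ j) ×-dec ((v ∈ˡ? l) ×-dec (j ∈ˡ? l))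
      separate : ∀ j (a : Dec (Here j)) (b : Dec (Together ls v j)) (c : Dec (Together (l ∷ ls) v j)) →
        when c (y j) ≡ when a (y j) + when b (y j)
      separate j (yes (v≢j , v∈ , j∈)) (yes (_ , any)) _ with find any
      ... | f , f∈ , v∈f , j∈f = contradiction (trans (h f∈ v∈ v∈f) (sym (h f∈ j∈ j∈f))) v≢j
      separate j (yes _) (no _) (yes _) = sym (ℚ.+-identityʳ (y j))
      separate j (yes (v≢j , both)) (no _) (no ¬c) = contradiction (v≢j , here both) ¬c
      separate j (no _) (yes _) (yes _) = sym (ℚ.+-identityˡ (y j))
      separate j (no _) (yes (v≢j , any)) (no ¬c) = contradiction (v≢j , there any) ¬c
      separate j (no ¬a) (no ¬b) (yes (v≢j , here both)) = contradiction (v≢j , both) ¬a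
      separate j (no ¬a) (no ¬b) (yes (v≢j , there any)) = contradiction (v≢j , any) ¬b
      separate j (no _) (no _) (no _) = refl
      cancel : ∀ a b → a + b - b ≡ a
      cancel = solve-∀ ring
      one-edge : (d : Dec (v ∈ˡ l)) →
        sum (λ j → when (here? j) (y j)) ≡ when d (sumL (map y l) - y v)
      one-edge (no v∉) = sum-zero (λ j → when-no (here? j) (λ (_ , v∈ , _) → v∉ v∈))
      one-edge (yes v∈) = begin
        sum (λ j → when (here? j) (y j))
          ≡⟨ cancel (sum (λ j → when (here? j) (y j))) (y v) ⟨
        sum (λ j → when (here? j) (y j)) + y v - y v
          ≡⟨ cong (λ q → sum (λ j → when (here? j) (y j)) + q - y v) (sum-single v y) ⟨
        sum (λ j → when (here? j) (y j)) + sum (λ j → when (j Fin.≟ v) (y j)) - y v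
          ≡⟨ cong (_- y v) (∑-distrib-+ (λ j → when (here? j) (y j)) (λ j → when (j Fin.≟ v) (y j))) ⟨
        sum (λ j → when (here? j) (y j) + when (j Fin.≟ v) (y j)) - y v
          ≡⟨ cong (_- y v) (sum-cong-≗ (λ j → split-v j (here? j) (j Fin.≟ v) (j ∈ˡ? l))) ⟨
        sum (λ j → when (j ∈ˡ? l) (y j)) - y v
          ≡⟨ cong (_- y v) (sum-members (u (here refl)) y) ⟩
        sumL (map y l) - y v ∎
        where
        split-v : ∀ j (a : Dec (Here j)) (b : Dec (j ≡ v)) (c : Dec (j ∈ˡ l)) →
          when c (y j) ≡ when a (y j) + when b (y j)
        split-v j (yes (v≢j , _)) (yes refl) _ = contradiction refl v≢j
        split-v j (yes _) (no _) (yes _) = sym (ℚ.+-identityʳ (y j))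
        split-v j (yes (_ , _ , j∈)) (no _) (no j∉) = contradiction j∈ j∉
        split-v j (no _) (yes refl) (yes _) = sym (ℚ.+-identityˡ (y j))
        split-v j (no _) (yes refl) (no j∉) = contradiction v∈ j∉
        split-v j (no ¬a) (no j≢v) (yes j∈) = contradiction (≢-sym j≢v , v∈ , j∈) ¬a
        split-v j (no _) (no _) (no _) = refl

open Neighbours


-- The eigenvalue equations along a rooted hypertree.

module EigenvectorEquations where

  open Rational
  open Sums

  -- In an edge whose ends have the values a and b, the equations of the s other vertices give each
  -- of them the value (a + b)/(ν + 1). The contribution of the edge to the end of value a is then
  -- `E s ν` times b + κa. This factor is common to all edges, and `E-total` removes it from the
  -- equations at the ends.
  κ : ℕ → ℚ → ℚ
  κ s ν = fromNat s * inv (ν + fromNat (suc s))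

  -- Up to the factor E s ν, the sum over the neighbours of a vertex that lie below it,
  -- if the vector is 1 at that vertex; below a vertex of cost C, an edge carries the
  -- values ν - C and 1 at its upper and lower vertex.
  cost : ℕ → ℚ → Shape → ℚ
  cost s ν ε       = 0ℚ
  cost s ν (c ▷ r) = κ s ν + inv (ν - cost s ν c) + cost s ν r

  E : ℕ → ℚ → ℚ
  E s ν = (ν + fromNat (suc s)) * inv (ν + 1ℚ)

  AllBelow : (Shape → Set) → Shape → Set
  AllBelow Q ε       = Unit
  AllBelow Q (c ▷ r) = Q c × AllBelow Q c × AllBelow Q r

  -- The margin 1, stronger than positivity, makes all reciprocals in `cost` at most 1 and the
  -- passage to them 1-Lipschitz.
  Regular : ℕ → ℚ → Shape → Set
  Regular s ν = AllBelow (λ c → 1ℚ ≤ ν - cost s ν c)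

  inverse-≥1 : ∀ {q} → 1ℚ ≤ q → q * inv q ≡ 1ℚ
  inverse-≥1 1≤q = inv-inverse (ℚ.<-≤-trans 0<1 1≤q)

  module _ {s : ℕ} {ν : ℚ} (0<ν : 0ℚ < ν) where

    private
      S i₁ iₙ : ℚ
      S = fromNat s
      i₁ = inv (ν + 1ℚ)
      iₙ = inv (ν + (1ℚ + S))

      i₁-inverse : (ν + 1ℚ) * i₁ ≡ 1ℚ
      i₁-inverse = inv-inverse (+-pos 0<ν 0<1)

      iₙ-inverse : (ν + (1ℚ + S)) * iₙ ≡ 1ℚ
      iₙ-inverse = inv-inverse (+-pos 0<ν (fromNat-pos s))

      upper-identity : ∀ ν S i₁ iₙ a g → (ν + 1ℚ) * i₁ ≡ 1ℚ → (ν + (1ℚ + S)) * iₙ ≡ 1ℚ →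
        g * a + S * ((a + g * a) * i₁) ≡ (ν + (1ℚ + S)) * i₁ * (S * iₙ + g) * a
      upper-identity ν S i₁ iₙ a g h₁ hₙ = begin
        g * a + S * ((a + g * a) * i₁)
          ≡⟨ expand S i₁ a g ⟩
        S * i₁ * 1ℚ * a + 1ℚ * g * a + S * i₁ * g * a
          ≡⟨ cong₂ (λ p q → S * i₁ * p * a + q * g * a + S * i₁ * g * a) hₙ h₁ ⟨
        S * i₁ * ((ν + (1ℚ + S)) * iₙ) * a + ((ν + 1ℚ) * i₁) * g * a + S * i₁ * g * a
          ≡⟨ collect ν S i₁ iₙ a g ⟩
        (ν + (1ℚ + S)) * i₁ * (S * iₙ + g) * a ∎
        where
        open ≡-Reasoning
        expand : ∀ S i₁ a g → g * a + S * ((a + g * a) * i₁) ≡ S * i₁ * 1ℚ * a + 1ℚ * g * a + S * i₁ * g * a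
        expand = solve-∀ ring
        collect : ∀ ν S i₁ iₙ a g →
          S * i₁ * ((ν + (1ℚ + S)) * iₙ) * a + ((ν + 1ℚ) * i₁) * g * a + S * i₁ * g * a
          ≡ (ν + (1ℚ + S)) * i₁ * (S * iₙ + g) * a
        collect = solve-∀ ring

      lower-identity : ∀ ν S i₁ C b → (ν + 1ℚ) * i₁ ≡ 1ℚ →
        (ν + (1ℚ + S)) * i₁ * C * b + ((ν - C) * b + S * (((ν - C) * b + b) * i₁)) ≡ (ν + S) * b
      lower-identity ν S i₁ C b h₁ = trans (expand ν S i₁ C b)
        (trans (cong (λ p → p * C * b + (ν - C) * b + S * p * b) h₁) (collect ν S C b))
        where
        expand : ∀ ν S i₁ C b →
          (ν + (1ℚ + S)) * i₁ * C * b + ((ν - C) * b + S * (((ν - C) * b + b) * i₁))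
          ≡ (ν + 1ℚ) * i₁ * C * b + (ν - C) * b + S * ((ν + 1ℚ) * i₁) * b
        expand = solve-∀ ring
        collect : ∀ ν S C b → 1ℚ * C * b + (ν - C) * b + S * 1ℚ * b ≡ (ν + S) * b
        collect = solve-∀ ring

      pad-identity : ∀ ν S i₁ a b → (ν + 1ℚ) * i₁ ≡ 1ℚ →
        a + (b + S * ((a + b) * i₁)) - (a + b) * i₁ ≡ (ν + S) * ((a + b) * i₁)
      pad-identity ν S i₁ a b h₁ = begin
        a + (b + S * ((a + b) * i₁)) - (a + b) * i₁
          ≡⟨ expand S i₁ a b ⟩
        1ℚ * (a + b) + S * ((a + b) * i₁) - (a + b) * i₁
          ≡⟨ cong (λ p → p * (a + b) + S * ((a + b) * i₁) - (a + b) * i₁) h₁ ⟨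
        (ν + 1ℚ) * i₁ * (a + b) + S * ((a + b) * i₁) - (a + b) * i₁
          ≡⟨ collect ν S i₁ a b ⟩
        (ν + S) * ((a + b) * i₁) ∎
        where
        open ≡-Reasoning
        expand : ∀ S i₁ a b → a + (b + S * ((a + b) * i₁)) - (a + b) * i₁
          ≡ 1ℚ * (a + b) + S * ((a + b) * i₁) - (a + b) * i₁
        expand = solve-∀ ring
        collect : ∀ ν S i₁ a b → (ν + 1ℚ) * i₁ * (a + b) + S * ((a + b) * i₁) - (a + b) * i₁
          ≡ (ν + S) * ((a + b) * i₁)
        collect = solve-∀ ring

    E-total : E s ν * (ν + κ s ν) ≡ ν + S
    E-total = begin
      (ν + (1ℚ + S)) * i₁ * (ν + S * iₙ)
        ≡⟨ expand ν S i₁ iₙ ⟩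
      (ν + (1ℚ + S)) * i₁ * ν + S * i₁ * ((ν + (1ℚ + S)) * iₙ)
        ≡⟨ cong (λ p → (ν + (1ℚ + S)) * i₁ * ν + S * i₁ * p) iₙ-inverse ⟩
      (ν + (1ℚ + S)) * i₁ * ν + S * i₁ * 1ℚ
        ≡⟨ collect ν S i₁ ⟩
      (ν + 1ℚ) * i₁ * (ν + S)
        ≡⟨ cong (_* (ν + S)) i₁-inverse ⟩
      1ℚ * (ν + S)
        ≡⟨ ℚ.*-identityˡ (ν + S) ⟩
      ν + S ∎
      where
      open ≡-Reasoning
      expand : ∀ ν S i₁ iₙ → (ν + (1ℚ + S)) * i₁ * (ν + S * iₙ)
        ≡ (ν + (1ℚ + S)) * i₁ * ν + S * i₁ * ((ν + (1ℚ + S)) * iₙ)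
      expand = solve-∀ ring
      collect : ∀ ν S i₁ → (ν + (1ℚ + S)) * i₁ * ν + S * i₁ * 1ℚ ≡ (ν + 1ℚ) * i₁ * (ν + S)
      collect = solve-∀ ring

    E-pos : 0ℚ < E s ν
    E-pos = *-pos (+-pos 0<ν (fromNat-pos s)) (inv-pos (+-pos 0<ν 0<1))

    module _ {n : ℕ} (y : Fin n → ℚ) where

      Good : Fin n → Forest s (Fin n) → Set
      Good u ε                = Unit
      Good u (branch ps w c r) = All (λ p → y p ≡ (y u + y w) * i₁) (Vec.toList ps) ×
        y w ≡ inv (ν - cost s ν (shape c)) * y u × Good w c × Good u r

      private
        sum-pads : ∀ {k q} (ps : Vec (Fin n) k) → All (λ p → y p ≡ q) (Vec.toList ps) →
          sumL (map y (Vec.toList ps)) ≡ fromNat k * q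
        sum-pads {q = q} [] [] = sym (ℚ.*-zeroˡ q)
        sum-pads {suc k} {q} (p ∷ ps) (eq ∷ eqs) = trans (cong₂ _+_ eq (sum-pads ps eqs))
          (collect (fromNat k) q)
          where
          collect : ∀ k q → q + k * q ≡ (1ℚ + k) * q
          collect = solve-∀ ring

      neighbourSum-outside : ∀ u (F : Forest s (Fin n)) {v} → v ∉ˡ u ∷ vertices F → neighbourSum y (edgeLists u F) v ≡ 0ℚ
      neighbourSum-outside u F v∉ = neighbourSum-∉ y (edgeLists u F)
        (λ l∈ v∈ → v∉ (∈-edge⇒∈-vertices {F = F} l∈ v∈))

      private
        edge-sum : ∀ {u} {ps : Vec (Fin n) s} {w} {v : Fin n} → v ∈ˡ u ∷ w ∷ Vec.toList ps →
          All (λ p → y p ≡ (y u + y w) * i₁) (Vec.toList ps) →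
          when (v ∈ˡ? u ∷ w ∷ Vec.toList ps) (sumL (map y (u ∷ w ∷ Vec.toList ps)) - y v)
          ≡ y u + (y w + S * ((y u + y w) * i₁)) - y v
        edge-sum {u} {ps} {w} {v} v∈ good with v ∈ˡ? u ∷ w ∷ Vec.toList ps
        ... | yes _ = cong (λ p → y u + (y w + p) - y v) (sum-pads ps good)
        ... | no v∉ = contradiction v∈ v∉

        neighbourSum-branch : ∀ u (ps : Vec (Fin n) s) w c r v → neighbourSum y (edgeLists u (branch ps w c r)) v
          ≡ neighbourSum y (edgeLists w c) v
            + (when (v ∈ˡ? u ∷ w ∷ Vec.toList ps) (sumL (map y (u ∷ w ∷ Vec.toList ps)) - y v)
               + neighbourSum y (edgeLists u r) v)
        neighbourSum-branch u ps w c r v = neighbourSum-++ y (edgeLists w c) v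

      neighbourSum-root : ∀ u F → Unique (u ∷ vertices F) → Good u F →
        neighbourSum y (edgeLists u F) u ≡ E s ν * cost s ν (shape F) * y u
      neighbourSum-root u ε _ _ = zero-product (E s ν) (y u)
        where
        zero-product : ∀ e a → 0ℚ ≡ e * 0ℚ * a
        zero-product = solve-∀ ring
      neighbourSum-root u (branch ps w c r) uniq (pads , eq-w , _ , good-r) = begin
        neighbourSum y (edgeLists u (branch ps w c r)) u
          ≡⟨ neighbourSum-branch u ps w c r u ⟩
        neighbourSum y (edgeLists w c) u
          + (when (u ∈ˡ? u ∷ w ∷ Vec.toList ps) (sumL (map y (u ∷ w ∷ Vec.toList ps)) - y u)
             + neighbourSum y (edgeLists u r) u)
          ≡⟨ cong₂ _+_ (neighbourSum-outside w c u∉) (cong₂ _+_ (edge-sum (here refl) pads)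
               (neighbourSum-root u r siblings-unique good-r)) ⟩
        0ℚ + (y u + (y w + S * ((y u + y w) * i₁)) - y u + E s ν * cost s ν (shape r) * y u)
          ≡⟨ drop (y u) (y w + S * ((y u + y w) * i₁)) (E s ν * cost s ν (shape r) * y u) ⟩
        (y w + S * ((y u + y w) * i₁)) + E s ν * cost s ν (shape r) * y u
          ≡⟨ cong (λ b → b + S * ((y u + b) * i₁) + E s ν * cost s ν (shape r) * y u) eq-w ⟩
        (g * y u + S * ((y u + g * y u) * i₁)) + E s ν * cost s ν (shape r) * y u
          ≡⟨ cong (_+ E s ν * cost s ν (shape r) * y u)
               (upper-identity ν S i₁ iₙ (y u) g i₁-inverse iₙ-inverse) ⟩
        E s ν * (κ s ν + g) * y u + E s ν * cost s ν (shape r) * y u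
          ≡⟨ collect (E s ν) (κ s ν + g) (cost s ν (shape r)) (y u) ⟩
        E s ν * (κ s ν + g + cost s ν (shape r)) * y u ∎
        where
        open ≡-Reasoning
        open Split (split ps w c r uniq)
        g : ℚ
        g = inv (ν - cost s ν (shape c))
        u∉ : u ∉ˡ w ∷ vertices c
        u∉ (here eq)  = unique⇒∉ edge-unique (here eq)
        u∉ (there u∈) = edge∩children (here refl) u∈
        drop : ∀ a b d → 0ℚ + (a + b - a + d) ≡ b + d
        drop = solve-∀ ring
        collect : ∀ e p q a → e * p * a + e * q * a ≡ e * (p + q) * a
        collect = solve-∀ ring

      neighbourSum-below : ∀ u F → Unique (u ∷ vertices F) → Regular s ν (shape F) → Good u F →
        ∀ {v} → v ∈ˡ vertices F → neighbourSum y (edgeLists u F) v ≡ (ν + S) * y v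
      neighbourSum-below u (branch ps w c r) uniq (1≤g , reg-c , reg-r) (pads , eq-w , good-c , good-r) {v} v∈ =
        trans (neighbourSum-branch u ps w c r v) (cases (∈-vertices-branch {ps = ps} {c = c} v∈))
        where
        open ≡-Reasoning
        open Split (split ps w c r uniq)
        C : ℚ
        C = cost s ν (shape c)
        -- The value at `w` was chosen as y u / (ν - C); read backwards, this is the equation at `w`
        -- with its pads eliminated.
        y-u : y u ≡ (ν - C) * y w
        y-u = begin
          y u                                 ≡⟨ ℚ.*-identityˡ (y u) ⟨
          1ℚ * y u                            ≡⟨ cong (_* y u) (inverse-≥1 1≤g) ⟨
          (ν - C) * inv (ν - C) * y u         ≡⟨ ℚ.*-assoc (ν - C) (inv (ν - C)) (y u) ⟩
          (ν - C) * (inv (ν - C) * y u)       ≡⟨ cong ((ν - C) *_) eq-w ⟨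
          (ν - C) * y w                       ∎
        Whole : Fin n → ℚ
        Whole v = neighbourSum y (edgeLists w c) v
          + (when (v ∈ˡ? u ∷ w ∷ Vec.toList ps) (sumL (map y (u ∷ w ∷ Vec.toList ps)) - y v)
             + neighbourSum y (edgeLists u r) v)
        not-r : ∀ {v} → v ∈ˡ w ∷ Vec.toList ps → v ∉ˡ u ∷ vertices r
        not-r v∈ (here refl) = unique⇒∉ edge-unique v∈
        not-r v∈ (there v∈r) = edge∩siblings (there v∈) v∈r
        cases : v ≡ w ⊎ v ∈ˡ Vec.toList ps ⊎ v ∈ˡ vertices c ⊎ v ∈ˡ vertices r → Whole v ≡ (ν + S) * y v
        cases (inj₁ refl) = begin
          Whole w
            ≡⟨ cong₂ _+_ (neighbourSum-root w c children-unique good-c)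
                 (cong₂ _+_ (edge-sum (there (here refl)) pads) (neighbourSum-outside u r (not-r (here refl)))) ⟩
          E s ν * C * y w + (y u + (y w + S * ((y u + y w) * i₁)) - y w + 0ℚ)
            ≡⟨ cong (E s ν * C * y w +_) (drop (y u) (y w) (S * ((y u + y w) * i₁))) ⟩
          E s ν * C * y w + (y u + S * ((y u + y w) * i₁))
            ≡⟨ cong (λ a → E s ν * C * y w + (a + S * ((a + y w) * i₁))) y-u ⟩
          E s ν * C * y w + ((ν - C) * y w + S * (((ν - C) * y w + y w) * i₁))
            ≡⟨ lower-identity ν S i₁ C (y w) i₁-inverse ⟩
          (ν + S) * y w ∎
          where
          drop : ∀ a b d → a + (b + d) - b + 0ℚ ≡ a + d
          drop = solve-∀ ring
        cases (inj₂ (inj₁ v∈ps)) = begin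
          Whole v
            ≡⟨ cong₂ _+_ (neighbourSum-outside w c v∉c)
                 (cong₂ _+_ (edge-sum (there (there v∈ps)) pads) (neighbourSum-outside u r (not-r (there v∈ps)))) ⟩
          0ℚ + (y u + (y w + S * ((y u + y w) * i₁)) - y v + 0ℚ)
            ≡⟨ trans (ℚ.+-identityˡ _) (ℚ.+-identityʳ _) ⟩
          y u + (y w + S * ((y u + y w) * i₁)) - y v
            ≡⟨ cong (λ p → y u + (y w + S * ((y u + y w) * i₁)) - p) (All.lookup pads v∈ps) ⟩
          y u + (y w + S * ((y u + y w) * i₁)) - (y u + y w) * i₁
            ≡⟨ pad-identity ν S i₁ (y u) (y w) i₁-inverse ⟩
          (ν + S) * ((y u + y w) * i₁)
            ≡⟨ cong ((ν + S) *_) (All.lookup pads v∈ps) ⟨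
          (ν + S) * y v ∎
          where
          v∉c : v ∉ˡ w ∷ vertices c
          v∉c (here refl) = unique⇒∉ (AllPairs.tail edge-unique) v∈ps
          v∉c (there v∈c) = edge∩children (there (there v∈ps)) v∈c
        cases (inj₂ (inj₂ (inj₁ v∈c))) = begin
          Whole v
            ≡⟨ cong₂ _+_ (neighbourSum-below w c children-unique reg-c good-c v∈c)
                 (cong₂ _+_ (when-no (v ∈ˡ? u ∷ w ∷ Vec.toList ps) (λ v∈e → edge∩children v∈e v∈c))
                   (neighbourSum-outside u r v∉r)) ⟩
          (ν + S) * y v + (0ℚ + 0ℚ)
            ≡⟨ ℚ.+-identityʳ _ ⟩
          (ν + S) * y v ∎
          where
          v∉r : v ∉ˡ u ∷ vertices r
          v∉r (here refl) = edge∩children (here refl) v∈c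
          v∉r (there v∈r) = children∩siblings v∈c v∈r
        cases (inj₂ (inj₂ (inj₂ v∈r))) = begin
          Whole v
            ≡⟨ cong₂ _+_ (neighbourSum-outside w c v∉c)
                 (cong₂ _+_ (when-no (v ∈ˡ? u ∷ w ∷ Vec.toList ps) (λ v∈e → edge∩siblings v∈e v∈r))
                   (neighbourSum-below u r siblings-unique reg-r good-r v∈r)) ⟩
          0ℚ + (0ℚ + (ν + S) * y v)
            ≡⟨ trans (ℚ.+-identityˡ _) (ℚ.+-identityˡ _) ⟩
          (ν + S) * y v ∎
          where
          v∉c : v ∉ˡ w ∷ vertices c
          v∉c (here refl) = edge∩siblings (there (here refl)) v∈r
          v∉c (there v∈c) = children∩siblings v∈c v∈r

open EigenvectorEquations


-- Cauchy continuity in ν.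

module Continuity where

  open Rational

  0<≥7 : ∀ {ν} → seven ≤ ν → 0ℚ < ν
  0<≥7 7≤ν = ℚ.<-≤-trans (fromNat-pos 6) 7≤ν

  -- Continuity as preservation of Cauchy sequences in [7, ∞): it gives a real value at an
  -- irrational zero of Φ and, unlike uniform continuity, it is preserved by products on an
  -- unbounded interval.
  record Continuous (f : ℚ → ℚ) : Set where
    constructor continuous
    field
      preserves : ∀ x → (∀ i → seven ≤ x i) → IsCauchy x → IsCauchy (f ∘ x)

  open Continuous public

  const-continuous : ∀ q → Continuous (λ _ → q)
  const-continuous q = continuous λ _ _ _ → cauchy (fromℚ q)

  id-continuous : Continuous (λ ν → ν)
  id-continuous = continuous λ _ _ c → c

  +-continuous : ∀ {f g} → Continuous f → Continuous g → Continuous (λ ν → f ν + g ν)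
  +-continuous {f} {g} cf cg = continuous λ x 7≤x c →
    +-cauchy (f ∘ x) (g ∘ x) (preserves cf x 7≤x c) (preserves cg x 7≤x c)

  *-continuous : ∀ {f g} → Continuous f → Continuous g → Continuous (λ ν → f ν * g ν)
  *-continuous {f} {g} cf cg = continuous λ x 7≤x c →
    *-cauchy (f ∘ x) (g ∘ x) (preserves cf x 7≤x c) (preserves cg x 7≤x c)

  neg-continuous : ∀ {f} → Continuous f → Continuous (λ ν → - f ν)
  neg-continuous {f} cf = continuous λ x 7≤x c → -‿cauchy (f ∘ x) (preserves cf x 7≤x c)

  inv-≤1 : ∀ {q} → 1ℚ ≤ q → inv q ≤ 1ℚ
  inv-≤1 {q} 1≤q = subst₂ _≤_ (ℚ.*-identityˡ (inv q)) (inverse-≥1 1≤q)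
    (*-monoʳ (ℚ.<⇒≤ (inv-pos (ℚ.<-≤-trans 0<1 1≤q))) 1≤q)

  inv-lipschitz : ∀ {p q} → 1ℚ ≤ p → 1ℚ ≤ q → ℚ.∣ inv p - inv q ∣ ≤ ℚ.∣ p - q ∣
  inv-lipschitz {p} {q} 1≤p 1≤q = begin
    ℚ.∣ inv p - inv q ∣                      ≡⟨ cong ℚ.∣_∣ difference ⟩
    ℚ.∣ (q - p) * (inv p * inv q) ∣          ≡⟨ ℚ.∣p*q∣≡∣p∣*∣q∣ (q - p) (inv p * inv q) ⟩
    ℚ.∣ q - p ∣ * ℚ.∣ inv p * inv q ∣        ≡⟨ cong₂ _*_ (∣-∣-swap q p) (ℚ.0≤p⇒∣p∣≡p 0≤pq) ⟩
    ℚ.∣ p - q ∣ * (inv p * inv q)            ≤⟨ *-monoˡ (ℚ.0≤∣p∣ (p - q)) ≤1 ⟩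
    ℚ.∣ p - q ∣ * 1ℚ                         ≡⟨ ℚ.*-identityʳ ℚ.∣ p - q ∣ ⟩
    ℚ.∣ p - q ∣                              ∎
    where
    open ℚ.≤-Reasoning
    0≤p = ℚ.<⇒≤ (inv-pos (ℚ.<-≤-trans 0<1 1≤p))
    0≤q = ℚ.<⇒≤ (inv-pos (ℚ.<-≤-trans 0<1 1≤q))
    0≤pq : 0ℚ ≤ inv p * inv q
    0≤pq = *-nonNeg 0≤p 0≤q
    ≤1 : inv p * inv q ≤ 1ℚ
    ≤1 = subst (inv p * inv q ≤_) (ℚ.*-identityˡ 1ℚ) (*-mono 0≤p 0≤q (inv-≤1 1≤p) (inv-≤1 1≤q))
    expand : ∀ p q i j → (q - p) * (i * j) ≡ (q * j) * i - (p * i) * j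
    expand = solve-∀ ring
    difference : inv p - inv q ≡ (q - p) * (inv p * inv q)
    difference = sym (trans (expand p q (inv p) (inv q))
      (trans (cong₂ (λ a b → a * inv p - b * inv q) (inverse-≥1 1≤q) (inverse-≥1 1≤p))
             (cong₂ _-_ (ℚ.*-identityˡ (inv p)) (ℚ.*-identityˡ (inv q)))))

  inv-continuous : ∀ {g} → Continuous g → (∀ {ν} → seven ≤ ν → 1ℚ ≤ g ν) → Continuous (λ ν → inv (g ν))
  inv-continuous {g} cg 1≤g = continuous λ x 7≤x c 0<δ →
    let N , close = preserves cg x 7≤x c 0<δ in
    N , λ {i} {j} N≤i N≤j → ℚ.≤-<-trans (inv-lipschitz (1≤g (7≤x i)) (1≤g (7≤x j))) (close N≤i N≤j)

  1≤ν+ : ∀ {ν q} → seven ≤ ν → 0ℚ ≤ q → 1ℚ ≤ ν + q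
  1≤ν+ {ν} {q} 7≤ν 0≤q = ℚ.≤-trans (fromNat-mono {1} {7} (s≤s z≤n)) (ℚ.≤-trans 7≤ν (≤-by 0≤q refl))

open Continuity

-- The vector as a function of ν.

module Eigenvectors where

  open Rational
  open Sums

  UniformlyRegular : ℕ → Shape → Set
  UniformlyRegular s = AllBelow (λ c → ∀ {ν} → seven ≤ ν → 1ℚ ≤ ν - cost s ν c)

  uniformly-regular : ∀ {s ν} → seven ≤ ν → ∀ t → UniformlyRegular s t → Regular s ν t
  uniformly-regular 7≤ν ε       _           = tt
  uniformly-regular 7≤ν (c ▷ r) (p , pc , pr) =
    p 7≤ν , uniformly-regular 7≤ν c pc , uniformly-regular 7≤ν r pr

  κ-continuous : ∀ s → Continuous (κ s)
  κ-continuous s = *-continuous (const-continuous (fromNat s))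
    (inv-continuous (+-continuous id-continuous (const-continuous (fromNat (suc s))))
      (λ 7≤ν → 1≤ν+ 7≤ν (fromNat-nonNeg (suc s))))

  E-continuous : ∀ s → Continuous (E s)
  E-continuous s = *-continuous (+-continuous id-continuous (const-continuous (fromNat (suc s))))
    (inv-continuous (+-continuous id-continuous (const-continuous 1ℚ)) (λ 7≤ν → 1≤ν+ 7≤ν (ℚ.<⇒≤ 0<1)))

  cost-continuous : ∀ s t → UniformlyRegular s t → Continuous (λ ν → cost s ν t)
  cost-continuous s ε _ = const-continuous 0ℚ
  cost-continuous s (c ▷ r) (1≤g , reg-c , reg-r) = +-continuous
    (+-continuous (κ-continuous s)
      (inv-continuous (+-continuous id-continuous (neg-continuous (cost-continuous s c reg-c))) 1≤g))
    (cost-continuous s r reg-r)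

  module _ (s : ℕ) where

    lower : (ℚ → ℚ) → Shape → ℚ → ℚ
    lower a c ν = inv (ν - cost s ν c) * a ν

    pad : (ℚ → ℚ) → (ℚ → ℚ) → ℚ → ℚ
    pad a b ν = (a ν + b ν) * inv (ν + 1ℚ)

    -- The entries are functions of ν, so that one vector is available along a whole sequence of ν.
    -- They depend on the shape alone; `relabel` later places them on the vertices.
    values : (ℚ → ℚ) → Shape → Forest s (ℚ → ℚ)
    values a ε       = ε
    values a (c ▷ r) =
      branch (Vec.replicate s (pad a (lower a c))) (lower a c) (values (lower a c) c) (values a r)

    shape-values : ∀ a t → shape (values a t) ≡ t
    shape-values a ε       = refl
    shape-values a (c ▷ r) = cong₂ _▷_ (shape-values (lower a c) c) (shape-values a r)

    -- Serves both for positivity at one ν and for continuity in ν.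
    values-All : ∀ {P : (ℚ → ℚ) → Set} {Q : Shape → Set} →
      (∀ {a c} → P a → Q c → AllBelow Q c → P (lower a c)) → (∀ {a b} → P a → P b → P (pad a b)) →
      ∀ {a} t → P a → AllBelow Q t → All P (vertices (values a t))
    values-All f g ε _ _ = []
    values-All {P} f g {a} (c ▷ r) pa (qc , qs , qr) =
      pb ∷ All.++⁺ (all-replicate s) (All.++⁺ (values-All f g c pb qs) (values-All f g r pa qr))
      where
      pb : P (lower a c)
      pb = f pa qc qs
      all-replicate : ∀ k → All P (Vec.toList (Vec.replicate k (pad a (lower a c))))
      all-replicate zero    = []
      all-replicate (suc k) = g pa pb ∷ all-replicate k

    branch-injective : ∀ {X : Set} {ps qs : Vec X s} {w x c d r t} →
      branch ps w c r ≡ branch qs x d t → ps ≡ qs × w ≡ x × c ≡ d × r ≡ t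
    branch-injective refl = refl , refl , refl , refl

    values-good : ∀ {n ν} (0<ν : 0ℚ < ν) (y : Fin n → ℚ → ℚ) u F →
      mapForest y F ≡ values (y u) (shape F) → Good 0<ν (λ v → y v ν) u F
    values-good 0<ν y u ε _ = tt
    values-good {n} {ν} 0<ν y u (branch ps w c r) eq with branch-injective eq
    ... | eq-ps , eq-w , eq-c , eq-r =
        pads ps eq-ps , cong (λ f → f ν) eq-w
      , values-good 0<ν y w c (trans eq-c (cong (λ b → values b (shape c)) (sym eq-w)))
      , values-good 0<ν y u r eq-r
      where
      pads : ∀ {k} (ps : Vec (Fin n) k) → Vec.map y ps ≡ Vec.replicate k (pad (y u) (lower (y u) (shape c))) →
        All (λ p → y p ν ≡ (y u ν + y w ν) * inv (ν + 1ℚ)) (Vec.toList ps)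
      pads []       _  = []
      pads (p ∷ ps) eq =
        trans (cong (λ f → f ν) (Vec.∷-injectiveˡ eq))
          (cong (λ b → (y u ν + b ν) * inv (ν + 1ℚ)) (sym eq-w))
        ∷ pads ps (Vec.∷-injectiveʳ eq)

    one : ℚ → ℚ
    one _ = 1ℚ

  record Eigenvector (s : ℕ) (H : Hypergraph) (u : Vertex H) (F : Forest s (Vertex H)) : Set where
    field
      vector : Vertex H → ℚ → ℚ
      root   : vector u ≡ one s
      below  : mapForest vector F ≡ values s (vector u) (shape F)

  eigenvector : ∀ {s H u F} → Model {s} H u F → Eigenvector s H u F
  eigenvector {s} {F = F} M
    with relabel {u′ = one s} {G = values s (one s) (shape F)} (Model.distinct M) (sym (shape-values s (one s) (shape F)))
  ... | f , root , eq = record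
    { vector = f ; root = root ; below = trans eq (cong (λ a → values s a (shape F)) (sym root)) }

  adjacent? : ∀ (H : Hypergraph) (i j : Vertex H) → Dec (i ≢ j × Any (λ e → i ∈ e × j ∈ e) (edges H))
  adjacent? H i j =
    ¬? (i Fin.≟ j) ×-dec Any.any? (λ e → (i Subset.∈? e) ×-dec (j Subset.∈? e)) (edges H)

  entry : ℕ → (H : Hypergraph) → Vertex H → Vertex H → ℚ
  entry m H i j = when (adjacent? H i j) (reciprocal (m ∸ 1))

  adjacency≡ : ∀ m H i j → adjacency m H i j ≡ fromℚ (entry m H i j)
  adjacency≡ m H i j
    with ¬? (i Fin.≟ j) ×-dec Any.any? (λ e → (i Subset.∈? e) ×-dec (j Subset.∈? e)) (edges H)
  ... | yes _ = refl
  ... | no  _ = refl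

open Eigenvectors


-- The vector under the adjacency matrix, and a norm bound.

module AdjacencyMatrix where

  open Rational
  open Sums

  reciprocal-pos : ∀ n → 0ℚ < reciprocal (suc n)
  reciprocal-pos n = ℚ.positive⁻¹ (reciprocal (suc n)) {{ℚ.normalize-pos 1 (suc n)}}

  module _ {s : ℕ} {H : Hypergraph} where

    private
      m : ℕ
      m = suc (suc s)
      q : ℚ
      q = reciprocal (suc s)

    entry-nonNeg : ∀ i j → 0ℚ ≤ entry m H i j
    entry-nonNeg i j with adjacent? H i j
    ... | yes _ = ℚ.<⇒≤ (reciprocal-pos s)
    ... | no _  = ℚ.≤-refl

    entry-sym : ∀ i j → entry m H i j ≡ entry m H j i
    entry-sym i j = when-⇔ (adjacent? H i j) (adjacent? H j i) flip flip
      where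
      flip : ∀ {i j} → i ≢ j × Any (λ e → i ∈ e × j ∈ e) (edges H) → j ≢ i × Any (λ e → j ∈ e × i ∈ e) (edges H)
      flip (i≢j , any) = ≢-sym i≢j , Any.map (λ (i∈ , j∈) → j∈ , i∈) any

    module _ {u : Vertex H} {F : Forest s (Vertex H)} (M : Model H u F) where

      open Model M

      matrix-sum : ∀ y v → sum (λ j → entry m H v j * y j) ≡ q * neighbourSum y (edgeLists u F) v
      matrix-sum y v = begin
        sum (λ j → entry m H v j * y j)
          ≡⟨ sum-cong-≗ (λ j → factor j (together? y (edgeLists u F) v j)) ⟩
        sum (λ j → q * when (together? y (edgeLists u F) v j) (y j))
          ≡⟨ *-distribˡ-sum q (λ j → when (together? y (edgeLists u F) v j) (y j)) ⟨
        q * sum (λ j → when (together? y (edgeLists u F) v j) (y j))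
          ≡⟨ cong (q *_) (sum-together y earF (edgeLists-unique {F = F} distinct) v) ⟩
        q * neighbourSum y (edgeLists u F) v ∎
        where
        open ≡-Reasoning
        earF : Ear (edgeLists u F)
        earF = subst Ear (List.++-identityʳ _) (edgeLists-ear {F = F} distinct (λ ()) [])
        to : ∀ {j} → v ≢ j × Any (λ e → v ∈ e × j ∈ e) (edges H) → Together y (edgeLists u F) v j
        to (v≢j , any) = v≢j , (let e , e∈ , v∈e , j∈e = find any ; l , l∈ , eq = complete e∈ in
          lose l∈ (∈-setOf⁻ (subst (v ∈_) eq v∈e) , ∈-setOf⁻ (subst (_ ∈_) eq j∈e)))
        from : ∀ {j} → Together y (edgeLists u F) v j → v ≢ j × Any (λ e → v ∈ e × j ∈ e) (edges H)
        from (v≢j , any) = v≢j , (let l , l∈ , v∈l , j∈l = find any in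
          lose (sound l∈) (∈-setOf⁺ v∈l , ∈-setOf⁺ j∈l))
        factor : ∀ j (d : Dec (Together y (edgeLists u F) v j)) → entry m H v j * y j ≡ q * when d (y j)
        factor j d = trans (cong (_* y j) (when-⇔ (adjacent? H v j) d to from)) (pull d)
          where
          pull : ∀ {P : Set} (d : Dec P) → when d q * y j ≡ q * when d (y j)
          pull (yes _) = refl
          pull (no _)  = trans (ℚ.*-zeroˡ (y j)) (sym (ℚ.*-zeroʳ q))

      module _ {ν : ℚ} (7≤ν : seven ≤ ν) (regular : Regular s ν (shape F)) where

        private
          0<ν : 0ℚ < ν
          0<ν = 0<≥7 7≤ν

        open Eigenvector (eigenvector M)

        private
          y : Vertex H → ℚ
          y v = vector v ν

          good : Good 0<ν y u F
          good = values-good s 0<ν vector u F below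

        vector-root : y u ≡ 1ℚ
        vector-root = cong (λ f → f ν) root

        eigen-root : sum (λ j → entry m H u j * y j) ≡ q * (E s ν * cost s ν (shape F))
        eigen-root = trans (matrix-sum y u) (cong (q *_)
          (trans (neighbourSum-root 0<ν y u F distinct good)
            (trans (cong (E s ν * cost s ν (shape F) *_) vector-root) (ℚ.*-identityʳ _))))

        eigen-below : ∀ {v} → v ∈ˡ vertices F →
          sum (λ j → entry m H v j * y j) ≡ q * (ν + fromNat s) * y v
        eigen-below {v} v∈ = trans (matrix-sum y v) (trans (cong (q *_)
          (neighbourSum-below 0<ν y u F distinct regular good v∈)) (sym (ℚ.*-assoc q (ν + fromNat s) (y v))))

        vector-pos : ∀ v → 0ℚ < y v
        vector-pos v with covers v
        ... | here refl = subst (0ℚ <_) (sym vector-root) 0<1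
        ... | there v∈  = All.lookup all (subst (vector v ∈ˡ_) map-vertices (Membership.∈-map⁺ vector v∈))
          where
          map-vertices : map vector (vertices F) ≡ vertices (values s (vector u) (shape F))
          map-vertices = trans (sym (vertices-map vector F)) (cong vertices below)
          all : All (λ f → 0ℚ < f ν) (vertices (values s (vector u) (shape F)))
          all = values-All s {P = λ f → 0ℚ < f ν} {Q = λ c → 1ℚ ≤ ν - cost s ν c}
            (λ 0<a 1≤g _ → *-pos (inv-pos (ℚ.<-≤-trans 0<1 1≤g)) 0<a)
            (λ 0<a 0<b → *-pos (+-pos 0<a 0<b) (inv-pos (+-pos 0<ν 0<1)))
            (shape F) (subst (0ℚ <_) (sym vector-root) 0<1) regular

        subinvariant : cost s ν (shape F) ≤ ν + κ s ν →
          ∀ v → sum (λ j → entry m H v j * y j) ≤ q * (ν + fromNat s) * y v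
        subinvariant cost≤ v with covers v
        ... | there v∈ = ℚ.≤-reflexive (eigen-below v∈)
        ... | here refl = begin
          sum (λ j → entry m H u j * y j)     ≡⟨ eigen-root ⟩
          q * (E s ν * cost s ν (shape F))    ≤⟨ *-monoˡ (ℚ.<⇒≤ (reciprocal-pos s)) (*-monoˡ (ℚ.<⇒≤ (E-pos {s} 0<ν)) cost≤) ⟩
          q * (E s ν * (ν + κ s ν))           ≡⟨ cong (q *_) (E-total {s} 0<ν) ⟩
          q * (ν + fromNat s)                 ≡⟨ ℚ.*-identityʳ _ ⟨
          q * (ν + fromNat s) * 1ℚ            ≡⟨ cong (q * (ν + fromNat s) *_) vector-root ⟨
          q * (ν + fromNat s) * y u           ∎
          where open ℚ.≤-Reasoning

  -- Σ w (ξ - τ)² ≥ 0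
  weighted-square : ∀ {n} (w ξ : Fin n → ℚ) τ → (∀ i → 0ℚ ≤ w i) →
    two * τ * sum (λ i → w i * ξ i) ≤ sum (λ i → w i * ξ i * ξ i) + τ * τ * sum w
  weighted-square {zero} w ξ τ _ = ℚ.≤-reflexive
    (trans (cong (two * τ *_) (sum-[] (λ i → w i * ξ i))) (trans (zeros τ)
      (sym (cong₂ (λ a b → a + τ * τ * b) (sum-[] (λ i → w i * ξ i * ξ i)) (sum-[] w)))))
    where
    zeros : ∀ τ → two * τ * 0ℚ ≡ 0ℚ + τ * τ * 0ℚ
    zeros = solve-∀ ring
  weighted-square {suc n} w ξ τ 0≤w
    rewrite sum-∷ (λ i → w i * ξ i) | sum-∷ (λ i → w i * ξ i * ξ i) | sum-∷ w = ≤-by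
    (+-nonNeg (*-nonNeg (0≤w zero) (square-nonNeg (ξ zero - τ)))
      (≤⇒0≤ (weighted-square (w ∘ suc) (ξ ∘ suc) τ (0≤w ∘ suc))))
    (regroup (w zero) (ξ zero) τ (sum (λ i → w (suc i) * ξ (suc i)))
      (sum (λ i → w (suc i) * ξ (suc i) * ξ (suc i))) (sum (w ∘ suc)))
    where
    regroup : ∀ w ξ τ S Q W →
      two * τ * (w * ξ + S) + (w * ((ξ - τ) * (ξ - τ)) + (Q + τ * τ * W - two * τ * S))
      ≡ w * ξ * ξ + Q + τ * τ * (w + W)
    regroup = solve-∀ ring

  -- Induction on the number of terms: what the first index adds to the difference of the two sides
  -- is `weighted-square` with τ the first value of ξ.
  cauchy-schwarz : ∀ {n} (w ξ : Fin n → ℚ) → (∀ i → 0ℚ ≤ w i) →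
    sum (λ i → w i * ξ i) * sum (λ i → w i * ξ i) ≤ sum w * sum (λ i → w i * ξ i * ξ i)
  cauchy-schwarz {zero} w ξ _ = ℚ.≤-reflexive (trans (cong₂ _*_ (sum-[] (λ i → w i * ξ i)) (sum-[] (λ i → w i * ξ i)))
    (sym (cong₂ _*_ (sum-[] w) (sum-[] (λ i → w i * ξ i * ξ i)))))
  cauchy-schwarz {suc n} w ξ 0≤w
    rewrite sum-∷ (λ i → w i * ξ i) | sum-∷ (λ i → w i * ξ i * ξ i) | sum-∷ w = ≤-by
    (+-nonNeg (*-nonNeg (0≤w zero) (≤⇒0≤ (weighted-square (w ∘ suc) (ξ ∘ suc) (ξ zero) (0≤w ∘ suc))))
      (≤⇒0≤ (cauchy-schwarz (w ∘ suc) (ξ ∘ suc) (0≤w ∘ suc))))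
    (regroup (w zero) (ξ zero) (sum (λ i → w (suc i) * ξ (suc i)))
      (sum (λ i → w (suc i) * ξ (suc i) * ξ (suc i))) (sum (w ∘ suc)))
    where
    regroup : ∀ w ξ S Q W →
      (w * ξ + S) * (w * ξ + S) + (w * (Q + ξ * ξ * W - two * ξ * S) + (W * Q - S * S))
      ≡ (w + W) * (w * ξ * ξ + Q)
    regroup = solve-∀ ring

  -- The Schur test. With x = y ξ, the Cauchy-Schwarz inequality with weights a i j * y j bounds
  -- each row; `Ay≤ty` is used once for the rows and, by symmetry, once for the columns.
  norm-bound : ∀ {n} (a : Fin n → Fin n → ℚ) (y : Fin n → ℚ) t →
    (∀ i j → 0ℚ ≤ a i j) → (∀ i j → a i j ≡ a j i) → (∀ i → 0ℚ < y i) → 0ℚ ≤ t →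
    (∀ i → sum (λ j → a i j * y j) ≤ t * y i) →
    ∀ (x : Fin n → ℚ) → sum (λ i → sum (λ j → a i j * x j) * sum (λ j → a i j * x j)) ≤ t * t * sum (λ i → x i * x i)
  norm-bound {n} a y t 0≤a a-sym 0<y 0≤t Ay≤ty x = begin
    sum (λ i → sum (λ j → a i j * x j) * sum (λ j → a i j * x j))
      ≡⟨ sum-cong-≗ (λ i → cong (λ p → p * p) (sum-cong-≗ (λ j → scale i j))) ⟩
    sum (λ i → sum (λ j → w i j * ξ j) * sum (λ j → w i j * ξ j))
      ≤⟨ sum-mono (λ i → cauchy-schwarz (w i) ξ (0≤w i)) ⟩
    sum (λ i → sum (w i) * sum (λ j → w i j * ξ j * ξ j))
      ≤⟨ sum-mono (λ i → *-monoʳ (sum-nonNeg (λ j → 0≤wξξ i j)) (Ay≤ty i)) ⟩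
    sum (λ i → t * y i * sum (λ j → w i j * ξ j * ξ j))
      ≡⟨ sum-cong-≗ (λ i → *-distribˡ-sum (t * y i) (λ j → w i j * ξ j * ξ j)) ⟩
    sum (λ i → sum (λ j → t * y i * (w i j * ξ j * ξ j)))
      ≡⟨ ∑-comm (λ i j → t * y i * (w i j * ξ j * ξ j)) ⟩
    sum (λ j → sum (λ i → t * y i * (w i j * ξ j * ξ j)))
      ≡⟨ sum-cong-≗ (λ j → trans (sum-cong-≗ (λ i → reorder i j))
           (sym (*-distribˡ-sum (t * (y j * ξ j * ξ j)) (λ i → a j i * y i)))) ⟩
    sum (λ j → t * (y j * ξ j * ξ j) * sum (λ i → a j i * y i))
      ≤⟨ sum-mono (λ j → *-monoˡ (*-nonNeg 0≤t (0≤yξξ j)) (Ay≤ty j)) ⟩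
    sum (λ j → t * (y j * ξ j * ξ j) * (t * y j))
      ≡⟨ sum-cong-≗ (λ j → trans (regroup t (y j) (ξ j)) (cong (t * t *_) (sym (cong₂ _*_ (x≡ j) (x≡ j))))) ⟩
    sum (λ j → t * t * (x j * x j))
      ≡⟨ *-distribˡ-sum (t * t) (λ j → x j * x j) ⟨
    t * t * sum (λ j → x j * x j) ∎
    where
    open ℚ.≤-Reasoning
    ξ : Fin n → ℚ
    ξ j = x j * inv (y j)
    w : Fin n → Fin n → ℚ
    w i j = a i j * y j
    0≤w : ∀ i j → 0ℚ ≤ w i j
    0≤w i j = *-nonNeg (0≤a i j) (ℚ.<⇒≤ (0<y j))
    assoc : ∀ a b → a * b * b ≡ a * (b * b)
    assoc = solve-∀ ring
    0≤wξξ : ∀ i j → 0ℚ ≤ w i j * ξ j * ξ j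
    0≤wξξ i j = subst (0ℚ ≤_) (sym (assoc (w i j) (ξ j))) (*-nonNeg (0≤w i j) (square-nonNeg (ξ j)))
    0≤yξξ : ∀ j → 0ℚ ≤ y j * ξ j * ξ j
    0≤yξξ j = subst (0ℚ ≤_) (sym (assoc (y j) (ξ j))) (*-nonNeg (ℚ.<⇒≤ (0<y j)) (square-nonNeg (ξ j)))
    cancel : ∀ y x i → y * (x * i) ≡ x * (y * i)
    cancel = solve-∀ ring
    x≡ : ∀ j → x j ≡ y j * ξ j
    x≡ j = sym (trans (cancel (y j) (x j) (inv (y j)))
      (trans (cong (x j *_) (inv-inverse (0<y j))) (ℚ.*-identityʳ (x j))))
    scale : ∀ i j → a i j * x j ≡ w i j * ξ j
    scale i j = trans (cong (a i j *_) (x≡ j)) (sym (ℚ.*-assoc (a i j) (y j) (ξ j)))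
    shuffle : ∀ t a y yj ξ → t * y * (a * yj * ξ * ξ) ≡ t * (yj * ξ * ξ) * (a * y)
    shuffle = solve-∀ ring
    reorder : ∀ i j → t * y i * (w i j * ξ j * ξ j) ≡ t * (y j * ξ j * ξ j) * (a j i * y i)
    reorder i j = trans (shuffle t (a i j) (y i) (y j) (ξ j))
      (cong (λ b → t * (y j * ξ j * ξ j) * (b * y i)) (a-sym i j))
    regroup : ∀ t y ξ → t * (y * ξ * ξ) * (t * y) ≡ t * t * (y * ξ * (y * ξ))
    regroup = solve-∀ ring

open AdjacencyMatrix


-- Limits of rational sequences and comparison of reals.

module Sequences where

  open Rational
  open Sums

  Eventually : (ℕ → Set) → Set
  Eventually P = ∃ λ N → ∀ i → N ℕ.≤ i → P i

  eventually₂ : ∀ {P Q R : ℕ → Set} → (∀ {i} → P i → Q i → R i) →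
    Eventually P → Eventually Q → Eventually R
  eventually₂ f (M , p) (N , q) = M ℕ.⊔ N , λ i ≤i →
    f (p i (ℕ.≤-trans (ℕ.m≤m⊔n M N) ≤i)) (q i (ℕ.≤-trans (ℕ.m≤n⊔m M N) ≤i))

  eventually-map : ∀ {P Q : ℕ → Set} → (∀ {i} → P i → Q i) → Eventually P → Eventually Q
  eventually-map f (N , p) = N , λ i ≤i → f (p i ≤i)

  Null : (ℕ → ℚ) → Set
  Null x = ∀ δ → 0ℚ < δ → Eventually (λ i → ℚ.∣ x i ∣ < δ)

  abstract
    half : ℚ → ℚ
    half δ = ½ * δ

    half-pos : ∀ {δ} → 0ℚ < δ → 0ℚ < half δ
    half-pos 0<δ = *-pos (ℚ.positive⁻¹ ½) 0<δ

    half+half : ∀ δ → half δ + half δ ≡ δ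
    half+half δ = trans (sym (ℚ.*-distribʳ-+ δ ½ ½)) (ℚ.*-identityˡ δ)

  null-+ : ∀ {x y} → Null x → Null y → Null (λ i → x i + y i)
  null-+ {x} {y} nx ny δ 0<δ = eventually₂
    (λ {i} p q → ℚ.≤-<-trans (ℚ.∣p+q∣≤∣p∣+∣q∣ (x i) (y i))
      (subst (ℚ.∣ x i ∣ + ℚ.∣ y i ∣ <_) (half+half δ) (ℚ.+-mono-< p q)))
    (nx (half δ) (half-pos 0<δ)) (ny (half δ) (half-pos 0<δ))

  null-≡ : ∀ {x y} → (∀ i → x i ≡ y i) → Null x → Null y
  null-≡ eq nx δ 0<δ = eventually-map (λ {i} → subst (λ q → ℚ.∣ q ∣ < δ) (eq i)) (nx δ 0<δ)

  null-0 : Null (λ _ → 0ℚ)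
  null-0 δ 0<δ = 0 , λ _ _ → 0<δ

  null-sum : ∀ {n} (x : Fin n → ℕ → ℚ) → (∀ v → Null (x v)) → Null (λ i → sum (λ v → x v i))
  null-sum {zero}  x _  = null-≡ (λ i → sym (sum-[] (λ v → x v i))) null-0
  null-sum {suc n} x nx = null-≡ (λ i → sym (sum-∷ (λ v → x v i)))
    (null-+ (nx zero) (null-sum (x ∘ suc) (nx ∘ suc)))

  bounded : ∀ {x} → IsCauchy x → ∃ λ B → 0ℚ < B × Eventually (λ i → ℚ.∣ x i ∣ ≤ B)
  bounded {x} c = let N , close = c 0<1 in
      1ℚ + ℚ.∣ x N ∣
    , ℚ.+-mono-<-≤ 0<1 (ℚ.0≤∣p∣ (x N))
    , N , λ i N≤i → begin
        ℚ.∣ x i ∣                       ≡⟨ cong ℚ.∣_∣ (insert (x i) (x N)) ⟩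
        ℚ.∣ x i - x N + x N ∣           ≤⟨ ℚ.∣p+q∣≤∣p∣+∣q∣ (x i - x N) (x N) ⟩
        ℚ.∣ x i - x N ∣ + ℚ.∣ x N ∣     ≤⟨ ℚ.+-monoˡ-≤ ℚ.∣ x N ∣ (ℚ.<⇒≤ (close N≤i ℕ.≤-refl)) ⟩
        1ℚ + ℚ.∣ x N ∣                  ∎
    where
    open ℚ.≤-Reasoning
    insert : ∀ a b → a ≡ a - b + b
    insert = solve-∀ ring

  null-* : ∀ {x y} → Null x → IsCauchy y → Null (λ i → x i * y i)
  null-* {x} {y} nx cy δ 0<δ = let B , 0<B , y-bound = bounded cy in eventually₂
    (λ {i} x< y≤ → begin-strict
      ℚ.∣ x i * y i ∣              ≡⟨ ℚ.∣p*q∣≡∣p∣*∣q∣ (x i) (y i) ⟩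
      ℚ.∣ x i ∣ * ℚ.∣ y i ∣        ≤⟨ *-monoˡ (ℚ.0≤∣p∣ (x i)) y≤ ⟩
      ℚ.∣ x i ∣ * B                <⟨ ℚ.*-monoˡ-<-pos B {{ℚ.positive 0<B}} x< ⟩
      δ * inv B * B                ≡⟨ trans (swap-factors δ (inv B) B)
                                        (trans (cong (δ *_) (inv-inverse 0<B)) (ℚ.*-identityʳ δ)) ⟩
      δ                            ∎)
    (nx (δ * inv B) (*-pos 0<δ (inv-pos 0<B))) y-bound
    where
    open ℚ.≤-Reasoning
    swap-factors : ∀ e i b → e * i * b ≡ e * (b * i)
    swap-factors = solve-∀ ring

  ≈⇒null : ∀ {x y} → x ≈ℝ y → Null (λ i → seq x i - seq y i)
  ≈⇒null x≈y δ 0<δ = let N , close = x≈y 0<δ in N , λ i N≤i → close N≤i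

  null⇒≈ : ∀ {x y} → Null (λ i → seq x i - seq y i) → x ≈ℝ y
  null⇒≈ n {δ} 0<δ = let N , close = n δ 0<δ in N , λ {i} N≤i → close i N≤i

  null-squares : ∀ {x y} → x ≈ℝ y → Null (λ i → seq x i * seq x i - seq y i * seq y i)
  null-squares {x} {y} x≈y = null-≡ (λ i → sym (factor (seq x i) (seq y i)))
    (null-* (≈⇒null {x} {y} x≈y) (+-cauchy (seq x) (seq y) (cauchy x) (cauchy y)))
    where
    factor : ∀ a b → a * a - b * b ≡ (a - b) * (a + b)
    factor = solve-∀ ring

  null-upper : ∀ {x} → Null x → ∀ {δ} → 0ℚ < δ → Eventually (λ i → x i < δ)
  null-upper {x} nx {δ} 0<δ = eventually-map (λ {i} → ℚ.≤-<-trans (≤-∣-∣ (x i))) (nx δ 0<δ)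

  infix 4 _≤lim_ _lim≤_

  _≤lim_ : ℚ → (ℕ → ℚ) → Set
  q ≤lim x = ∀ {δ} → 0ℚ < δ → Eventually (λ i → q < x i + δ)

  _lim≤_ : (ℕ → ℚ) → ℚ → Set
  x lim≤ q = ∀ {δ} → 0ℚ < δ → Eventually (λ i → x i < q + δ)

  -- `y ≤ℝ x` is a negation and yields no index by itself. But comparing `q` with one good
  -- approximation of `x` is decidable: either `q` is within reach of it, or `x <ℝ y` would follow.
  ≤ℝ⇒≤lim : ∀ {x y q} → y ≤ℝ x → Eventually (λ i → q ≤ seq y i) → q ≤lim seq x
  ≤ℝ⇒≤lim {x} {y} {q} y≤x (M , q≤y) {δ} 0<δ with cauchy x (half-pos (half-pos 0<δ))
  ... | N , close with seq x N + (half (half δ) + half (half δ)) ℚ.≤? q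
  ... | yes far = contradiction
    (η , half-pos (half-pos 0<δ) , M ℕ.⊔ N , λ {i} ≤i → begin
      seq x i + η        ≤⟨ ℚ.+-monoˡ-≤ η (ℚ.<⇒≤ (close-upper {seq x i} {seq x N} (close (ℕ.≤-trans (ℕ.m≤n⊔m M N) ≤i) ℕ.≤-refl))) ⟩
      seq x N + η + η    ≡⟨ ℚ.+-assoc (seq x N) η η ⟩
      seq x N + (η + η)  ≤⟨ far ⟩
      q                  ≤⟨ q≤y i (ℕ.≤-trans (ℕ.m≤m⊔n M N) ≤i) ⟩
      seq y i            ∎)
    y≤x
    where
    open ℚ.≤-Reasoning
    η : ℚ
    η = half (half δ)
  ... | no near = N , λ i N≤i → begin-strict
      q                          <⟨ ℚ.≰⇒> near ⟩
      seq x N + (η + η)          <⟨ ℚ.+-monoˡ-< (η + η) (close-upper {seq x N} {seq x i} (close ℕ.≤-refl N≤i)) ⟩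
      seq x i + η + (η + η)      ≤⟨ ≤-by {d = η} (ℚ.<⇒≤ (half-pos (half-pos 0<δ))) (regroup (seq x i) η) ⟩
      seq x i + ((η + η) + (η + η)) ≡⟨ cong (λ e → seq x i + (e + e)) (half+half (half δ)) ⟩
      seq x i + (half δ + half δ)  ≡⟨ cong (seq x i +_) (half+half δ) ⟩
      seq x i + δ                ∎
    where
    open ℚ.≤-Reasoning
    η : ℚ
    η = half (half δ)
    regroup : ∀ x e → x + e + (e + e) + e ≡ x + ((e + e) + (e + e))
    regroup = solve-∀ ring

  -- The rational gap that a strict inequality demands is `d`, a quarter of q - p. The squares give
  -- x ≤ p + d eventually, and y ≥ p + 2d once y ≤ -(p + 2d) is excluded by 0 ≤ y.
  <-from-squares : ∀ {x y p q} → 0ℝ ≤ℝ y → 0ℚ ≤ p → p < q →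
    seq (x *ℝ x) lim≤ p * p → q * q ≤lim seq (y *ℝ y) → x <ℝ y
  <-from-squares {x} {y} {p} {q} 0≤y 0≤p p<q x≤ q≤y = d , 0<d , conclude
    (eventually₂ (λ {i} h k → ℚ.≤-trans (ℚ.+-monoˡ-≤ d h) k)
      (eventually-map (λ {i} → x-upper {i}) (x≤ 0<a²-p²))
      (eventually₂ (λ {i} → y-lower {i}) (q≤y 0<q²-b²) (≤ℝ⇒≤lim {y} {0ℝ} 0≤y (0 , λ _ _ → ℚ.≤-refl) 0<b)))
    where
    d a b : ℚ
    d = half (half (q - p))
    a = p + d
    b = a + d
    conclude : Eventually (λ i → seq x i + d ≤ seq y i) → ∃ λ N → ∀ {i} → N ℕ.≤ i → seq x i + d ≤ seq y i
    conclude (N , h) = N , λ {i} → h i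
    0<d : 0ℚ < d
    0<d = half-pos (half-pos (<⇒0< p<q))
    p<a : p < a
    p<a = <-by 0<d refl
    0<a : 0ℚ < a
    0<a = ℚ.≤-<-trans 0≤p p<a
    0<b : 0ℚ < b
    0<b = +-pos 0<a 0<d
    b<q : b < q
    b<q = <-by (+-pos 0<d 0<d) (begin-equality
      p + d + d + (d + d)          ≡⟨ regroup p d ⟩
      p + ((d + d) + (d + d))      ≡⟨ cong (λ e → p + (e + e)) (half+half (half (q - p))) ⟩
      p + (half (q - p) + half (q - p)) ≡⟨ cong (p +_) (half+half (q - p)) ⟩
      p + (q - p)                  ≡⟨ cancel p q ⟩
      q                            ∎)
      where
      open ℚ.≤-Reasoning
      regroup : ∀ p d → p + d + d + (d + d) ≡ p + ((d + d) + (d + d))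
      regroup = solve-∀ ring
      cancel : ∀ p q → p + (q - p) ≡ q
      cancel = solve-∀ ring
    difference : ∀ u v → (v - u) * (v + u) ≡ v * v - u * u
    difference = solve-∀ ring
    squares-< : ∀ {u v} → u < v → 0ℚ < v + u → 0ℚ < v * v - u * u
    squares-< {u} {v} u<v 0<v+u = subst (0ℚ <_) (difference u v) (*-pos (<⇒0< u<v) 0<v+u)
    0<a²-p² : 0ℚ < a * a - p * p
    0<a²-p² = squares-< p<a (ℚ.+-mono-<-≤ 0<a 0≤p)
    0<q²-b² : 0ℚ < q * q - b * b
    0<q²-b² = squares-< b<q (+-pos (ℚ.<-trans 0<b b<q) 0<b)
    cancel : ∀ u v → u + (v - u) ≡ v
    cancel = solve-∀ ring
    x-upper : ∀ {i} → seq x i * seq x i < p * p + (a * a - p * p) → seq x i ≤ a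
    x-upper {i} h = ℚ.≮⇒≥ λ a<x → ℚ.<-asym
      (subst (seq x i * seq x i <_) (cancel (p * p) (a * a)) h)
      (<-by (squares-< a<x (+-pos (ℚ.<-trans 0<a a<x) 0<a)) (cancel (a * a) (seq x i * seq x i)))
    y-lower : ∀ {i} → q * q < seq y i * seq y i + (q * q - b * b) → 0ℚ < seq y i + b → b ≤ seq y i
    y-lower {i} h 0<y+b = ℚ.≮⇒≥ λ y<b → ℚ.<-irrefl refl (begin-strict
      q * q                                    <⟨ h ⟩
      seq y i * seq y i + (q * q - b * b)      <⟨ <-by (squares-< y<b (subst (0ℚ <_) (ℚ.+-comm (seq y i) b) 0<y+b)) (regroup (seq y i) q b) ⟩
      q * q                                    ∎)
      where
      open ℚ.≤-Reasoning
      regroup : ∀ y q b → y * y + (q * q - b * b) + (b * b - y * y) ≡ q * q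
      regroup = solve-∀ ring

open Sequences


-- Upper and lower bounds for the spectral radius.

module SpectralBounds where

  open Rational
  open Sums

  Φ : ℕ → Shape → ℚ → ℚ
  Φ s t ν = ν + κ s ν - cost s ν t

  threshold : ℕ → ℚ → ℚ
  threshold s ν = reciprocal (suc s) * (ν + fromNat s)

  threshold-nonNeg : ∀ {s ν} → seven ≤ ν → 0ℚ ≤ threshold s ν
  threshold-nonNeg {s} 7≤ν = *-nonNeg (ℚ.<⇒≤ (reciprocal-pos s)) (+-nonNeg (ℚ.<⇒≤ (0<≥7 7≤ν)) (fromNat-nonNeg s))

  re-row : ∀ {n} (A : Fin n → ℝ) (a : Fin n → ℚ) → (∀ j → A j ≡ fromℚ (a j)) → (x : Fin n → ℂ) → ∀ i →
    seq (re (sumℂ (λ j → fromℝ (A j) *ℂ x j))) i ≡ sum (λ j → a j * seq (re (x j)) i)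
  re-row {zero}  A a eq x i = sym (sum-[] (λ j → a j * seq (re (x j)) i))
  re-row {suc n} A a eq x i = trans (cong₂ _+_ first (re-row (A ∘ suc) (a ∘ suc) (eq ∘ suc) (x ∘ suc) i))
    (sym (sum-∷ (λ j → a j * seq (re (x j)) i)))
    where
    simplify : ∀ a p q → a * p + (- (0ℚ * q)) ≡ a * p
    simplify = solve-∀ ring
    first : seq (A zero) i * seq (re (x zero)) i + (- (0ℚ * seq (im (x zero)) i)) ≡ a zero * seq (re (x zero)) i
    first = trans (cong (λ b → seq b i * seq (re (x zero)) i + (- (0ℚ * seq (im (x zero)) i))) (eq zero))
      (simplify (a zero) (seq (re (x zero)) i) (seq (im (x zero)) i))

  im-row : ∀ {n} (A : Fin n → ℝ) (a : Fin n → ℚ) → (∀ j → A j ≡ fromℚ (a j)) → (x : Fin n → ℂ) → ∀ i →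
    seq (im (sumℂ (λ j → fromℝ (A j) *ℂ x j))) i ≡ sum (λ j → a j * seq (im (x j)) i)
  im-row {zero}  A a eq x i = sym (sum-[] (λ j → a j * seq (im (x j)) i))
  im-row {suc n} A a eq x i = trans (cong₂ _+_ first (im-row (A ∘ suc) (a ∘ suc) (eq ∘ suc) (x ∘ suc) i))
    (sym (sum-∷ (λ j → a j * seq (im (x j)) i)))
    where
    simplify : ∀ a p q → a * q + 0ℚ * p ≡ a * q
    simplify = solve-∀ ring
    first : seq (A zero) i * seq (im (x zero)) i + 0ℚ * seq (re (x zero)) i ≡ a zero * seq (im (x zero)) i
    first = trans (cong (λ b → seq b i * seq (im (x zero)) i + 0ℚ * seq (re (x zero)) i) (eq zero))
      (simplify (a zero) (seq (re (x zero)) i) (seq (im (x zero)) i))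

  sum-≥ : ∀ {n} {f : Fin n → ℚ} → (∀ i → 0ℚ ≤ f i) → ∀ v → f v ≤ sum f
  sum-≥ {suc n} {f} 0≤f zero = subst (f zero ≤_) (sym (sum-∷ f)) (≤-by (sum-nonNeg (0≤f ∘ suc)) refl)
  sum-≥ {suc n} {f} 0≤f (suc v) = subst (f (suc v) ≤_) (sym (sum-∷ f))
    (ℚ.≤-trans (sum-≥ (0≤f ∘ suc) v) (≤-by (0≤f zero) (ℚ.+-comm (sum (f ∘ suc)) (f zero))))

  -- ∣z∣² Σ ∣x v∣² = Σ ∣(A x) v∣² up to a null sequence
  eigenvalue-bound : ∀ {n} (A : Matrix n) (a : Fin n → Fin n → ℚ) → (∀ i j → A i j ≡ fromℚ (a i j)) →
    ∀ T → 0ℚ ≤ T → (∀ (x : Fin n → ℚ) →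
      sum (λ i → sum (λ j → a i j * x j) * sum (λ j → a i j * x j)) ≤ T * sum (λ i → x i * x i)) →
    ∀ z → IsEigenvalue A z → seq (∣ z ∣²) lim≤ T
  eigenvalue-bound {n} A a A≡ T 0≤T norm z (x , (v₀ , e₀ , 0<e₀ , N₀ , x≥e₀) , eigen) {δ} 0<δ =
    -- Some coordinate of the eigenvector has squared modulus eventually at least `e₀`, so an error
    -- below `δ * e₀` amounts to less than δ after division by the squared norm.
    eventually₂ {P = λ i → error i < δ * e₀} {Q = λ i → e₀ ≤ norm² i} conclude
      (null-upper null-error (*-pos 0<δ 0<e₀))
      (N₀ , λ i N≤i → ℚ.≤-trans (subst (_≤ norm²-at v₀ i) (ℚ.+-identityˡ e₀) (x≥e₀ N≤i))
        (sum-≥ (λ v → norm²-nonNeg v i) v₀))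
    where
    p q : Fin n → ℕ → ℚ
    p v i = seq (re (x v)) i
    q v i = seq (im (x v)) i
    Ax : Fin n → ℂ
    Ax v = sumℂ (λ j → fromℝ (A v j) *ℂ x j)
    norm²-at : Fin n → ℕ → ℚ
    norm²-at v i = p v i * p v i + q v i * q v i
    norm²-nonNeg : ∀ v i → 0ℚ ≤ norm²-at v i
    norm²-nonNeg v i = +-nonNeg (square-nonNeg (p v i)) (square-nonNeg (q v i))
    norm² error : ℕ → ℚ
    norm² i = sum (λ v → norm²-at v i)
    error-at : Fin n → ℕ → ℚ
    error-at v i = (seq (re (z *ℂ x v)) i * seq (re (z *ℂ x v)) i - seq (re (Ax v)) i * seq (re (Ax v)) i)
      + (seq (im (z *ℂ x v)) i * seq (im (z *ℂ x v)) i - seq (im (Ax v)) i * seq (im (Ax v)) i)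
    error i = sum (λ v → error-at v i)
    null-error : Null error
    null-error = null-sum error-at λ v → null-+
      (null-squares {re (z *ℂ x v)} {re (Ax v)} (≈ℝ-sym {re (Ax v)} {re (z *ℂ x v)} (proj₁ (eigen v))))
      (null-squares {im (z *ℂ x v)} {im (Ax v)} (≈ℝ-sym {im (Ax v)} {im (z *ℂ x v)} (proj₂ (eigen v))))
      where
      ≈ℝ-sym : ∀ {x y} → x ≈ℝ y → y ≈ℝ x
      ≈ℝ-sym {x} {y} x≈y 0<ε = let N , close = x≈y 0<ε in
        N , λ {i} N≤i → subst (_< _) (∣-∣-swap (seq x i) (seq y i)) (close N≤i)
    rows : ℕ → ℚ
    rows i = sum (λ v → sum (λ j → a v j * p j i) * sum (λ j → a v j * p j i))
      + sum (λ v → sum (λ j → a v j * q j i) * sum (λ j → a v j * q j i))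
    balance : ∀ i → norm² i * seq (∣ z ∣²) i ≡ rows i + error i
    balance i = begin
      norm² i * Z
        ≡⟨ ℚ.*-comm (norm² i) Z ⟩
      Z * norm² i
        ≡⟨ *-distribˡ-sum Z (λ v → norm²-at v i) ⟩
      sum (λ v → Z * norm²-at v i)
        ≡⟨ sum-cong-≗ pointwise ⟩
      sum (λ v → R v * R v + I v * I v + error-at v i)
        ≡⟨ ∑-distrib-+ (λ v → R v * R v + I v * I v) (λ v → error-at v i) ⟩
      sum (λ v → R v * R v + I v * I v) + error i
        ≡⟨ cong (_+ error i) (∑-distrib-+ (λ v → R v * R v) (λ v → I v * I v)) ⟩
      rows i + error i ∎
      where
      open ≡-Reasoning
      Z : ℚ
      Z = seq (∣ z ∣²) i
      R I : Fin n → ℚ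
      R v = sum (λ j → a v j * p j i)
      I v = sum (λ j → a v j * q j i)
      regroup : ∀ zr zi p q R I → (zr * zr + zi * zi) * (p * p + q * q)
        ≡ R * R + I * I + ((((zr * p + (- (zi * q))) * (zr * p + (- (zi * q)))) - R * R)
          + ((zr * q + zi * p) * (zr * q + zi * p) - I * I))
      regroup = solve-∀ ring
      pointwise : ∀ v → Z * norm²-at v i ≡ R v * R v + I v * I v + error-at v i
      pointwise v = trans (regroup (seq (re z) i) (seq (im z) i) (p v i) (q v i) (R v) (I v))
        (cong₂ (λ r s → R v * R v + I v * I v
            + ((seq (re (z *ℂ x v)) i * seq (re (z *ℂ x v)) i - r * r)
              + (seq (im (z *ℂ x v)) i * seq (im (z *ℂ x v)) i - s * s)))
          (sym (re-row (A v) (a v) (A≡ v) x i)) (sym (im-row (A v) (a v) (A≡ v) x i)))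
    rows-≤ : ∀ i → rows i ≤ T * norm² i
    rows-≤ i = ℚ.≤-trans (ℚ.+-mono-≤ (norm (λ v → p v i)) (norm (λ v → q v i)))
      (ℚ.≤-reflexive (trans (sym (ℚ.*-distribˡ-+ T _ _))
        (cong (T *_) (sym (∑-distrib-+ (λ v → p v i * p v i) (λ v → q v i * q v i))))))
    conclude : ∀ {i} → error i < δ * e₀ → e₀ ≤ norm² i → seq (∣ z ∣²) i < T + δ
    conclude {i} small large = *-cancelˡ-< (ℚ.≤-trans (ℚ.<⇒≤ 0<e₀) large) (begin-strict
      norm² i * seq (∣ z ∣²) i   ≡⟨ balance i ⟩
      rows i + error i           <⟨ ℚ.+-mono-≤-< (rows-≤ i) small ⟩
      T * norm² i + δ * e₀       ≤⟨ ℚ.+-monoʳ-≤ (T * norm² i) (*-monoˡ (ℚ.<⇒≤ 0<δ) large) ⟩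
      T * norm² i + δ * norm² i  ≡⟨ collect T δ (norm² i) ⟩
      norm² i * (T + δ)          ∎)
      where
      open ℚ.≤-Reasoning
      collect : ∀ T δ N → T * N + δ * N ≡ N * (T + δ)
      collect = solve-∀ ring

  module _ {s : ℕ} {H : Hypergraph} {u : Vertex H} {F : Forest s (Vertex H)} (M : Model H u F)
    {ρ : ℝ} (radius : IsSpectralRadius (adjacency (suc (suc s)) H) ρ) where

    open IsSpectralRadius radius

    -- The eigenvalue that attains the radius may be complex. Since the matrix is rational, the norm
    -- bound applies separately to the approximations of the real and imaginary parts of its
    -- eigenvector.
    radius-≤ : ∀ {ν} → seven ≤ ν → Regular s ν (shape F) → 0ℚ ≤ Φ s (shape F) ν →
      seq (ρ *ℝ ρ) lim≤ threshold s ν * threshold s ν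
    radius-≤ {ν} 7≤ν regular 0≤Φ {δ} 0<δ =
      let z , eigen , z≈ρ = attained in
      eventually₂ (combine {z})
        (≈⇒null {∣ z ∣²} {ρ *ℝ ρ} z≈ρ (half δ) (half-pos 0<δ))
        (eigenvalue-bound (adjacency m H) (entry m H) (adjacency≡ m H) τ
          (*-nonNeg (threshold-nonNeg {s} 7≤ν) (threshold-nonNeg {s} 7≤ν))
          (norm-bound (entry m H) (λ v → vector v ν) (threshold s ν) (entry-nonNeg {s} {H}) (entry-sym {s} {H})
            (vector-pos M 7≤ν regular) (threshold-nonNeg {s} 7≤ν) (subinvariant M 7≤ν regular cost≤))
          z eigen (half-pos 0<δ))
      where
      open Eigenvector (eigenvector M)
      m : ℕ
      m = suc (suc s)
      τ : ℚ
      τ = threshold s ν * threshold s ν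
      cost≤ : cost s ν (shape F) ≤ ν + κ s ν
      cost≤ = ≤-by 0≤Φ (cancel (cost s ν (shape F)) (ν + κ s ν))
        where
        cancel : ∀ c d → c + (d - c) ≡ d
        cancel = solve-∀ ring
      combine : ∀ {z i} → ℚ.∣ seq (∣ z ∣²) i - seq (ρ *ℝ ρ) i ∣ < half δ → seq (∣ z ∣²) i < τ + half δ →
        seq (ρ *ℝ ρ) i < τ + δ
      combine {z} {i} close z< = ℚ.<-trans
        (close-lower {seq (∣ z ∣²) i} close)
        (subst (seq (∣ z ∣²) i + half δ <_)
          (trans (ℚ.+-assoc τ (half δ) (half δ)) (cong (τ +_) (half+half δ)))
          (ℚ.+-monoˡ-< (half δ) z<))

    module _ (uniform : UniformlyRegular s (shape F)) (x : ℕ → ℚ) (7≤x : ∀ i → seven ≤ x i)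
      (x-cauchy : IsCauchy x) (root-of-Φ : Null (Φ s (shape F) ∘ x)) where

      open Eigenvector (eigenvector M)

      private
        m : ℕ
        m = suc (suc s)
        q S : ℚ
        q = reciprocal (suc s)
        S = fromNat s
        C : ℚ → ℚ
        C ν = cost s ν (shape F)

      vector-continuous : ∀ v → Continuous (vector v)
      vector-continuous v with Model.covers M v
      ... | here refl = subst Continuous (sym root) (const-continuous 1ℚ)
      ... | there v∈  = All.lookup all (subst (vector v ∈ˡ_) map-vertices (Membership.∈-map⁺ vector v∈))
        where
        map-vertices : map vector (vertices F) ≡ vertices (values s (vector u) (shape F))
        map-vertices = trans (sym (vertices-map vector F)) (cong vertices below)
        all : All Continuous (vertices (values s (vector u) (shape F)))
        all = values-All s {P = Continuous} {Q = λ c → ∀ {ν} → seven ≤ ν → 1ℚ ≤ ν - cost s ν c}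
          (λ {a} {c} ca 1≤g reg → *-continuous
            (inv-continuous (+-continuous id-continuous (neg-continuous (cost-continuous s c reg))) 1≤g) ca)
          (λ ca cb → *-continuous (+-continuous ca cb)
            (inv-continuous (+-continuous id-continuous (const-continuous 1ℚ)) (λ 7≤ν → 1≤ν+ 7≤ν (ℚ.<⇒≤ 0<1))))
          (shape F) (subst Continuous (sym root) (const-continuous 1ℚ)) uniform

      eigenvalue : ℝ
      eigenvalue = mkℝ (λ i → q * (x i + S))
        (preserves (*-continuous (const-continuous q) (+-continuous id-continuous (const-continuous S)))
          x 7≤x x-cauchy)

      private
        X : Vertex H → ℂ
        X v = fromℝ (mkℝ (vector v ∘ x) (preserves (vector-continuous v) x 7≤x x-cauchy))

        row : Vertex H → ℕ → ℚ
        row v i = sum (λ j → entry m H v j * vector j (x i))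

        residual : ∀ v → Null (λ i → row v i - q * (x i + S) * vector v (x i))
        residual v with Model.covers M v
        ... | there v∈ = null-≡ (λ i → sym (trans
          (cong (_- q * (x i + S) * vector v (x i))
            (eigen-below M (7≤x i) (uniformly-regular (7≤x i) (shape F) uniform) v∈))
          (ℚ.+-inverseʳ (q * (x i + S) * vector v (x i))))) null-0
        -- At the root the residual is -qEΦ(x i), a null sequence times a Cauchy sequence.
        ... | here refl = null-≡ at-root
          (null-* {y = λ i → - (q * E s (x i))} root-of-Φ
            (preserves (neg-continuous (*-continuous (const-continuous q) (E-continuous s))) x 7≤x x-cauchy))
          where
          regroup : ∀ q e ν k c → (ν + k - c) * (- (q * e)) ≡ q * (e * c) - q * (e * (ν + k)) * 1ℚ
          regroup = solve-∀ ring
          at-root : ∀ i → Φ s (shape F) (x i) * (- (q * E s (x i))) ≡ row u i - q * (x i + S) * vector u (x i)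
          at-root i = trans (regroup q (E s (x i)) (x i) (κ s (x i)) (C (x i)))
            (cong₂ _-_ (sym (eigen-root M (7≤x i) (uniformly-regular (7≤x i) (shape F) uniform)))
              (cong₂ (λ e a → q * e * a) (E-total {s} (0<≥7 (7≤x i)))
                (sym (vector-root M (7≤x i) (uniformly-regular (7≤x i) (shape F) uniform)))))

      isEigenvalue : IsEigenvalue (adjacency m H) (fromℝ eigenvalue)
      isEigenvalue = X
        , (u , 1ℚ , 0<1 , 0 , λ {i} _ → ℚ.≤-reflexive (sym (nonzero i)))
        , λ v → null⇒≈ {re (rows v)} {re (fromℝ eigenvalue *ℂ X v)} (null-≡ (λ i → cong₂ _-_
                  (sym (re-row (adjacency m H v) (entry m H v) (adjacency≡ m H v) X i))
                  (real (q * (x i + S)) (vector v (x i)))) (residual v))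
              , null⇒≈ {im (rows v)} {im (fromℝ eigenvalue *ℂ X v)} (null-≡ (λ i → sym (trans (cong₂ _-_
                  (trans (im-row (adjacency m H v) (entry m H v) (adjacency≡ m H v) X i)
                    (sum-zero (λ j → ℚ.*-zeroʳ (entry m H v j))))
                  (imaginary (q * (x i + S)) (vector v (x i)))) (ℚ.+-inverseʳ 0ℚ))) null-0)
        where
        rows : Vertex H → ℂ
        rows v = sumℂ (λ j → fromℝ (adjacency m H v j) *ℂ X j)
        one-zero : ∀ a → a ≡ 1ℚ → a * a + 0ℚ * 0ℚ ≡ 0ℚ + 1ℚ
        one-zero a refl = refl
        nonzero : ∀ i → vector u (x i) * vector u (x i) + 0ℚ * 0ℚ ≡ 0ℚ + 1ℚ
        nonzero i = one-zero (vector u (x i)) (cong (λ f → f (x i)) root)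
        real : ∀ a b → a * b ≡ a * b + (- (0ℚ * 0ℚ))
        real = solve-∀ ring
        imaginary : ∀ a b → a * 0ℚ + 0ℚ * b ≡ 0ℚ
        imaginary = solve-∀ ring

      ≤-radius : ∀ {ν} → seven ≤ ν → Eventually (λ i → ν ≤ x i) →
        threshold s ν * threshold s ν ≤lim seq (ρ *ℝ ρ)
      ≤-radius {ν} 7≤ν large = ≤ℝ⇒≤lim {ρ *ℝ ρ} {∣ fromℝ eigenvalue ∣²} (dominates (fromℝ eigenvalue) isEigenvalue)
        (eventually-map (λ {i} ν≤x → subst (threshold s ν * threshold s ν ≤_) (pad-zero (q * (x i + S)))
          (*-mono (threshold-nonNeg {s} 7≤ν) (threshold-nonNeg {s} 7≤ν) (bound ν≤x) (bound ν≤x))) large)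
        where
        bound : ∀ {b} → ν ≤ b → threshold s ν ≤ q * (b + S)
        bound ν≤b = *-monoˡ (ℚ.<⇒≤ (reciprocal-pos s)) (ℚ.+-monoˡ-≤ S ν≤b)
        pad-zero : ∀ a → a * a ≡ a * a + 0ℚ * 0ℚ
        pad-zero = solve-∀ ring

open SpectralBounds


-- Bisection, and the comparison of two spectral radii.

module Bisection where

  open Rational

  archimedean : ∀ q → ∃ λ N → q < fromNat N
  archimedean q@(ℚ.mkℚ n d _) = suc ℤ.∣ n ∣ , ℚ.toℚᵘ-cancel-<
    (ℚᵘ.<-respʳ-≃ (ℚᵘ.≃-sym (toℚᵘ-fromNat (suc ℤ.∣ n ∣))) (ℚᵘ.*<* (subst₂ ℤ._<_
      (sym (ℤ.*-identityʳ n)) refl (ℤ.≤-<-trans (i≤∣i∣ n) (ℤ.+<+ bound)))))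
    where
    toℚᵘ-fromNat : ∀ N → ℚ.toℚᵘ (fromNat N) ℚᵘ.≃ ℚᵘ.mkℚᵘ (ℤ.+ N) 0
    toℚᵘ-fromNat zero    = ℚᵘ.≃-refl
    toℚᵘ-fromNat (suc N) = ℚᵘ.≃-trans (ℚ.toℚᵘ-homo-+ 1ℚ (fromNat N))
      (ℚᵘ.≃-trans (ℚᵘ.+-congʳ (ℚ.toℚᵘ 1ℚ) (toℚᵘ-fromNat N)) (ℚᵘ.≃-reflexive (cong (λ k → ℚᵘ.mkℚᵘ k 0)
        (cong (λ k → ℤ.+ 1 ℤ.+ k) (ℤ.*-identityʳ (ℤ.+ N))))))
    i≤∣i∣ : ∀ i → i ℤ.≤ ℤ.+ ℤ.∣ i ∣
    i≤∣i∣ (ℤ.+ _)      = ℤ.≤-refl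
    i≤∣i∣ (ℤ.-[1+ _ ]) = ℤ.-≤+
    bound : ℤ.∣ n ∣ ℕ.< suc ℤ.∣ n ∣ ℕ.* suc d
    bound = ℕ.m≤m*n (suc ℤ.∣ n ∣) (suc d)

  module _ (f : ℚ → ℚ) (f-continuous : Continuous f) {a b : ℚ} (7≤a : seven ≤ a) (a≤b : a ≤ b)
    (fa<0 : f a < 0ℚ) (0≤fb : 0ℚ ≤ f b) where

    record Bracket : Set where
      field
        lo hi : ℚ
        lo≤hi : lo ≤ hi
        negative   : f lo < 0ℚ
        nonNeg     : 0ℚ ≤ f hi

    open Bracket

    midpoint : ℚ → ℚ → ℚ
    midpoint l r = half (l + r)

    midpoint-sum : ∀ l r → midpoint l r + midpoint l r ≡ l + r
    midpoint-sum l r = half+half (l + r)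

    double-≤ : ∀ {p q} → p + p ≤ q + q → p ≤ q
    double-≤ {p} {q} h = ℚ.≮⇒≥ λ q<p → ℚ.<-irrefl refl (ℚ.<-≤-trans (ℚ.+-mono-< q<p q<p) h)

    lo≤midpoint : ∀ {l r} → l ≤ r → l ≤ midpoint l r
    lo≤midpoint {l} {r} l≤r = double-≤ (subst (l + l ≤_) (sym (midpoint-sum l r)) (ℚ.+-monoʳ-≤ l l≤r))

    midpoint≤hi : ∀ {l r} → l ≤ r → midpoint l r ≤ r
    midpoint≤hi {l} {r} l≤r = double-≤ (subst (_≤ r + r) (sym (midpoint-sum l r)) (ℚ.+-monoˡ-≤ r l≤r))

    refine : Bracket → Bracket
    refine B with 0ℚ ℚ.≤? f (midpoint (lo B) (hi B))
    ... | yes 0≤ = record { lo≤hi = lo≤midpoint (lo≤hi B) ; negative = negative B ; nonNeg = 0≤ }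
    ... | no ¬0≤ = record { lo≤hi = midpoint≤hi (lo≤hi B) ; negative = ℚ.≰⇒> ¬0≤ ; nonNeg = nonNeg B }

    bracket : ℕ → Bracket
    bracket zero    = record { lo≤hi = a≤b ; negative = fa<0 ; nonNeg = 0≤fb }
    bracket (suc j) = refine (bracket j)

    l r : ℕ → ℚ
    l j = lo (bracket j)
    r j = hi (bracket j)

    refine-lo : ∀ B → lo B ≤ lo (refine B)
    refine-lo B with 0ℚ ℚ.≤? f (midpoint (lo B) (hi B))
    ... | yes _ = ℚ.≤-refl
    ... | no _  = lo≤midpoint (lo≤hi B)

    refine-hi : ∀ B → hi (refine B) ≤ hi B
    refine-hi B with 0ℚ ℚ.≤? f (midpoint (lo B) (hi B))
    ... | yes _ = midpoint≤hi (lo≤hi B)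
    ... | no _  = ℚ.≤-refl

    width : Bracket → ℚ
    width B = hi B - lo B

    refine-width : ∀ B → width (refine B) + width (refine B) ≡ width B
    refine-width B with 0ℚ ℚ.≤? f (midpoint (lo B) (hi B))
    ... | yes _ = trans (first (lo B) (midpoint (lo B) (hi B)))
      (trans (cong (_- (lo B + lo B)) (midpoint-sum (lo B) (hi B))) (second (lo B) (hi B)))
      where
      first : ∀ l m → m - l + (m - l) ≡ m + m - (l + l)
      first = solve-∀ ring
      second : ∀ l r → l + r - (l + l) ≡ r - l
      second = solve-∀ ring
    ... | no _ = trans (first (hi B) (midpoint (lo B) (hi B)))
      (trans (cong (λ w → (hi B + hi B) - w) (midpoint-sum (lo B) (hi B))) (second (lo B) (hi B)))
      where
      first : ∀ r m → r - m + (r - m) ≡ r + r - (m + m)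
      first = solve-∀ ring
      second : ∀ l r → r + r - (l + r) ≡ r - l
      second = solve-∀ ring

    l-mono : ∀ {i j} → i ℕ.≤ j → l i ≤ l j
    l-mono {i} i≤j = go (ℕ.≤⇒≤′ i≤j)
      where
      go : ∀ {j} → i ℕ.≤′ j → l i ≤ l j
      go (ℕ.≤′-reflexive refl) = ℚ.≤-refl
      go (ℕ.≤′-step {j} i≤j)   = ℚ.≤-trans (go i≤j) (refine-lo (bracket j))

    r-anti : ∀ {i j} → i ℕ.≤ j → r j ≤ r i
    r-anti {i} i≤j = go (ℕ.≤⇒≤′ i≤j)
      where
      go : ∀ {j} → i ℕ.≤′ j → r j ≤ r i
      go (ℕ.≤′-reflexive refl) = ℚ.≤-refl
      go (ℕ.≤′-step {j} i≤j)   = ℚ.≤-trans (refine-hi (bracket j)) (go i≤j)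

    width-nonNeg : ∀ j → 0ℚ ≤ width (bracket j)
    width-nonNeg j = ≤⇒0≤ (lo≤hi (bracket j))

    -- The width is (b - a)/2^j; the weaker bound with j + 1 in place of 2^j suffices and follows
    -- from j + 2 ≤ 2(j + 1).
    width-bound : ∀ j → fromNat (suc j) * width (bracket j) ≤ b - a
    width-bound zero = ℚ.≤-reflexive (simplify (b - a))
      where
      simplify : ∀ w → 1ℚ * w ≡ w
      simplify = solve-∀ ring
    width-bound (suc j) = ℚ.≤-trans (≤-by (*-nonNeg (fromNat-nonNeg j) (width-nonNeg (suc j)))
      (trans (regroup (fromNat j) (width (bracket (suc j))))
        (cong (fromNat (suc j) *_) (refine-width (bracket j))))) (width-bound j)
      where
      regroup : ∀ k w → (1ℚ + (1ℚ + k)) * w + k * w ≡ (1ℚ + k) * (w + w)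
      regroup = solve-∀ ring

    width-small : ∀ {δ} → 0ℚ < δ → ∃ λ N → width (bracket N) < δ
    width-small {δ} 0<δ = let N , large = archimedean ((b - a) * inv δ) in
      N , *-cancelˡ-< (fromNat-nonNeg (suc N)) (begin-strict
        fromNat (suc N) * width (bracket N)  ≤⟨ width-bound N ⟩
        b - a                                ≡⟨ ℚ.*-identityʳ (b - a) ⟨
        (b - a) * 1ℚ                         ≡⟨ cong ((b - a) *_) (inv-inverse 0<δ) ⟨
        (b - a) * (δ * inv δ)                ≡⟨ regroup (b - a) δ (inv δ) ⟩
        (b - a) * inv δ * δ                  <⟨ ℚ.*-monoˡ-<-pos δ {{ℚ.positive 0<δ}} (ℚ.<-≤-trans large (fromNat-mono (ℕ.n≤1+n N))) ⟩
        fromNat (suc N) * δ                  ∎)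
      where
      open ℚ.≤-Reasoning
      regroup : ∀ c d i → c * (d * i) ≡ c * i * d
      regroup = solve-∀ ring

    private
      -- Interleaves the left and right ends into one Cauchy sequence. Its image under `f` is
      -- Cauchy, so f (l j) and f (r j) approach each other, and their opposite signs force f (l j)
      -- to 0.
      alternate : (ℕ → ℚ) → (ℕ → ℚ) → ℕ → ℚ
      alternate x y zero          = x 0
      alternate x y (suc zero)    = y 0
      alternate x y (suc (suc i)) = alternate (x ∘ suc) (y ∘ suc) i

      alternate-even : ∀ x y j → alternate x y (j ℕ.+ j) ≡ x j
      alternate-even x y zero    = refl
      alternate-even x y (suc j) =
        trans (cong (λ i → alternate x y (1 ℕ.+ i)) (ℕ.+-suc j j)) (alternate-even (x ∘ suc) (y ∘ suc) j)

      alternate-odd : ∀ x y j → alternate x y (suc (j ℕ.+ j)) ≡ y j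
      alternate-odd x y zero    = refl
      alternate-odd x y (suc j) =
        trans (cong (λ i → alternate x y (2 ℕ.+ i)) (ℕ.+-suc j j)) (alternate-odd (x ∘ suc) (y ∘ suc) j)

      alternate-∈ : ∀ {P : ℚ → Set} x y → ∀ N → (∀ j → N ℕ.≤ j → P (x j)) → (∀ j → N ℕ.≤ j → P (y j)) →
        ∀ i → N ℕ.+ N ℕ.≤ i → P (alternate x y i)
      alternate-∈ x y zero px py zero _ = px 0 z≤n
      alternate-∈ x y zero px py (suc zero) _ = py 0 z≤n
      alternate-∈ {P} x y zero px py (suc (suc i)) _ =
        alternate-∈ {P} (x ∘ suc) (y ∘ suc) zero (λ j _ → px (suc j) z≤n) (λ j _ → py (suc j) z≤n) i z≤n
      alternate-∈ {P} x y (suc N) px py i N≤i with subst (ℕ._≤ i) (cong suc (ℕ.+-suc N N)) N≤i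
      ... | s≤s (s≤s N≤i′) = alternate-∈ {P} (x ∘ suc) (y ∘ suc) N
        (λ j N≤j → px (suc j) (s≤s N≤j)) (λ j N≤j → py (suc j) (s≤s N≤j)) _ N≤i′

      ends : ℕ → ℚ
      ends = alternate l r

      Inside : ℕ → ℚ → Set
      Inside N q = l N ≤ q × q ≤ r N

      l-inside : ∀ N j → N ℕ.≤ j → Inside N (l j)
      l-inside N j N≤j = l-mono N≤j , ℚ.≤-trans (lo≤hi (bracket j)) (r-anti N≤j)

      r-inside : ∀ N j → N ℕ.≤ j → Inside N (r j)
      r-inside N j N≤j = ℚ.≤-trans (l-mono N≤j) (lo≤hi (bracket j)) , r-anti N≤j

      inside-close : ∀ {N p q δ} → width (bracket N) < δ → Inside N p → Inside N q → ℚ.∣ p - q ∣ < δ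
      inside-close {N} {p} {q} w<δ (l≤p , p≤r) (l≤q , q≤r) = ∣-∣-<
        (ℚ.≤-<-trans (ℚ.+-mono-≤ p≤r (ℚ.neg-antimono-≤ l≤q)) w<δ)
        (ℚ.≤-<-trans (subst (_≤ width (bracket N)) (negate p q) (ℚ.+-mono-≤ q≤r (ℚ.neg-antimono-≤ l≤p))) w<δ)
        where
        negate : ∀ p q → q - p ≡ - (p - q)
        negate = solve-∀ ring

      7≤inside : ∀ {q} → Inside 0 q → seven ≤ q
      7≤inside (a≤q , _) = ℚ.≤-trans 7≤a a≤q

      7≤ends : ∀ i → seven ≤ ends i
      7≤ends i = 7≤inside (alternate-∈ {Inside 0} l r 0 (l-inside 0) (r-inside 0) i z≤n)

      ends-cauchy : IsCauchy ends
      ends-cauchy 0<δ = let N , w<δ = width-small 0<δ in N ℕ.+ N , λ {i} {j} N≤i N≤j →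
        inside-close {N} w<δ (alternate-∈ {Inside N} l r N (l-inside N) (r-inside N) i N≤i)
                             (alternate-∈ {Inside N} l r N (l-inside N) (r-inside N) j N≤j)

    7≤l : ∀ j → seven ≤ l j
    7≤l j = 7≤inside (l-inside 0 j z≤n)

    l≤b : ∀ j → l j ≤ b
    l≤b j = proj₂ (l-inside 0 j z≤n)

    l-cauchy : IsCauchy l
    l-cauchy 0<δ = let N , w<δ = width-small 0<δ in N , λ {i} {j} N≤i N≤j →
      inside-close {N} w<δ (l-inside N i N≤i) (l-inside N j N≤j)

    l-negative : ∀ j → f (l j) < 0ℚ
    l-negative j = negative (bracket j)

    l-root : Null (f ∘ l)
    l-root δ 0<δ = let N , close = preserves f-continuous ends 7≤ends ends-cauchy 0<δ in
      N , λ j N≤j → small j (subst₂ (λ p q → ℚ.∣ f p - f q ∣ < δ) (alternate-even l r j) (alternate-odd l r j)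
        (close (ℕ.≤-trans N≤j (ℕ.m≤m+n j j)) (ℕ.≤-trans N≤j (ℕ.≤-trans (ℕ.m≤m+n j j) (ℕ.n≤1+n _)))))
      where
      cancel : ∀ p → 0ℚ - p ≡ - p
      cancel = solve-∀ ring
      negate : ∀ p q → q - p ≡ - (p - q)
      negate = solve-∀ ring
      small : ∀ j → ℚ.∣ f (l j) - f (r j) ∣ < δ → ℚ.∣ f (l j) ∣ < δ
      small j close = ∣-∣-< (ℚ.<-trans (l-negative j) 0<δ) (begin-strict
        - f (l j)                  ≡⟨ cancel (f (l j)) ⟨
        0ℚ - f (l j)               ≤⟨ ℚ.+-monoˡ-≤ (- f (l j)) (nonNeg (bracket j)) ⟩
        f (r j) - f (l j)          ≤⟨ ≤-∣-∣ (f (r j) - f (l j)) ⟩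
        ℚ.∣ f (r j) - f (l j) ∣    ≡⟨ ∣-∣-swap (f (r j)) (f (l j)) ⟩
        ℚ.∣ f (l j) - f (r j) ∣    <⟨ close ⟩
        δ                          ∎)
        where open ℚ.≤-Reasoning

  -- The comparison takes place at a rational ν₀, a left end of the bisection for `H` with -γ <
  -- Φ(ν₀) < 0. There `bound` provides a subinvariant vector for `G`, so σ is at most the threshold
  -- at ν₀; a later left end ν₁ > ν₀ gives the lower bound for ρ.
  separate : ∀ {s t t′ H G} → HasShape s H t → HasShape s G t′ → UniformlyRegular s t →
    ∀ {a b} → seven ≤ a → a ≤ b → Φ s t a < 0ℚ → 0ℚ ≤ Φ s t b →
    ∀ {γ} → 0ℚ < γ →
    (∀ {ν} → seven ≤ ν → ν ≤ b → - γ < Φ s t ν → Φ s t ν < 0ℚ → Regular s ν t′ × 0ℚ ≤ Φ s t′ ν) →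
    ∀ {ρ σ} → IsSpectralRadius (adjacency (suc (suc s)) H) ρ → IsSpectralRadius (adjacency (suc (suc s)) G) σ →
    σ <ℝ ρ
  separate {s} {t} {t′} (_ , F , M , refl) (_ , F′ , N , refl) uniform {a} {b} 7≤a a≤b Φa<0 0≤Φb {γ} 0<γ bound {ρ} {σ} radius radius′ =
    <-from-squares {σ} {ρ} (IsSpectralRadius.nonNegative radius) (threshold-nonNeg {s} 7≤ν₀) (threshold-mono ν₀<ν₁)
      (radius-≤ N radius′ 7≤ν₀ (proj₁ certificate) (proj₂ certificate))
      (≤-radius M radius uniform x (7≤l f fc 7≤a a≤b Φa<0 0≤Φb) (l-cauchy f fc 7≤a a≤b Φa<0 0≤Φb) null
        (7≤l f fc 7≤a a≤b Φa<0 0≤Φb j₁) (j₁ , λ i → l-mono f fc 7≤a a≤b Φa<0 0≤Φb))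
    where
    f : ℚ → ℚ
    f = Φ s t
    fc : Continuous f
    fc = +-continuous (+-continuous id-continuous (κ-continuous s)) (neg-continuous (cost-continuous s t uniform))
    x : ℕ → ℚ
    x = l f fc 7≤a a≤b Φa<0 0≤Φb
    null : Null (f ∘ x)
    null = l-root f fc 7≤a a≤b Φa<0 0≤Φb
    abstract
      above : ∀ δ → 0ℚ < δ → Eventually (λ j → - δ < f (x j))
      above δ 0<δ = eventually-map (λ {j} small → negate (ℚ.≤-<-trans (≤-∣-∣ (- f (x j)))
        (subst (_< δ) (sym (ℚ.∣-p∣≡∣p∣ (f (x j)))) small))) (null δ 0<δ)
        where
        double-negation : ∀ p → - (- p) ≡ p
        double-negation = solve-∀ ring
        negate : ∀ {p} → - p < δ → - δ < p
        negate {p} h = subst (- δ <_) (double-negation p) (ℚ.neg-antimono-< h)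
    j₀ j₁ : ℕ
    j₀ = proj₁ (above γ 0<γ)
    ν₀ : ℚ
    ν₀ = x j₀
    7≤ν₀ : seven ≤ ν₀
    7≤ν₀ = 7≤l f fc 7≤a a≤b Φa<0 0≤Φb j₀
    fν₀<0 : f ν₀ < 0ℚ
    fν₀<0 = l-negative f fc 7≤a a≤b Φa<0 0≤Φb j₀
    certificate : Regular s ν₀ t′ × 0ℚ ≤ Φ s t′ ν₀
    certificate = bound 7≤ν₀ (l≤b f fc 7≤a a≤b Φa<0 0≤Φb j₀) (proj₂ (above γ 0<γ) j₀ ℕ.≤-refl) fν₀<0
    -- Φ is negative at ν₀ and tends to 0 along the left ends, so a later left end has a larger
    -- value of Φ. It therefore differs from ν₀, and by monotonicity of the left ends it is larger.
    later : Eventually (λ j → - (- f ν₀) < f (x j))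
    later = above (- f ν₀) (ℚ.neg-antimono-< fν₀<0)
    j₁ = j₀ ℕ.⊔ proj₁ later
    ν₀<ν₁ : ν₀ < x j₁
    ν₀<ν₁ = ℚ.≰⇒> λ ν₁≤ν₀ → ℚ.<-irrefl
      (trans (double-negation (f ν₀)) (cong f (ℚ.≤-antisym
        (l-mono f fc 7≤a a≤b Φa<0 0≤Φb (ℕ.m≤m⊔n j₀ (proj₁ later))) ν₁≤ν₀)))
      (proj₂ later j₁ (ℕ.m≤n⊔m j₀ (proj₁ later)))
      where
      double-negation : ∀ p → - (- p) ≡ p
      double-negation = solve-∀ ring
    threshold-mono : ∀ {p q} → p < q → threshold s p < threshold s q
    threshold-mono p<q = ℚ.*-monoʳ-<-pos (reciprocal (suc s)) {{ℚ.positive (reciprocal-pos s)}}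
      (ℚ.+-monoˡ-< (fromNat s) p<q)

open Bisection


-- Estimates of costs for ν ≥ 7.

module Costs (s : ℕ) {ν : ℚ} (7≤ν : seven ℚ.≤ ν) where

  open Rational

  -- `α` is the cost of a pendant edge; in general an edge above a part of cost x costs
  -- `κ s ν + ψ x`.
  β α : ℚ
  β = inv ν
  α = κ s ν + β

  ψ : ℚ → ℚ
  ψ x = inv (ν - x)

  private
    k : ℚ
    k = κ s ν
    0<ν : 0ℚ < ν
    0<ν = 0<≥7 7≤ν

  ν-inverse : ν * β ≡ 1ℚ
  ν-inverse = inv-inverse 0<ν

  0<β : 0ℚ < β
  0<β = inv-pos 0<ν

  seven-β≤1 : seven * β ≤ 1ℚ
  seven-β≤1 = subst (seven * β ≤_) ν-inverse (*-monoʳ (ℚ.<⇒≤ 0<β) 7≤ν)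

  four-β≤1 : four * β ≤ 1ℚ
  four-β≤1 = ℚ.≤-trans (≤-by (*-nonNeg (fromNat-nonNeg 3) (ℚ.<⇒≤ 0<β)) (regroup β)) seven-β≤1
    where
    regroup : ∀ β → four * β + three * β
      ≡ seven * β
    regroup = solve-∀ ring

  β≤1 : β ≤ 1ℚ
  β≤1 = ℚ.≤-trans (≤-by (*-nonNeg (fromNat-nonNeg 3) (ℚ.<⇒≤ 0<β)) (regroup β)) four-β≤1
    where
    regroup : ∀ β → β + three * β ≡ four * β
    regroup = solve-∀ ring

  0≤κ : 0ℚ ≤ k
  0≤κ = *-nonNeg (fromNat-nonNeg s) (ℚ.<⇒≤ (inv-pos (+-pos 0<ν (fromNat-pos s))))

  κ≤1 : k ≤ 1ℚ
  κ≤1 = subst (k ≤_) (inv-inverse 0<ν+n) (*-monoʳ (ℚ.<⇒≤ (inv-pos 0<ν+n))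
    (≤-by {fromNat s} (+-nonNeg (ℚ.<⇒≤ 0<ν) (ℚ.<⇒≤ 0<1)) (regroup (fromNat s) ν)))
    where
    0<ν+n : 0ℚ < ν + fromNat (suc s)
    0<ν+n = +-pos 0<ν (fromNat-pos s)
    regroup : ∀ S ν → S + (ν + 1ℚ) ≡ ν + (1ℚ + S)
    regroup = solve-∀ ring

  0<α : 0ℚ < α
  0<α = ℚ.+-mono-≤-< 0≤κ 0<β

  β≤α : β ≤ α
  β≤α = ≤-by 0≤κ (ℚ.+-comm β k)

  -- 4 - 3α = 3 (1 - κ) + (1 - 3β)
  three-α≤4 : α + (α + α) ≤ four
  three-α≤4 = ≤-by (+-nonNeg (+-nonNeg (*-nonNeg (fromNat-nonNeg 3) (≤⇒0≤ κ≤1)) (≤⇒0≤ four-β≤1)) (ℚ.<⇒≤ 0<β))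
    (regroup k β)
    where
    regroup : ∀ k β → k + β + (k + β + (k + β))
      + (three * (1ℚ - k) + (1ℚ - four * β) + β) ≡ four
    regroup = solve-∀ ring

  ψ-inverse : ∀ {x} → 1ℚ ≤ ν - x → (ν - x) * ψ x ≡ 1ℚ
  ψ-inverse = inverse-≥1

  ψ-pos : ∀ {x} → 1ℚ ≤ ν - x → 0ℚ < ψ x
  ψ-pos 1≤ = inv-pos (ℚ.<-≤-trans 0<1 1≤)

  ψ-difference : ∀ {x y} → 1ℚ ≤ ν - x → 1ℚ ≤ ν - y → ψ x - ψ y ≡ (x - y) * (ψ x * ψ y)
  ψ-difference {x} {y} 1≤x 1≤y = sym (begin
    (x - y) * (ψ x * ψ y)                                  ≡⟨ expand ν x y (ψ x) (ψ y) ⟩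
    (ν - y) * ψ y * ψ x - (ν - x) * ψ x * ψ y              ≡⟨ cong₂ (λ a b → a * ψ x - b * ψ y) (ψ-inverse 1≤y) (ψ-inverse 1≤x) ⟩
    1ℚ * ψ x - 1ℚ * ψ y                                    ≡⟨ cong₂ _-_ (ℚ.*-identityˡ (ψ x)) (ℚ.*-identityˡ (ψ y)) ⟩
    ψ x - ψ y                                              ∎)
    where
    open ≡-Reasoning
    expand : ∀ ν x y a b → (x - y) * (a * b) ≡ (ν - y) * b * a - (ν - x) * a * b
    expand = solve-∀ ring

  ν-0 : ν - 0ℚ ≡ ν
  ν-0 = ℚ.+-identityʳ ν

  ψ-0 : ψ 0ℚ ≡ β
  ψ-0 = cong inv ν-0

  1≤ν : 1ℚ ≤ ν
  1≤ν = ℚ.≤-trans (fromNat-mono {1} {7} (s≤s z≤n)) 7≤ν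

  ψ-β : ∀ {x} → 1ℚ ≤ ν - x → ψ x - β ≡ x * (ψ x * β)
  ψ-β {x} 1≤ = subst (λ b → ψ x - b ≡ x * (ψ x * b)) ψ-0
    (trans (ψ-difference {x} {0ℚ} 1≤ (subst (1ℚ ≤_) (sym ν-0) 1≤ν)) (cong (_* (ψ x * ψ 0ℚ)) (ℚ.+-identityʳ x)))

  ψ-mono : ∀ {x y} → 1ℚ ≤ ν - y → x ≤ y → ψ x ≤ ψ y
  ψ-mono {x} {y} 1≤ x≤y = inv-antimono (ℚ.<-≤-trans 0<1 1≤) (ℚ.+-monoʳ-≤ ν (ℚ.neg-antimono-≤ x≤y))

  β≤ψ : ∀ {x} → 0ℚ ≤ x → 1ℚ ≤ ν - x → β ≤ ψ x
  β≤ψ 0≤x 1≤ = subst (_≤ ψ _) ψ-0 (ψ-mono 1≤ 0≤x)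

  -- an edge above a part of cost x costs α + x/4 at most
  quarter : ∀ {x} → 0ℚ ≤ x → 1ℚ ≤ ν - x → four * (ψ x - β) ≤ x
  quarter {x} 0≤x 1≤ = begin
    four * (ψ x - β)             ≡⟨ cong (four *_) (ψ-β 1≤) ⟩
    four * (x * (ψ x * β))       ≡⟨ regroup four x (ψ x) β ⟩
    x * (ψ x * (four * β))       ≤⟨ *-monoˡ 0≤x (*-mono (ℚ.<⇒≤ (ψ-pos 1≤)) (*-nonNeg (ℚ.<⇒≤ 0<four) (ℚ.<⇒≤ 0<β)) (inv-≤1 1≤) four-β≤1) ⟩
    x * (1ℚ * 1ℚ)                ≡⟨ simplify x ⟩
    x                            ∎
    where
    open ℚ.≤-Reasoning
    regroup : ∀ f x p b → f * (x * (p * b)) ≡ x * (p * (f * b))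
    regroup = solve-∀ ring
    simplify : ∀ x → x * (1ℚ * 1ℚ) ≡ x
    simplify = solve-∀ ring

  ψ≤β+ : ∀ {x} → 0ℚ ≤ x → 1ℚ ≤ ν - x → ψ x ≤ β + x
  ψ≤β+ {x} 0≤x 1≤ = *-cancelˡ-≤ 0<four (≤-by (+-nonNeg (≤⇒0≤ (quarter 0≤x 1≤)) (*-nonNeg (fromNat-nonNeg 3) 0≤x))
    (regroup (ψ x) β x))
    where
    regroup : ∀ p β x → four * p
      + (x - four * (p - β) + three * x) ≡ four * (β + x)
    regroup = solve-∀ ring

  cost-nonNeg : ∀ t → Regular s ν t → 0ℚ ≤ cost s ν t
  cost-nonNeg ε       _              = ℚ.≤-refl
  cost-nonNeg (c ▷ r) (1≤ , _ , reg) = +-nonNeg (+-nonNeg 0≤κ (ℚ.<⇒≤ (ψ-pos 1≤))) (cost-nonNeg r reg)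

  weight : Shape → ℚ
  weight t = fromNat ⟪ t ⟫ * α

  weight-▷ : ∀ c r → weight (c ▷ r) ≡ α + (weight c + weight r)
  weight-▷ c r = trans (cong (λ n → (1ℚ + n) * α) (fromNat-+ ⟪ c ⟫ ⟪ r ⟫)) (regroup (fromNat ⟪ c ⟫) (fromNat ⟪ r ⟫) α)
    where
    regroup : ∀ c r α → (1ℚ + (c + r)) * α ≡ α + (c * α + r * α)
    regroup = solve-∀ ring

  weight-mono : ∀ {c n} → ⟪ c ⟫ ℕ.≤ n → weight c ≤ fromNat n * α
  weight-mono c≤n = *-monoʳ (ℚ.<⇒≤ 0<α) (fromNat-mono c≤n)

  -- By `ψ≤β+` an edge above a part of cost C costs at most α + C, so no part costs more than the
  -- same number of pendant edges. One bound `n` on all sizes lets a single inequality give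
  -- regularity at every level.
  cost≤weight : ∀ t {n} → ⟪ t ⟫ ℕ.≤ n → 1ℚ ≤ ν - fromNat n * α → Regular s ν t × cost s ν t ≤ weight t
  cost≤weight ε       _   _ = tt , ℚ.≤-reflexive (sym (ℚ.*-zeroˡ α))
  cost≤weight (c ▷ r) {n} t≤n 1≤
    with cost≤weight c {n} (ℕ.≤-trans (ℕ.≤-trans (ℕ.m≤m+n ⟪ c ⟫ ⟪ r ⟫) (ℕ.n≤1+n _)) t≤n) 1≤
       | cost≤weight r {n} (ℕ.≤-trans (ℕ.≤-trans (ℕ.m≤n+m ⟪ r ⟫ ⟪ c ⟫) (ℕ.n≤1+n _)) t≤n) 1≤
  ... | reg-c , cost-c | reg-r , cost-r = (1≤c , reg-c , reg-r) , (begin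
      k + ψ (cost s ν c) + cost s ν r
        ≤⟨ ℚ.+-mono-≤ (ℚ.+-monoʳ-≤ k (ℚ.≤-trans (ψ≤β+ (cost-nonNeg c reg-c) 1≤c) (ℚ.+-monoʳ-≤ β cost-c))) cost-r ⟩
      k + (β + weight c) + weight r
        ≡⟨ regroup k β (weight c) (weight r) ⟩
      α + (weight c + weight r)
        ≡⟨ weight-▷ c r ⟨
      weight (c ▷ r) ∎)
    where
    open ℚ.≤-Reasoning
    regroup : ∀ k β c r → k + (β + c) + r ≡ k + β + (c + r)
    regroup = solve-∀ ring
    1≤c : 1ℚ ≤ ν - cost s ν c
    1≤c = ℚ.≤-trans 1≤ (ℚ.+-monoʳ-≤ ν (ℚ.neg-antimono-≤ (ℚ.≤-trans cost-c
      (weight-mono (ℕ.≤-trans (ℕ.≤-trans (ℕ.m≤m+n ⟪ c ⟫ ⟪ r ⟫) (ℕ.n≤1+n _)) t≤n)))))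

  small-branches : ∀ t {n} → AllBranches (λ c → ⟪ c ⟫ ℕ.≤ n) t → 1ℚ ≤ ν - fromNat n * α → Regular s ν t
  small-branches ε _ _ = tt
  small-branches (c ▷ r) {n} (c≤ , r≤) 1≤ = let reg-c , cost-c = cost≤weight c {n} c≤ 1≤ in
      ℚ.≤-trans 1≤ (ℚ.+-monoʳ-≤ ν (ℚ.neg-antimono-≤ (ℚ.≤-trans cost-c (weight-mono c≤))))
    , reg-c , small-branches r {n} r≤ 1≤

  -- By `quarter` an edge with j edges below it costs at most α + jα/4 instead of (1 + j)α, so every
  -- edge off the root saves at least 3α/4.
  four-cost : ∀ t {n} → AllBranches (λ c → ⟪ c ⟫ ℕ.≤ n) t → 1ℚ ≤ ν - fromNat n * α →
    four * cost s ν t + three * (fromNat (excess t) * α)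
      ≤ four * weight t
  four-cost ε _ _ = ℚ.≤-reflexive (zeros α)
    where
    zeros : ∀ α → four * 0ℚ + three * (0ℚ * α) ≡ four * (0ℚ * α)
    zeros = solve-∀ ring
  four-cost (c ▷ r) {n} (c≤ , r≤) 1≤ with cost≤weight c {n} c≤ 1≤
  ... | reg-c , cost-c = subst₂ (λ e w → four * cost s ν (c ▷ r) + three * e ≤ four * w)
    (trans (sym (ℚ.*-distribʳ-+ α (fromNat ⟪ c ⟫) (fromNat (excess r)))) (cong (_* α) (sym (fromNat-+ ⟪ c ⟫ (excess r)))))
    (sym (weight-▷ c r))
    (≤-by (+-nonNeg (≤⇒0≤ (ℚ.≤-trans (quarter (cost-nonNeg c reg-c) 1≤c) cost-c)) (≤⇒0≤ (four-cost r {n} r≤ 1≤)))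
      (regroup k β (ψ (cost s ν c)) (cost s ν r) (weight c) (weight r) (fromNat (excess r) * α)))
    where
    1≤c : 1ℚ ≤ ν - cost s ν c
    1≤c = ℚ.≤-trans 1≤ (ℚ.+-monoʳ-≤ ν (ℚ.neg-antimono-≤ (ℚ.≤-trans cost-c (weight-mono c≤))))
    regroup : ∀ k β p C w W e →
      four * (k + p + C) + three * (w + e)
      + (w - four * (p - β)
        + (four * W - (four * C + three * e)))
      ≡ four * (k + β + (w + W))
    regroup = solve-∀ ring


-- Inequalities between the costs of small branches.

module Gaps (s : ℕ) {ν : ℚ} (7≤ν : seven ℚ.≤ ν) where

  open Rational
  open Costs s 7≤ν

  -- What an edge above a part of cost x costs beyond a pendant edge; see `x≡`.
  Δ : ℚ → ℚ
  Δ x = ψ x - β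

  private
    k : ℚ
    k = κ s ν

  -- Three edges below an edge are the most that occur in the explicit comparisons, and they cost at
  -- most 3α. As 3α ≤ 4, the bound ν ≥ 7 leaves ν - x ≥ 3.
  data InRange (x : ℚ) : Set where
    in-range : 0ℚ ≤ x → x ≤ α + (α + α) → InRange x

  module _ {x : ℚ} where

    3≤ν-x : InRange x → three ≤ ν - x
    3≤ν-x (in-range _ x≤) = ≤-by (+-nonNeg (≤⇒0≤ 7≤ν) (+-nonNeg (≤⇒0≤ three-α≤4) (≤⇒0≤ x≤))) (regroup ν α x)
      where
      regroup : ∀ ν α x → three + (ν - seven
        + (four - (α + (α + α)) + (α + (α + α) - x))) ≡ ν - x
      regroup = solve-∀ ring

    1≤ν-x : InRange x → 1ℚ ≤ ν - x
    1≤ν-x r = ℚ.≤-trans (≤-by (+-nonNeg (ℚ.<⇒≤ 0<1) (ℚ.<⇒≤ 0<1)) regroup) (3≤ν-x r)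
      where
      regroup : 1ℚ + two ≡ three
      regroup = refl

    0<ψ : InRange x → 0ℚ < ψ x
    0<ψ r = ψ-pos (1≤ν-x r)

    two-ψ≤1 : InRange x → ψ x + ψ x ≤ 1ℚ
    two-ψ≤1 r = ℚ.≤-trans (≤-by (ℚ.<⇒≤ (0<ψ r)) (regroup (ψ x))) (subst (three * ψ x ≤_)
      (ψ-inverse (1≤ν-x r)) (*-monoʳ (ℚ.<⇒≤ (0<ψ r)) (3≤ν-x r)))
      where
      regroup : ∀ p → p + p + p ≡ three * p
      regroup = solve-∀ ring

    Δ≡ : InRange x → Δ x ≡ x * (ψ x * β)
    Δ≡ r = ψ-β (1≤ν-x r)

    Δ-nonNeg : InRange x → 0ℚ ≤ Δ x
    Δ-nonNeg r@(in-range 0≤x _) = ≤⇒0≤ (β≤ψ 0≤x (1≤ν-x r))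

    four-Δ : InRange x → four * Δ x ≤ x
    four-Δ r@(in-range 0≤x _) = quarter 0≤x (1≤ν-x r)

    -- Δ x = x ψ β ≥ β³ for x ≥ α
    β³≤Δ : InRange x → α ≤ x → β * (β * β) ≤ Δ x
    β³≤Δ r@(in-range 0≤x _) α≤x = subst (β * (β * β) ≤_) (sym (Δ≡ r))
      (*-mono (ℚ.<⇒≤ 0<β) (ℚ.<⇒≤ (*-pos 0<β 0<β)) (ℚ.≤-trans β≤α α≤x)
        (*-monoʳ (ℚ.<⇒≤ 0<β) (β≤ψ 0≤x (1≤ν-x r))))

  0≤α : 0ℚ ≤ α
  0≤α = ℚ.<⇒≤ 0<α

  range₁ : InRange α
  range₁ = in-range 0≤α (≤-by (+-nonNeg 0≤α 0≤α) refl)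

  range₂ : InRange (α + α)
  range₂ = in-range (+-nonNeg 0≤α 0≤α) (≤-by 0≤α (ℚ.+-assoc α α α))

  range₃ : InRange (α + (α + α))
  range₃ = in-range (+-nonNeg 0≤α (+-nonNeg 0≤α 0≤α)) ℚ.≤-refl

  Δ≤α : ∀ {x} → InRange x → Δ x ≤ α
  Δ≤α {x} r@(in-range _ x≤) = *-cancelˡ-≤ 0<four (ℚ.≤-trans (four-Δ r) (ℚ.≤-trans x≤
    (≤-by 0≤α (regroup α))))
    where
    regroup : ∀ α → α + (α + α) + α ≡ four * α
    regroup = solve-∀ ring

  -- The costs of `path₂` and of `ε ▷ star₁ ▷ ε`.
  x₁ xₑ : ℚ
  x₁ = k + ψ α
  xₑ = α + x₁

  x≡ : ∀ y → k + ψ y ≡ α + Δ y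
  x≡ y = regroup k (ψ y) β
    where
    regroup : ∀ k p β → k + p ≡ k + β + (p - β)
    regroup = solve-∀ ring

  above-≤ : ∀ {y} → InRange y → k + ψ y ≤ α + α
  above-≤ {y} r = subst (_≤ α + α) (sym (x≡ y)) (ℚ.+-monoʳ-≤ α (Δ≤α r))

  above-≥ : ∀ {y} → InRange y → α ≤ k + ψ y
  above-≥ {y} r = subst (α ≤_) (sym (x≡ y)) (≤-by (Δ-nonNeg r) refl)

  above-range : ∀ {y} → InRange y → InRange (k + ψ y)
  above-range r = in-range (ℚ.≤-trans 0≤α (above-≥ r))
    (ℚ.≤-trans (above-≤ r) (≤-by 0≤α (ℚ.+-assoc α α α)))

  rangeₑ : InRange xₑ
  rangeₑ = in-range (+-nonNeg 0≤α (ℚ.≤-trans 0≤α (above-≥ range₁)))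
    (ℚ.+-monoʳ-≤ α (above-≤ range₁))

  Δ₁ Δ₂ Δ₃ : ℚ
  Δ₁ = Δ α
  Δ₂ = Δ (α + α)
  Δ₃ = Δ (α + (α + α))

  -- The delicate gaps are at least a product αψΔ with α and ψ at least β and Δ at least β³, whence
  -- a margin up to β⁵.
  module _ {g : ℚ} (0<g : 0ℚ < g) (g≤β⁵ : g ≤ β * (β * (β * (β * β)))) where

    private
      0≤β : 0ℚ ≤ β
      0≤β = ℚ.<⇒≤ 0<β

      0≤g : 0ℚ ≤ g
      0≤g = ℚ.<⇒≤ 0<g

      β²≤β : β * β ≤ β
      β²≤β = subst (β * β ≤_) (ℚ.*-identityʳ β) (*-monoˡ 0≤β β≤1)

      β³≤β : β * (β * β) ≤ β
      β³≤β = ℚ.≤-trans (*-monoˡ 0≤β β²≤β) β²≤β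

      -- β⁵ = β³ β² and 4 β² ≤ β ≤ 1
      four-g≤β³ : four * g ≤ β * (β * β)
      four-g≤β³ = begin
        four * g                               ≤⟨ *-monoˡ (ℚ.<⇒≤ 0<four) g≤β⁵ ⟩
        four * (β * (β * (β * (β * β))))       ≡⟨ regroup four β ⟩
        (β * (β * β)) * ((four * β) * β)       ≤⟨ *-monoˡ (*-nonNeg 0≤β (*-nonNeg 0≤β 0≤β))
                                                   (*-mono (*-nonNeg (ℚ.<⇒≤ 0<four) 0≤β) 0≤β four-β≤1 β≤1) ⟩
        (β * (β * β)) * (1ℚ * 1ℚ)              ≡⟨ simplify (β * (β * β)) ⟩
        β * (β * β)                            ∎
        where
        open ℚ.≤-Reasoning
        regroup : ∀ f b → f * (b * (b * (b * (b * b)))) ≡ b * (b * b) * (f * b * b)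
        regroup = solve-∀ ring
        simplify : ∀ x → x * (1ℚ * 1ℚ) ≡ x
        simplify = solve-∀ ring

      four-g≤α : four * g ≤ α
      four-g≤α = ℚ.≤-trans four-g≤β³ (ℚ.≤-trans β³≤β β≤α)

      g≤β³ : g ≤ β * (β * β)
      g≤β³ = ℚ.≤-trans (≤-by (*-nonNeg (fromNat-nonNeg 3) 0≤g) (regroup g)) four-g≤β³
        where
        regroup : ∀ g → g + three * g ≡ four * g
        regroup = solve-∀ ring

      product-≥ : ∀ {p x} → β ≤ p → β * (β * β) ≤ x → g ≤ α * p * x
      product-≥ {p} {x} β≤p β³≤x = ℚ.≤-trans g≤β⁵ (subst (_≤ α * p * x) (regroup β)
        (*-mono (*-nonNeg 0≤β 0≤β) (*-nonNeg 0≤β (*-nonNeg 0≤β 0≤β))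
          (*-mono 0≤β 0≤β β≤α β≤p) β³≤x))
        where
        regroup : ∀ b → b * b * (b * (b * b)) ≡ b * (b * (b * (b * b)))
        regroup = solve-∀ ring

      β≤ψ₁ : β ≤ ψ α
      β≤ψ₁ = β≤ψ 0≤α (1≤ν-x range₁)

      Δ₁≡ : Δ₁ ≡ α * (ψ α * β)
      Δ₁≡ = Δ≡ range₁

      Δ-step : ∀ {x y d} → InRange x → InRange y → x ≡ y + d → Δ x ≡ Δ y + d * (ψ x * ψ y)
      Δ-step {x} {y} {d} rx ry refl = begin
        ψ (y + d) - β                            ≡⟨ insert (ψ (y + d)) (ψ y) β ⟩
        ψ y - β + (ψ (y + d) - ψ y)              ≡⟨ cong (ψ y - β +_) (ψ-difference (1≤ν-x rx) (1≤ν-x ry)) ⟩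
        ψ y - β + (y + d - y) * (ψ (y + d) * ψ y) ≡⟨ cong (λ e → ψ y - β + e * (ψ (y + d) * ψ y)) (cancel y d) ⟩
        ψ y - β + d * (ψ (y + d) * ψ y)          ∎
        where
        open ≡-Reasoning
        insert : ∀ a b β → a - β ≡ b - β + (a - b)
        insert = solve-∀ ring
        cancel : ∀ y d → y + d - y ≡ d
        cancel = solve-∀ ring

    -- Δ₂ - 2 Δ₁ = α ψ₁ Δ₂
    gap-two : Δ₁ + Δ₁ + g ≤ Δ₂
    gap-two = subst (Δ₁ + Δ₁ + g ≤_) (sym Δ-total) (ℚ.+-monoʳ-≤ (Δ₁ + Δ₁) (product-≥ β≤ψ₁ (β³≤Δ range₂ (≤-by 0≤α refl))))
      where
      regroup : ∀ α p₁ p₂ β → α * (p₁ * β) + α * (p₂ * p₁) ≡ α * (p₁ * β) + α * (p₁ * β) + α * p₁ * (p₂ - β)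
      regroup = solve-∀ ring
      Δ-total : Δ₂ ≡ Δ₁ + Δ₁ + α * ψ α * Δ₂
      Δ-total = trans (Δ-step range₂ range₁ refl)
        (subst (λ d → d + α * (ψ (α + α) * ψ α) ≡ d + d + α * ψ α * Δ₂) (sym Δ₁≡)
          (regroup α (ψ α) (ψ (α + α)) β))

    -- Δ₃ - Δ₂ - Δ₁ = α (ψ₃ ψ₂ - ψ₁ β) ≥ α ψ₁ Δ₃
    gap-three : Δ₁ + Δ₂ + g ≤ Δ₃
    gap-three = begin
      Δ₁ + Δ₂ + g                                         ≤⟨ ℚ.+-monoʳ-≤ (Δ₁ + Δ₂) (product-≥ β≤ψ₁ (β³≤Δ range₃ (≤-by (+-nonNeg 0≤α 0≤α) refl))) ⟩
      Δ₁ + Δ₂ + α * ψ α * Δ₃                              ≤⟨ ≤-by (*-nonNeg (*-nonNeg 0≤α (ℚ.<⇒≤ (0<ψ range₃))) (≤⇒0≤ (ψ-mono (1≤ν-x range₂) (≤-by 0≤α refl))))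
                                                                refl ⟩
      Δ₁ + Δ₂ + α * ψ α * Δ₃ + α * ψ y * (ψ (α + α) - ψ α) ≡⟨ Δ-total ⟨
      Δ₃                                                  ∎
      where
      open ℚ.≤-Reasoning
      y : ℚ
      y = α + (α + α)
      regroup : ∀ α d₂ p₁ p₂ p₃ β → d₂ + α * (p₃ * p₂)
        ≡ α * (p₁ * β) + d₂ + α * p₁ * (p₃ - β) + α * p₃ * (p₂ - p₁)
      regroup = solve-∀ ring
      Δ-total : Δ₃ ≡ Δ₁ + Δ₂ + α * ψ α * Δ₃ + α * ψ y * (ψ (α + α) - ψ α)
      Δ-total = trans (Δ-step range₃ range₂ (ℚ.+-comm α (α + α)))
        (subst (λ d → Δ₂ + α * (ψ y * ψ (α + α)) ≡ d + Δ₂ + α * ψ α * Δ₃ + α * ψ y * (ψ (α + α) - ψ α)) (sym Δ₁≡)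
          (regroup α Δ₂ (ψ α) (ψ (α + α)) (ψ y) β))

    -- a further part of cost Δ₁ adds Δ₁ ψ ψ′ ≤ Δ₁/2 only
    half-step : ∀ {x y} → InRange x → InRange y → x ≡ y + Δ₁ → Δ x + g ≤ Δ y + Δ₁
    half-step {x} {y} rx ry eq = quarters-of (begin
      four * (Δ x + g)                                       ≡⟨ cong (λ d → four * (d + g)) (Δ-step rx ry eq) ⟩
      four * (Δ y + Δ₁ * (ψ x * ψ y) + g)                    ≡⟨ expand (Δ y) Δ₁ (ψ x) (ψ y) g ⟩
      four * Δ y + Δ₁ * ((ψ x + ψ x) * (ψ y + ψ y)) + four * g ≤⟨ ℚ.+-mono-≤ (ℚ.+-monoʳ-≤ (four * Δ y) (*-monoˡ 0≤Δ₁
                                                                   (*-mono (2ψ rx) (2ψ ry) (two-ψ≤1 rx) (two-ψ≤1 ry)))) (ℚ.≤-trans four-g≤β³ (β³≤Δ range₁ ℚ.≤-refl)) ⟩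
      four * Δ y + Δ₁ * (1ℚ * 1ℚ) + Δ₁                       ≤⟨ ≤-by (+-nonNeg 0≤Δ₁ 0≤Δ₁) (collect (Δ y) Δ₁) ⟩
      four * (Δ y + Δ₁)                                      ∎)
      where
      open ℚ.≤-Reasoning
      quarters-of : ∀ {p q} → four * p ≤ four * q → p ≤ q
      quarters-of = *-cancelˡ-≤ 0<four
      0≤Δ₁ : 0ℚ ≤ Δ₁
      0≤Δ₁ = Δ-nonNeg range₁
      2ψ : ∀ {z} → InRange z → 0ℚ ≤ ψ z + ψ z
      2ψ r = +-nonNeg (ℚ.<⇒≤ (0<ψ r)) (ℚ.<⇒≤ (0<ψ r))
      expand : ∀ dy d p q g → four * (dy + d * (p * q) + g)
        ≡ four * dy + d * ((p + p) * (q + q)) + four * g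
      expand = solve-∀ ring
      collect : ∀ dy d → four * dy + d * (1ℚ * 1ℚ) + d + (d + d) ≡ four * (dy + d)
      collect = solve-∀ ring

    gap-path : Δ x₁ + g ≤ Δ₁ + Δ₁
    gap-path = half-step (above-range range₁) range₁ (x≡ α)

    gap-fork : Δ xₑ + g ≤ Δ₂ + Δ₁
    gap-fork = half-step rangeₑ range₂ (trans (cong (α +_) (x≡ α)) (sym (ℚ.+-assoc α α Δ₁)))

    -- The part below consists of a single edge at its upper vertex and costs at most 2α, so Δ of it
    -- is at most Δ₂; the margin is paid by Δ₁ ≥ β³.
    gap-below : ∀ {y} → InRange y → Δ (k + ψ y) + g ≤ Δ₂ + Δ₁
    gap-below {y} r = ℚ.+-mono-≤
      (ℚ.+-monoˡ-≤ (- β) (ψ-mono (1≤ν-x range₂) (above-≤ r)))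
      (ℚ.≤-trans g≤β³ (β³≤Δ range₁ ℚ.≤-refl))

    -- A step that puts one more edge off the root loses a whole α, against which the coarse bound
    -- of `quarter` is enough. The same holds for `gap₂₃` and `gap₅₆`.
    gap₁₂ : Δ₁ + g ≤ α
    gap₁₂ = *-cancelˡ-≤ 0<four
      (≤-by (+-nonNeg (+-nonNeg (≤⇒0≤ (four-Δ range₁)) (≤⇒0≤ four-g≤α)) (+-nonNeg 0≤α 0≤α)) (regroup α Δ₁ g))
      where
      regroup : ∀ α d g → four * (d + g)
        + (α - four * d + (α - four * g) + (α + α)) ≡ four * α
      regroup = solve-∀ ring

    gap₂₃ : Δ₂ + g ≤ α + Δ₁
    gap₂₃ = ℚ.≤-trans {j = α} (*-cancelˡ-≤ 0<four
      (≤-by (+-nonNeg (+-nonNeg (≤⇒0≤ (four-Δ range₂)) (≤⇒0≤ four-g≤α)) 0≤α) (regroup α Δ₂ g)))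
      (≤-by (Δ-nonNeg range₁) refl)
      where
      regroup : ∀ α d g → four * (d + g)
        + (α + α - four * d + (α - four * g) + α) ≡ four * α
      regroup = solve-∀ ring

    -- Here Δ₃ ≤ 3α/4 and g ≤ α/4 together use up α exactly.
    gap₅₆ : Δ₃ + g ≤ α + Δ x₁
    gap₅₆ = ℚ.≤-trans {j = α} (*-cancelˡ-≤ 0<four
      (≤-by (+-nonNeg (≤⇒0≤ (four-Δ range₃)) (≤⇒0≤ four-g≤α)) (regroup α Δ₃ g)))
      (≤-by (Δ-nonNeg (above-range range₁)) refl)
      where
      regroup : ∀ α d g → four * (d + g)
        + (α + (α + α) - four * d + (α - four * g)) ≡ four * α
      regroup = solve-∀ ring


-- Costs of the listed and unlisted hypertrees compared.

module Deficits (s : ℕ) {ν : ℚ} (7≤ν : seven ℚ.≤ ν) where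

  open Rational
  open Costs s 7≤ν
  open Gaps s 7≤ν

  private
    k : ℚ
    k = κ s ν

  -- the cost of branches beyond that of the same number of pendant edges
  deficit : List Shape → ℚ
  deficit []       = 0ℚ
  deficit (b ∷ bs) = Δ (cost s ν b) - weight b + deficit bs

  -- For a fixed number of edges the first summand is the same for all hypertrees, so costs are
  -- ordered as deficits are.
  cost-rooted : ∀ bs a → cost s ν (rooted bs a) ≡ fromNat (length bs ℕ.+ total bs ℕ.+ a) * α + deficit bs
  cost-rooted [] a = trans (cost-leaves a) (sym (ℚ.+-identityʳ (fromNat a * α)))
    where
    cost-leaves : ∀ a → cost s ν (leaves a ε) ≡ fromNat a * α
    cost-leaves zero    = sym (ℚ.*-zeroˡ α)
    cost-leaves (suc a) = trans (cong₂ (λ p c → k + p + c) ψ-0 (cost-leaves a)) (collect k β (fromNat a))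
      where
      collect : ∀ k β a → k + β + a * (k + β) ≡ (1ℚ + a) * (k + β)
      collect = solve-∀ ring
  cost-rooted (b ∷ bs) a = begin
    k + ψ (cost s ν b) + cost s ν (rooted bs a)
      ≡⟨ cong (k + ψ (cost s ν b) +_) (cost-rooted bs a) ⟩
    k + ψ (cost s ν b) + (fromNat n * α + deficit bs)
      ≡⟨ regroup k β (ψ (cost s ν b)) (fromNat ⟪ b ⟫) (fromNat n) (deficit bs) ⟩
    (1ℚ + (fromNat ⟪ b ⟫ + fromNat n)) * α + (Δ (cost s ν b) - weight b + deficit bs)
      ≡⟨ cong (λ m → (1ℚ + m) * α + deficit (b ∷ bs)) (fromNat-+ ⟪ b ⟫ n) ⟨
    fromNat (suc (⟪ b ⟫ ℕ.+ n)) * α + deficit (b ∷ bs)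
      ≡⟨ cong (λ m → fromNat (suc m) * α + deficit (b ∷ bs)) count ⟩
    fromNat (length (b ∷ bs) ℕ.+ total (b ∷ bs) ℕ.+ a) * α + deficit (b ∷ bs) ∎
    where
    open ≡-Reasoning
    n : ℕ
    n = length bs ℕ.+ total bs ℕ.+ a
    count : ⟪ b ⟫ ℕ.+ (length bs ℕ.+ total bs ℕ.+ a) ≡ length bs ℕ.+ (⟪ b ⟫ ℕ.+ total bs) ℕ.+ a
    count = trans (sym (ℕ.+-assoc ⟪ b ⟫ (length bs ℕ.+ total bs) a)) (cong (ℕ._+ a)
      (trans (sym (ℕ.+-assoc ⟪ b ⟫ (length bs) (total bs)))
        (trans (cong (ℕ._+ total bs) (ℕ.+-comm ⟪ b ⟫ (length bs))) (ℕ.+-assoc (length bs) ⟪ b ⟫ (total bs)))))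
    regroup : ∀ k β p b n d → k + p + (n * (k + β) + d)
      ≡ (1ℚ + (b + n)) * (k + β) + (p - β - b * (k + β) + d)
    regroup = solve-∀ ring

  private
    leaf : k + ψ 0ℚ + 0ℚ ≡ α
    leaf = trans (ℚ.+-identityʳ (k + ψ 0ℚ)) (cong (k +_) ψ-0)

    cost-star₁ : cost s ν star₁ ≡ α
    cost-star₁ = leaf

    prepend : ∀ {c x} → c ≡ x → k + ψ 0ℚ + c ≡ α + x
    prepend = cong₂ _+_ (cong (k +_) ψ-0)

    single : ∀ {c x} → c ≡ x → k + ψ c + 0ℚ ≡ k + ψ x
    single refl = ℚ.+-identityʳ _

  private
    evaluate : ∀ b {x} n d → cost s ν b ≡ x → ⟪ b ⟫ ≡ n → Δ (cost s ν b) - weight b + d ≡ Δ x - fromNat n * α + d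
    evaluate b n d refl refl = refl

  private
    cost-star₂ : cost s ν star₂ ≡ α + α
    cost-star₂ = prepend leaf

    cost-star₃ : cost s ν star₃ ≡ α + (α + α)
    cost-star₃ = prepend cost-star₂

    cost-path₂ : cost s ν path₂ ≡ x₁
    cost-path₂ = single cost-star₁

    d-star₁ : ∀ d → Δ (cost s ν star₁) - weight star₁ + d ≡ Δ₁ - 1ℚ * α + d
    d-star₁ d = evaluate star₁ 1 d cost-star₁ refl

    d-star₂ : ∀ d → Δ (cost s ν star₂) - weight star₂ + d ≡ Δ₂ - two * α + d
    d-star₂ d = evaluate star₂ 2 d cost-star₂ refl

    d-star₃ : ∀ d → Δ (cost s ν star₃) - weight star₃ + d ≡ Δ₃ - three * α + d
    d-star₃ d = evaluate star₃ 3 d cost-star₃ refl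

    d-path₂ : ∀ d → Δ (cost s ν path₂) - weight path₂ + d ≡ Δ x₁ - two * α + d
    d-path₂ d = evaluate path₂ 2 d cost-path₂ refl

  last-deficit : deficit (star₂ ∷ star₁ ∷ []) ≡ Δ₁ + Δ₂ - (α + (α + α))
  last-deficit = trans (d-star₂ _) (trans (cong (λ d → Δ₂ - two * α + d) (d-star₁ 0ℚ)) (regroup Δ₁ Δ₂ α))
    where
    regroup : ∀ a b α → b - two * α + (a - 1ℚ * α + 0ℚ) ≡ a + b - (α + (α + α))
    regroup = solve-∀ ring

  module _ {g : ℚ} (0<g : 0ℚ < g) (g≤β⁵ : g ≤ β * (β * (β * (β * β)))) where

    private
      shift : ∀ {p q p′ q′} e → p ≤ q → p + e ≡ p′ → q + e ≡ q′ → p′ ≤ q′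
      shift e p≤q refl refl = ℚ.+-monoˡ-≤ e p≤q

      one-branch : ∀ b {x} → cost s ν b ≡ x → ⟪ b ⟫ ≡ 3 → Δ x + g ≤ Δ₂ + Δ₁ →
        deficit (b ∷ []) + g ≤ deficit (star₂ ∷ star₁ ∷ [])
      one-branch b {x} cost≡ size≡3 h = shift (- (α + (α + α))) h
        (trans (regroup (Δ x) α g) (cong (_+ g) (sym (evaluate b 3 0ℚ cost≡ size≡3))))
        (trans (regroup′ Δ₁ Δ₂ α) (sym last-deficit))
        where
        regroup : ∀ d α g → d + g + - (α + (α + α)) ≡ d - three * α + 0ℚ + g
        regroup = solve-∀ ring
        regroup′ : ∀ a b α → b + a + - (α + (α + α)) ≡ a + b - (α + (α + α))
        regroup′ = solve-∀ ring

    -- Each case is an inequality from `Gaps`, shifted by a multiple of α and by Δ₁ where both lists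
    -- have a further `star₁`.
    before : ∀ {bs cs} → Before bs cs → deficit cs + g ≤ deficit bs
    before step₁ = shift (- α) (gap₁₂ 0<g g≤β⁵)
      (trans (regroup Δ₁ α g) (cong (_+ g) (sym (d-star₁ 0ℚ)))) (ℚ.+-inverseʳ α)
      where
      regroup : ∀ d α g → d + g + - α ≡ d - 1ℚ * α + 0ℚ + g
      regroup = solve-∀ ring
    before step₂ = shift (- (α + α)) (gap₂₃ 0<g g≤β⁵)
      (trans (regroup Δ₂ α g) (cong (_+ g) (sym (d-star₂ 0ℚ))))
      (trans (regroup′ Δ₁ α) (sym (d-star₁ 0ℚ)))
      where
      regroup : ∀ d α g → d + g + - (α + α) ≡ d - two * α + 0ℚ + g
      regroup = solve-∀ ring
      regroup′ : ∀ d α → α + d + - (α + α) ≡ d - 1ℚ * α + 0ℚ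
      regroup′ = solve-∀ ring
    before step₃ = shift (- (α + α)) (gap-two 0<g g≤β⁵)
      (trans (regroup Δ₁ α g) (cong (_+ g) (sym
        (trans (d-star₁ _) (cong (λ d → Δ₁ - 1ℚ * α + d) (d-star₁ 0ℚ))))))
      (trans (regroup′ Δ₂ α) (sym (d-star₂ 0ℚ)))
      where
      regroup : ∀ d α g → d + d + g + - (α + α) ≡ d - 1ℚ * α + (d - 1ℚ * α + 0ℚ) + g
      regroup = solve-∀ ring
      regroup′ : ∀ d α → d + - (α + α) ≡ d - two * α + 0ℚ
      regroup′ = solve-∀ ring
    before step₄ = shift (- (α + α)) (gap-path 0<g g≤β⁵)
      (trans (regroup (Δ x₁) α g) (cong (_+ g) (sym (d-path₂ 0ℚ))))
      (trans (regroup′ Δ₁ α) (sym (trans (d-star₁ _) (cong (λ d → Δ₁ - 1ℚ * α + d) (d-star₁ 0ℚ)))))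
      where
      regroup : ∀ d α g → d + g + - (α + α) ≡ d - two * α + 0ℚ + g
      regroup = solve-∀ ring
      regroup′ : ∀ d α → d + d + - (α + α) ≡ d - 1ℚ * α + (d - 1ℚ * α + 0ℚ)
      regroup′ = solve-∀ ring
    before step₅ = shift (- (α + (α + α))) (gap₅₆ 0<g g≤β⁵)
      (trans (regroup Δ₃ α g) (cong (_+ g) (sym (d-star₃ 0ℚ))))
      (trans (regroup′ (Δ x₁) α) (sym (d-path₂ 0ℚ)))
      where
      regroup : ∀ d α g → d + g + - (α + (α + α)) ≡ d - three * α + 0ℚ + g
      regroup = solve-∀ ring
      regroup′ : ∀ d α → α + d + - (α + (α + α)) ≡ d - two * α + 0ℚ
      regroup′ = solve-∀ ring
    before step₆ = shift (- (α + (α + α))) (gap-three 0<g g≤β⁵)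
      (trans (regroup Δ₁ Δ₂ α g) (cong (_+ g) (sym last-deficit)))
      (trans (regroup′ Δ₃ α) (sym (d-star₃ 0ℚ)))
      where
      regroup : ∀ a b α g → a + b + g + - (α + (α + α)) ≡ a + b - (α + (α + α)) + g
      regroup = solve-∀ ring
      regroup′ : ∀ d α → d + - (α + (α + α)) ≡ d - three * α + 0ℚ
      regroup′ = solve-∀ ring
    -- One `star₁` is common to both lists; the other two are compared with `star₂`.
    before (step₇ three-branches) = shift (Δ₁ - (α + (α + α))) (gap-two 0<g g≤β⁵)
      (trans (regroup Δ₁ α g) (cong (_+ g) (sym (trans (d-star₁ _) (cong (λ d → Δ₁ - 1ℚ * α + d)
        (trans (d-star₁ _) (cong (λ d → Δ₁ - 1ℚ * α + d) (d-star₁ 0ℚ))))))))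
      (trans (regroup′ Δ₁ Δ₂ α) (sym last-deficit))
      where
      regroup : ∀ d α g → d + d + g + (d - (α + (α + α)))
        ≡ d - 1ℚ * α + (d - 1ℚ * α + (d - 1ℚ * α + 0ℚ)) + g
      regroup = solve-∀ ring
      regroup′ : ∀ a b α → b + (a - (α + (α + α))) ≡ a + b - (α + (α + α))
      regroup′ = solve-∀ ring
    -- With the common `star₁` set aside, `path₂` is compared with `star₂` by way of two copies of
    -- `star₁`.
    before (step₇ path-and-star) = shift (Δ₁ - (α + (α + α)))
      (ℚ.≤-trans (gap-path 0<g g≤β⁵) (ℚ.≤-trans (≤-by (ℚ.<⇒≤ 0<g) refl) (gap-two 0<g g≤β⁵)))
      (trans (regroup (Δ x₁) Δ₁ α g) (cong (_+ g) (sym (trans (d-path₂ _) (cong (λ d → Δ x₁ - two * α + d) (d-star₁ 0ℚ))))))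
      (trans (regroup′ Δ₁ Δ₂ α) (sym last-deficit))
      where
      regroup : ∀ x d α g → x + g + (d - (α + (α + α)))
        ≡ x - two * α + (d - 1ℚ * α + 0ℚ) + g
      regroup = solve-∀ ring
      regroup′ : ∀ a b α → b + (a - (α + (α + α))) ≡ a + b - (α + (α + α))
      regroup′ = solve-∀ ring
    before (step₇ leaf-and-star₁) =
      one-branch (ε ▷ star₁ ▷ ε) (prepend (single cost-star₁)) refl (gap-fork 0<g g≤β⁵)
    before (step₇ below-star₂) =
      one-branch (star₂ ▷ ε) (single cost-star₂) refl (gap-below 0<g g≤β⁵ range₂)
    before (step₇ below-path₂) =
      one-branch (path₂ ▷ ε) (single cost-path₂) refl (gap-below 0<g g≤β⁵ (above-range range₁))


-- The comparisons for k edges.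

module Ordering (s k : ℕ) (large : 7 ℕ.* (6 ℕ.+ suc s) ℕ.+ 3 ℕ.* suc s ℕ.≤ k ℕ.* suc s) where

  open Rational

  private
    K : ℚ
    K = fromNat k

  2≤k : 2 ℕ.≤ k
  2≤k = ℕ.≮⇒≥ λ k<2 → ℕ.<⇒≱ (ℕ.<-≤-trans (ℕ.*-monoˡ-< (suc s) k<2) (ℕ.≤-trans
    (ℕ.*-mono-≤ {2} {7} {suc s} {6 ℕ.+ suc s} (s≤s (s≤s z≤n)) (ℕ.m≤n+m (suc s) 6)) (ℕ.m≤m+n _ _))) large

  5≤k : 5 ℕ.≤ k
  5≤k = ℕ.≮⇒≥ λ k<5 → ℕ.<⇒≱ (ℕ.<-≤-trans (ℕ.*-monoˡ-< (suc s) k<5) (ℕ.≤-trans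
    (ℕ.*-mono-≤ {5} {7} {suc s} {6 ℕ.+ suc s} (s≤s (s≤s (s≤s (s≤s (s≤s z≤n))))) (ℕ.m≤n+m (suc s) 6)) (ℕ.m≤m+n _ _))) large

  4≤k : 4 ℕ.≤ k
  4≤k = ℕ.≤-trans (ℕ.n≤1+n 4) 5≤k

  7≤2k : 7 ℕ.≤ k ℕ.+ k
  7≤2k = ℕ.≤-trans (s≤s (s≤s (s≤s (s≤s (s≤s (s≤s (s≤s z≤n))))))) (ℕ.+-mono-≤ 5≤k 5≤k)

  -- Upper end of the bisection: κ and 1/ν are at most 1, so a cost of at most kα is at most 2k.
  ceiling : ℚ
  ceiling = fromNat (k ℕ.+ k)

  7≤ceiling : seven ≤ ceiling
  7≤ceiling = fromNat-mono 7≤2k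

  to-last : ∀ {bs} → ListedBranches bs → Star Before bs (star₂ ∷ star₁ ∷ [])
  to-last listed₁ = step₁ ◅ step₂ ◅ step₃ ◅ step₄ ◅ step₅ ◅ step₆ ◅ Star.ε
  to-last listed₂ = step₂ ◅ step₃ ◅ step₄ ◅ step₅ ◅ step₆ ◅ Star.ε
  to-last listed₃ = step₃ ◅ step₄ ◅ step₅ ◅ step₆ ◅ Star.ε
  to-last listed₄ = step₄ ◅ step₅ ◅ step₆ ◅ Star.ε
  to-last listed₅ = step₅ ◅ step₆ ◅ Star.ε
  to-last listed₆ = step₆ ◅ Star.ε
  to-last listed₇ = Star.ε

  from-first : ∀ {bs} → ListedBranches bs → Star Before [] bs
  from-first listed₁ = Star.ε
  from-first listed₂ = step₁ ◅ Star.ε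
  from-first listed₃ = step₁ ◅ step₂ ◅ Star.ε
  from-first listed₄ = step₁ ◅ step₂ ◅ step₃ ◅ Star.ε
  from-first listed₅ = step₁ ◅ step₂ ◅ step₃ ◅ step₄ ◅ Star.ε
  from-first listed₆ = step₁ ◅ step₂ ◅ step₃ ◅ step₄ ◅ step₅ ◅ Star.ε
  from-first listed₇ = step₁ ◅ step₂ ◅ step₃ ◅ step₄ ◅ step₅ ◅ step₆ ◅ Star.ε

  module At {ν : ℚ} (7≤ν : seven ≤ ν) where

    open Costs s 7≤ν public
    open Deficits s 7≤ν public

    Φ-rooted : ∀ {bs a} → length bs ℕ.+ total bs ℕ.+ a ≡ k →
      Φ s (rooted bs a) ν ≡ ν + κ s ν - (K * α + deficit bs)
    Φ-rooted {bs} {a} refl = cong (λ c → ν + κ s ν - c) (cost-rooted bs a)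

    β⁵ : ℚ
    β⁵ = β * (β * (β * (β * β)))

    0<β⁵ : 0ℚ < β⁵
    0<β⁵ = *-pos 0<β (*-pos 0<β (*-pos 0<β (*-pos 0<β 0<β)))

    before-≤ : ∀ {bs cs} → Before bs cs → deficit cs ≤ deficit bs
    before-≤ p = ℚ.≤-trans (≤-by (ℚ.<⇒≤ 0<β⁵) refl) (before 0<β⁵ ℚ.≤-refl p)

    befores-≤ : ∀ {bs cs} → Star Before bs cs → deficit cs ≤ deficit bs
    befores-≤ Star.ε   = ℚ.≤-refl
    befores-≤ (p ◅ ps) = ℚ.≤-trans (befores-≤ ps) (before-≤ p)

    last≤ : ∀ {bs} → ListedBranches bs → deficit (star₂ ∷ star₁ ∷ []) ≤ deficit bs
    last≤ = befores-≤ ∘ to-last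

    ≤first : ∀ {bs} → ListedBranches bs → deficit bs ≤ 0ℚ
    ≤first = befores-≤ ∘ from-first

  -- The hypothesis says exactly that the star with k - 3 edges has ν ≥ 7.
  module _ where

    open At {seven} ℚ.≤-refl
    open Gaps s {seven} ℚ.≤-refl using (Δ₁; Δ₂; Δ-nonNeg; range₁; range₂; β³≤Δ)

    private
      S i w : ℚ
      S = fromNat s
      i = inv (seven + fromNat (suc s))
      -- `seven` unfolds to 1 + w and `fromNat 8` to 1 + (1 + w); the ring identities below hold
      -- with `w` as a variable.
      w = fromNat 6

      0<7+n : 0ℚ < seven + fromNat (suc s)
      0<7+n = +-pos (fromNat-pos 6) (fromNat-pos s)

      large-ℚ : (1ℚ + w) * (w + (1ℚ + S)) + three * (1ℚ + S) ≤ K * (1ℚ + S)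
      large-ℚ = subst₂ _≤_ (trans (fromNat-+ (7 ℕ.* (6 ℕ.+ suc s)) (3 ℕ.* suc s))
          (cong₂ _+_ (trans (fromNat-* 7 (6 ℕ.+ suc s)) (cong (seven *_) (fromNat-+ 6 (suc s)))) (fromNat-* 3 (suc s))))
        (fromNat-* k (suc s)) (fromNat-mono large)

      -- multiply by 7 (7 + n)
      at-seven : seven + κ s seven + (α + (α + α)) ≤ K * α
      at-seven = *-cancelˡ-≤ (*-pos (fromNat-pos 6) 0<7+n) (≤-by
        -- At ν = 7 one has 7(8 + S)α = 8(1 + S), so the slack of the hypothesis enters with the
        -- factor 8.
        (*-nonNeg (fromNat-nonNeg 8) (≤⇒0≤ large-ℚ)) (begin
          P * (seven + S * i + (a + (a + a))) + fromNat 8 * (K * (1ℚ + S) - (seven * (w + (1ℚ + S)) + three * (1ℚ + S)))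
            ≡⟨ expand w S i β K ⟩
          X (seven + (1ℚ + S)) S (n * i) (seven * β)
            ≡⟨ cong₂ (X (seven + (1ℚ + S)) S) (inv-inverse 0<7+n) ν-inverse ⟩
          X (seven + (1ℚ + S)) S 1ℚ 1ℚ
            ≡⟨ collect w S K ⟩
          Y (seven + (1ℚ + S)) S 1ℚ 1ℚ
            ≡⟨ cong₂ (Y (seven + (1ℚ + S)) S) (inv-inverse 0<7+n) ν-inverse ⟨
          Y (seven + (1ℚ + S)) S (n * i) (seven * β)
            ≡⟨ expand′ w S i β K ⟩
          P * (K * a) ∎))
        where
        open ≡-Reasoning
        n P a : ℚ
        n = seven + (1ℚ + S)
        P = seven * n
        a = S * i + β
        -- the two sides in terms of p = n i and q = 7 β, which are both 1
        X Y : ℚ → ℚ → ℚ → ℚ → ℚ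
        X n S p q = seven * n * seven + seven * S * p + three * (seven * S * p + n * q)
          + fromNat 8 * (K * (1ℚ + S) - (seven * (w + (1ℚ + S)) + three * (1ℚ + S)))
        Y n S p q = K * (seven * S * p + n * q)
        expand : ∀ w S i β K →
          (1ℚ + w) * (1ℚ + w + (1ℚ + S)) * (1ℚ + w + S * i + (S * i + β + (S * i + β + (S * i + β))))
            + (1ℚ + (1ℚ + w)) * (K * (1ℚ + S) - ((1ℚ + w) * (w + (1ℚ + S)) + three * (1ℚ + S)))
          ≡ (1ℚ + w) * (1ℚ + w + (1ℚ + S)) * (1ℚ + w) + (1ℚ + w) * S * ((1ℚ + w + (1ℚ + S)) * i)
            + three * ((1ℚ + w) * S * ((1ℚ + w + (1ℚ + S)) * i) + (1ℚ + w + (1ℚ + S)) * ((1ℚ + w) * β))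
            + (1ℚ + (1ℚ + w)) * (K * (1ℚ + S) - ((1ℚ + w) * (w + (1ℚ + S)) + three * (1ℚ + S)))
        expand = solve-∀ ring
        collect : ∀ w S K →
          (1ℚ + w) * (1ℚ + w + (1ℚ + S)) * (1ℚ + w) + (1ℚ + w) * S * 1ℚ
            + three * ((1ℚ + w) * S * 1ℚ + (1ℚ + w + (1ℚ + S)) * 1ℚ)
            + (1ℚ + (1ℚ + w)) * (K * (1ℚ + S) - ((1ℚ + w) * (w + (1ℚ + S)) + three * (1ℚ + S)))
          ≡ K * ((1ℚ + w) * S * 1ℚ + (1ℚ + w + (1ℚ + S)) * 1ℚ)
        collect = solve-∀ ring
        expand′ : ∀ w S i β K → K * ((1ℚ + w) * S * ((1ℚ + w + (1ℚ + S)) * i) + (1ℚ + w + (1ℚ + S)) * ((1ℚ + w) * β))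
          ≡ (1ℚ + w) * (1ℚ + w + (1ℚ + S)) * (K * (S * i + β))
        expand′ = solve-∀ ring

    -- The seventh list has the least deficit, Δ₁ + Δ₂ - 3α. So every cost is at least (k - 3)α + Δ₁
    -- + Δ₂, which exceeds 7 + κ by `at-seven`.
    Φ-seven : ∀ {bs a} → ListedBranches bs → length bs ℕ.+ total bs ℕ.+ a ≡ k → Φ s (rooted bs a) seven < 0ℚ
    Φ-seven {bs} L count = subst (_< 0ℚ) (sym (Φ-rooted {bs} count)) (ℚ.≤-<-trans
      (ℚ.+-monoʳ-≤ (seven + κ s seven) (ℚ.neg-antimono-≤ (ℚ.+-mono-≤ at-seven (last≤ L))))
      (subst (_< 0ℚ) (trans (regroup (seven + κ s seven) (α + (α + α)) Δ₁ Δ₂)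
        (cong (λ d → seven + κ s seven - (seven + κ s seven + (α + (α + α)) + d)) (sym last-deficit)))
        (ℚ.neg-antimono-< 0<Δ)))
      where
      0<Δ : 0ℚ < Δ₁ + Δ₂
      0<Δ = ℚ.+-mono-<-≤ (ℚ.<-≤-trans (*-pos 0<β (*-pos 0<β 0<β)) (β³≤Δ range₁ ℚ.≤-refl)) (Δ-nonNeg range₂)
      regroup : ∀ p t a b → - (a + b) ≡ p - (p + t + (a + b - t))
      regroup = solve-∀ ring

  Φ-ceiling : ∀ {bs a} → ListedBranches bs → length bs ℕ.+ total bs ℕ.+ a ≡ k → 0ℚ ≤ Φ s (rooted bs a) ceiling
  Φ-ceiling {bs} L count = subst (0ℚ ≤_) (sym (Φ-rooted {bs} count)) (≤⇒0≤ (begin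
    K * α + deficit bs          ≤⟨ ℚ.+-monoʳ-≤ (K * α) (≤first L) ⟩
    K * α + 0ℚ                  ≡⟨ ℚ.+-identityʳ (K * α) ⟩
    K * (κ s ceiling + β)       ≤⟨ *-monoˡ (fromNat-nonNeg k) (ℚ.+-mono-≤ κ≤1 β≤1) ⟩
    K * two               ≡⟨ trans (double K) (sym (fromNat-+ k k)) ⟩
    ceiling                     ≤⟨ ≤-by 0≤κ refl ⟩
    ceiling + κ s ceiling       ∎))
    where
    open At {ceiling} 7≤ceiling
    open ℚ.≤-Reasoning
    double : ∀ K → K * two ≡ K + K
    double = solve-∀ ring

  -- A part of at most three edges costs at most 3α ≤ 4, whatever ν ≥ 7 is.
  uniform : ∀ {bs} a → All (λ b → ⟪ b ⟫ ℕ.≤ 3) bs → UniformlyRegular s (rooted bs a)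
  uniform {bs} a small = AllBelow-∀ (rooted bs a) λ {ν} 7≤ν → regular 7≤ν
    where
    AllBelow-∀ : ∀ t → (∀ {ν} → seven ≤ ν → Regular s ν t) → UniformlyRegular s t
    AllBelow-∀ ε       _ = tt
    AllBelow-∀ (c ▷ r) h = (λ 7≤ν → proj₁ (h 7≤ν))
      , AllBelow-∀ c (λ 7≤ν → proj₁ (proj₂ (h 7≤ν))) , AllBelow-∀ r (λ 7≤ν → proj₂ (proj₂ (h 7≤ν)))
    branches : ∀ bs → All (λ b → ⟪ b ⟫ ℕ.≤ 3) bs → AllBranches (λ c → ⟪ c ⟫ ℕ.≤ 3) (rooted bs a)
    branches []       []       = pendants-only a
      where
      pendants-only : ∀ a → AllBranches (λ c → ⟪ c ⟫ ℕ.≤ 3) (leaves a ε)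
      pendants-only zero    = tt
      pendants-only (suc a) = z≤n , pendants-only a
    branches (b ∷ bs) (p ∷ ps) = p , branches bs ps
    regular : ∀ {ν} → seven ≤ ν → Regular s ν (rooted bs a)
    regular {ν} 7≤ν = small-branches (rooted bs a) {3} (branches bs small)
      (subst (λ x → 1ℚ ≤ ν - x) (sym (three-α α)) (1≤ν-x range₃))
      where
      open At 7≤ν
      open Gaps s 7≤ν using (1≤ν-x; range₃)
      three-α : ∀ α → three * α ≡ α + (α + α)
      three-α = solve-∀ ring

  listed-small : ∀ {bs} → ListedBranches bs → All (λ b → ⟪ b ⟫ ℕ.≤ 3) bs
  listed-small listed₁ = []
  listed-small listed₂ = s≤s z≤n ∷ []
  listed-small listed₃ = s≤s (s≤s z≤n) ∷ []
  listed-small listed₄ = s≤s z≤n ∷ s≤s z≤n ∷ []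
  listed-small listed₅ = s≤s (s≤s z≤n) ∷ []
  listed-small listed₆ = ℕ.≤-refl ∷ []
  listed-small listed₇ = s≤s (s≤s z≤n) ∷ s≤s z≤n ∷ []

  unlisted-small : ∀ {bs} → UnlistedBranches bs → All (λ b → ⟪ b ⟫ ℕ.≤ 3) bs
  unlisted-small three-branches = s≤s z≤n ∷ s≤s z≤n ∷ s≤s z≤n ∷ []
  unlisted-small path-and-star  = s≤s (s≤s z≤n) ∷ s≤s z≤n ∷ []
  unlisted-small leaf-and-star₁ = ℕ.≤-refl ∷ []
  unlisted-small below-star₂    = ℕ.≤-refl ∷ []
  unlisted-small below-path₂    = ℕ.≤-refl ∷ []

  -- `separate` asks for one margin on the whole bisection interval. The available margin β⁵
  -- decreases in ν, so its value at the ceiling is taken.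
  γ : ℚ
  γ = let b = inv ceiling in b * (b * (b * (b * b)))

  0<γ : 0ℚ < γ
  0<γ = *-pos 0<b (*-pos 0<b (*-pos 0<b (*-pos 0<b 0<b)))
    where
    0<b : 0ℚ < inv ceiling
    0<b = inv-pos (0<≥7 7≤ceiling)

  γ≤β⁵ : ∀ {ν} (7≤ν : seven ≤ ν) → ν ≤ ceiling → γ ≤ At.β⁵ 7≤ν
  γ≤β⁵ {ν} 7≤ν ν≤ceiling = *-mono 0≤b 0≤b⁴ b≤β (*-mono 0≤b 0≤b³ b≤β (*-mono 0≤b 0≤b² b≤β (*-mono 0≤b 0≤b b≤β b≤β)))
    where
    b≤β : inv ceiling ≤ inv ν
    b≤β = inv-antimono (0<≥7 7≤ν) ν≤ceiling
    0≤b : 0ℚ ≤ inv ceiling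
    0≤b = ℚ.<⇒≤ (inv-pos (0<≥7 7≤ceiling))
    0≤b² = *-nonNeg 0≤b 0≤b
    0≤b³ = *-nonNeg 0≤b 0≤b²
    0≤b⁴ = *-nonNeg 0≤b 0≤b³

  module _ {H G : Hypergraph} {ρ σ : ℝ}
    (radius : IsSpectralRadius (adjacency (suc (suc s)) H) ρ)
    (radius′ : IsSpectralRadius (adjacency (suc (suc s)) G) σ) where

    Counts : List Shape → ℕ → Set
    Counts bs a = length bs ℕ.+ total bs ℕ.+ a ≡ k

    listed-> : ∀ {bs a t} → ListedBranches bs → Counts bs a →
      HasShape s H (rooted bs a) → HasShape s G t →
      (∀ {ν} → seven ≤ ν → ν ≤ ceiling → - γ < Φ s (rooted bs a) ν → Regular s ν t × 0ℚ ≤ Φ s t ν) →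
      σ <ℝ ρ
    listed-> {bs} {a} L count h h′ bound = separate h h′ (uniform a (listed-small L)) ℚ.≤-refl 7≤ceiling
      (Φ-seven {bs} L count) (Φ-ceiling {bs} L count) 0<γ
      (λ 7≤ν ν≤ceiling -γ<Φ _ → bound 7≤ν ν≤ceiling -γ<Φ) radius radius′

    -- The values of Φ differ by the difference of the deficits, which is at least γ throughout the
    -- interval; where the first exceeds -γ, the second is positive.
    before-> : ∀ {bs cs a b} → ListedBranches bs → Before bs cs → All (λ c → ⟪ c ⟫ ℕ.≤ 3) cs →
      Counts bs a → Counts cs b → HasShape s H (rooted bs a) → HasShape s G (rooted cs b) → σ <ℝ ρ
    before-> {bs} {cs} {a} {b} L p small count count′ h h′ = listed-> L count h h′
      λ {ν} 7≤ν ν≤ceiling -γ<Φ → uniformly-regular 7≤ν (rooted cs b) (uniform b small)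
        , (let open At 7≤ν in subst (0ℚ ≤_) (sym (Φ-rooted {cs} count′)) (ℚ.<⇒≤ (begin-strict
            0ℚ                                              ≡⟨ ℚ.+-inverseˡ γ ⟨
            - γ + γ                                         <⟨ ℚ.+-monoˡ-< γ -γ<Φ ⟩
            Φ s (rooted bs a) ν + γ                         ≡⟨ cong (_+ γ) (Φ-rooted {bs} count) ⟩
            ν + κ s ν - (K * α + deficit bs) + γ            ≤⟨ shrink {p = ν + κ s ν} {K * α} (before 0<γ (γ≤β⁵ 7≤ν ν≤ceiling) p) ⟩
            ν + κ s ν - (K * α + deficit cs)                ∎)))
      where
      open ℚ.≤-Reasoning
      shrink : ∀ {p w d e g} → e + g ≤ d → p - (w + d) + g ≤ p - (w + e)
      shrink {p} {w} {d} {e} {g} h = ≤-by (≤⇒0≤ h) (regroup p w d e g)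
        where
        regroup : ∀ p w d e g → p - (w + d) + g + (d - (e + g)) ≡ p - (w + e)
        regroup = solve-∀ ring

    -- Four edges off the root, each saving 3α/4, save 3α in all, while the seventh hypertree saves
    -- only 3α - Δ₁ - Δ₂. The lightness of the branches is what yields regularity.
    balanced-> : ∀ {a t} → Counts (star₂ ∷ star₁ ∷ []) a → HasShape s H (rooted (star₂ ∷ star₁ ∷ []) a) →
      HasShape s G t → AllBranches (Centroid.Light k) t → 4 ℕ.≤ excess t → ⟪ t ⟫ ≡ k → σ <ℝ ρ
    balanced-> {a} {t} count h h′ light 4≤excess size≡k = listed-> listed₇ count h h′ bound
      where
      n : ℕ
      n = ℕ.⌊ k /2⌋
      half-≤ : ∀ t → AllBranches (Centroid.Light k) t → AllBranches (λ c → ⟪ c ⟫ ℕ.≤ n) t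
      half-≤ ε _ = tt
      half-≤ (c ▷ r) (p , ps) = subst (ℕ._≤ n) (sym (ℕ.n≡⌊n+n/2⌋ ⟪ c ⟫)) (ℕ.⌊n/2⌋-mono p) , half-≤ r ps
      n+n≤k : n ℕ.+ n ℕ.≤ k
      n+n≤k = subst (n ℕ.+ n ℕ.≤_) (ℕ.⌊n/2⌋+⌈n/2⌉≡n k) (ℕ.+-monoʳ-≤ n (ℕ.⌊n/2⌋≤⌈n/2⌉ k))
      bound : ∀ {ν} → seven ≤ ν → ν ≤ ceiling → - γ < Φ s (rooted (star₂ ∷ star₁ ∷ []) a) ν →
        Regular s ν t × 0ℚ ≤ Φ s t ν
      bound {ν} 7≤ν ν≤ceiling -γ<Φ = small-branches t {n} branches-≤ 1≤ν-nα , ≤⇒0≤ (*-cancelˡ-≤ {four} {cost s ν t} {ν + κ s ν} 0<four (begin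
        four * cost s ν t                        ≤⟨ ≤-by (*-nonNeg (fromNat-nonNeg 3) (*-nonNeg (≤⇒0≤ 4≤J) 0≤α)) (regroup (cost s ν t) (fromNat (excess t)) α) ⟩
        four * cost s ν t + three * (fromNat (excess t) * α) - three * (four * α)
                                                 ≤⟨ ℚ.+-monoˡ-≤ (- (three * (four * α))) (four-cost t {n} branches-≤ 1≤ν-nα) ⟩
        four * weight t - three * (four * α) ≡⟨ cong (λ m → four * (fromNat m * α) - three * (four * α)) size≡k ⟩
        four * (K * α) - three * (four * α)  ≡⟨ regroup′ (K * α) α ⟩
        four * (K * α - (α + (α + α)))           ≤⟨ *-monoˡ (ℚ.<⇒≤ 0<four) (subtract {K * α} {ν + κ s ν} {α + (α + α)} Kα≤) ⟩
        four * (ν + κ s ν)                       ∎))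
        where
        open ℚ.≤-Reasoning
        open At 7≤ν
        open Gaps s 7≤ν using (Δ₁; Δ₂; Δ-nonNeg; range₁; gap-two; 0≤α)
        branches-≤ : AllBranches (λ c → ⟪ c ⟫ ℕ.≤ n) t
        branches-≤ = half-≤ t light
        4≤J : four ≤ fromNat (excess t)
        4≤J = fromNat-mono 4≤excess
        regroup : ∀ c J α → four * c
          + three * ((J - four) * α)
          ≡ four * c + three * (J * α)
            - three * (four * α)
        regroup = solve-∀ ring
        regroup′ : ∀ w α → four * w - three * (four * α)
          ≡ four * (w - (α + (α + α)))
        regroup′ = solve-∀ ring
        subtract : ∀ {w x y} → w ≤ x + y → w - y ≤ x
        subtract {w} {x} {y} h = ≤-by (≤⇒0≤ h) (cancel w x y)
          where
          cancel : ∀ w x y → w - y + (x + y - w) ≡ x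
          cancel = solve-∀ ring
        -- Φ of the seventh hypertree exceeds -γ, and `gap-two` gives Δ₁ + Δ₂ - γ ≥ 3Δ₁ ≥ 0, so the
        -- margin is absorbed.
        Kα≤ : K * α ≤ ν + κ s ν + (α + (α + α))
        Kα≤ = ≤-by (+-nonNeg (+-nonNeg (≤⇒0≤ (ℚ.<⇒≤ (subst (- γ <_)
            (trans (Φ-rooted {star₂ ∷ star₁ ∷ []} {a} count) (cong (λ d → ν + κ s ν - (K * α + d)) last-deficit)) -γ<Φ)))
            (≤⇒0≤ (gap-two 0<γ (γ≤β⁵ 7≤ν ν≤ceiling))))
            (+-nonNeg (Δ-nonNeg range₁) (+-nonNeg (Δ-nonNeg range₁) (Δ-nonNeg range₁))))
          (collect (K * α) (ν + κ s ν) (α + (α + α)) Δ₁ Δ₂ γ)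
          where
          collect : ∀ w p t a b g → w + (p - (w + (a + b - t)) - (- g) + (b - (a + a + g)) + (a + (a + a))) ≡ p + t
          collect = solve-∀ ring
        -- 2 n α ≤ K α ≤ ν + 1 + 4
        1≤ν-nα : 1ℚ ≤ ν - fromNat n * α
        1≤ν-nα = *-cancelˡ-≤ (+-pos 0<1 0<1) (≤-by (+-nonNeg (+-nonNeg
            (≤⇒0≤ (ℚ.≤-trans (*-monoʳ 0≤α (subst (_≤ K) (fromNat-+ n n) (fromNat-mono n+n≤k))) Kα≤))
            (+-nonNeg (≤⇒0≤ κ≤1) (≤⇒0≤ three-α≤4))) (≤⇒0≤ 7≤ν))
          (collect ν (κ s ν) α (fromNat n)))
          where
          collect : ∀ ν k α n → two * 1ℚ + (ν + k + (α + (α + α)) - (n + n) * α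
            + (1ℚ - k + (four - (α + (α + α))))
            + (ν - seven))
            ≡ two * (ν - n * α)
          collect = solve-∀ ring


-- From shapes back to the hypertrees of the theorem.

module Conclusion where

  count⇒size : ∀ bs a → ⟪ rooted bs a ⟫ ≡ length bs ℕ.+ total bs ℕ.+ a
  count⇒size [] zero    = refl
  count⇒size [] (suc a) = cong suc (count⇒size [] a)
  count⇒size (b ∷ bs) a = cong suc (trans (cong (⟪ b ⟫ ℕ.+_) (count⇒size bs a)) (begin
    ⟪ b ⟫ ℕ.+ (length bs ℕ.+ total bs ℕ.+ a)   ≡⟨ ℕ.+-assoc ⟪ b ⟫ (length bs ℕ.+ total bs) a ⟨
    ⟪ b ⟫ ℕ.+ (length bs ℕ.+ total bs) ℕ.+ a   ≡⟨ cong (ℕ._+ a) (trans (sym (ℕ.+-assoc ⟪ b ⟫ (length bs) (total bs)))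
                                                    (cong (ℕ._+ total bs) (ℕ.+-comm ⟪ b ⟫ (length bs)))) ⟩
    length bs ℕ.+ ⟪ b ⟫ ℕ.+ total bs ℕ.+ a     ≡⟨ cong (ℕ._+ a) (ℕ.+-assoc (length bs) ⟪ b ⟫ (total bs)) ⟩
    length bs ℕ.+ (⟪ b ⟫ ℕ.+ total bs) ℕ.+ a   ∎))
    where open ≡-Reasoning

  hasShape⇒hypertree : ∀ {s k H} bs a → length bs ℕ.+ total bs ℕ.+ a ≡ k → HasShape s H (rooted bs a) →
    IsUniformHypertree (suc (suc s)) k H
  hasShape⇒hypertree {s} {H = H} bs a count (u , F , M , sh) =
    subst (λ k → IsUniformHypertree (suc (suc s)) k H) (trans (cong ⟪_⟫ sh) (trans (count⇒size bs a) count))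
      (model⇒hypertree M)

  rooted-≅ : ∀ bs {s k H G t a b} → t ≈ rooted bs a → HasShape s H t → HasShape s G (rooted bs b) →
    length bs ℕ.+ total bs ℕ.+ a ≡ k → length bs ℕ.+ total bs ℕ.+ b ≡ k → H ≅ G
  rooted-≅ bs {s} {G = G} p h h′ count count′ = hasShape-≅ (hasShape-≈ p h)
    (subst (λ a → HasShape s G (rooted bs a)) (ℕ.+-cancelˡ-≡ (length bs ℕ.+ total bs) _ _ (trans count′ (sym count))) h′)

  -- With n = m - 1, the hypothesis reads 42 + 10n ≤ kn, and 42 + 10n = 7(6 + n) + 3n is the form in
  -- which ν = 7 is tested against k - 3 pendant edges.
  large⇒ℕ : ∀ s k → (ℤ.+ k ℤ.- ℤ.+ 10) ℤ.* (ℤ.+ suc (suc s) ℤ.- ℤ.+ 1) ℤ.≥ ℤ.+ 42 →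
    7 ℕ.* (6 ℕ.+ suc s) ℕ.+ 3 ℕ.* suc s ℕ.≤ k ℕ.* suc s
  large⇒ℕ s k h = subst₂ ℕ._≤_ (linear s) refl (ℤ.drop‿+≤+ (subst₂ ℤ._≤_ refl (trans (cancel (ℤ.+ k) (ℤ.+ suc s)) (sym (ℤ.pos-* k (suc s))))
    (ℤ.≤-trans (ℤ.≤-reflexive (cong (λ n → ℤ.+ 42 ℤ.+ n) (ℤ.pos-* 10 (suc s))))
      (ℤ.+-monoˡ-≤ (ℤ.+ 10 ℤ.* ℤ.+ suc s) h))))
    where
    linear : ∀ s → 42 ℕ.+ 10 ℕ.* suc s ≡ 7 ℕ.* (6 ℕ.+ suc s) ℕ.+ 3 ℕ.* suc s
    linear = NatSolver.solve-∀
    cancel : ∀ x n → (x ℤ.- ℤ.+ 10) ℤ.* n ℤ.+ ℤ.+ 10 ℤ.* n ≡ x ℤ.* n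
    cancel = IntSolver.solve-∀

open Conclusion

open import Data.Integer.Base using (+_; _-_; _*_; _≥_)
open import Data.Nat.Base using (_>_)

theorem2p3p1 :
    ∀ (m k : ℕ) .{{_ : NonTrivial m}} → k > 0 →
    (+ k - + 10) * (+ m - + 1) ≥ + 42 →
    let T₁ = T m 2 (k ∸ 2 ∷ [])
        T₂ = T m 3 (k ∸ 3 ∷ 0 ∷ [])
        T₃ = T m 3 (k ∸ 4 ∷ 1 ∷ [])
        T₄ = T m 4 (0 ∷ k ∸ 4 ∷ 0 ∷ [])
        T₅ = T m 4 (k ∸ 4 ∷ 0 ∷ 0 ∷ [])
        T₆ = T m 3 (k ∸ 5 ∷ 2 ∷ [])
        T₇ = T m 4 (1 ∷ k ∸ 5 ∷ 0 ∷ [])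
        Ts = T₁ ∷ T₂ ∷ T₃ ∷ T₄ ∷ T₅ ∷ T₆ ∷ T₇ ∷ []
    in
    All (IsUniformHypertree m k) Ts ×
    (∀ {ρ₁ ρ₂ ρ₃ ρ₄ ρ₅ ρ₆ ρ₇} →
      IsSpectralRadius (adjacency m T₁) ρ₁ →
      IsSpectralRadius (adjacency m T₂) ρ₂ →
      IsSpectralRadius (adjacency m T₃) ρ₃ →
      IsSpectralRadius (adjacency m T₄) ρ₄ →
      IsSpectralRadius (adjacency m T₅) ρ₅ →
      IsSpectralRadius (adjacency m T₆) ρ₆ →
      IsSpectralRadius (adjacency m T₇) ρ₇ →
      ρ₁ >ℝ ρ₂ × ρ₂ >ℝ ρ₃ × ρ₃ >ℝ ρ₄ × ρ₄ >ℝ ρ₅ × ρ₅ >ℝ ρ₆ × ρ₆ >ℝ ρ₇ ×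
      (∀ H → IsUniformHypertree m k H → ¬ Any (H ≅_) Ts →
        ∀ {ρ} → IsSpectralRadius (adjacency m H) ρ → ρ <ℝ ρ₇))
theorem2p3p1 (suc (suc s)) k _ h =
    ( hasShape⇒hypertree [] _ c₁ (hasShape₁ s k)
    ∷ hasShape⇒hypertree (star₁ ∷ []) _ c₂ (hasShape₂ s k)
    ∷ hasShape⇒hypertree (star₂ ∷ []) _ c₃ (hasShape₃ s k)
    ∷ hasShape⇒hypertree (star₁ ∷ star₁ ∷ []) _ c₃ (hasShape₄ s k)
    ∷ hasShape⇒hypertree (path₂ ∷ []) _ c₃ (hasShape₅ s k)
    ∷ hasShape⇒hypertree (star₃ ∷ []) _ c₅ (hasShape₆ s k)
    ∷ hasShape⇒hypertree (star₂ ∷ star₁ ∷ []) _ c₅ (hasShape₇ s k)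
    ∷ [])
  , λ r₁ r₂ r₃ r₄ r₅ r₆ r₇ →
      before-> r₁ r₂ listed₁ step₁ (listed-small listed₂) c₁ c₂ (hasShape₁ s k) (hasShape₂ s k)
    , before-> r₂ r₃ listed₂ step₂ (listed-small listed₃) c₂ c₃ (hasShape₂ s k) (hasShape₃ s k)
    , before-> r₃ r₄ listed₃ step₃ (listed-small listed₄) c₃ c₃ (hasShape₃ s k) (hasShape₄ s k)
    , before-> r₄ r₅ listed₄ step₄ (listed-small listed₅) c₃ c₃ (hasShape₄ s k) (hasShape₅ s k)
    , before-> r₅ r₆ listed₅ step₅ (listed-small listed₆) c₃ c₅ (hasShape₅ s k) (hasShape₆ s k)
    , before-> r₆ r₇ listed₆ step₆ (listed-small listed₇) c₅ c₅ (hasShape₆ s k) (hasShape₇ s k)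
    , λ H hypertree other r →
        let t , shape-H , size≡k = hypertree⇒shape hypertree 2≤k
        in bound r₇ r shape-H (λ p kind count → other (identify p shape-H kind count))
             (classify k (ℕ.≤-trans (s≤s z≤n) 2≤k) t size≡k)
  where
  open Ordering s k (large⇒ℕ s k h)
  m : ℕ
  m = suc (suc s)
  c₁ : 2 ℕ.+ (k ∸ 2) ≡ k
  c₁ = ℕ.m+[n∸m]≡n 2≤k
  c₂ : 3 ℕ.+ (k ∸ 3) ≡ k
  c₂ = ℕ.m+[n∸m]≡n (ℕ.≤-trans (ℕ.n≤1+n 3) 4≤k)
  c₃ : 4 ℕ.+ (k ∸ 4) ≡ k
  c₃ = ℕ.m+[n∸m]≡n 4≤k
  c₅ : 5 ℕ.+ (k ∸ 5) ≡ k
  c₅ = ℕ.m+[n∸m]≡n 5≤k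

  identify : ∀ {H t bs a} → t ≈ rooted bs a → HasShape s H t → ListedBranches bs →
    length bs ℕ.+ total bs ℕ.+ a ≡ k →
    Any (H ≅_) ( T m 2 (k ∸ 2 ∷ []) ∷ T m 3 (k ∸ 3 ∷ 0 ∷ []) ∷ T m 3 (k ∸ 4 ∷ 1 ∷ [])
               ∷ T m 4 (0 ∷ k ∸ 4 ∷ 0 ∷ []) ∷ T m 4 (k ∸ 4 ∷ 0 ∷ 0 ∷ []) ∷ T m 3 (k ∸ 5 ∷ 2 ∷ [])
               ∷ T m 4 (1 ∷ k ∸ 5 ∷ 0 ∷ []) ∷ [])
  identify p h listed₁ count = here (rooted-≅ [] p h (hasShape₁ s k) count c₁)
  identify p h listed₂ count = there (here (rooted-≅ (star₁ ∷ []) p h (hasShape₂ s k) count c₂))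
  identify p h listed₃ count = there (there (here (rooted-≅ (star₂ ∷ []) p h (hasShape₃ s k) count c₃)))
  identify p h listed₄ count = there (there (there (here (rooted-≅ (star₁ ∷ star₁ ∷ []) p h (hasShape₄ s k) count c₃))))
  identify p h listed₅ count = there (there (there (there (here (rooted-≅ (path₂ ∷ []) p h (hasShape₅ s k) count c₃)))))
  identify p h listed₆ count = there (there (there (there (there (here (rooted-≅ (star₃ ∷ []) p h (hasShape₆ s k) count c₅))))))
  identify p h listed₇ count = there (there (there (there (there (there (here (rooted-≅ (star₂ ∷ star₁ ∷ []) p h (hasShape₇ s k) count c₅)))))))

  bound : ∀ {H t ρ ρ₇} → IsSpectralRadius (adjacency m (T m 4 (1 ∷ k ∸ 5 ∷ 0 ∷ []))) ρ₇ →
    IsSpectralRadius (adjacency m H) ρ → HasShape s H t →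
    (∀ {bs a} → t ≈ rooted bs a → ListedBranches bs → length bs ℕ.+ total bs ℕ.+ a ≢ k) →
    Verdict k t → ρ <ℝ ρ₇
  bound r₇ r shape-H other (listed p (mkRooted a q kind count)) =
    contradiction count (other (≈-trans p (arrange q)) kind)
  bound r₇ r shape-H other (unlisted p (mkRooted a q kind count)) =
    before-> r₇ r listed₇ (step₇ kind) (unlisted-small kind) c₅ count (hasShape₇ s k)
      (hasShape-≈ (≈-trans p (arrange q)) shape-H)
  bound r₇ r shape-H other (balanced p light 4≤excess size≡k) =
    balanced-> r₇ r c₅ (hasShape₇ s k) (hasShape-≈ p shape-H) light 4≤excess size≡k
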